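{- Let $n\ge 1$ be an integer and let $N=p_1^{k_1}\cdots p_r^{k_r}$ with $r\ge 1$, $p_1>\dots>p_r$ primes and $k_1,\dots,k_r\ge 1$ integers. Let $m\in\mathbb{N}$, $\epsilon\in[0,1]$, and let $S\subseteq(\mathbb{Z}/N\mathbb{Z})^n$ be an $(m,\epsilon)$-Kakeya set. Then $$|S|\ge C_{N,n}\,\epsilon\, m^n,$$ where $$C_{N,n}=\left(\prod_{j=1}^{r-1}\frac{1}{k_j\log(p_j)+1}\ \prod_{i=1}^r\frac{1}{2\left(k_i+\lceil\log_{p_i}(n)\rceil\right)}\right)^n.$$
   Context: For $N=p_1^{k_1}\cdots p_r^{k_r}$ ($p_i$ distinct primes), the projective space $\mathbb{P}(\mathbb{Z}/N\mathbb{Z})^{n-1}$ consists of the vectors $u\in(\mathbb{Z}/N\mathbb{Z})^n$ such that, for every $i\in\{1,\dots,r\}$, $u \bmod p_i^{k_i}$ has at least one coordinate that is a unit, taken up to multiplication by units in $(\mathbb{Z}/N\mathbb{Z})^\times$. One representative in $(\mathbb{Z}/N\mathbb{Z})^n$ is fixed for each element. A line in direction $u$ is a set $\{a+tu : t\in\mathbb{Z}/N\mathbb{Z}\}$ with $a\in(\mathbb{Z}/N\mathbb{Z})^n$. A subset $S\subseteq(\mathbb{Z}/N\mathbb{Z})^n$ is $(m,\epsilon)$-Kakeya if for at least an $\epsilon$ fraction of the directions $u\in\mathbb{P}(\mathbb{Z}/N\mathbb{Z})^{n-1}$ there exists a line $L_u$ in direction $u$ with $|L_u\cap S|\ge m$.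 $\log$ denotes the natural logarithm and $\log_p$ the logarithm to base $p$; an empty product is $1$. -}

module Defs where

open import Data.Fin.Base as Fin using (Fin; toℕ; inject₁)
open import Data.Fin.Properties as Fin using (any?)
open import Data.Integer.Base as ℤ using (+_; +[1+_]; -[1+_])
import Data.Integer.Properties as ℤ
open import Data.List.Base using (List; length; filter)
open import Data.List.Relation.Binary.Sublist.Propositional using (_⊆_)
open import Data.List.Relation.Unary.All using (All)
open import Data.List.Relation.Unary.AllPairs using (AllPairs)
open import Data.List.Relation.Unary.Any using (Any)
open import Data.Nat.Base as ℕ using (ℕ; zero; suc; NonZero)
open import Data.Nat.DivMod using (_mod_)
open import Data.Nat.Primality using (Prime; prime⇒nonZero)
import Data.Nat.Properties as ℕ
open import Data.Product.Base using (∃; _×_; _,_; proj₁; proj₂)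
open import Data.Rational.Base as ℚ using (ℚ; mkℚ; 0ℚ; 1ℚ; ½)
import Data.Rational.Properties as ℚ
import Data.Rational.Unnormalised.Base as ℚᵘ
import Data.Rational.Unnormalised.Properties as ℚᵘ
open import Data.Sum.Base using (inj₁; inj₂)
open import Data.Vec.Base as Vec using (Vec)
import Data.Vec.Functional as Vector
import Data.Vec.Properties as Vec
import Data.Vec.Relation.Unary.Any as VecAny
open import Function.Base using (_∘_)
open import Level using (0ℓ)
open import Relation.Binary.PropositionalEquality
  using (_≡_; refl; sym; trans; cong; cong₂; subst; subst₂)
open import Relation.Nullary.Decidable using (Dec; yes; no; dec⇒maybe)
open import Relation.Nullary.Negation using (¬_)
open import Tactic.RingSolver using (solve-∀)
open import Tactic.RingSolver.Core.AlmostCommutativeRing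
  using (AlmostCommutativeRing; fromCommutativeRing)

------------------------------------------------------------------------
-- Real numbers

-- Cauchy sequences of rationals.  Two sequences denote the same real
-- when each is ≤ᴿ the other.
record ℝ : Set where
  constructor mkℝ
  field
    approx : ℕ → ℚ
    cauchy : ∀ δ → 0ℚ ℚ.< δ →
             ∃ λ M → ∀ i j → M ℕ.≤ i → M ℕ.≤ j →
             ℚ.∣ approx i ℚ.- approx j ∣ ℚ.≤ δ

open ℝ public

infix 4 _≤ᴿ_

_≤ᴿ_ : ℝ → ℝ → Set
x ≤ᴿ y = ∀ δ → 0ℚ ℚ.< δ →
         ∃ λ M → ∀ i → M ℕ.≤ i → approx x i ℚ.≤ approx y i ℚ.+ δ

record Positive (x : ℝ) : Set where
  constructor mkPositive
  field
    bound   : ℚ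
    0<bound : 0ℚ ℚ.< bound
    from    : ℕ
    bound≤  : ∀ i → from ℕ.≤ i → bound ℚ.≤ approx x i

private
  ℚ-ring : AlmostCommutativeRing 0ℓ 0ℓ
  ℚ-ring = fromCommutativeRing ℚ.+-*-commutativeRing
    (λ q → dec⇒maybe (0ℚ ℚ.≟ q))

  ∣∣-lub : ∀ {p q} → p ℚ.≤ q → ℚ.- p ℚ.≤ q → ℚ.∣ p ∣ ℚ.≤ q
  ∣∣-lub {p} {q} p≤q -p≤q with ℚ.∣p∣≡p∨∣p∣≡-p p
  ... | inj₁ e = subst (ℚ._≤ q) (sym e) p≤q
  ... | inj₂ e = subst (ℚ._≤ q) (sym e) -p≤q

  0<½* : ∀ {δ} → 0ℚ ℚ.< δ → 0ℚ ℚ.< ½ ℚ.* δ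
  0<½* {δ} δ>0 = subst (ℚ._< ½ ℚ.* δ) (ℚ.*-zeroʳ ½) (ℚ.*-monoʳ-<-pos ½ δ>0)

  0<* : ∀ {p q} → 0ℚ ℚ.< p → 0ℚ ℚ.< q → 0ℚ ℚ.< p ℚ.* q
  0<* {p} {q} p>0 q>0 =
    subst (ℚ._< p ℚ.* q) (ℚ.*-zeroʳ p)
      (ℚ.*-monoʳ-<-pos p {{ℚ.positive p>0}} q>0)

  halves : ∀ δ → ½ ℚ.* δ ℚ.+ ½ ℚ.* δ ≡ δ
  halves δ = trans (sym (ℚ.*-distribʳ-+ δ ½ ½)) (ℚ.*-identityˡ δ)

  ≤-*-mono : ∀ {p q r s} → 0ℚ ℚ.≤ p → p ℚ.≤ q → 0ℚ ℚ.≤ r → r ℚ.≤ s →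
             p ℚ.* r ℚ.≤ q ℚ.* s
  ≤-*-mono {p} {q} {r} {s} 0≤p p≤q 0≤r r≤s = ℚ.≤-trans
    (ℚ.*-monoʳ-≤-nonNeg r {{ℚ.nonNegative 0≤r}} p≤q)
    (ℚ.*-monoˡ-≤-nonNeg q {{ℚ.nonNegative (ℚ.≤-trans 0≤p p≤q)}} r≤s)

  bounded : ∀ x → ∃ λ B → 0ℚ ℚ.< B ×
            ∃ λ M → ∀ i → M ℕ.≤ i → ℚ.∣ approx x i ∣ ℚ.≤ B
  bounded x with cauchy x 1ℚ (ℚ.positive⁻¹ 1ℚ)
  ... | M , h = ℚ.∣ approx x M ∣ ℚ.+ 1ℚ
              , ℚ.+-mono-≤-< (ℚ.0≤∣p∣ (approx x M)) (ℚ.positive⁻¹ 1ℚ)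
              , M , λ i M≤i → begin
    ℚ.∣ approx x i ∣
      ≡⟨ cong ℚ.∣_∣ (lem (approx x i) (approx x M)) ⟩
    ℚ.∣ approx x M ℚ.+ (approx x i ℚ.- approx x M) ∣
      ≤⟨ ℚ.∣p+q∣≤∣p∣+∣q∣ (approx x M) _ ⟩
    ℚ.∣ approx x M ∣ ℚ.+ ℚ.∣ approx x i ℚ.- approx x M ∣
      ≤⟨ ℚ.+-monoʳ-≤ ℚ.∣ approx x M ∣ (h i M M≤i ℕ.≤-refl) ⟩
    ℚ.∣ approx x M ∣ ℚ.+ 1ℚ ∎
    where
    open ℚ.≤-Reasoning
    lem : ∀ a b → a ≡ b ℚ.+ (a ℚ.- b)
    lem = solve-∀ ℚ-ring

fromℚ : ℚ → ℝ
fromℚ q = mkℝ (λ _ → q) λ δ δ>0 → 0 , λ _ _ _ _ →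
  subst (ℚ._≤ δ) (sym (cong ℚ.∣_∣ (ℚ.+-inverseʳ q))) (ℚ.<⇒≤ δ>0)

fromℕ : ℕ → ℝ
fromℕ n = fromℚ (+ n ℚ./ 1)

infixl 6 _+ᴿ_
infixl 7 _*ᴿ_
infixr 8 _^ᴿ_

_+ᴿ_ : ℝ → ℝ → ℝ
x +ᴿ y = mkℝ (λ i → approx x i ℚ.+ approx y i) λ δ δ>0 →
  let (M , f) = cauchy x (½ ℚ.* δ) (0<½* δ>0)
      (L , g) = cauchy y (½ ℚ.* δ) (0<½* δ>0)
  in M ℕ.⊔ L , λ i j hi hj → begin
    ℚ.∣ (approx x i ℚ.+ approx y i) ℚ.- (approx x j ℚ.+ approx y j) ∣
      ≡⟨ cong ℚ.∣_∣ (lem (approx x i) (approx y i) (approx x j) (approx y j)) ⟩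
    ℚ.∣ (approx x i ℚ.- approx x j) ℚ.+ (approx y i ℚ.- approx y j) ∣
      ≤⟨ ℚ.∣p+q∣≤∣p∣+∣q∣ (approx x i ℚ.- approx x j) _ ⟩
    ℚ.∣ approx x i ℚ.- approx x j ∣ ℚ.+ ℚ.∣ approx y i ℚ.- approx y j ∣
      ≤⟨ ℚ.+-mono-≤ (f i j (ℕ.m⊔n≤o⇒m≤o M L hi) (ℕ.m⊔n≤o⇒m≤o M L hj))
                    (g i j (ℕ.m⊔n≤o⇒n≤o M L hi) (ℕ.m⊔n≤o⇒n≤o M L hj)) ⟩
    ½ ℚ.* δ ℚ.+ ½ ℚ.* δ
      ≡⟨ halves δ ⟩
    δ ∎
  where
  open ℚ.≤-Reasoning
  lem : ∀ a b c d → (a ℚ.+ b) ℚ.- (c ℚ.+ d) ≡ (a ℚ.- c) ℚ.+ (b ℚ.- d)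
  lem = solve-∀ ℚ-ring

private
  cancel : ∀ b .{{_ : ℚ.NonZero b}} q → b ℚ.* (ℚ.1/ b ℚ.* q) ≡ q
  cancel b q = trans (sym (ℚ.*-assoc b (ℚ.1/ b) q))
    (trans (cong (ℚ._* q) (ℚ.*-inverseʳ b)) (ℚ.*-identityˡ q))

  0<1/ : ∀ b → 0ℚ ℚ.< b → .{{_ : ℚ.NonZero b}} → 0ℚ ℚ.< ℚ.1/ b
  0<1/ b b>0 {{b≢0}} = ℚ.positive⁻¹ ((ℚ.1/ b) {{b≢0}})
    {{ℚ.1/pos⇒pos b {{ℚ.positive b>0}}}}

  *-split : ∀ a b c d → a ℚ.* b ℚ.- c ℚ.* d ≡ a ℚ.* (b ℚ.- d) ℚ.+ d ℚ.* (a ℚ.- c)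
  *-split = solve-∀ ℚ-ring

  *-close : ∀ a b c d B C η .{{_ : ℚ.NonZero B}} .{{_ : ℚ.NonZero C}} →
            ℚ.∣ a ∣ ℚ.≤ B → ℚ.∣ d ∣ ℚ.≤ C →
            ℚ.∣ b ℚ.- d ∣ ℚ.≤ ℚ.1/ B ℚ.* η → ℚ.∣ a ℚ.- c ∣ ℚ.≤ ℚ.1/ C ℚ.* η →
            ℚ.∣ a ℚ.* b ℚ.- c ℚ.* d ∣ ℚ.≤ η ℚ.+ η
  *-close a b c d B C η a≤B d≤C b-d a-c = begin
    ℚ.∣ a ℚ.* b ℚ.- c ℚ.* d ∣
      ≡⟨ cong ℚ.∣_∣ (*-split a b c d) ⟩
    ℚ.∣ a ℚ.* (b ℚ.- d) ℚ.+ d ℚ.* (a ℚ.- c) ∣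
      ≤⟨ ℚ.∣p+q∣≤∣p∣+∣q∣ (a ℚ.* (b ℚ.- d)) (d ℚ.* (a ℚ.- c)) ⟩
    ℚ.∣ a ℚ.* (b ℚ.- d) ∣ ℚ.+ ℚ.∣ d ℚ.* (a ℚ.- c) ∣
      ≡⟨ cong₂ ℚ._+_ (ℚ.∣p*q∣≡∣p∣*∣q∣ a (b ℚ.- d)) (ℚ.∣p*q∣≡∣p∣*∣q∣ d (a ℚ.- c)) ⟩
    ℚ.∣ a ∣ ℚ.* ℚ.∣ b ℚ.- d ∣ ℚ.+ ℚ.∣ d ∣ ℚ.* ℚ.∣ a ℚ.- c ∣
      ≤⟨ ℚ.+-mono-≤
           (≤-*-mono (ℚ.0≤∣p∣ a) a≤B (ℚ.0≤∣p∣ (b ℚ.- d)) b-d)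
           (≤-*-mono (ℚ.0≤∣p∣ d) d≤C (ℚ.0≤∣p∣ (a ℚ.- c)) a-c) ⟩
    B ℚ.* (ℚ.1/ B ℚ.* η) ℚ.+ C ℚ.* (ℚ.1/ C ℚ.* η)
      ≡⟨ cong₂ ℚ._+_ (cancel B η) (cancel C η) ⟩
    η ℚ.+ η ∎
    where open ℚ.≤-Reasoning

_*ᴿ_ : ℝ → ℝ → ℝ
x *ᴿ y = mkℝ (λ i → approx x i ℚ.* approx y i) λ δ δ>0 →
  let (B , B>0 , M₁ , hB) = bounded x
      (C , C>0 , M₂ , hC) = bounded y
      B≢0 = ℚ.>-nonZero B>0
      C≢0 = ℚ.>-nonZero C>0
      η = ½ ℚ.* δ
      (M₃ , hx) = cauchy x ((ℚ.1/ C) {{C≢0}} ℚ.* η)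
                    (0<* (0<1/ C C>0 {{C≢0}}) (0<½* δ>0))
      (M₄ , hy) = cauchy y ((ℚ.1/ B) {{B≢0}} ℚ.* η)
                    (0<* (0<1/ B B>0 {{B≢0}}) (0<½* δ>0))
      M₁₂ = M₁ ℕ.⊔ M₂
      M₃₄ = M₃ ℕ.⊔ M₄
  in M₁₂ ℕ.⊔ M₃₄ , λ i j hi hj →
    let i₁₂ = ℕ.m⊔n≤o⇒m≤o M₁₂ M₃₄ hi
        j₁₂ = ℕ.m⊔n≤o⇒m≤o M₁₂ M₃₄ hj
        i₃₄ = ℕ.m⊔n≤o⇒n≤o M₁₂ M₃₄ hi
        j₃₄ = ℕ.m⊔n≤o⇒n≤o M₁₂ M₃₄ hj
    in subst (ℚ.∣ approx x i ℚ.* approx y i ℚ.- approx x j ℚ.* approx y j ∣ ℚ.≤_)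
         (halves δ)
         (*-close (approx x i) (approx y i) (approx x j) (approx y j)
           B C η {{B≢0}} {{C≢0}}
           (hB i (ℕ.m⊔n≤o⇒m≤o M₁ M₂ i₁₂)) (hC j (ℕ.m⊔n≤o⇒n≤o M₁ M₂ j₁₂))
           (hy i j (ℕ.m⊔n≤o⇒n≤o M₃ M₄ i₃₄) (ℕ.m⊔n≤o⇒n≤o M₃ M₄ j₃₄))
           (hx i j (ℕ.m⊔n≤o⇒m≤o M₃ M₄ i₃₄) (ℕ.m⊔n≤o⇒m≤o M₃ M₄ j₃₄)))

_^ᴿ_ : ℝ → ℕ → ℝ
x ^ᴿ zero  = fromℕ 1
x ^ᴿ suc n = x *ᴿ x ^ᴿ n

∏ᴿ : ∀ {n} → (Fin n → ℝ) → ℝ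
∏ᴿ = Vector.foldr _*ᴿ_ (fromℕ 1)

-- The sequence is shifted past the finitely many initial terms that
-- might vanish.
recip : (x : ℝ) → Positive x → ℝ
recip x (mkPositive b b>0 M b≤) = mkℝ
  (λ i → (ℚ.1/ approx x (M ℕ.+ i)) {{nz i}}) prf
  where
  open ℚ.≤-Reasoning
  pos : ∀ i → 0ℚ ℚ.< approx x (M ℕ.+ i)
  pos i = ℚ.<-≤-trans b>0 (b≤ (M ℕ.+ i) (ℕ.m≤m+n M i))
  nz : ∀ i → ℚ.NonZero (approx x (M ℕ.+ i))
  nz i = ℚ.>-nonZero (pos i)
  -- For p, q ≥ b:  b² ∣1/p - 1/q∣ ≤ p q ∣1/p - 1/q∣ = ∣p - q∣.
  step : ∀ p q .{{_ : ℚ.NonZero p}} .{{_ : ℚ.NonZero q}} {δ} →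
         b ℚ.≤ p → b ℚ.≤ q → ℚ.∣ p ℚ.- q ∣ ℚ.≤ b ℚ.* b ℚ.* δ →
         ℚ.∣ ℚ.1/ p ℚ.- ℚ.1/ q ∣ ℚ.≤ δ
  step p q {δ} b≤p b≤q h =
    ℚ.*-cancelˡ-≤-pos (b ℚ.* b) {{ℚ.positive (0<* b>0 b>0)}} (begin
      b ℚ.* b ℚ.* D ≤⟨ ℚ.*-monoʳ-≤-nonNeg D {{ℚ.∣-∣-nonNeg d}}
                        (≤-*-mono 0≤b b≤p 0≤b b≤q) ⟩
      p ℚ.* q ℚ.* D ≡⟨ cong (ℚ._* D) (sym (ℚ.0≤p⇒∣p∣≡p 0≤pq)) ⟩
      ℚ.∣ p ℚ.* q ∣ ℚ.* D ≡⟨ sym (ℚ.∣p*q∣≡∣p∣*∣q∣ (p ℚ.* q) d) ⟩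
      ℚ.∣ p ℚ.* q ℚ.* d ∣ ≡⟨ cong ℚ.∣_∣ pqd ⟩
      ℚ.∣ q ℚ.- p ∣ ≡⟨ cong ℚ.∣_∣ (flip p q) ⟩
      ℚ.∣ ℚ.- (p ℚ.- q) ∣ ≡⟨ ℚ.∣-p∣≡∣p∣ (p ℚ.- q) ⟩
      ℚ.∣ p ℚ.- q ∣ ≤⟨ h ⟩
      b ℚ.* b ℚ.* δ ∎)
    where
    d D : ℚ
    d = ℚ.1/ p ℚ.- ℚ.1/ q
    D = ℚ.∣ d ∣
    0≤b : 0ℚ ℚ.≤ b
    0≤b = ℚ.<⇒≤ b>0
    0≤pq : 0ℚ ℚ.≤ p ℚ.* q
    0≤pq = ℚ.<⇒≤ (0<* (ℚ.<-≤-trans b>0 b≤p) (ℚ.<-≤-trans b>0 b≤q))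
    flip : ∀ u v → v ℚ.- u ≡ ℚ.- (u ℚ.- v)
    flip = solve-∀ ℚ-ring
    expand : ∀ u v u′ v′ → u ℚ.* v ℚ.* (u′ ℚ.- v′)
                         ≡ u ℚ.* u′ ℚ.* v ℚ.- v ℚ.* v′ ℚ.* u
    expand = solve-∀ ℚ-ring
    pqd : p ℚ.* q ℚ.* d ≡ q ℚ.- p
    pqd = trans (expand p q (ℚ.1/ p) (ℚ.1/ q)) (cong₂ ℚ._-_
      (trans (cong (ℚ._* q) (ℚ.*-inverseʳ p)) (ℚ.*-identityˡ q))
      (trans (cong (ℚ._* p) (ℚ.*-inverseʳ q)) (ℚ.*-identityˡ p)))
  prf : ∀ δ → 0ℚ ℚ.< δ → ∃ λ L → ∀ i j → L ℕ.≤ i → L ℕ.≤ j →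
        ℚ.∣ (ℚ.1/ approx x (M ℕ.+ i)) {{nz i}}
            ℚ.- (ℚ.1/ approx x (M ℕ.+ j)) {{nz j}} ∣ ℚ.≤ δ
  prf δ δ>0 =
    let (L , h) = cauchy x (b ℚ.* b ℚ.* δ) (0<* (0<* b>0 b>0) δ>0)
    in L , λ i j hi hj →
      step (approx x (M ℕ.+ i)) (approx x (M ℕ.+ j)) {{nz i}} {{nz j}}
        (b≤ _ (ℕ.m≤m+n M i)) (b≤ _ (ℕ.m≤m+n M j))
        (h _ _ (ℕ.≤-trans hi (ℕ.m≤n+m i M)) (ℕ.≤-trans hj (ℕ.m≤n+m j M)))

------------------------------------------------------------------------
-- Logarithms

-- 1/(a+1) + 1/(a+2) + … + 1/(a+l)
harmonic : ℕ → ℕ → ℚ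
harmonic a zero    = 0ℚ
harmonic a (suc l) = + 1 ℚ./ suc a ℚ.+ harmonic (suc a) l

private
  1/suc : ℕ → ℚ
  1/suc a = + 1 ℚ./ suc a

  0≤1/suc : ∀ a → 0ℚ ℚ.≤ 1/suc a
  0≤1/suc a = ℚ.nonNegative⁻¹ (1/suc a) {{ℚ.normalize-nonNeg 1 (suc a)}}

  0≤harmonic : ∀ a l → 0ℚ ℚ.≤ harmonic a l
  0≤harmonic a zero    = ℚ.≤-refl
  0≤harmonic a (suc l) = ℚ.+-mono-≤ (0≤1/suc a) (0≤harmonic (suc a) l)

  1/suc-anti : ∀ {a b} → a ℕ.≤ b → 1/suc b ℚ.≤ 1/suc a
  1/suc-anti {a} {b} a≤b = ℚ.toℚᵘ-cancel-≤
    (ℚᵘ.≤-respˡ-≃ (ℚᵘ.≃-sym (ℚ.toℚᵘ-fromℚᵘ (ℚᵘ.mkℚᵘ (+ 1) b)))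
    (ℚᵘ.≤-respʳ-≃ (ℚᵘ.≃-sym (ℚ.toℚᵘ-fromℚᵘ (ℚᵘ.mkℚᵘ (+ 1) a)))
    (ℚᵘ.*≤* (ℤ.+≤+ (ℕ.+-monoˡ-≤ 0 (ℕ.s≤s a≤b))))))

  times-1/ : ∀ K a → (+ suc K ℚ./ 1) ℚ.* 1/suc (K ℕ.+ a ℕ.* suc K) ≡ 1/suc a
  times-1/ K a = ℚ.toℚᵘ-injective (begin
    ℚ.toℚᵘ ((+ suc K ℚ./ 1) ℚ.* 1/suc (K ℕ.+ a ℕ.* suc K))
      ≈⟨ ℚ.toℚᵘ-homo-* (+ suc K ℚ./ 1) (1/suc (K ℕ.+ a ℕ.* suc K)) ⟩
    ℚ.toℚᵘ (+ suc K ℚ./ 1) ℚᵘ.* ℚ.toℚᵘ (1/suc (K ℕ.+ a ℕ.* suc K))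
      ≈⟨ ℚᵘ.*-cong (ℚ.toℚᵘ-fromℚᵘ (ℚᵘ.mkℚᵘ (+ suc K) 0))
                   (ℚ.toℚᵘ-fromℚᵘ (ℚᵘ.mkℚᵘ (+ 1) (K ℕ.+ a ℕ.* suc K))) ⟩
    ℚᵘ.mkℚᵘ (+ suc K) 0 ℚᵘ.* ℚᵘ.mkℚᵘ (+ 1) (K ℕ.+ a ℕ.* suc K)
      ≈⟨ ℚᵘ.*≡* (cong +_ eq) ⟩
    ℚᵘ.mkℚᵘ (+ 1) a
      ≈⟨ ℚᵘ.≃-sym (ℚ.toℚᵘ-fromℚᵘ (ℚᵘ.mkℚᵘ (+ 1) a)) ⟩
    ℚ.toℚᵘ (1/suc a) ∎)
    where
    open ℚᵘ.≃-Reasoning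
    eq : (suc K ℕ.* 1) ℕ.* suc a ≡ 1 ℕ.* (1 ℕ.* (suc a ℕ.* suc K))
    eq = trans (cong (ℕ._* suc a) (ℕ.*-identityʳ (suc K)))
      (trans (ℕ.*-comm (suc K) (suc a))
        (sym (trans (ℕ.*-identityˡ (1 ℕ.* (suc a ℕ.* suc K)))
          (ℕ.*-identityˡ (suc a ℕ.* suc K)))))

  harmonic-++ : ∀ a l l′ →
    harmonic a (l ℕ.+ l′) ≡ harmonic a l ℚ.+ harmonic (l ℕ.+ a) l′
  harmonic-++ a zero    l′ = sym (ℚ.+-identityˡ _)
  harmonic-++ a (suc l) l′ = trans
    (cong (1/suc a ℚ.+_) (trans (harmonic-++ (suc a) l l′)
      (cong (λ b → harmonic (suc a) l ℚ.+ harmonic b l′) (ℕ.+-suc l a))))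
    (sym (ℚ.+-assoc (1/suc a) (harmonic (suc a) l) _))

  suc/1 : ∀ l c → c ℚ.+ (+ l ℚ./ 1) ℚ.* c ≡ (+ suc l ℚ./ 1) ℚ.* c
  suc/1 l c = trans (cong (ℚ._+ (+ l ℚ./ 1) ℚ.* c) (sym (ℚ.*-identityˡ c)))
    (trans (sym (ℚ.*-distribʳ-+ c 1ℚ (+ l ℚ./ 1))) (cong (ℚ._* c) eq))
    where
    eq : 1ℚ ℚ.+ (+ l ℚ./ 1) ≡ + suc l ℚ./ 1
    eq = ℚ.toℚᵘ-injective (ℚᵘ.≃-trans (ℚ.toℚᵘ-homo-+ 1ℚ (+ l ℚ./ 1))
      (ℚᵘ.≃-trans (ℚᵘ.+-congʳ ℚᵘ.1ℚᵘ (ℚ.toℚᵘ-fromℚᵘ (ℚᵘ.mkℚᵘ (+ l) 0)))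
      (ℚᵘ.≃-trans (ℚᵘ.*≡* (cong (ℤ._* + 1) (cong (λ z → + 1 ℤ.+ z) (ℤ.*-identityʳ (+ l)))))
        (ℚᵘ.≃-sym (ℚ.toℚᵘ-fromℚᵘ (ℚᵘ.mkℚᵘ (+ suc l) 0))))))

  harmonic-≥ : ∀ a l {c} → (∀ j → j ℕ.< l → c ℚ.≤ 1/suc (j ℕ.+ a)) →
               (+ l ℚ./ 1) ℚ.* c ℚ.≤ harmonic a l
  harmonic-≥ a zero    {c} h = ℚ.≤-reflexive (ℚ.*-zeroˡ c)
  harmonic-≥ a (suc l) {c} h = subst (ℚ._≤ harmonic a (suc l)) (suc/1 l c)
    (ℚ.+-mono-≤ (h 0 (ℕ.s≤s ℕ.z≤n)) (harmonic-≥ (suc a) l λ j j<l →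
      subst (λ b → c ℚ.≤ 1/suc b) (sym (ℕ.+-suc j a)) (h (suc j) (ℕ.s≤s j<l))))

  harmonic-≤ : ∀ a l {c} → (∀ j → j ℕ.< l → 1/suc (j ℕ.+ a) ℚ.≤ c) →
               harmonic a l ℚ.≤ (+ l ℚ./ 1) ℚ.* c
  harmonic-≤ a zero    {c} h = ℚ.≤-reflexive (sym (ℚ.*-zeroˡ c))
  harmonic-≤ a (suc l) {c} h = subst (harmonic a (suc l) ℚ.≤_) (suc/1 l c)
    (ℚ.+-mono-≤ (h 0 (ℕ.s≤s ℕ.z≤n)) (harmonic-≤ (suc a) l λ j j<l →
      subst (λ b → 1/suc b ℚ.≤ c) (sym (ℕ.+-suc j a)) (h (suc j) (ℕ.s≤s j<l))))

  block-≥ : ∀ K a → 1/suc a ℚ.≤ harmonic (a ℕ.* suc K) (suc K)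
  block-≥ K a = subst (ℚ._≤ harmonic (a ℕ.* suc K) (suc K)) (times-1/ K a)
    (harmonic-≥ (a ℕ.* suc K) (suc K) λ j j<K →
      1/suc-anti (ℕ.+-monoˡ-≤ (a ℕ.* suc K) (ℕ.s≤s⁻¹ j<K)))

  block-≤ : ∀ K a → harmonic (suc a ℕ.* suc K) (suc K) ℚ.≤ 1/suc a
  block-≤ K a = subst (harmonic (suc a ℕ.* suc K) (suc K) ℚ.≤_) (times-1/ K a)
    (harmonic-≤ (suc a ℕ.* suc K) (suc K) λ j j<K →
      1/suc-anti (ℕ.≤-trans (ℕ.n≤1+n _) (ℕ.m≤n+m _ j)))

  refine-≥ : ∀ K a l → harmonic a l ℚ.≤ harmonic (a ℕ.* suc K) (l ℕ.* suc K)
  refine-≥ K a zero    = ℚ.≤-refl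
  refine-≥ K a (suc l) = subst (harmonic a (suc l) ℚ.≤_)
    (sym (harmonic-++ (a ℕ.* suc K) (suc K) (l ℕ.* suc K)))
    (ℚ.+-mono-≤ (block-≥ K a) (refine-≥ K (suc a) l))

  refine-≤ : ∀ K a l → harmonic (suc a ℕ.* suc K) (l ℕ.* suc K)
                       ℚ.+ 1/suc (a ℕ.+ l)
                     ℚ.≤ harmonic (suc a) l ℚ.+ 1/suc a
  refine-≤ K a zero = ℚ.≤-reflexive (cong (λ b → 0ℚ ℚ.+ 1/suc b) (ℕ.+-identityʳ a))
  refine-≤ K a (suc l) = begin
    harmonic (suc a ℕ.* suc K) (suc l ℕ.* suc K) ℚ.+ 1/suc (a ℕ.+ suc l)
      ≡⟨ cong₂ ℚ._+_ (harmonic-++ (suc a ℕ.* suc K) (suc K) (l ℕ.* suc K))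
                     (cong 1/suc (ℕ.+-suc a l)) ⟩
    harmonic (suc a ℕ.* suc K) (suc K)
      ℚ.+ harmonic (suc (suc a) ℕ.* suc K) (l ℕ.* suc K)
      ℚ.+ 1/suc (suc a ℕ.+ l)
      ≡⟨ ℚ.+-assoc (harmonic (suc a ℕ.* suc K) (suc K)) _ _ ⟩
    harmonic (suc a ℕ.* suc K) (suc K)
      ℚ.+ (harmonic (suc (suc a) ℕ.* suc K) (l ℕ.* suc K)
      ℚ.+ 1/suc (suc a ℕ.+ l))
      ≤⟨ ℚ.+-mono-≤ (block-≤ K a) (refine-≤ K (suc a) l) ⟩
    1/suc a ℚ.+ (harmonic (suc (suc a)) l ℚ.+ 1/suc (suc a))
      ≡⟨ lem (1/suc a) (harmonic (suc (suc a)) l) (1/suc (suc a)) ⟩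
    harmonic (suc a) (suc l) ℚ.+ 1/suc a ∎
    where
    open ℚ.≤-Reasoning
    lem : ∀ u v w → u ℚ.+ (v ℚ.+ w) ≡ w ℚ.+ v ℚ.+ u
    lem = solve-∀ ℚ-ring

  riemann : ℕ → ℕ → ℚ
  riemann p i = harmonic (suc i) ((p ℕ.∸ 1) ℕ.* suc i)

  riemann-close : ∀ p i j → riemann p i ℚ.≤ riemann p j ℚ.+ 1/suc j
  riemann-close p i j = begin
    riemann p i
      ≤⟨ refine-≥ j (suc i) (l ℕ.* suc i) ⟩
    harmonic (suc i ℕ.* suc j) (l ℕ.* suc i ℕ.* suc j)
      ≡⟨ cong₂ harmonic (ℕ.*-comm (suc i) (suc j)) eq ⟩
    harmonic (suc j ℕ.* suc i) (l ℕ.* suc j ℕ.* suc i)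
      ≡⟨ sym (ℚ.+-identityʳ _) ⟩
    harmonic (suc j ℕ.* suc i) (l ℕ.* suc j ℕ.* suc i) ℚ.+ 0ℚ
      ≤⟨ ℚ.+-monoʳ-≤ (harmonic (suc j ℕ.* suc i) (l ℕ.* suc j ℕ.* suc i))
           (0≤1/suc (j ℕ.+ l ℕ.* suc j)) ⟩
    harmonic (suc j ℕ.* suc i) (l ℕ.* suc j ℕ.* suc i)
      ℚ.+ 1/suc (j ℕ.+ l ℕ.* suc j)
      ≤⟨ refine-≤ i j (l ℕ.* suc j) ⟩
    riemann p j ℚ.+ 1/suc j ∎
    where
    open ℚ.≤-Reasoning
    l = p ℕ.∸ 1
    eq : l ℕ.* suc i ℕ.* suc j ≡ l ℕ.* suc j ℕ.* suc i
    eq = trans (ℕ.*-assoc l (suc i) (suc j))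
      (trans (cong (l ℕ.*_) (ℕ.*-comm (suc i) (suc j)))
        (sym (ℕ.*-assoc l (suc j) (suc i))))

  archimedean : ∀ δ → 0ℚ ℚ.< δ → ∃ λ M → 1/suc M ℚ.≤ δ
  archimedean (mkℚ +[1+ n ] d c) _ = d , ℚ.toℚᵘ-cancel-≤
    (ℚᵘ.≤-respˡ-≃ (ℚᵘ.≃-sym (ℚ.toℚᵘ-fromℚᵘ (ℚᵘ.mkℚᵘ (+ 1) d)))
    (ℚᵘ.*≤* (ℤ.+≤+ (ℕ.*-monoˡ-≤ (suc d) (ℕ.s≤s (ℕ.z≤n {n}))))))
  archimedean (mkℚ (+ 0) d c) (ℚ.*<* (ℤ.+<+ ()))
  archimedean (mkℚ -[1+ n ] d c) (ℚ.*<* ())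

-- log p = ∫₁ᵖ dx/x, for p ≥ 1, as the limit of the right Riemann sums
-- with mesh 1/M (M = i+1):
--   Σ_{j=1}^{(p-1)M} (1/M) · 1/(1 + j/M)  =  Σ_{j=1}^{(p-1)M} 1/(M+j).
log : ℕ → ℝ
log p = mkℝ (λ i → harmonic (suc i) ((p ℕ.∸ 1) ℕ.* suc i)) λ δ δ>0 →
  let (M , M≤) = archimedean δ δ>0
      close : ∀ i j → M ℕ.≤ j → riemann p i ℚ.- riemann p j ℚ.≤ δ
      close i j M≤j = begin
        riemann p i ℚ.- riemann p j
          ≤⟨ ℚ.+-monoˡ-≤ (ℚ.- riemann p j) (riemann-close p i j) ⟩
        riemann p j ℚ.+ 1/suc j ℚ.- riemann p j
          ≡⟨ lem (riemann p j) (1/suc j) ⟩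
        1/suc j
          ≤⟨ 1/suc-anti M≤j ⟩
        1/suc M
          ≤⟨ M≤ ⟩
        δ ∎
  in M , λ i j M≤i M≤j → ∣∣-lub (close i j M≤j)
       (subst (ℚ._≤ δ) (flip (riemann p i) (riemann p j)) (close j i M≤i))
  where
  open ℚ.≤-Reasoning
  lem : ∀ u v → u ℚ.+ v ℚ.- u ≡ v
  lem = solve-∀ ℚ-ring
  flip : ∀ u v → v ℚ.- u ≡ ℚ.- (u ℚ.- v)
  flip = solve-∀ ℚ-ring

k·log+1-positive : ∀ k p → Positive (fromℕ k *ᴿ log p +ᴿ fromℕ 1)
k·log+1-positive k p = mkPositive 1ℚ (ℚ.positive⁻¹ 1ℚ) 0 λ i _ →
  let q = (+ k ℚ./ 1) ℚ.* riemann p i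
      q≥0 = ℚ.nonNeg*nonNeg⇒nonNeg (+ k ℚ./ 1) {{ℚ.normalize-nonNeg k 1}}
              (riemann p i) {{ℚ.nonNegative (0≤harmonic (suc i) ((p ℕ.∸ 1) ℕ.* suc i))}}
  in subst (ℚ._≤ q ℚ.+ 1ℚ) (ℚ.+-identityˡ 1ℚ)
       (ℚ.+-monoˡ-≤ 1ℚ (ℚ.nonNegative⁻¹ q {{q≥0}}))

private
  leastFrom : (b n c fuel : ℕ) → ℕ
  leastFrom b n c zero       = c
  leastFrom b n c (suc fuel) with n ℕ.≤? b ℕ.^ c
  ... | yes _ = c
  ... | no  _ = leastFrom b n (suc c) fuel

  n<b^n : ∀ {b} → 2 ℕ.≤ b → ∀ n → n ℕ.< b ℕ.^ n
  n<b^n 2≤b zero    = ℕ.s≤s ℕ.z≤n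
  n<b^n {b} 2≤b (suc n) = begin-strict
    suc n                   ≤⟨ n<b^n 2≤b n ⟩
    b ℕ.^ n                 <⟨ ℕ.m<m+n (b ℕ.^ n) (ℕ.≤-trans (ℕ.s≤s ℕ.z≤n) (n<b^n 2≤b n)) ⟩
    b ℕ.^ n ℕ.+ b ℕ.^ n     ≡⟨ cong (b ℕ.^ n ℕ.+_) (ℕ.+-identityʳ (b ℕ.^ n)) ⟨
    2 ℕ.* b ℕ.^ n           ≤⟨ ℕ.*-monoˡ-≤ (b ℕ.^ n) 2≤b ⟩
    b ℕ.* b ℕ.^ n           ∎
    where open ℕ.≤-Reasoning

  leastFrom-spec : ∀ b n c fuel → n ℕ.≤ b ℕ.^ (fuel ℕ.+ c) →
    (∀ d → d ℕ.< c → ¬ n ℕ.≤ b ℕ.^ d) →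
    n ℕ.≤ b ℕ.^ leastFrom b n c fuel ×
    (∀ d → n ℕ.≤ b ℕ.^ d → leastFrom b n c fuel ℕ.≤ d)
  leastFrom-spec b n c zero    top below =
    top , λ d n≤ → ℕ.≮⇒≥ λ d<c → below d d<c n≤
  leastFrom-spec b n c (suc fuel) top below with n ℕ.≤? b ℕ.^ c
  ... | yes n≤ = n≤ , λ d n≤ → ℕ.≮⇒≥ λ d<c → below d d<c n≤
  ... | no  n≰ = leastFrom-spec b n (suc c) fuel
    (subst (λ e → n ℕ.≤ b ℕ.^ e) (sym (ℕ.+-suc fuel c)) top) below′
    where
    below′ : ∀ d → d ℕ.< suc c → ¬ n ℕ.≤ b ℕ.^ d
    below′ d d<1+c with ℕ.m<1+n⇒m<n∨m≡n d<1+c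
    ... | inj₁ d<c  = below d d<c
    ... | inj₂ refl = n≰

-- For b ≥ 2 and n ≥ 1, ⌈log b ⌉ n is the least natural number c with
-- n ≤ bᶜ; the search stops by c = n because n ≤ bⁿ.  The lemma
-- ⌈log⌉-ceiling shows that this is the ceiling of log n / log b, which
-- cannot itself be computed from a Cauchy real.
⌈log_⌉ : ℕ → ℕ → ℕ
⌈log b ⌉ n = leastFrom b n 0 n

⌈log⌉-least : ∀ b n → 2 ℕ.≤ b →
  n ℕ.≤ b ℕ.^ ⌈log b ⌉ n × (∀ c → n ℕ.≤ b ℕ.^ c → ⌈log b ⌉ n ℕ.≤ c)
⌈log⌉-least b n 2≤b = leastFrom-spec b n 0 n
  (subst (λ e → n ℕ.≤ b ℕ.^ e) (sym (ℕ.+-identityʳ n)) (ℕ.<⇒≤ (n<b^n 2≤b n)))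
  λ _ ()

private
  harmonic-mono : ∀ a {l l′} → l ℕ.≤ l′ → harmonic a l ℚ.≤ harmonic a l′
  harmonic-mono a {l} {l′} l≤l′ = subst₂ ℚ._≤_ (ℚ.+-identityʳ (harmonic a l))
    (trans (sym (harmonic-++ a l (l′ ℕ.∸ l))) (cong (harmonic a) (ℕ.m+[n∸m]≡n l≤l′)))
    (ℚ.+-monoʳ-≤ (harmonic a l) (0≤harmonic (l ℕ.+ a) (l′ ℕ.∸ l)))

  riemann-mono : ∀ {m n} i → m ℕ.≤ n → riemann m i ℚ.≤ riemann n i
  riemann-mono i m≤n =
    harmonic-mono (suc i) (ℕ.*-monoˡ-≤ (suc i) (ℕ.∸-monoˡ-≤ 1 m≤n))

  riemann-gap : ∀ m {n} i → .{{NonZero m}} → m ℕ.< n →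
                riemann m i ℚ.+ 1/suc m ℚ.≤ riemann n i
  riemann-gap m@(suc m′) {n} i m<n = begin
    riemann m i ℚ.+ 1/suc m
      ≤⟨ ℚ.+-monoʳ-≤ (riemann m i) (block-≥ i m) ⟩
    riemann m i ℚ.+ harmonic (m ℕ.* suc i) (suc i)
      ≡⟨ cong (λ a → riemann m i ℚ.+ harmonic a (suc i)) (ℕ.+-comm (suc i) (m′ ℕ.* suc i)) ⟩
    riemann m i ℚ.+ harmonic (m′ ℕ.* suc i ℕ.+ suc i) (suc i)
      ≡⟨ sym (harmonic-++ (suc i) (m′ ℕ.* suc i) (suc i)) ⟩
    harmonic (suc i) (m′ ℕ.* suc i ℕ.+ suc i)
      ≡⟨ cong (harmonic (suc i)) (ℕ.+-comm (m′ ℕ.* suc i) (suc i)) ⟩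
    riemann (suc m) i
      ≤⟨ riemann-mono i m<n ⟩
    riemann n i ∎
    where open ℚ.≤-Reasoning

  riemann-* : ∀ a b i → .{{NonZero a}} → .{{NonZero b}} → ∃ λ i′ → i ℕ.≤ i′ ×
              riemann (a ℕ.* b) i ≡ riemann b i ℚ.+ riemann a i′
  riemann-* (suc a′) (suc b′) i = i ℕ.+ b′ ℕ.* suc i , ℕ.m≤m+n i (b′ ℕ.* suc i) ,
    trans (cong (harmonic (suc i)) (ℕ.*-distribʳ-+ (suc i) b′ (a′ ℕ.* suc b′)))
    (trans (harmonic-++ (suc i) (b′ ℕ.* suc i) (a′ ℕ.* suc b′ ℕ.* suc i))
      (cong (riemann (suc b′) i ℚ.+_)
        (cong₂ harmonic (ℕ.+-comm (b′ ℕ.* suc i) (suc i))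
          (ℕ.*-assoc a′ (suc b′) (suc i)))))

  riemann-^-≤ : ∀ b c i → .{{NonZero b}} →
    riemann (b ℕ.^ c) i ℚ.≤ (+ c ℚ./ 1) ℚ.* (riemann b i ℚ.+ 1/suc i)
  riemann-^-≤ b zero    i = ℚ.≤-reflexive (sym (ℚ.*-zeroˡ (riemann b i ℚ.+ 1/suc i)))
  riemann-^-≤ b (suc c) i {{b≢0}} with riemann-* b (b ℕ.^ c) i {{b≢0}} {{ℕ.m^n≢0 b c}}
  ... | i′ , i≤i′ , eq = begin
    riemann (b ℕ.* b ℕ.^ c) i
      ≡⟨ trans eq (ℚ.+-comm (riemann (b ℕ.^ c) i) (riemann b i′)) ⟩
    riemann b i′ ℚ.+ riemann (b ℕ.^ c) i
      ≤⟨ ℚ.+-mono-≤ (riemann-close b i′ i) (riemann-^-≤ b c i) ⟩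
    (riemann b i ℚ.+ 1/suc i) ℚ.+ (+ c ℚ./ 1) ℚ.* (riemann b i ℚ.+ 1/suc i)
      ≡⟨ suc/1 c (riemann b i ℚ.+ 1/suc i) ⟩
    (+ suc c ℚ./ 1) ℚ.* (riemann b i ℚ.+ 1/suc i) ∎
    where open ℚ.≤-Reasoning

  riemann-^-≥ : ∀ b c i → .{{NonZero b}} →
    (+ c ℚ./ 1) ℚ.* riemann b i ℚ.≤ riemann (b ℕ.^ c) i ℚ.+ (+ c ℚ./ 1) ℚ.* 1/suc i
  riemann-^-≥ b zero    i = ℚ.≤-reflexive (trans (ℚ.*-zeroˡ (riemann b i))
    (sym (trans (ℚ.+-identityˡ _) (ℚ.*-zeroˡ (1/suc i)))))
  riemann-^-≥ b (suc c) i {{b≢0}} with riemann-* b (b ℕ.^ c) i {{b≢0}} {{ℕ.m^n≢0 b c}}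
  ... | i′ , i≤i′ , eq = begin
    (+ suc c ℚ./ 1) ℚ.* riemann b i
      ≡⟨ sym (suc/1 c (riemann b i)) ⟩
    riemann b i ℚ.+ (+ c ℚ./ 1) ℚ.* riemann b i
      ≤⟨ ℚ.+-mono-≤ (ℚ.≤-trans (riemann-close b i i′)
           (ℚ.+-monoʳ-≤ (riemann b i′) (1/suc-anti i≤i′))) (riemann-^-≥ b c i) ⟩
    (riemann b i′ ℚ.+ 1/suc i) ℚ.+ (riemann (b ℕ.^ c) i ℚ.+ (+ c ℚ./ 1) ℚ.* 1/suc i)
      ≡⟨ shuffle (riemann b i′) (1/suc i) (riemann (b ℕ.^ c) i) _ ⟩
    (riemann (b ℕ.^ c) i ℚ.+ riemann b i′) ℚ.+ (1/suc i ℚ.+ (+ c ℚ./ 1) ℚ.* 1/suc i)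
      ≡⟨ cong₂ ℚ._+_ (sym eq) (suc/1 c (1/suc i)) ⟩
    riemann (b ℕ.* b ℕ.^ c) i ℚ.+ (+ suc c ℚ./ 1) ℚ.* 1/suc i ∎
    where
    open ℚ.≤-Reasoning
    shuffle : ∀ u v w z → (u ℚ.+ v) ℚ.+ (w ℚ.+ z) ≡ (w ℚ.+ u) ℚ.+ (v ℚ.+ z)
    shuffle = solve-∀ ℚ-ring

  small : ∀ c δ → 0ℚ ℚ.< δ → ∃ λ M → ∀ i → M ℕ.≤ i → (+ c ℚ./ 1) ℚ.* 1/suc i ℚ.≤ δ
  small zero    δ δ>0 = 0 , λ i _ →
    subst (ℚ._≤ δ) (sym (ℚ.*-zeroˡ (1/suc i))) (ℚ.<⇒≤ δ>0)
  small (suc c) δ δ>0 =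
    let (L , L≤) = small c (½ ℚ.* δ) (0<½* δ>0)
        (M , M≤) = archimedean (½ ℚ.* δ) (0<½* δ>0)
    in L ℕ.⊔ M , λ i h → subst₂ ℚ._≤_ (suc/1 c (1/suc i)) (halves δ)
         (ℚ.+-mono-≤ (ℚ.≤-trans (1/suc-anti (ℕ.m⊔n≤o⇒n≤o L M h)) M≤)
                     (L≤ i (ℕ.m⊔n≤o⇒m≤o L M h)))

  n≤b^c⇒log≤ : ∀ b n c → .{{NonZero b}} → n ℕ.≤ b ℕ.^ c →
               log n ≤ᴿ fromℕ c *ᴿ log b
  n≤b^c⇒log≤ b n c n≤ δ δ>0 =
    let (M , M≤) = small c δ δ>0 in M , λ i M≤i → begin
      riemann n i
        ≤⟨ riemann-mono i n≤ ⟩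
      riemann (b ℕ.^ c) i
        ≤⟨ riemann-^-≤ b c i ⟩
      (+ c ℚ./ 1) ℚ.* (riemann b i ℚ.+ 1/suc i)
        ≡⟨ ℚ.*-distribˡ-+ (+ c ℚ./ 1) (riemann b i) (1/suc i) ⟩
      (+ c ℚ./ 1) ℚ.* riemann b i ℚ.+ (+ c ℚ./ 1) ℚ.* 1/suc i
        ≤⟨ ℚ.+-monoʳ-≤ ((+ c ℚ./ 1) ℚ.* riemann b i) (M≤ i M≤i) ⟩
      (+ c ℚ./ 1) ℚ.* riemann b i ℚ.+ δ ∎
    where open ℚ.≤-Reasoning

  log≤⇒n≤b^c : ∀ b n c → .{{NonZero b}} → log n ≤ᴿ fromℕ c *ᴿ log b →
               n ℕ.≤ b ℕ.^ c
  log≤⇒n≤b^c b n c log≤ = ℕ.≮⇒≥ λ b^c<n → impossible b^c<n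
    where
    η δ : ℚ
    η = 1/suc (b ℕ.^ c)
    δ = ½ ℚ.* (½ ℚ.* η)
    η>0 : 0ℚ ℚ.< η
    η>0 = ℚ.positive⁻¹ η {{ℚ.normalize-pos 1 (suc (b ℕ.^ c))}}
    δ>0 : 0ℚ ℚ.< δ
    δ>0 = 0<½* (0<½* η>0)
    cancelˡ : ∀ u v → ℚ.- u ℚ.+ (u ℚ.+ v) ≡ v
    cancelˡ = solve-∀ ℚ-ring
    impossible : ¬ b ℕ.^ c ℕ.< n
    impossible b^c<n =
      let (L , L≤) = log≤ δ δ>0
          (M , M≤) = small c δ δ>0
          i = L ℕ.⊔ M
          R = riemann (b ℕ.^ c) i
          R+η≤R+½η = begin
            R ℚ.+ η
              ≤⟨ riemann-gap (b ℕ.^ c) i {{ℕ.m^n≢0 b c}} b^c<n ⟩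
            riemann n i
              ≤⟨ L≤ i (ℕ.m≤m⊔n L M) ⟩
            (+ c ℚ./ 1) ℚ.* riemann b i ℚ.+ δ
              ≤⟨ ℚ.+-monoˡ-≤ δ (riemann-^-≥ b c i) ⟩
            R ℚ.+ (+ c ℚ./ 1) ℚ.* 1/suc i ℚ.+ δ
              ≤⟨ ℚ.+-monoˡ-≤ δ (ℚ.+-monoʳ-≤ R (M≤ i (ℕ.m≤n⊔m L M))) ⟩
            R ℚ.+ δ ℚ.+ δ
              ≡⟨ trans (ℚ.+-assoc R δ δ) (cong (R ℚ.+_) (halves (½ ℚ.* η))) ⟩
            R ℚ.+ ½ ℚ.* η ∎
          η≤½η = subst₂ ℚ._≤_ (cancelˡ R η) (cancelˡ R (½ ℚ.* η))
                   (ℚ.+-monoʳ-≤ (ℚ.- R) R+η≤R+½η)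
          ½η<η = subst₂ ℚ._<_ (ℚ.+-identityʳ (½ ℚ.* η)) (halves η)
                   (ℚ.+-monoʳ-< (½ ℚ.* η) (0<½* η>0))
      in ℚ.<-irrefl refl (ℚ.<-≤-trans ½η<η η≤½η)
      where open ℚ.≤-Reasoning

⌈log⌉-ceiling : ∀ b n c → 2 ℕ.≤ b →
  (⌈log b ⌉ n ℕ.≤ c → log n ≤ᴿ fromℕ c *ᴿ log b) ×
  (log n ≤ᴿ fromℕ c *ᴿ log b → ⌈log b ⌉ n ℕ.≤ c)
⌈log⌉-ceiling b n c 2≤b =
    (λ ≤c → n≤b^c⇒log≤ b n c
      (ℕ.≤-trans (proj₁ (⌈log⌉-least b n 2≤b)) (ℕ.^-monoʳ-≤ b ≤c)))
  , (λ log≤ → proj₂ (⌈log⌉-least b n 2≤b) c (log≤⇒n≤b^c b n c log≤))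
  where
  instance
    b≢0 : NonZero b
    b≢0 = ℕ.>-nonZero (ℕ.≤-trans (ℕ.s≤s ℕ.z≤n) 2≤b)

------------------------------------------------------------------------
-- ℤ/Nℤ and (ℤ/Nℤ)ⁿ

ℤ/ : ℕ → Set
ℤ/ N = Fin N

module _ {N : ℕ} .{{_ : NonZero N}} where

  infixl 6 _+ₘ_ _⊕_
  infixl 7 _*ₘ_ _•_

  _+ₘ_ _*ₘ_ : ℤ/ N → ℤ/ N → ℤ/ N
  a +ₘ b = (toℕ a ℕ.+ toℕ b) mod N
  a *ₘ b = (toℕ a ℕ.* toℕ b) mod N

  IsUnit : ℤ/ N → Set
  IsUnit a = ∃ λ b → a *ₘ b ≡ 1 mod N

  _⊕_ : ∀ {n} → Vec (ℤ/ N) n → Vec (ℤ/ N) n → Vec (ℤ/ N) n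
  _⊕_ = Vec.zipWith _+ₘ_

  _•_ : ∀ {n} → ℤ/ N → Vec (ℤ/ N) n → Vec (ℤ/ N) n
  c • u = Vec.map (c *ₘ_) u

  Proportional : ∀ {n} → Vec (ℤ/ N) n → Vec (ℤ/ N) n → Set
  Proportional u v = ∃ λ c → IsUnit c × v ≡ c • u

  -- Membership in the line { a + t u : t ∈ ℤ/Nℤ }.
  OnLine : ∀ {n} (a u x : Vec (ℤ/ N) n) → Set
  OnLine a u x = ∃ λ t → x ≡ a ⊕ t • u

  onLine? : ∀ {n} (a u x : Vec (ℤ/ N) n) → Dec (OnLine a u x)
  onLine? a u x = Fin.any? λ t → Vec.≡-dec Fin._≟_ x (a ⊕ t • u)

reduce : ∀ {N} M .{{_ : NonZero M}} → ℤ/ N → ℤ/ M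
reduce M a = toℕ a mod M

------------------------------------------------------------------------
-- Projective space and Kakeya sets

record PrimeFactorisation (r N : ℕ) : Set where
  field
    prime      : Fin r → ℕ
    exponent   : Fin r → ℕ
    isPrime    : ∀ i → Prime (prime i)
    decreasing : ∀ {i j} → i Fin.< j → prime j ℕ.< prime i
    exponent≥1 : ∀ i → 1 ℕ.≤ exponent i

  primePower : Fin r → ℕ
  primePower i = prime i ℕ.^ exponent i

  field
    factors : N ≡ Vector.foldr ℕ._*_ 1 primePower

  primePower≢0 : ∀ i → NonZero (primePower i)
  primePower≢0 i =
    ℕ.m^n≢0 (prime i) (exponent i) {{prime⇒nonZero (isPrime i)}}

module _ {r N : ℕ} .{{_ : NonZero N}} (F : PrimeFactorisation r N) where

  open PrimeFactorisation F

  HasUnitCoordinates : ∀ {n} → Vec (ℤ/ N) n → Set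
  HasUnitCoordinates u = ∀ i →
    let instance _ = primePower≢0 i
    in VecAny.Any (IsUnit ∘ reduce (primePower i)) u

  -- A choice of exactly one representative, in no particular order, of
  -- every class of vectors modulo multiplication by units.
  record ProjectiveSpace (n : ℕ) : Set where
    field
      points     : List (Vec (ℤ/ N) n)
      sound      : All HasUnitCoordinates points
      distinct   : AllPairs (λ u v → ¬ Proportional u v) points
      exhaustive : ∀ u → HasUnitCoordinates u → Any (Proportional u) points

module _ {r N n : ℕ} .{{_ : NonZero N}} {F : PrimeFactorisation r N} where

  -- S stands for a finite set, so it is only used without repetitions;
  -- then the filtered list has length ∣ L ∩ S ∣.
  HasRichLine : List (Vec (ℤ/ N) n) → ℕ → Vec (ℤ/ N) n → Set
  HasRichLine S m u = ∃ λ a → m ℕ.≤ length (filter (onLine? a u) S)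

  -- The proportion of good directions is at least ε when some set D of
  -- good directions has ε ∣ℙ∣ ≤ ∣D∣.
  IsKakeya : ProjectiveSpace F n → ℕ → ℝ → List (Vec (ℤ/ N) n) → Set
  IsKakeya P m ε S = ∃ λ D →
    D ⊆ points × All (HasRichLine S m) D ×
    ε *ᴿ fromℕ (length points) ≤ᴿ fromℕ (length D)
    where open ProjectiveSpace P

module _ {r N : ℕ} (F : PrimeFactorisation (suc r) N) (n : ℕ) where

  open PrimeFactorisation F renaming (prime to p; exponent to k)

  denominator : Fin (suc r) → ℕ
  denominator i = 2 ℕ.* (k i ℕ.+ ⌈log p i ⌉ n)

  denominator≢0 : ∀ i → NonZero (denominator i)
  denominator≢0 i = ℕ.m*n≢0 2 (k i ℕ.+ ⌈log p i ⌉ n)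
    {{_}} {{ℕ.>-nonZero (ℕ.≤-trans (exponent≥1 i) (ℕ.m≤m+n (k i) _))}}

  kakeyaConstant : ℝ
  kakeyaConstant =
    ( ∏ᴿ (λ (j : Fin r) → let i = inject₁ j in
          recip (fromℕ (k i) *ᴿ log (p i) +ᴿ fromℕ 1)
                (k·log+1-positive (k i) (p i)))
    *ᴿ ∏ᴿ (λ i → fromℚ ((+ 1 ℚ./ denominator i) {{denominator≢0 i}})))
    ^ᴿ n

{-# OPTIONS --safe #-}

-- For a prime power q let ζ be a primitive q-th root of unity and
-- π = ζ - 1.  If T ⊆ (ℤ/q)ⁿ has few points, the functions
-- i ↦ i^α ζ^⟨y,i⟩ with y ∈ T and |α| < n are killed by a combination
-- over ℤ[ζ] of difference operators P_j, with a coefficient that is not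
-- divisible by π.  Divided differences at the nodes ζᵘ show that, up to
-- saturation, these functions span one congruent modulo π to
-- (⟨u,i⟩ choose e) whenever T contains more than e/n points of some
-- line in direction u.  The P_j are Newton polynomials chosen so that
-- along u = (1, j′) the operator P_j has order exactly level j modulo p
-- and the later ones vanish; by triangularity T cannot be small.
-- Averaging over affine charts of the projective space gives a bound
-- for ∑ |L_u ∩ S|ⁿ over all directions u.
--
-- Such sums are compatible with products: a line over X × Y has fibres
-- of varying multiplicity over Y, and choosing the best layer
-- {multiplicity ≥ a} costs a harmonic sum H_q ≤ 1 + k log p.  Induction
-- over the primes and the Chinese remainder theorem conclude.

module Submission where

open import Defs
open import Algebra.Bundles using (CommutativeRing; RawRing)
import Algebra.Properties.CommutativeSemiring.Binomial as Binomial
import Algebra.Properties.Ring as RingProperties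
import Algebra.Properties.Semiring.Exp as Exp
import Algebra.Properties.Semiring.Mult as Mult
import Algebra.Properties.Semiring.Sum as SemiringSum
import Algebra.Solver.Ring as RingSolver′
import Algebra.Solver.Ring.AlmostCommutativeRing as ACR
open import Data.Bool.Base using (true; false; if_then_else_)
open import Data.Empty using (⊥)
open import Data.Fin.Base as Fin using (Fin; zero; suc; toℕ)
open import Data.Fin.Properties as Fin using (any?)
open import Data.Integer.Base as ℤ using (ℤ; +_; 0ℤ; 1ℤ)
open import Data.Integer.Divisibility.Signed as ℤ∣ using () renaming (_∣_ to _∣ᶻ_; _∣?_ to _∣ᶻ?_)
import Data.Integer.Properties as ℤ
import Data.Integer.Tactic.RingSolver as ℤSolver
open import Data.List.Base as List using (List; []; _∷_; length; _++_)
open import Data.List.Membership.Propositional using (_∈_; _∉_; find)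
import Data.List.Membership.Propositional.Properties as ∈
import Data.List.Properties as List
open import Data.List.Relation.Binary.Sublist.Propositional as Sublist using (_⊆_)
open import Data.List.Relation.Unary.All as All using (All; []; _∷_)
import Data.List.Relation.Unary.All.Properties as All
open import Data.List.Relation.Unary.AllPairs as AllPairs using (AllPairs; []; _∷_)
open import Data.List.Relation.Unary.Any as Any using (Any; here; there)
open import Data.List.Relation.Unary.Unique.Propositional using (Unique)
import Data.List.Relation.Unary.Unique.DecPropositional.Properties as UniqueDec
import Data.List.Relation.Unary.Unique.Propositional.Properties as Unique
open import Data.Maybe.Base using (Maybe; just; nothing)
open import Data.Nat.Base as ℕ using (ℕ; zero; suc; _≤_; _<_; NonZero; z≤n; s≤s)
open import Data.Nat.Combinatorics using (_C_; nCk+nC[k+1]≡[n+1]C[k+1]; nCn≡1)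
open import Data.Nat.Coprimality as Coprime using (Coprime)
open import Data.Nat.Divisibility as ℕ using (_∣_; divides)
open import Data.Nat.DivMod as ℕ using (_%_; _/_; _mod_)
open import Data.Nat.GCD using (gcd; gcd[m,n]∣m; gcd[m,n]∣n; gcd-GCD; module Bézout)
open import Data.Nat.Induction using (<-rec)
open import Data.Nat.Primality
  using (Prime; prime⇒nonZero; prime⇒nonTrivial; prime⇒irreducible; euclidsLemma)
import Data.Nat.Properties as ℕ
import Data.Nat.Tactic.RingSolver as ℕSolver
open import Data.Product.Base using (∃; ∃₂; _×_; _,_; proj₁; proj₂)
open import Data.Rational.Base as ℚ using (ℚ; 0ℚ; 1ℚ)
import Data.Rational.Properties as ℚ
import Data.Rational.Unnormalised.Base as ℚᵘ
import Data.Rational.Unnormalised.Properties as ℚᵘ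
open import Data.Sum.Base using (_⊎_; inj₁; inj₂)
open import Data.Unit.Base using (⊤; tt)
open import Data.Vec.Base as Vec using (Vec; []; _∷_)
import Data.Vec.Functional as Vector
import Data.Vec.Functional.Properties as Vector
import Data.Vec.Properties as Vec
open import Data.Vec.Relation.Binary.Pointwise.Inductive as Pointwise using (Pointwise; []; _∷_)
import Data.Vec.Relation.Unary.Any as VecAny
open import Function.Base using (_∘_; id)
open import Level using (0ℓ)
open import Relation.Binary.Bundles using (Setoid)
open import Relation.Binary.Definitions using (DecidableEquality; tri<; tri≈; tri>)
open import Relation.Binary.PropositionalEquality
  using (_≡_; _≢_; refl; sym; trans; cong; cong₂; subst; subst₂; module ≡-Reasoning)
import Relation.Binary.Reasoning.Setoid as SetoidReasoning
open import Relation.Nullary.Decidable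
  using (Dec; yes; no; ¬?; _×-dec_; decidable-stable; dec⇒maybe; does; map′)
open import Relation.Nullary.Negation using (¬_; contradiction)
import Tactic.RingSolver as RingSolver
open import Tactic.RingSolver.Core.AlmostCommutativeRing using (AlmostCommutativeRing; fromCommutativeRing)

-- The differences `ζᵗ - ζᵘ` of the nodes are divisible by `π`, so divided differences leave the
-- ℤ[ζ]-span of the functions coming from `T`. Vanishing of a linear functional survives division by
-- nonzerodivisors, whence the saturated span; but the functional must stay nonzero modulo `π`,
-- where the contradiction is read off. So the linear algebra over ℤ[ζ] has to return a solution
-- with an entry prime to `π`. Origin of the constant, for `q = pᵏ` in dimension `n`: a line with
-- `a` points serves every index `j` with `level j < n a`. Modulo `p` the order at 1 of the product
-- of `xᵗ - 1` over `1 ≤ t ≤ i` is the sum of the `p`-parts of the `t`, at most `K i` for `i < pᴷ`,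
-- and `K = k + ⌈log_p n⌉` covers all indices met. This leaves at least as many indices as vectors
-- with coordinate sum below `n a / K`, against vectors with sum below `n` for each point of `T`;
-- the ratio is at least `(a / 2K)ⁿ`. An index prescribes its direction `(1, j′)`, so a single chart
-- weights the directions unevenly; averaging over charts restores uniformity.

-- Ring identities are decided with coefficients in the pairs a - b of
-- naturals: an abstract ring has no decidable equality of its own.
module IntegerSolver {c ℓ} (R : CommutativeRing c ℓ) where

  open CommutativeRing R hiding (zero) renaming (refl to ≈-refl; sym to ≈-sym; trans to ≈-trans)
  open Mult semiring using (×-homo-+; ×1-homo-*) renaming (_×_ to infixr 8 _·_)
  open RingProperties (CommutativeRing.ring R)
    using (-‿distribˡ-*; -‿distribʳ-*; -‿+-comm; -0#≈0#; -‿involutive)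
  open SetoidReasoning setoid

  private
    R′ : ACR.AlmostCommutativeRing c ℓ
    R′ = ACR.fromCommutativeRing R

    interchange : ∀ a b c d → (a + b) + (c + d) ≈ (a + c) + (b + d)
    interchange a b c d = begin
      (a + b) + (c + d) ≈⟨ +-assoc a b (c + d) ⟩
      a + (b + (c + d)) ≈⟨ +-congˡ (+-assoc b c d) ⟨
      a + ((b + c) + d) ≈⟨ +-congˡ (+-congʳ (+-comm b c)) ⟩
      a + ((c + b) + d) ≈⟨ +-congˡ (+-assoc c b d) ⟩
      a + (c + (b + d)) ≈⟨ +-assoc a c (b + d) ⟨
      (a + c) + (b + d) ∎

    -‿interchange : ∀ a b c d → (a + b) - (c + d) ≈ (a - c) + (b - d)
    -‿interchange a b c d = ≈-trans (+-congˡ (≈-sym (-‿+-comm c d))) (interchange a b (- c) (- d))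

    mul-differences : ∀ a b c d → (a * c + b * d) - (a * d + b * c) ≈ (a - b) * (c - d)
    mul-differences a b c d = begin
      (a * c + b * d) - (a * d + b * c)
        ≈⟨ -‿interchange (a * c) (b * d) (a * d) (b * c) ⟩
      (a * c - a * d) + (b * d - b * c)
        ≈⟨ +-cong (≈-trans (+-congˡ (-‿distribʳ-* a d)) (≈-sym (distribˡ a c (- d))))
             (≈-trans (+-cong (≈-sym (≈-trans (≈-sym (-‿distribˡ-* b (- d)))
               (≈-trans (-‿cong (≈-sym (-‿distribʳ-* b d))) (-‿involutive (b * d)))))
               (-‿distribˡ-* b c))
               (≈-trans (≈-sym (distribˡ (- b) (- d) c)) (*-congˡ (+-comm (- d) c)))) ⟩
      a * (c - d) + (- b) * (c - d)
        ≈⟨ distribʳ (c - d) a (- b) ⟨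
      (a - b) * (c - d) ∎

    Coeff : RawRing _ _
    Coeff = record
      { Carrier = ℕ × ℕ
      ; _≈_ = λ _ _ → ℕ
      ; _+_ = λ (a , b) (c , d) → a ℕ.+ c , b ℕ.+ d
      ; _*_ = λ (a , b) (c , d) → a ℕ.* c ℕ.+ b ℕ.* d , a ℕ.* d ℕ.+ b ℕ.* c
      ; -_ = λ (a , b) → b , a
      ; 0# = 0 , 0
      ; 1# = 1 , 0
      }

    ⟦_⟧ : ℕ × ℕ → Carrier
    ⟦ a , b ⟧ = a · 1# - b · 1#

    ·1-homo : ∀ a b c d →
      (a ℕ.* b ℕ.+ c ℕ.* d) · 1# ≈ (a · 1#) * (b · 1#) + (c · 1#) * (d · 1#)
    ·1-homo a b c d = ≈-trans (×-homo-+ 1# (a ℕ.* b) (c ℕ.* d))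
      (+-cong (×1-homo-* a b) (×1-homo-* c d))

    morphism : Coeff ACR.-Raw-AlmostCommutative⟶ R′
    morphism = record
      { ⟦_⟧ = ⟦_⟧
      ; +-homo = λ (a , b) (c , d) → ≈-trans
          (+-cong (×-homo-+ 1# a c) (-‿cong (×-homo-+ 1# b d)))
          (-‿interchange (a · 1#) (c · 1#) (b · 1#) (d · 1#))
      ; *-homo = λ (a , b) (c , d) → ≈-trans
          (+-cong (·1-homo a c b d) (-‿cong (·1-homo a d b c)))
          (mul-differences (a · 1#) (b · 1#) (c · 1#) (d · 1#))
      ; -‿homo = λ (a , b) → ≈-trans (+-comm (b · 1#) (- (a · 1#)))
          (≈-trans (+-congˡ (≈-sym (-‿involutive (b · 1#)))) (-‿+-comm (a · 1#) (- (b · 1#))))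
      ; 0-homo = -‿inverseʳ 0#
      ; 1-homo = ≈-trans (+-cong (+-identityʳ 1#) -0#≈0#) (+-identityʳ 1#)
      }

    equal? : ∀ x y → Maybe (⟦ x ⟧ ≈ ⟦ y ⟧)
    equal? (a , b) (c , d) with a ℕ.+ d ℕ.≟ c ℕ.+ b
    ... | no _ = nothing
    ... | yes e = just (begin
      α - β               ≈⟨ +-identityʳ (α - β) ⟨
      (α - β) + 0#        ≈⟨ +-congˡ (-‿inverseʳ δ) ⟨
      (α - β) + (δ - δ)   ≈⟨ interchange α (- β) δ (- δ) ⟩
      (α + δ) + (- β - δ) ≈⟨ +-congʳ (≈-trans (≈-sym (×-homo-+ 1# a d))
                               (≈-trans (reflexive (cong (_· 1#) e)) (×-homo-+ 1# c b))) ⟩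
      (γ + β) + (- β - δ) ≈⟨ interchange γ β (- β) (- δ) ⟩
      (γ - β) + (β - δ)   ≈⟨ +-congʳ (+-comm γ (- β)) ⟩
      (- β + γ) + (β - δ) ≈⟨ interchange (- β) γ β (- δ) ⟩
      (- β + β) + (γ - δ) ≈⟨ +-congʳ (-‿inverseˡ β) ⟩
      0# + (γ - δ)        ≈⟨ +-identityˡ (γ - δ) ⟩
      γ - δ               ∎)
      where
      α = a · 1# ; β = b · 1# ; γ = c · 1# ; δ = d · 1#

  open RingSolver′ Coeff R′ morphism equal? public
    using (solve; _:=_; _:+_; _:*_; _:-_; :-_; con)

-- Binomial coefficients and the Frobenius congruence

C-absorb : ∀ n k → suc k ℕ.* (suc n C suc k) ≡ suc n ℕ.* (n C k)
C-absorb zero zero = refl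
C-absorb zero (suc k) = ℕ.*-zeroʳ k
C-absorb (suc n) zero = begin
  1 ℕ.* (suc (suc n) C 1)          ≡⟨ cong (1 ℕ.*_) (sym (nCk+nC[k+1]≡[n+1]C[k+1] (suc n) 0)) ⟩
  1 ℕ.* (1 ℕ.+ (suc n C 1))        ≡⟨ lem (suc n C 1) ⟩
  1 ℕ.+ 1 ℕ.* (suc n C 1)          ≡⟨ cong (1 ℕ.+_) (C-absorb n zero) ⟩
  suc (suc n) ℕ.* 1                ∎
  where
  open ≡-Reasoning
  lem : ∀ a → 1 ℕ.* (1 ℕ.+ a) ≡ 1 ℕ.+ 1 ℕ.* a
  lem = ℕSolver.solve-∀
C-absorb (suc n) (suc k) = begin
  suc (suc k) ℕ.* (suc (suc n) C suc (suc k))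
    ≡⟨ cong (suc (suc k) ℕ.*_) (sym (nCk+nC[k+1]≡[n+1]C[k+1] (suc n) (suc k))) ⟩
  suc (suc k) ℕ.* ((suc n C suc k) ℕ.+ (suc n C suc (suc k)))
    ≡⟨ lem (suc k) (suc n C suc k) (suc n C suc (suc k)) ⟩
  (suc n C suc k) ℕ.+ suc k ℕ.* (suc n C suc k) ℕ.+ suc (suc k) ℕ.* (suc n C suc (suc k))
    ≡⟨ cong₂ (λ a b → (suc n C suc k) ℕ.+ a ℕ.+ b) (C-absorb n k) (C-absorb n (suc k)) ⟩
  (suc n C suc k) ℕ.+ suc n ℕ.* (n C k) ℕ.+ suc n ℕ.* (n C suc k)
    ≡⟨ lem′ (suc n C suc k) (suc n) (n C k) (n C suc k) ⟩
  (suc n C suc k) ℕ.+ suc n ℕ.* ((n C k) ℕ.+ (n C suc k))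
    ≡⟨ cong (λ a → (suc n C suc k) ℕ.+ suc n ℕ.* a) (nCk+nC[k+1]≡[n+1]C[k+1] n k) ⟩
  suc (suc n) ℕ.* (suc n C suc k) ∎
  where
  open ≡-Reasoning
  lem : ∀ k a b → suc k ℕ.* (a ℕ.+ b) ≡ a ℕ.+ k ℕ.* a ℕ.+ suc k ℕ.* b
  lem = ℕSolver.solve-∀
  lem′ : ∀ a n b c → a ℕ.+ n ℕ.* b ℕ.+ n ℕ.* c ≡ a ℕ.+ n ℕ.* (b ℕ.+ c)
  lem′ = ℕSolver.solve-∀

-- By `C-absorb` the product of `k` and `p C k` is a multiple of `p`, while `0 < k < p` keeps `p`
-- from dividing `k`.
prime∣C : ∀ {p} → Prime p → ∀ k → 0 < k → k < p → p ∣ p C k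
prime∣C {suc p} pp (suc k) _ k<p
  with euclidsLemma (suc k) (suc p C suc k) pp
         (subst (suc p ∣_) (sym (C-absorb p k)) (ℕ.m∣m*n (p C k)))
... | inj₁ p∣k = contradiction (ℕ.∣⇒≤ p∣k) (ℕ.<⇒≱ k<p)
... | inj₂ p∣C = p∣C

module CharP {c ℓ} (R : CommutativeRing c ℓ) {p : ℕ} (pp : Prime p) where

  open CommutativeRing R hiding (zero) renaming (refl to ≈-refl; sym to ≈-sym; trans to ≈-trans)
  open Exp semiring using (_^_; ^-congˡ; ^-assocʳ; ^-homo-*) public
  open Mult semiring
    using (×-congʳ; ×-homo-+; ×-assoc-*; ×-comm-*; ×-assocˡ; ×-congˡ)
    renaming (_×_ to infixr 8 _·_) public
  open SemiringSum semiring using (sum; sum-init-last; sum-cong-≋)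
  open SetoidReasoning setoid
  open IntegerSolver R

  ×-distribˡ-+ : ∀ n x y → n · (x + y) ≈ n · x + n · y
  ×-distribˡ-+ zero    x y = ≈-sym (+-identityʳ 0#)
  ×-distribˡ-+ (suc n) x y = ≈-trans (+-congˡ (×-distribˡ-+ n x y)) (lem x y (n · x) (n · y))
    where
    lem : ∀ a b c d → (a + b) + (c + d) ≈ (a + c) + (b + d)
    lem = solve 4 (λ a b c d → (a :+ b) :+ (c :+ d) := (a :+ c) :+ (b :+ d)) ≈-refl

  Multiple : Carrier → Set _
  Multiple x = ∃ λ z → x ≈ p · z

  multiple-+ : ∀ {x y} → Multiple x → Multiple y → Multiple (x + y)
  multiple-+ (z , x≈) (w , y≈) = z + w , ≈-trans (+-cong x≈ y≈) (≈-sym (×-distribˡ-+ p z w))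

  multiple-0 : Multiple 0#
  multiple-0 = 0# , ≈-sym (n·0 p)
    where
    n·0 : ∀ n → n · 0# ≈ 0#
    n·0 zero    = ≈-refl
    n·0 (suc n) = ≈-trans (+-identityˡ _) (n·0 n)

  multiple-*ʳ : ∀ {x} y → Multiple x → Multiple (x * y)
  multiple-*ʳ y (z , x≈) = z * y , ≈-trans (*-congʳ x≈) (×-assoc-* p z y)

  multiple-cong : ∀ {x y} → x ≈ y → Multiple x → Multiple y
  multiple-cong x≈y (z , x≈) = z , ≈-trans (≈-sym x≈y) x≈

  multiple-∣ : ∀ {n} x → p ∣ n → Multiple (n · x)
  multiple-∣ {n} x (divides m n≡) = m · x , (begin
    n · x        ≡⟨ cong (_· x) (trans n≡ (ℕ.*-comm m p)) ⟩
    (p ℕ.* m) · x ≈⟨ ×-assocˡ x p m ⟨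
    p · m · x    ∎)

  multiple-sum : ∀ {n} (t : Fin n → Carrier) → (∀ i → Multiple (t i)) → Multiple (sum t)
  multiple-sum {zero}  t h = multiple-0
  multiple-sum {suc n} t h = multiple-+ (h zero) (multiple-sum (t ∘ suc) (h ∘ suc))

  1^n≈1 : ∀ n → 1# ^ n ≈ 1#
  1^n≈1 zero    = ≈-refl
  1^n≈1 (suc n) = ≈-trans (*-identityˡ _) (1^n≈1 n)

  infix 4 _≡ₚ_
  _≡ₚ_ : Carrier → Carrier → Set _
  x ≡ₚ y = Multiple (x - y)

  ≡ₚ-trans : ∀ {x y z} → x ≡ₚ y → y ≡ₚ z → x ≡ₚ z
  ≡ₚ-trans {x} {y} {z} h h′ = multiple-cong (lem x y z) (multiple-+ h h′)
    where
    lem : ∀ x y z → (x - y) + (y - z) ≈ x - z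
    lem = solve 3 (λ x y z → (x :- y) :+ (y :- z) := x :- z) ≈-refl

  ≡ₚ-* : ∀ {x y z w} → x ≡ₚ y → z ≡ₚ w → x * z ≡ₚ y * w
  ≡ₚ-* {x} {y} {z} {w} h h′ =
    multiple-cong (lem x y z w) (multiple-+ (multiple-*ʳ z h) (multiple-*ʳ y h′))
    where
    lem : ∀ x y z w → (x - y) * z + (z - w) * y ≈ x * z - y * w
    lem = solve 4 (λ x y z w → (x :- y) :* z :+ (z :- w) :* y := x :* z :- y :* w) ≈-refl

  ≡ₚ-reflexive : ∀ {x y} → x ≈ y → x ≡ₚ y
  ≡ₚ-reflexive {x} {y} x≈y = multiple-cong
    (≈-sym (≈-trans (+-congʳ x≈y) (-‿inverseʳ y))) multiple-0

  ≡ₚ-^ : ∀ {x y} → x ≡ₚ y → ∀ n → x ^ n ≡ₚ y ^ n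
  ≡ₚ-^ h zero    = ≡ₚ-reflexive ≈-refl
  ≡ₚ-^ h (suc n) = ≡ₚ-* h (≡ₚ-^ h n)

  private
    module B = Binomial commutativeSemiring

    -- The successor form of `p` lets both end terms of the binomial sum be split off; `prime∣C`
    -- disposes of those in `mid`.
    frobenius′ : ∀ m → suc m ≡ p → ∀ y → (1# + y) ^ p ≡ₚ 1# + y ^ p
    frobenius′ m refl y = multiple-cong eq (multiple-sum mid mid-multiple)
      where
      term : Fin (suc p) → Carrier
      term i = (p C toℕ i) · (y ^ toℕ i * 1# ^ (p ℕ.∸ toℕ i))
      term≈ : ∀ i → term i ≈ (p C toℕ i) · y ^ toℕ i
      term≈ i = ×-congʳ (p C toℕ i) (≈-trans (*-congˡ (1^n≈1 (p ℕ.∸ toℕ i))) (*-identityʳ _))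
      mid : Fin m → Carrier
      mid i = term (suc (Fin.inject₁ i))
      last : Fin (suc p)
      last = suc (Fin.fromℕ m)
      mid-multiple : ∀ i → Multiple (mid i)
      mid-multiple i = multiple-∣ _ (prime∣C pp (suc (toℕ (Fin.inject₁ i))) (s≤s z≤n)
        (s≤s (subst (_< m) (sym (Fin.toℕ-inject₁ i)) (Fin.toℕ<n i))))
      expand : (1# + y) ^ p ≈ 1# + (sum mid + y ^ p)
      expand = begin
        (1# + y) ^ p           ≈⟨ ^-congˡ p (+-comm 1# y) ⟩
        (y + 1#) ^ p           ≈⟨ B.theorem p y 1# ⟩
        sum term               ≈⟨ +-cong head (≈-trans (sum-init-last (term ∘ suc)) (+-congˡ tail)) ⟩
        1# + (sum mid + y ^ p) ∎
        where
        head : term zero ≈ 1#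
        head = ≈-trans (term≈ zero) (+-identityʳ 1#)
        tail : term last ≈ y ^ p
        tail = begin
          term last                   ≈⟨ term≈ last ⟩
          (p C toℕ last) · y ^ toℕ last ≡⟨ cong (λ j → (p C suc j) · y ^ suc j) (Fin.toℕ-fromℕ m) ⟩
          (p C p) · y ^ p             ≡⟨ cong (_· y ^ p) (nCn≡1 p) ⟩
          1 · y ^ p                   ≈⟨ +-identityʳ _ ⟩
          y ^ p                       ∎
      lem : ∀ s u v → s ≈ u + (s + v) - (u + v)
      lem = solve 3 (λ s u v → s := u :+ (s :+ v) :- (u :+ v)) ≈-refl
      eq : sum mid ≈ (1# + y) ^ p - (1# + y ^ p)
      eq = ≈-trans (lem (sum mid) 1# (y ^ p)) (+-congʳ (≈-sym expand))

  frobenius : ∀ y → (1# + y) ^ p ≡ₚ 1# + y ^ p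
  frobenius y = frobenius′ (ℕ.pred p) (ℕ.suc-pred p {{prime⇒nonZero pp}}) y

  frobenius-^ : ∀ v y → (1# + y) ^ (p ℕ.^ v) ≡ₚ 1# + y ^ (p ℕ.^ v)
  frobenius-^ zero y = ≡ₚ-reflexive (≈-trans (*-identityʳ _) (+-congˡ (≈-sym (*-identityʳ y))))
  frobenius-^ (suc v) y = ≡ₚ-trans
    (≡ₚ-reflexive (≈-sym (≈-trans (^-assocʳ (1# + y) (p ℕ.^ v) p) (^-≡ (1# + y)))))
    (≡ₚ-trans (≡ₚ-^ (frobenius-^ v y) p)
    (≡ₚ-trans (frobenius (y ^ (p ℕ.^ v)))
      (≡ₚ-reflexive (+-congˡ (≈-trans (^-assocʳ y (p ℕ.^ v) p) (^-≡ y))))))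
    where
    ^-≡ : ∀ z → z ^ (p ℕ.^ v ℕ.* p) ≈ z ^ (p ℕ.* p ℕ.^ v)
    ^-≡ z = reflexive (cong (z ^_) (ℕ.*-comm (p ℕ.^ v) p))

-- Formal sums of shifts of integer sequences

-- A list of pairs (c , e) stands for the polynomial Σ c xᵉ, and acts on
-- sequences with x acting as the shift.
Poly : Set
Poly = List (ℤ × ℕ)

opaque

  act : Poly → (ℕ → ℤ) → ℕ → ℤ
  act []            φ s = 0ℤ
  act ((c , e) ∷ f) φ s = c ℤ.* φ (e ℕ.+ s) ℤ.+ act f φ s

  zeroPoly : Poly
  zeroPoly = []

  term : ℤ → ℕ → Poly
  term c e = (c , e) ∷ []

  addPoly : Poly → Poly → Poly
  addPoly = _++_

  mulTerm : ℤ → ℕ → Poly → Poly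
  mulTerm c e = List.map (λ (d , k) → c ℤ.* d , k ℕ.+ e)

  mulPoly : Poly → Poly → Poly
  mulPoly []            g = []
  mulPoly ((c , e) ∷ f) g = addPoly (mulTerm c e g) (mulPoly f g)

  negPoly : Poly → Poly
  negPoly = List.map (λ (c , e) → ℤ.- c , e)

  act-cong : ∀ f {φ ψ} → (∀ s → φ s ≡ ψ s) → ∀ s → act f φ s ≡ act f ψ s
  act-cong []            h s = refl
  act-cong ((c , e) ∷ f) h s = cong₂ (λ a b → c ℤ.* a ℤ.+ b) (h (e ℕ.+ s)) (act-cong f h s)

  act-add : ∀ f g φ s → act (addPoly f g) φ s ≡ act f φ s ℤ.+ act g φ s
  act-add []            g φ s = sym (ℤ.+-identityˡ _)
  act-add ((c , e) ∷ f) g φ s = trans (cong (λ z → c ℤ.* φ (e ℕ.+ s) ℤ.+ z) (act-add f g φ s))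
    (sym (ℤ.+-assoc (c ℤ.* φ (e ℕ.+ s)) (act f φ s) (act g φ s)))

  act-neg : ∀ f φ s → act (negPoly f) φ s ≡ ℤ.- act f φ s
  act-neg []            φ s = refl
  act-neg ((c , e) ∷ f) φ s = trans (cong (λ z → ℤ.- c ℤ.* φ (e ℕ.+ s) ℤ.+ z) (act-neg f φ s))
    (lem c (φ (e ℕ.+ s)) (act f φ s))
    where
    lem : ∀ c x y → ℤ.- c ℤ.* x ℤ.+ ℤ.- y ≡ ℤ.- (c ℤ.* x ℤ.+ y)
    lem = ℤSolver.solve-∀

  act-mulTerm : ∀ c e g φ s → act (mulTerm c e g) φ s ≡ c ℤ.* act g φ (e ℕ.+ s)
  act-mulTerm c e []            φ s = sym (ℤ.*-zeroʳ c)
  act-mulTerm c e ((d , k) ∷ g) φ s = trans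
    (cong₂ (λ t a → c ℤ.* d ℤ.* φ t ℤ.+ a) (ℕ.+-assoc k e s) (act-mulTerm c e g φ s))
    (lem c d (φ (k ℕ.+ (e ℕ.+ s))) (act g φ (e ℕ.+ s)))
    where
    lem : ∀ c d x y → c ℤ.* d ℤ.* x ℤ.+ c ℤ.* y ≡ c ℤ.* (d ℤ.* x ℤ.+ y)
    lem = ℤSolver.solve-∀

  act-mul : ∀ f g φ s → act (mulPoly f g) φ s ≡ act f (act g φ) s
  act-mul []            g φ s = refl
  act-mul ((c , e) ∷ f) g φ s = trans (act-add (mulTerm c e g) (mulPoly f g) φ s)
    (cong₂ ℤ._+_ (act-mulTerm c e g φ s) (act-mul f g φ s))

  act-+ : ∀ f φ ψ s → act f (λ t → φ t ℤ.+ ψ t) s ≡ act f φ s ℤ.+ act f ψ s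
  act-+ []            φ ψ s = refl
  act-+ ((c , e) ∷ f) φ ψ s = trans (cong (λ z → c ℤ.* (φ (e ℕ.+ s) ℤ.+ ψ (e ℕ.+ s)) ℤ.+ z) (act-+ f φ ψ s))
    (lem c (φ (e ℕ.+ s)) (ψ (e ℕ.+ s)) (act f φ s) (act f ψ s))
    where
    lem : ∀ c x y u v → c ℤ.* (x ℤ.+ y) ℤ.+ (u ℤ.+ v) ≡ (c ℤ.* x ℤ.+ u) ℤ.+ (c ℤ.* y ℤ.+ v)
    lem = ℤSolver.solve-∀

  act-scale : ∀ f c φ s → act f (λ t → c ℤ.* φ t) s ≡ c ℤ.* act f φ s
  act-scale []            c φ s = sym (ℤ.*-zeroʳ c)
  act-scale ((d , e) ∷ f) c φ s = trans (cong (λ z → d ℤ.* (c ℤ.* φ (e ℕ.+ s)) ℤ.+ z) (act-scale f c φ s))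
    (lem c d (φ (e ℕ.+ s)) (act f φ s))
    where
    lem : ∀ c d x u → d ℤ.* (c ℤ.* x) ℤ.+ c ℤ.* u ≡ c ℤ.* (d ℤ.* x ℤ.+ u)
    lem = ℤSolver.solve-∀

  act-0 : ∀ f s → act f (λ _ → 0ℤ) s ≡ 0ℤ
  act-0 []            s = refl
  act-0 ((c , e) ∷ f) s = cong₂ ℤ._+_ (ℤ.*-zeroʳ c) (act-0 f s)

  act-shift : ∀ f φ k s → act f (λ t → φ (k ℕ.+ t)) s ≡ act f φ (k ℕ.+ s)
  act-shift []            φ k s = refl
  act-shift ((c , e) ∷ f) φ k s = cong₂ (λ t a → c ℤ.* φ t ℤ.+ a)
    (trans (sym (ℕ.+-assoc k e s)) (trans (cong (ℕ._+ s) (ℕ.+-comm k e)) (ℕ.+-assoc e k s)))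
    (act-shift f φ k s)

  -- Shifts commute. This makes multiplication well defined modulo annihilators: a congruence in the
  -- left factor is used after moving that factor to the inside.
  act-comm : ∀ f g φ s → act f (act g φ) s ≡ act g (act f φ) s
  act-comm []            g φ s = sym (act-0 g s)
  act-comm ((c , e) ∷ f) g φ s = begin
    c ℤ.* act g φ (e ℕ.+ s) ℤ.+ act f (act g φ) s
      ≡⟨ cong₂ ℤ._+_ (sym (trans (act-scale g c _ s) (cong (c ℤ.*_) (act-shift g φ e s))))
                     (act-comm f g φ s) ⟩
    act g (λ t → c ℤ.* φ (e ℕ.+ t)) s ℤ.+ act g (act f φ) s
      ≡⟨ sym (act-+ g _ (act f φ) s) ⟩
    act g (λ t → c ℤ.* φ (e ℕ.+ t) ℤ.+ act f φ t) s ∎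
    where open ≡-Reasoning

  act-zero : ∀ φ s → act zeroPoly φ s ≡ 0ℤ
  act-zero φ s = refl

  act-term : ∀ c e φ s → act (term c e) φ s ≡ c ℤ.* φ (e ℕ.+ s)
  act-term c e φ s = ℤ.+-identityʳ _

  addPoly-assoc : ∀ f g h → addPoly (addPoly f g) h ≡ addPoly f (addPoly g h)
  addPoly-assoc = List.++-assoc

  -- The list representation is sealed after this block; this principle stands in for matching on
  -- it.
  poly-induction : (P : Poly → Set) → P zeroPoly →
                   (∀ c e f → P f → P (addPoly (term c e) f)) → ∀ f → P f
  poly-induction P z t []            = z
  poly-induction P z t ((c , e) ∷ f) = t c e f (poly-induction P z t f)

  act-one : ∀ f s → act f (λ _ → 1ℤ) s ≡ act f (λ _ → 1ℤ) 0
  act-one []            s = refl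
  act-one ((c , e) ∷ f) s = cong (λ z → c ℤ.* 1ℤ ℤ.+ z) (act-one f s)

-- The value at x = 1.
ρ : Poly → ℤ
ρ f = act f (λ _ → 1ℤ) 0

ρ-* : ∀ f g → ρ (mulPoly f g) ≡ ρ f ℤ.* ρ g
ρ-* f g = trans (act-mul f g _ 0) (trans
  (act-cong f (λ s → trans (act-one g s) (sym (ℤ.*-identityʳ (ρ g)))) 0)
  (trans (act-scale f (ρ g) _ 0) (ℤ.*-comm (ρ g) (ρ f))))

ρ-+ : ∀ f g → ρ (addPoly f g) ≡ ρ f ℤ.+ ρ g
ρ-+ f g = act-add f g _ 0

ρ-neg : ∀ f → ρ (negPoly f) ≡ ℤ.- ρ f
ρ-neg f = act-neg f _ 0

ρ-0 : ρ zeroPoly ≡ 0ℤ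
ρ-0 = act-zero _ 0

ρ-term : ∀ c e → ρ (term c e) ≡ c
ρ-term c e = trans (act-term c e _ 0) (ℤ.*-identityʳ c)

const : ℤ → Poly
const c = term c 0

x^ : ℕ → Poly
x^ e = term 1ℤ e

act-x^ : ∀ e φ s → act (x^ e) φ s ≡ φ (e ℕ.+ s)
act-x^ e φ s = trans (act-term 1ℤ e φ s) (ℤ.*-identityˡ _)

act-const : ∀ c φ s → act (const c) φ s ≡ c ℤ.* φ s
act-const c φ s = act-term c 0 φ s

-- ℤ[x] modulo the polynomials that annihilate every sequence κ i.
module ShiftRing {I : Set} (κ : I → ℕ → ℤ) where

  infix 4 _≈ₛ_
  record _≈ₛ_ (f g : Poly) : Set where
    constructor mk≈
    field at : ∀ i s → act f (κ i) s ≡ act g (κ i) s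
  open _≈ₛ_ public

  shiftRing : CommutativeRing _ _
  shiftRing = record
    { Carrier = Poly
    ; _≈_ = _≈ₛ_
    ; _+_ = addPoly
    ; _*_ = mulPoly
    ; -_ = negPoly
    ; 0# = zeroPoly
    ; 1# = x^ 0
    ; isCommutativeRing = record
      { isRing = record
        { +-isAbelianGroup = record
          { isGroup = record
            { isMonoid = record
              { isSemigroup = record
                { isMagma = record
                  { isEquivalence = record
                    { refl = mk≈ λ i s → refl
                    ; sym = λ h → mk≈ λ i s → sym (at h i s)
                    ; trans = λ h h′ → mk≈ λ i s → trans (at h i s) (at h′ i s)
                    }
                  ; ∙-cong = λ {f} {f′} {g} {g′} h h′ → mk≈ λ i s →
                      trans (act-add f g (κ i) s)
                      (trans (cong₂ ℤ._+_ (at h i s) (at h′ i s)) (sym (act-add f′ g′ (κ i) s)))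
                  }
                ; assoc = λ f g h → mk≈ λ i s → cong (λ l → act l (κ i) s) (addPoly-assoc f g h)
                }
              ; identity = (λ f → mk≈ λ i s → trans (act-add zeroPoly f (κ i) s)
                    (trans (cong (λ z → z ℤ.+ act f (κ i) s) (act-zero (κ i) s)) (ℤ.+-identityˡ _)))
                         , (λ f → mk≈ λ i s → trans (act-add f zeroPoly (κ i) s)
                    (trans (cong (λ z → act f (κ i) s ℤ.+ z) (act-zero (κ i) s)) (ℤ.+-identityʳ _)))
              }
            ; inverse = (λ f → mk≈ λ i s → trans (act-add (negPoly f) f (κ i) s)
                          (trans (cong (λ z → z ℤ.+ act f (κ i) s) (act-neg f (κ i) s))
                            (trans (ℤ.+-inverseˡ (act f (κ i) s)) (sym (act-zero (κ i) s)))))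
                      , (λ f → mk≈ λ i s → trans (act-add f (negPoly f) (κ i) s)
                          (trans (cong (λ z → act f (κ i) s ℤ.+ z) (act-neg f (κ i) s))
                            (trans (ℤ.+-inverseʳ (act f (κ i) s)) (sym (act-zero (κ i) s)))))
            ; ⁻¹-cong = λ {f} {g} h → mk≈ λ i s → trans (act-neg f (κ i) s)
                (trans (cong ℤ.-_ (at h i s)) (sym (act-neg g (κ i) s)))
            }
          ; comm = λ f g → mk≈ λ i s → trans (act-add f g (κ i) s)
              (trans (ℤ.+-comm (act f (κ i) s) (act g (κ i) s)) (sym (act-add g f (κ i) s)))
          }
        ; *-cong = λ {f} {f′} {g} {g′} h h′ → mk≈ λ i s → begin
            act (mulPoly f g) (κ i) s   ≡⟨ act-mul f g (κ i) s ⟩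
            act f (act g (κ i)) s       ≡⟨ act-cong f (at h′ i) s ⟩
            act f (act g′ (κ i)) s      ≡⟨ act-comm f g′ (κ i) s ⟩
            act g′ (act f (κ i)) s      ≡⟨ act-cong g′ (at h i) s ⟩
            act g′ (act f′ (κ i)) s     ≡⟨ act-comm g′ f′ (κ i) s ⟩
            act f′ (act g′ (κ i)) s     ≡⟨ sym (act-mul f′ g′ (κ i) s) ⟩
            act (mulPoly f′ g′) (κ i) s ∎
        ; *-assoc = λ f g h → mk≈ λ i s → begin
            act (mulPoly (mulPoly f g) h) (κ i) s ≡⟨ act-mul (mulPoly f g) h (κ i) s ⟩
            act (mulPoly f g) (act h (κ i)) s     ≡⟨ act-mul f g (act h (κ i)) s ⟩
            act f (act g (act h (κ i))) s         ≡⟨ act-cong f (λ t → sym (act-mul g h (κ i) t)) s ⟩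
            act f (act (mulPoly g h) (κ i)) s     ≡⟨ sym (act-mul f (mulPoly g h) (κ i) s) ⟩
            act (mulPoly f (mulPoly g h)) (κ i) s ∎
        ; *-identity = (λ f → mk≈ λ i s → trans (act-mul (x^ 0) f (κ i) s) (act-x^ 0 (act f (κ i)) s))
                     , (λ f → mk≈ λ i s → trans (act-mul f (x^ 0) (κ i) s)
                          (act-cong f (act-x^ 0 (κ i)) s))
        ; distrib = (λ f g h → mk≈ λ i s → begin
                        act (mulPoly f (addPoly g h)) (κ i) s
                          ≡⟨ act-mul f (addPoly g h) (κ i) s ⟩
                        act f (act (addPoly g h) (κ i)) s
                          ≡⟨ act-cong f (act-add g h (κ i)) s ⟩
                        act f (λ t → act g (κ i) t ℤ.+ act h (κ i) t) s
                          ≡⟨ act-+ f (act g (κ i)) (act h (κ i)) s ⟩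
                        act f (act g (κ i)) s ℤ.+ act f (act h (κ i)) s
                          ≡⟨ cong₂ ℤ._+_ (sym (act-mul f g (κ i) s)) (sym (act-mul f h (κ i) s)) ⟩
                        act (mulPoly f g) (κ i) s ℤ.+ act (mulPoly f h) (κ i) s
                          ≡⟨ sym (act-add (mulPoly f g) (mulPoly f h) (κ i) s) ⟩
                        act (addPoly (mulPoly f g) (mulPoly f h)) (κ i) s ∎)
                  , (λ f g h → mk≈ λ i s → begin
                        act (mulPoly (addPoly g h) f) (κ i) s
                          ≡⟨ act-mul (addPoly g h) f (κ i) s ⟩
                        act (addPoly g h) (act f (κ i)) s
                          ≡⟨ act-add g h (act f (κ i)) s ⟩
                        act g (act f (κ i)) s ℤ.+ act h (act f (κ i)) s
                          ≡⟨ cong₂ ℤ._+_ (sym (act-mul g f (κ i) s)) (sym (act-mul h f (κ i) s)) ⟩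
                        act (mulPoly g f) (κ i) s ℤ.+ act (mulPoly h f) (κ i) s
                          ≡⟨ sym (act-add (mulPoly g f) (mulPoly h f) (κ i) s) ⟩
                        act (addPoly (mulPoly g f) (mulPoly h f)) (κ i) s ∎)
        }
      ; *-comm = λ f g → mk≈ λ i s → trans (act-mul f g (κ i) s)
          (trans (act-comm f g (κ i) s) (sym (act-mul g f (κ i) s)))
      }
    }
    where open ≡-Reasoning

-- Divisibility by primes and prime powers

prime∤⇒coprime : ∀ {p} → Prime p → ∀ d → ¬ p ∣ d → Coprime d p
prime∤⇒coprime pp d p∤d {g} (g∣d , g∣p) with prime⇒irreducible pp g∣p
... | inj₁ g≡1 = g≡1
... | inj₂ g≡p = contradiction (subst (_∣ d) g≡p g∣d) p∤d

-- The divisors of a prime power form a chain. Applied to `gcd d q`, this says that the gcd divides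
-- `Q` unless `q` divides `d`.
∣p^⇒ : ∀ {p} → Prime p → ∀ k d → d ∣ p ℕ.^ suc k → p ℕ.^ suc k ∣ d ⊎ d ∣ p ℕ.^ k
∣p^⇒ {p} pp k d d∣ with p ℕ.∣? d
∣p^⇒ {p} pp k d d∣ | no p∤d =
  inj₂ (Coprime.coprime-divisor {d} {p} (prime∤⇒coprime pp d p∤d) d∣)
∣p^⇒ {p} pp k d d∣ | yes (divides e d≡) = go k (ℕ.*-cancelˡ-∣ p {{prime⇒nonZero pp}}
    (subst (_∣ p ℕ.^ suc k) d≡′ d∣))
  where
  d≡′ : d ≡ p ℕ.* e
  d≡′ = trans d≡ (ℕ.*-comm e p)
  go : ∀ k → e ∣ p ℕ.^ k → p ℕ.^ suc k ∣ d ⊎ d ∣ p ℕ.^ k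
  go zero    e∣ = inj₁ (subst₂ _∣_ (sym (ℕ.*-identityʳ p)) (sym d≡′) (ℕ.m∣m*n e))
  go (suc k) e∣ with ∣p^⇒ pp k e e∣
  ... | inj₁ h = inj₁ (subst (p ℕ.^ suc (suc k) ∣_) (sym d≡′) (ℕ.*-monoʳ-∣ p h))
  ... | inj₂ h = inj₂ (subst (_∣ p ℕ.^ suc k) (sym d≡′) (ℕ.*-monoʳ-∣ p h))

euclidᶻ : ∀ {p} → Prime p → ∀ a b → + p ∣ᶻ a ℤ.* b → + p ∣ᶻ a ⊎ + p ∣ᶻ b
euclidᶻ {p} pp a b h
  with euclidsLemma ℤ.∣ a ∣ ℤ.∣ b ∣ pp (subst (p ∣_) (ℤ.abs-* a b) (ℤ∣.∣⇒∣ᵤ h))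
... | inj₁ h = inj₁ (ℤ∣.∣ᵤ⇒∣ h)
... | inj₂ h = inj₂ (ℤ∣.∣ᵤ⇒∣ h)

-- Powers of x and expansion at x = 1 in a shift ring

module ShiftRingProperties {I : Set} (κ : I → ℕ → ℤ) where

  open ShiftRing κ public
  open CommutativeRing shiftRing public
    using (_≈_; _+_; _*_; -_; _-_; 0#; 1#; +-cong; +-congˡ; +-congʳ; *-cong; *-congˡ; *-congʳ;
           *-comm; *-assoc; distribˡ; distribʳ; +-identityˡ; +-identityʳ; *-identityˡ; *-identityʳ;
           zeroˡ; zeroʳ; -‿cong; -‿inverseʳ; -‿inverseˡ; setoid; semiring; reflexive)
    renaming (refl to ≈-refl; sym to ≈-sym; trans to ≈-trans)
  open IntegerSolver shiftRing public
  open Exp semiring public using (_^_; ^-congˡ; ^-assocʳ; ^-homo-*)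
  open Mult semiring public using (×-congʳ; ×-homo-+; ×-assoc-*; ×-comm-*; ×-assocˡ) renaming (_×_ to infixr 8 _·_)

  act-· : ∀ n f φ s → act (n · f) φ s ≡ + n ℤ.* act f φ s
  act-· zero    f φ s = act-zero φ s
  act-· (suc n) f φ s = trans (act-add f (n · f) φ s)
    (trans (cong (λ z → act f φ s ℤ.+ z) (act-· n f φ s))
      (sym (ℤ.suc-* (+ n) (act f φ s))))

  π : Poly
  π = x^ 1 - 1#

  x^-homo : ∀ a b → x^ (a ℕ.+ b) ≈ x^ a * x^ b
  x^-homo a b = mk≈ λ i s → trans (act-x^ (a ℕ.+ b) (κ i) s) (sym (trans
    (act-mul (x^ a) (x^ b) (κ i) s) (trans (act-x^ a _ s) (trans (act-x^ b (κ i) (a ℕ.+ s))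
      (cong (κ i) (trans (sym (ℕ.+-assoc b a s)) (cong (ℕ._+ s) (ℕ.+-comm b a))))))))

  x^-pow : ∀ a m → x^ a ^ m ≈ x^ (a ℕ.* m)
  x^-pow a zero    = reflexive (cong x^ (sym (ℕ.*-zeroʳ a)))
  x^-pow a (suc m) = ≈-trans (*-congˡ (x^-pow a m))
    (≈-trans (≈-sym (x^-homo a (a ℕ.* m))) (reflexive (cong x^ (sym (ℕ.*-suc a m)))))

  1+π≈x : 1# + π ≈ x^ 1
  1+π≈x = solve 2 (λ o x → o :+ (x :- o) := x) ≈-refl 1# (x^ 1)

  x^≈1+π : ∀ e → ∃ λ g → x^ e ≈ 1# + π * g
  x^≈1+π zero    = 0# , ≈-sym (≈-trans (+-congˡ (zeroʳ π)) (+-identityʳ 1#))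
  x^≈1+π (suc e) with x^≈1+π e
  ... | g , h = 1# + x^ 1 * g , (begin
    x^ (suc e)                    ≈⟨ x^-homo 1 e ⟩
    x^ 1 * x^ e                   ≈⟨ *-congˡ h ⟩
    x^ 1 * (1# + π * g)           ≈⟨ distribˡ (x^ 1) 1# (π * g) ⟩
    x^ 1 * 1# + x^ 1 * (π * g)    ≈⟨ +-congʳ (*-identityʳ (x^ 1)) ⟩
    x^ 1 + x^ 1 * (π * g)         ≈⟨ +-congʳ 1+π≈x ⟨
    1# + π + x^ 1 * (π * g)       ≈⟨ solve 4 (λ o π x g → o :+ π :+ x :* (π :* g)
                                       := o :+ (π :+ π :* (x :* g))) ≈-refl 1# π (x^ 1) g ⟩
    1# + (π + π * (x^ 1 * g))     ≈⟨ +-congˡ (+-congʳ (*-identityʳ π)) ⟨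
    1# + (π * 1# + π * (x^ 1 * g)) ≈⟨ +-congˡ (distribˡ π 1# (x^ 1 * g)) ⟨
    1# + π * (1# + x^ 1 * g)      ∎)
    where open SetoidReasoning setoid

  const-+ : ∀ a b → const (a ℤ.+ b) ≈ const a + const b
  const-+ a b = mk≈ λ i s → trans (act-const (a ℤ.+ b) (κ i) s)
    (trans (ℤ.*-distribʳ-+ (κ i s) a b)
      (trans (cong₂ ℤ._+_ (sym (act-const a (κ i) s)) (sym (act-const b (κ i) s)))
        (sym (act-add (const a) (const b) (κ i) s))))

  term≈ : ∀ c e → term c e ≈ const c * x^ e
  term≈ c e = mk≈ λ i s → trans (act-term c e (κ i) s) (sym (trans
    (act-mul (const c) (x^ e) (κ i) s)
    (trans (act-const c _ s) (cong (c ℤ.*_) (act-x^ e (κ i) s)))))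

  const-* : ∀ a b → const (a ℤ.* b) ≈ const a * const b
  const-* a b = mk≈ λ i s → trans (act-const (a ℤ.* b) (κ i) s) (trans (ℤ.*-assoc a b (κ i s)) (sym (trans
    (act-mul (const a) (const b) (κ i) s)
    (trans (act-const a _ s) (cong (a ℤ.*_) (act-const b (κ i) s))))))

  const-0 : const 0ℤ ≈ 0#
  const-0 = mk≈ λ i s → trans (act-const 0ℤ (κ i) s) (sym (act-zero (κ i) s))

  -- Every power of `x` is 1 modulo `π = x - 1`, so modulo `π` a polynomial equals its value at 1.
  augment : ∀ f → ∃ λ g → f ≈ const (ρ f) + π * g
  augment = poly-induction _ base step
    where
    open SetoidReasoning setoid
    base : ∃ λ g → 0# ≈ const (ρ 0#) + π * g
    base = 0# , ≈-sym (≈-trans (+-cong (≈-trans (reflexive (cong const ρ-0)) const-0) (zeroʳ π))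
                        (+-identityʳ 0#))
    step : ∀ c e f → (∃ λ g → f ≈ const (ρ f) + π * g) →
           ∃ λ g → term c e + f ≈ const (ρ (term c e + f)) + π * g
    step c e f (g , h) with x^≈1+π e
    ... | g′ , h′ = const c * g′ + g , (begin
      term c e + f
        ≈⟨ +-cong (term≈ c e) h ⟩
      const c * x^ e + (const (ρ f) + π * g)
        ≈⟨ +-congʳ (*-congˡ h′) ⟩
      const c * (1# + π * g′) + (const (ρ f) + π * g)
        ≈⟨ +-congʳ (distribˡ (const c) 1# (π * g′)) ⟩
      const c * 1# + const c * (π * g′) + (const (ρ f) + π * g)
        ≈⟨ +-congʳ (+-congʳ (*-identityʳ (const c))) ⟩
      const c + const c * (π * g′) + (const (ρ f) + π * g)
        ≈⟨ solve 5 (λ c r π g g′ → c :+ c :* (π :* g′) :+ (r :+ π :* g)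
                                 := (c :+ r) :+ π :* (c :* g′ :+ g)) ≈-refl
             (const c) (const (ρ f)) π g g′ ⟩
      const c + const (ρ f) + π * (const c * g′ + g)
        ≈⟨ +-congʳ (≈-sym (const-+ c (ρ f))) ⟩
      const (c ℤ.+ ρ f) + π * (const c * g′ + g)
        ≡⟨ cong (λ z → const z + π * (const c * g′ + g))
             (sym (trans (ρ-+ (term c e) f) (cong (λ z → z ℤ.+ ρ f) (ρ-term c e)))) ⟩
      const (ρ (term c e + f)) + π * (const c * g′ + g) ∎)

  ρ-^ : ∀ f n → ρ (f ^ n) ≡ ρ f ℤ.^ n
  ρ-^ f zero    = ρ-term 1ℤ 0
  ρ-^ f (suc n) = trans (ρ-* f (f ^ n)) (cong (ρ f ℤ.*_) (ρ-^ f n))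

  NonZeroDivisor : Poly → Set
  NonZeroDivisor x = ∀ y → x * y ≈ 0# → y ≈ 0#

-- The ring ℤ[ζ], ζ a primitive pᵏ⁺¹-th root of unity

module Cyclotomic {p : ℕ} (pp : Prime p) (k : ℕ) where

  private
    instance
      p≢0 : NonZero p
      p≢0 = prime⇒nonZero pp

  p>1 : 1 < p
  p>1 = ℕ.nonTrivial⇒n>1 p {{prime⇒nonTrivial pp}}

  Q q : ℕ
  Q = p ℕ.^ k
  q = p ℕ.^ suc k

  private
    instance
      Q≢0 : NonZero Q
      Q≢0 = ℕ.m^n≢0 p k
      q≢0 : NonZero q
      q≢0 = ℕ.m^n≢0 p (suc k)

    Q<q : Q < q
    Q<q = subst (_< q) (ℕ.*-identityˡ Q) (ℕ.*-monoˡ-< Q p>1)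

    indicator : ℕ → ℤ
    indicator s = if does (q ℕ.∣? s) then 1ℤ else 0ℤ

    indicator-yes : ∀ {s} → q ∣ s → indicator s ≡ 1ℤ
    indicator-yes {s} h with q ℕ.∣? s
    ... | yes _ = refl
    ... | no ¬h = contradiction h ¬h

    indicator-no : ∀ {s} → ¬ q ∣ s → indicator s ≡ 0ℤ
    indicator-no {s} ¬h with q ℕ.∣? s
    ... | yes h = contradiction h ¬h
    ... | no _  = refl

    indicator-period : ∀ s → indicator (q ℕ.+ s) ≡ indicator s
    indicator-period s with q ℕ.∣? s
    ... | yes h = indicator-yes (ℕ.∣m∣n⇒∣m+n ℕ.∣-refl h)
    ... | no ¬h = indicator-no λ h → ¬h (ℕ.∣m+n∣m⇒∣n h ℕ.∣-refl)

  -- The cyclotomic polynomial 1 + x^Q + … + x^((p-1)Q) kills κ, and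
  -- generates its annihilator.
  κ : ⊤ → ℕ → ℤ
  κ _ s = indicator s ℤ.- indicator (Q ℕ.+ s)

  open ShiftRingProperties κ public

  private
    at₀ : ∀ {f g} → f ≈ g → ∀ s → act f (κ tt) s ≡ act g (κ tt) s
    at₀ h = at h tt

    κ-period : ∀ s → κ tt (q ℕ.+ s) ≡ κ tt s
    κ-period s = cong₂ ℤ._-_ (indicator-period s) (trans
      (cong indicator (trans (sym (ℕ.+-assoc Q q s)) (trans (cong (ℕ._+ s) (ℕ.+-comm Q q)) (ℕ.+-assoc q Q s))))
      (indicator-period (Q ℕ.+ s)))

    κ0≡1 : κ tt 0 ≡ 1ℤ
    κ0≡1 = cong₂ ℤ._-_ (indicator-yes (q ℕ.∣0))
      (indicator-no λ h → ℕ.>⇒∤ Q<q (subst (q ∣_) (ℕ.+-identityʳ Q) h))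

  x^q≈1 : x^ q ≈ 1#
  x^q≈1 = mk≈ λ _ s → trans (act-x^ q (κ tt) s) (trans (κ-period s) (sym (act-x^ 0 (κ tt) s)))

  x^-mod : ∀ a b → x^ (a ℕ.+ b ℕ.* q) ≈ x^ a
  x^-mod a b = begin
    x^ (a ℕ.+ b ℕ.* q)  ≈⟨ x^-homo a (b ℕ.* q) ⟩
    x^ a * x^ (b ℕ.* q) ≡⟨ cong (λ e → x^ a * x^ e) (ℕ.*-comm b q) ⟩
    x^ a * x^ (q ℕ.* b) ≈⟨ *-congˡ (x^-pow q b) ⟨
    x^ a * x^ q ^ b     ≈⟨ *-congˡ (≈-trans (^-congˡ b x^q≈1) (one^ b)) ⟩
    x^ a * 1#           ≈⟨ *-identityʳ (x^ a) ⟩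
    x^ a                ∎
    where
    open SetoidReasoning setoid
    one^ : ∀ n → 1# ^ n ≈ 1#
    one^ zero    = ≈-refl
    one^ (suc n) = ≈-trans (*-identityˡ _) (one^ n)

  private
    -- `Φ p` is the `q`-th cyclotomic polynomial. The partial sums are kept because their action on
    -- `κ` telescopes.
    Φ : ℕ → Poly
    Φ zero    = 0#
    Φ (suc m) = x^ (m ℕ.* Q) + Φ m

    ρ-Φ : ∀ m → ρ (Φ m) ≡ + m
    ρ-Φ zero    = ρ-0
    ρ-Φ (suc m) = trans (ρ-+ (x^ (m ℕ.* Q)) (Φ m)) (cong₂ ℤ._+_ (ρ-term 1ℤ (m ℕ.* Q)) (ρ-Φ m))

    act-Φ : ∀ m s → act (Φ m) (κ tt) s ≡ indicator s ℤ.- indicator (m ℕ.* Q ℕ.+ s)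
    act-Φ zero    s = trans (act-zero (κ tt) s) (sym (ℤ.+-inverseʳ (indicator s)))
    act-Φ (suc m) s = begin
      act (x^ (m ℕ.* Q) + Φ m) (κ tt) s
        ≡⟨ act-add (x^ (m ℕ.* Q)) (Φ m) (κ tt) s ⟩
      act (x^ (m ℕ.* Q)) (κ tt) s ℤ.+ act (Φ m) (κ tt) s
        ≡⟨ cong₂ ℤ._+_ (act-x^ (m ℕ.* Q) (κ tt) s) (act-Φ m s) ⟩
      (indicator (m ℕ.* Q ℕ.+ s) ℤ.- indicator (Q ℕ.+ (m ℕ.* Q ℕ.+ s)))
        ℤ.+ (indicator s ℤ.- indicator (m ℕ.* Q ℕ.+ s))
        ≡⟨ lem (indicator (m ℕ.* Q ℕ.+ s)) (indicator (Q ℕ.+ (m ℕ.* Q ℕ.+ s))) (indicator s) ⟩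
      indicator s ℤ.- indicator (Q ℕ.+ (m ℕ.* Q ℕ.+ s))
        ≡⟨ cong (λ t → indicator s ℤ.- indicator t) (sym (ℕ.+-assoc Q (m ℕ.* Q) s)) ⟩
      indicator s ℤ.- indicator (suc m ℕ.* Q ℕ.+ s) ∎
      where
      open ≡-Reasoning
      lem : ∀ a b c → (a ℤ.- b) ℤ.+ (c ℤ.- a) ≡ c ℤ.- b
      lem = ℤSolver.solve-∀

    Φ≈0 : Φ p ≈ 0#
    Φ≈0 = mk≈ λ _ s → trans (act-Φ p s) (trans
      (cong (λ z → indicator s ℤ.- z) (indicator-period s))
      (trans (ℤ.+-inverseʳ (indicator s)) (sym (act-zero (κ tt) s))))

    -- h(s + Q) = h(s) and Φ h = 0 give p h = 0.
    Q-periodic⇒0 : ∀ y → (∀ s → act y (κ tt) (Q ℕ.+ s) ≡ act y (κ tt) s) → y ≈ 0#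
    Q-periodic⇒0 y per = mk≈ λ _ s → trans (zero-value s) (sym (act-zero (κ tt) s))
      where
      h : ℕ → ℤ
      h = act y (κ tt)
      per-* : ∀ m s → h (m ℕ.* Q ℕ.+ s) ≡ h s
      per-* zero    s = refl
      per-* (suc m) s = trans (cong h (ℕ.+-assoc Q (m ℕ.* Q) s))
        (trans (per (m ℕ.* Q ℕ.+ s)) (per-* m s))
      Φh : ∀ m s → act (Φ m) h s ≡ + m ℤ.* h s
      Φh zero    s = act-zero h s
      Φh (suc m) s = trans (act-add (x^ (m ℕ.* Q)) (Φ m) h s) (trans
        (cong₂ ℤ._+_ (trans (act-x^ (m ℕ.* Q) h s) (per-* m s)) (Φh m s))
        (sym (ℤ.suc-* (+ m) (h s))))
      zero-value : ∀ s → h s ≡ 0ℤ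
      zero-value s with ℤ.i*j≡0⇒i≡0∨j≡0 (+ p) (begin
        + p ℤ.* h s             ≡⟨ Φh p s ⟨
        act (Φ p) h s           ≡⟨ act-comm (Φ p) y (κ tt) s ⟩
        act y (act (Φ p) (κ tt)) s ≡⟨ act-cong y (λ t → trans (at₀ Φ≈0 t) (act-zero (κ tt) t)) s ⟩
        act y (λ _ → 0ℤ) s      ≡⟨ act-0 y s ⟩
        0ℤ                      ∎)
        where open ≡-Reasoning
      ... | inj₁ p≡0 = contradiction (ℤ.+-injective p≡0) (ℕ.≢-nonZero⁻¹ p)
      ... | inj₂ h≡0 = h≡0

    -- Bézout: modulo q, some multiple of d is ± Q unless q ∣ d.
    bezout : ∀ d → ¬ q ∣ d →
      (∃₂ λ a b → a ℕ.* d ≡ Q ℕ.+ b ℕ.* q) ⊎ (∃₂ λ a b → b ℕ.* q ≡ a ℕ.* d ℕ.+ Q)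
    bezout d q∤d with ∣p^⇒ pp k (gcd d q) (gcd[m,n]∣n d q)
    ... | inj₁ q∣g = contradiction (ℕ.∣-trans q∣g (gcd[m,n]∣m d q)) q∤d
    ... | inj₂ (divides m Q≡) with Bézout.identity (gcd-GCD d q)
    ...   | Bézout.+- a b eq = inj₁ (m ℕ.* a , m ℕ.* b , (begin
      m ℕ.* a ℕ.* d             ≡⟨ ℕ.*-assoc m a d ⟩
      m ℕ.* (a ℕ.* d)           ≡⟨ cong (m ℕ.*_) (sym eq) ⟩
      m ℕ.* (gcd d q ℕ.+ b ℕ.* q) ≡⟨ ℕ.*-distribˡ-+ m (gcd d q) (b ℕ.* q) ⟩
      m ℕ.* gcd d q ℕ.+ m ℕ.* (b ℕ.* q) ≡⟨ cong₂ ℕ._+_ (sym Q≡) (sym (ℕ.*-assoc m b q)) ⟩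
      Q ℕ.+ m ℕ.* b ℕ.* q       ∎))
      where open ≡-Reasoning
    ...   | Bézout.-+ a b eq = inj₂ (m ℕ.* a , m ℕ.* b , (begin
      m ℕ.* b ℕ.* q             ≡⟨ ℕ.*-assoc m b q ⟩
      m ℕ.* (b ℕ.* q)           ≡⟨ cong (m ℕ.*_) (sym eq) ⟩
      m ℕ.* (gcd d q ℕ.+ a ℕ.* d) ≡⟨ ℕ.*-distribˡ-+ m (gcd d q) (a ℕ.* d) ⟩
      m ℕ.* gcd d q ℕ.+ m ℕ.* (a ℕ.* d) ≡⟨ cong₂ ℕ._+_ (sym Q≡) (sym (ℕ.*-assoc m a d)) ⟩
      Q ℕ.+ m ℕ.* a ℕ.* d       ≡⟨ ℕ.+-comm Q (m ℕ.* a ℕ.* d) ⟩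
      m ℕ.* a ℕ.* d ℕ.+ Q       ∎))
      where open ≡-Reasoning

  -- If `ζᵈ - 1` kills `y`, the sequence of `y` has the periods `d` and `q`. By `bezout` it has the
  -- period `Q`, which forces it to vanish.
  x^d-1-nonZeroDivisor : ∀ d → ¬ q ∣ d → NonZeroDivisor (x^ d - 1#)
  x^d-1-nonZeroDivisor d q∤d y [x-1]y≈0 = Q-periodic⇒0 y Q-period
    where
    h : ℕ → ℤ
    h = act y (κ tt)
    d-period : ∀ s → h (d ℕ.+ s) ≡ h s
    d-period s = ℤ.i-j≡0⇒i≡j (h (d ℕ.+ s)) (h s) (begin
      h (d ℕ.+ s) ℤ.- h s
        ≡⟨ cong₂ ℤ._-_ (sym (act-x^ d h s)) (sym (act-x^ 0 h s)) ⟩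
      act (x^ d) h s ℤ.- act 1# h s
        ≡⟨ cong (λ z → act (x^ d) h s ℤ.+ z) (sym (act-neg 1# h s)) ⟩
      act (x^ d) h s ℤ.+ act (- 1#) h s
        ≡⟨ sym (act-add (x^ d) (- 1#) h s) ⟩
      act (x^ d - 1#) h s
        ≡⟨ sym (act-mul (x^ d - 1#) y (κ tt) s) ⟩
      act ((x^ d - 1#) * y) (κ tt) s
        ≡⟨ trans (at₀ [x-1]y≈0 s) (act-zero (κ tt) s) ⟩
      0ℤ ∎)
      where open ≡-Reasoning
    q-period : ∀ s → h (q ℕ.+ s) ≡ h s
    q-period s = trans (sym (act-shift y (κ tt) q s)) (act-cong y κ-period s)
    multiple : ∀ {e} → (∀ s → h (e ℕ.+ s) ≡ h s) → ∀ m s → h (m ℕ.* e ℕ.+ s) ≡ h s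
    multiple         per zero    s = refl
    multiple {e} per (suc m) s = trans (cong h (ℕ.+-assoc e (m ℕ.* e) s))
      (trans (per (m ℕ.* e ℕ.+ s)) (multiple per m s))
    Q-period : ∀ s → h (Q ℕ.+ s) ≡ h s
    Q-period s with bezout d q∤d
    ... | inj₁ (a , b , eq) = begin
      h (Q ℕ.+ s)                 ≡⟨ multiple q-period b (Q ℕ.+ s) ⟨
      h (b ℕ.* q ℕ.+ (Q ℕ.+ s))   ≡⟨ cong h (trans (sym (ℕ.+-assoc (b ℕ.* q) Q s))
                                       (cong (ℕ._+ s) (trans (ℕ.+-comm (b ℕ.* q) Q) (sym eq)))) ⟩
      h (a ℕ.* d ℕ.+ s)           ≡⟨ multiple d-period a s ⟩
      h s                         ∎
      where open ≡-Reasoning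
    ... | inj₂ (a , b , eq) = begin
      h (Q ℕ.+ s)                 ≡⟨ multiple d-period a (Q ℕ.+ s) ⟨
      h (a ℕ.* d ℕ.+ (Q ℕ.+ s))   ≡⟨ cong h (trans (sym (ℕ.+-assoc (a ℕ.* d) Q s))
                                       (cong (ℕ._+ s) (sym eq))) ⟩
      h (b ℕ.* q ℕ.+ s)           ≡⟨ multiple q-period b s ⟩
      h s                         ∎
      where open ≡-Reasoning

  -- `ζᵃ` is invertible, with inverse the power of exponent `(q - 1) a`.
  x^-nonZeroDivisor : ∀ a → NonZeroDivisor (x^ a)
  x^-nonZeroDivisor a y xy≈0 = begin
    y                              ≈⟨ *-identityˡ y ⟨
    1# * y                         ≈⟨ *-congʳ (x^-mod 0 a) ⟨
    x^ (a ℕ.* q) * y               ≡⟨ cong (λ e → x^ e * y) (sym lem) ⟩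
    x^ (ℕ.pred q ℕ.* a ℕ.+ a) * y  ≈⟨ *-congʳ (x^-homo (ℕ.pred q ℕ.* a) a) ⟩
    x^ (ℕ.pred q ℕ.* a) * x^ a * y ≈⟨ *-assoc _ (x^ a) y ⟩
    x^ (ℕ.pred q ℕ.* a) * (x^ a * y) ≈⟨ *-congˡ xy≈0 ⟩
    x^ (ℕ.pred q ℕ.* a) * 0#       ≈⟨ zeroʳ _ ⟩
    0#                             ∎
    where
    open SetoidReasoning setoid
    lem : ℕ.pred q ℕ.* a ℕ.+ a ≡ a ℕ.* q
    lem = trans (ℕ.+-comm _ a) (trans (cong (ℕ._* a) (ℕ.suc-pred q)) (ℕ.*-comm q a))

  private
    ordered : ∀ {a b} → b < a → a < q → NonZeroDivisor (x^ a - x^ b)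
    ordered {a} {b} b<a a<q y h = x^d-1-nonZeroDivisor (a ℕ.∸ b)
      (ℕ.>⇒∤ {{ℕ.>-nonZero (ℕ.m<n⇒0<n∸m b<a)}} (ℕ.≤-<-trans (ℕ.m∸n≤m a b) a<q)) y
      (x^-nonZeroDivisor b _ (≈-trans (begin
        x^ b * ((x^ (a ℕ.∸ b) - 1#) * y)
          ≈⟨ solve 4 (λ b d o y → b :* ((d :- o) :* y) := (b :* d :- b :* o) :* y) ≈-refl
               (x^ b) (x^ (a ℕ.∸ b)) 1# y ⟩
        (x^ b * x^ (a ℕ.∸ b) - x^ b * 1#) * y
          ≈⟨ *-congʳ (+-cong (≈-trans (≈-sym (x^-homo b (a ℕ.∸ b)))
               (reflexive (cong x^ (ℕ.m+[n∸m]≡n (ℕ.<⇒≤ b<a))))) (-‿cong (*-identityʳ (x^ b)))) ⟩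
        (x^ a - x^ b) * y ∎) h))
      where open SetoidReasoning setoid

  x^-x^-nonZeroDivisor : ∀ a b → a < q → b < q → a ≢ b → NonZeroDivisor (x^ a - x^ b)
  x^-x^-nonZeroDivisor a b a<q b<q a≢b with ℕ.<-cmp a b
  ... | tri≈ _ a≡b _ = contradiction a≡b a≢b
  ... | tri> _ _ b<a = ordered b<a a<q
  ... | tri< a<b _ _ = λ y h → ordered a<b b<q y (begin
    (x^ b - x^ a) * y                       ≈⟨ +-identityʳ _ ⟨
    (x^ b - x^ a) * y + 0#                  ≈⟨ +-congˡ h ⟨
    (x^ b - x^ a) * y + (x^ a - x^ b) * y   ≈⟨ solve 3 (λ a b y → (b :- a) :* y :+ (a :- b) :* y
                                                 := (a :- a) :* y) ≈-refl (x^ a) (x^ b) y ⟩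
    (x^ a - x^ a) * y                       ≈⟨ *-congʳ (-‿inverseʳ (x^ a)) ⟩
    0# * y                                  ≈⟨ zeroˡ y ⟩
    0#                                      ∎)
    where open SetoidReasoning setoid

  private
    module P = CharP shiftRing pp

  -- The cyclotomic polynomial takes the value `p` at 1, so expanding `Φ(ζ) = 0` at 1 reads
  -- `p + π g = 0`.
  p∈π : ∃ λ g → const (+ p) ≈ π * g
  p∈π = - g , (begin
    const (+ p)                   ≈⟨ solve 3 (λ c π g → c := (c :+ π :* g) :+ π :* (:- g)) ≈-refl (const (+ p)) π g ⟩
    const (+ p) + π * g + π * - g ≡⟨ cong (λ z → const z + π * g + π * - g) (sym (ρ-Φ p)) ⟩
    const (ρ (Φ p)) + π * g + π * - g ≈⟨ +-congʳ h ⟨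
    Φ p + π * - g                 ≈⟨ +-congʳ Φ≈0 ⟩
    0# + π * - g                  ≈⟨ +-identityˡ _ ⟩
    π * - g                       ∎)
    where
    open SetoidReasoning setoid
    g = proj₁ (augment (Φ p))
    h = proj₂ (augment (Φ p))

  p∣ρ⇒π∣ : ∀ f → + p ∣ᶻ ρ f → ∃ λ g → f ≈ π * g
  p∣ρ⇒π∣ f (ℤ∣.divides c ρ≡) = const c * g′ + g , (begin
    f                            ≈⟨ h ⟩
    const (ρ f) + π * g          ≈⟨ +-congʳ (≈-trans (reflexive (cong const ρ≡)) (const-* c (+ p))) ⟩
    const c * const (+ p) + π * g ≈⟨ +-congʳ (*-congˡ h′) ⟩
    const c * (π * g′) + π * g   ≈⟨ solve 4 (λ c π g g′ → c :* (π :* g′) :+ π :* g := π :* (c :* g′ :+ g))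
                                      ≈-refl (const c) π g g′ ⟩
    π * (const c * g′ + g)       ∎)
    where
    open SetoidReasoning setoid
    g = proj₁ (augment f)
    h = proj₂ (augment f)
    g′ = proj₁ p∈π
    h′ = proj₂ p∈π

  -- Frobenius applied to `1 = ζ^q = (1 + π)^q` leaves `π^q ≡ 0` modulo `p`. The sharp exponent
  -- would be `q - Q`, but any power of `π` serves below.
  π^q∈p : ∃ λ z → π ^ q ≈ p · z
  π^q∈p = - z , (begin
    π ^ q       ≈⟨ solve 1 (λ a → a := :- (:- a)) ≈-refl (π ^ q) ⟩
    - (- π ^ q) ≈⟨ -‿cong h ⟩
    - (p · z)   ≈⟨ neg-· p z ⟩
    p · (- z)   ∎)
    where
    open SetoidReasoning setoid
    x^q≈[1+π]^q : 1# ≈ (1# + π) ^ q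
    x^q≈[1+π]^q = begin
      1#              ≈⟨ x^q≈1 ⟨
      x^ q            ≡⟨ cong x^ (sym (ℕ.*-identityˡ q)) ⟩
      x^ (1 ℕ.* q)    ≈⟨ x^-pow 1 q ⟨
      x^ 1 ^ q        ≈⟨ ^-congˡ q 1+π≈x ⟨
      (1# + π) ^ q    ∎
    lem : (1# - (1# + π) ^ q) + ((1# + π) ^ q - (1# + π ^ q)) ≈ - π ^ q
    lem = solve 3 (λ o a b → (o :- a) :+ (a :- (o :+ b)) := :- b) ≈-refl 1# ((1# + π) ^ q) (π ^ q)
    -π^q : P.Multiple (- π ^ q)
    -π^q = P.multiple-cong lem (P.multiple-+ (P.≡ₚ-reflexive x^q≈[1+π]^q) (P.frobenius-^ (suc k) π))
    z = proj₁ -π^q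
    h = proj₂ -π^q
    neg-· : ∀ n z → - (n · z) ≈ n · (- z)
    neg-· zero    z = ≈-trans (≈-sym (+-identityˡ _)) (-‿inverseʳ 0#)
    neg-· (suc n) z = ≈-trans (solve 2 (λ a b → :- (a :+ b) := :- a :+ (:- b)) ≈-refl z (n · z))
      (+-congˡ (neg-· n z))

  p∣act-π^q : ∀ b s → + p ∣ᶻ act (π ^ q * b) (κ tt) s
  p∣act-π^q b s = ℤ∣.divides (act (z * b) (κ tt) s) (trans
    (at (≈-trans (*-congʳ (proj₂ π^q∈p)) (×-assoc-* p z b)) tt s)
    (trans (act-· p (z * b) (κ tt) s) (ℤ.*-comm (+ p) _)))
    where z = proj₁ π^q∈p

  -- c = ρ(f - g) is a multiple of π, so c^q is a multiple of p.
  ρ-cong : ∀ {f g} → f ≈ g → + p ∣ᶻ ρ f ℤ.- ρ g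
  ρ-cong {f} {g} f≈g = root q (subst (+ p ∣ᶻ_) value (p∣act-π^q ((- h) ^ q) 0))
    where
    c : ℤ
    c = ρ f ℤ.- ρ g
    h = proj₁ (augment (f - g))
    const-c : const c ≈ π * (- h)
    const-c = begin
      const c                        ≡⟨ cong const (sym (trans (ρ-+ f (- g)) (cong (λ z → ρ f ℤ.+ z) (ρ-neg g)))) ⟩
      const (ρ (f - g))              ≈⟨ solve 3 (λ c π h → c := (c :+ π :* h) :+ π :* (:- h)) ≈-refl (const (ρ (f - g))) π h ⟩
      const (ρ (f - g)) + π * h + π * - h ≈⟨ +-congʳ (proj₂ (augment (f - g))) ⟨
      (f - g) + π * - h              ≈⟨ +-congʳ (≈-trans (+-congʳ f≈g) (-‿inverseʳ g)) ⟩
      0# + π * - h                   ≈⟨ +-identityˡ _ ⟩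
      π * - h                        ∎
      where open SetoidReasoning setoid
    *-^ : ∀ a b n → (a * b) ^ n ≈ a ^ n * b ^ n
    *-^ a b zero    = ≈-sym (*-identityˡ 1#)
    *-^ a b (suc n) = ≈-trans (*-congˡ (*-^ a b n))
      (solve 4 (λ a b x y → (a :* b) :* (x :* y) := (a :* x) :* (b :* y)) ≈-refl a b (a ^ n) (b ^ n))
    const-^ : ∀ n → const c ^ n ≈ const (c ℤ.^ n)
    const-^ zero    = ≈-refl
    const-^ (suc n) = ≈-trans (*-congˡ (const-^ n)) (≈-sym (const-* c (c ℤ.^ n)))
    value : act (π ^ q * (- h) ^ q) (κ tt) 0 ≡ c ℤ.^ q
    value = trans (at (≈-trans (≈-sym (*-^ π (- h) q)) (≈-trans (^-congˡ q (≈-sym const-c)) (const-^ q))) tt 0)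
      (trans (act-const (c ℤ.^ q) (κ tt) 0) (trans (cong (c ℤ.^ q ℤ.*_) κ0≡1) (ℤ.*-identityʳ _)))
    root : ∀ n → + p ∣ᶻ c ℤ.^ n → + p ∣ᶻ c
    root zero    h = contradiction (ℕ.∣⇒≤ (ℤ∣.∣⇒∣ᵤ h)) (ℕ.<⇒≱ p>1)
    root (suc n) h with euclidᶻ pp c (c ℤ.^ n) h
    ... | inj₁ h = h
    ... | inj₂ h = root n h

  -- Iterates `π^q∈p`. Since values are integers, it limits how often `π` can divide a nonzero
  -- element.
  p^E∣act : ∀ E b s → ∃ λ v → act (π ^ (q ℕ.* E) * b) (κ tt) s ≡ + (p ℕ.^ E) ℤ.* v
  p^E∣act zero b s = act (1# * b) (κ tt) s , trans
    (cong (λ e → act (π ^ e * b) (κ tt) s) (ℕ.*-zeroʳ q)) (sym (ℤ.*-identityˡ _))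
  p^E∣act (suc E) b s = v , (begin
    act (π ^ (q ℕ.* suc E) * b) (κ tt) s     ≡⟨ at eq tt s ⟩
    act (p · (π ^ (q ℕ.* E) * (z * b))) (κ tt) s ≡⟨ act-· p _ (κ tt) s ⟩
    + p ℤ.* act (π ^ (q ℕ.* E) * (z * b)) (κ tt) s ≡⟨ cong (+ p ℤ.*_) e ⟩
    + p ℤ.* (+ (p ℕ.^ E) ℤ.* v)              ≡⟨ sym (ℤ.*-assoc (+ p) (+ (p ℕ.^ E)) v) ⟩
    + p ℤ.* + (p ℕ.^ E) ℤ.* v                ≡⟨ cong (ℤ._* v) (sym (ℤ.pos-* p (p ℕ.^ E))) ⟩
    + (p ℕ.^ suc E) ℤ.* v                    ∎)
    where
    open ≡-Reasoning
    z = proj₁ π^q∈p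
    h = proj₂ π^q∈p
    v = proj₁ (p^E∣act E (z * b) s)
    e = proj₂ (p^E∣act E (z * b) s)
    eq : π ^ (q ℕ.* suc E) * b ≈ p · (π ^ (q ℕ.* E) * (z * b))
    eq = ≈-trans (*-congʳ (≈-trans (reflexive (cong (π ^_) (ℕ.*-suc q E))) (^-homo-* π q (q ℕ.* E))))
      (≈-trans (*-congʳ (*-congʳ h)) (≈-trans (*-assoc (p · z) (π ^ (q ℕ.* E)) b)
      (≈-trans (×-assoc-* p z (π ^ (q ℕ.* E) * b))
        (×-congʳ p (solve 3 (λ z a b → z :* (a :* b) := a :* (z :* b)) ≈-refl z (π ^ (q ℕ.* E)) b)))))

  -- Invertible modulo `π`, that is, in the localisation at `π`; an inverse in ℤ[ζ] need not exist.
  Unit : Poly → Set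
  Unit f = ¬ + p ∣ᶻ ρ f

  unit-* : ∀ {f g} → Unit f → Unit g → Unit (f * g)
  unit-* {f} {g} uf ug h with euclidᶻ pp (ρ f) (ρ g) (subst (+ p ∣ᶻ_) (ρ-* f g) h)
  ... | inj₁ h = uf h
  ... | inj₂ h = ug h

  -- The sequence of `f` has period `q`, so finitely many values decide whether `f` is zero.
  zero-or-value : ∀ f → f ≈ 0# ⊎ ∃ λ s → act f (κ tt) s ≢ 0ℤ
  zero-or-value f with ℕ.anyUpTo? (λ s → ¬? (act f (κ tt) s ℤ.≟ 0ℤ)) q
  ... | yes (s , _ , h) = inj₂ (s , h)
  ... | no ¬h = inj₁ (mk≈ λ _ s → trans (value-mod s) (trans
          (decidable-stable (_ ℤ.≟ 0ℤ) λ h → ¬h (s % q , ℕ.m%n<n s q , h))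
          (sym (act-zero (κ tt) s))))
    where
    κ-per : ∀ b t → κ tt (b ℕ.* q ℕ.+ t) ≡ κ tt t
    κ-per zero    t = refl
    κ-per (suc b) t = trans (cong (κ tt) (ℕ.+-assoc q (b ℕ.* q) t))
      (trans (κ-period (b ℕ.* q ℕ.+ t)) (κ-per b t))
    value-mod : ∀ s → act f (κ tt) s ≡ act f (κ tt) (s % q)
    value-mod s = trans (cong (act f (κ tt)) (trans (ℕ.m≡m%n+[m/n]*n s q) (ℕ.+-comm (s % q) _)))
      (trans (sym (act-shift f (κ tt) (s / q ℕ.* q) (s % q))) (act-cong f (κ-per (s / q)) (s % q)))

  n<p^n : ∀ n → n < p ℕ.^ n
  n<p^n zero    = s≤s z≤n
  n<p^n (suc n) = ℕ.≤-trans (s≤s (n<p^n n)) (ℕ.^-monoʳ-< p p>1 (ℕ.n<1+n n))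

  -- A nonzero integer `v` is not divisible by `p` to the power `∣v∣`, which exceeds `∣v∣`.
  π^-bounded : ∀ f b s → act f (κ tt) s ≢ 0ℤ →
               ¬ f ≈ π ^ (q ℕ.* ℤ.∣ act f (κ tt) s ∣) * b
  π^-bounded f b s v≢0 h = ℕ.<⇒≱ (n<p^n ℤ.∣ v ∣)
    (ℕ.∣⇒≤ {{ℕ.≢-nonZero λ e → v≢0 (ℤ.∣i∣≡0⇒i≡0 e)}}
      (ℤ∣.∣⇒∣ᵤ {+ (p ℕ.^ ℤ.∣ v ∣)} (ℤ∣.divides w (trans v≡ (ℤ.*-comm (+ (p ℕ.^ ℤ.∣ v ∣)) w)))))
    where
    v = act f (κ tt) s
    w = proj₁ (p^E∣act ℤ.∣ v ∣ b s)
    v≡ : v ≡ + (p ℕ.^ ℤ.∣ v ∣) ℤ.* w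
    v≡ = trans (at h tt s) (proj₂ (p^E∣act ℤ.∣ v ∣ b s))

  private
    Factored : ∀ {m} → (Fin m → Poly) → ℕ → Set
    Factored {m} a e = ∃ λ (b : Fin m → Poly) → ∀ j → a j ≈ π ^ e * b j

    factor-step : ∀ {m} (a : Fin m → Poly) e → ((b , _) : Factored a e) →
                  (∃ λ j → Unit (b j)) ⊎ Factored a (suc e)
    factor-step a e (b , h) with any? (λ j → ¬? (+ p ∣ᶻ? ρ (b j)))
    ... | yes u = inj₁ u
    ... | no ¬u = inj₂ ((λ j → proj₁ (quot j)) , λ j → begin
      a j                           ≈⟨ h j ⟩
      π ^ e * b j                   ≈⟨ *-congˡ (proj₂ (quot j)) ⟩
      π ^ e * (π * proj₁ (quot j))  ≈⟨ solve 3 (λ a b c → a :* (b :* c) := (b :* a) :* c) ≈-refl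
                                         (π ^ e) π (proj₁ (quot j)) ⟩
      π ^ suc e * proj₁ (quot j)    ∎)
      where
      open SetoidReasoning setoid
      quot = λ j → p∣ρ⇒π∣ (b j) (decidable-stable (+ p ∣ᶻ? ρ (b j)) λ n → ¬u (j , n))

  -- A finite family is zero, or has a power of π as greatest common
  -- divisor up to units at π.
  commonFactor : ∀ {m} (a : Fin m → Poly) → (∀ j → a j ≈ 0#) ⊎
    (∃₂ λ e (b : Fin m → Poly) → (∀ j → a j ≈ π ^ e * b j) × ∃ λ j → Unit (b j))
  commonFactor {m} a with any? {P = λ j → ∃ λ s → act (a j) (κ tt) s ≢ 0ℤ} (λ j → value? (zero-or-value (a j)))
    where
    value? : ∀ {f} → f ≈ 0# ⊎ (∃ λ s → act f (κ tt) s ≢ 0ℤ) → Dec (∃ λ s → act f (κ tt) s ≢ 0ℤ)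
    value? (inj₁ z) = no λ (s , h) → h (trans (at z tt s) (act-zero (κ tt) s))
    value? (inj₂ v) = yes v
  ... | no ¬v = inj₁ λ j → allZero (zero-or-value (a j)) λ v → ¬v (j , v)
    where
    allZero : ∀ {f} → f ≈ 0# ⊎ (∃ λ s → act f (κ tt) s ≢ 0ℤ) → ¬ (∃ λ s → act f (κ tt) s ≢ 0ℤ) → f ≈ 0#
    allZero (inj₁ z) _ = z
    allZero (inj₂ v) h = contradiction v h
  ... | yes (j , s , v≢0) = inj₂ (search E (ℕ.+-identityʳ E) (a , λ j → ≈-sym (*-identityˡ (a j))))
    where
    -- `π^-bounded` excludes this power of `π` as a common factor, so extracting factors one at a
    -- time must meet a unit before reaching it.
    E = q ℕ.* ℤ.∣ act (a j) (κ tt) s ∣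
    search : ∀ fuel {e} → fuel ℕ.+ e ≡ E → Factored a e →
      ∃₂ λ e (b : Fin m → Poly) → (∀ j → a j ≈ π ^ e * b j) × ∃ λ j → Unit (b j)
    search zero    {e} refl (b , h) = contradiction (h j) (π^-bounded (a j) (b j) s v≢0)
    search (suc n) {e} eq fac@(b , h) with factor-step a e fac
    ... | inj₁ u    = e , b , h , u
    ... | inj₂ fac′ = search n (trans (ℕ.+-suc n e) eq) fac′

-- Linear elimination over ℤ[ζ]

module Elimination {p : ℕ} (pp : Prime p) (k : ℕ) where

  open Cyclotomic pp k
  open SemiringSum semiring using (sum; sum-remove; sum-cong-≋; ∑-distrib-+; *-distribˡ-sum; sum-replicate-zero)

  private
    sum-zero : ∀ {m} (t : Fin m → Poly) → (∀ j → t j ≈ 0#) → sum t ≈ 0#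
    sum-zero {m} t h = ≈-trans (sum-cong-≋ h) (sum-replicate-zero m)

    module Pivot {m : ℕ} (b : Fin (suc m) → Poly) (i : Fin (suc m)) where

      reduceRow : (Fin (suc m) → Poly) → Fin m → Poly
      reduceRow r j = b i * r (Fin.punchIn i j) - b (Fin.punchIn i j) * r i

      -- Solves for the unknown `i` without dividing by the pivot: all other entries are multiplied
      -- by `b i` instead, and entry `i` is chosen to make the row `b` vanish.
      extend : (Fin m → Poly) → Fin (suc m) → Poly
      extend c = Vector.insertAt (λ j → b i * c j) i (sum λ j → - (b (Fin.punchIn i j) * c j))

      extend-row : ∀ r c → sum (λ j → r j * extend c j) ≈ sum (λ j → reduceRow r j * c j)
      extend-row r c = begin
        sum (λ j → r j * extend c j)
          ≈⟨ sum-remove {i = i} (λ j → r j * extend c j) ⟩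
        r i * extend c i + sum (λ j → r (Fin.punchIn i j) * extend c (Fin.punchIn i j))
          ≈⟨ +-cong (*-congˡ (reflexive (Vector.insertAt-lookup _ i _)))
               (sum-cong-≋ λ j → *-congˡ (reflexive (Vector.insertAt-punchIn _ i _ j))) ⟩
        r i * sum (λ j → - (b (Fin.punchIn i j) * c j)) + sum (λ j → r (Fin.punchIn i j) * (b i * c j))
          ≈⟨ +-congʳ (*-distribˡ-sum (r i) (λ j → - (b (Fin.punchIn i j) * c j))) ⟩
        sum (λ j → r i * - (b (Fin.punchIn i j) * c j)) + sum (λ j → r (Fin.punchIn i j) * (b i * c j))
          ≈⟨ ∑-distrib-+ (λ j → r i * - (b (Fin.punchIn i j) * c j)) _ ⟨
        sum (λ j → r i * - (b (Fin.punchIn i j) * c j) + r (Fin.punchIn i j) * (b i * c j))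
          ≈⟨ sum-cong-≋ (λ j → solve 5 (λ rᵢ bⱼ c rⱼ bᵢ → rᵢ :* (:- (bⱼ :* c)) :+ rⱼ :* (bᵢ :* c)
               := (bᵢ :* rⱼ :- bⱼ :* rᵢ) :* c) ≈-refl
               (r i) (b (Fin.punchIn i j)) (c j) (r (Fin.punchIn i j)) (b i)) ⟩
        sum (λ j → reduceRow r j * c j) ∎
        where open SetoidReasoning setoid

  private
    Kernel : ∀ {m} → List (Fin m → Poly) → Set
    Kernel {m} rows = ∃ λ (c : Fin m → Poly) → (∃ λ j → Unit (c j)) ×
      All (λ r → sum (λ j → r j * c j) ≈ 0#) rows

    -- Gaussian elimination with at most one unknown lost per row. The common power of `π` is taken
    -- out of a row before its pivot is chosen, so the pivot is a unit at `π`, and multiplying by it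
    -- preserves the unit entry of the smaller solution.
    kernel′ : ∀ l {m} (rows : List (Fin m → Poly)) → length rows ≡ l → l < m → Kernel rows
    kernel′ zero {suc m} [] _ _ = (λ _ → 1#) , (zero , λ h →
      contradiction (ℕ.∣⇒≤ (ℤ∣.∣⇒∣ᵤ (subst (+ p ∣ᶻ_) (ρ-term 1ℤ 0) h))) (ℕ.<⇒≱ p>1)) , []
    kernel′ (suc l) {suc m} (r ∷ rows) |rows| l<m = cases (commonFactor r)
      where
      cases : (∀ j → r j ≈ 0#) ⊎
        (∃₂ λ e (b : Fin (suc m) → Poly) → (∀ j → r j ≈ π ^ e * b j) × ∃ λ j → Unit (b j)) →
        Kernel (r ∷ rows)
      cases (inj₁ r≈0) =
        let (c , u , killed) = kernel′ l rows (ℕ.suc-injective |rows|) (ℕ.<-trans (ℕ.n<1+n _) l<m) in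
        c , u , sum-zero _ (λ j → ≈-trans (*-congʳ (r≈0 j)) (zeroˡ (c j))) ∷ killed
      cases (inj₂ (e , b , r≈ , i , uᵢ)) =
        let (c , (j , uⱼ) , killed) = kernel′ l (List.map reduceRow rows)
              (trans (List.length-map reduceRow rows) (ℕ.suc-injective |rows|)) (ℕ.≤-pred l<m) in
        extend c
        , (Fin.punchIn i j , subst Unit (sym (Vector.insertAt-punchIn _ i _ j))
            (unit-* {b i} {c j} uᵢ uⱼ))
        , ≈-trans (extend-row r c) (sum-zero _ λ j → ≈-trans (*-congʳ (pivot-row j)) (zeroˡ (c j)))
        ∷ All.map (λ {r} h → ≈-trans (extend-row r c) h) (All.map⁻ killed)
        where
        open Pivot b i
        pivot-row : ∀ j → reduceRow r j ≈ 0#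
        pivot-row j = begin
          b i * r j′ - b j′ * r i
            ≈⟨ +-cong (*-congˡ (r≈ j′)) (-‿cong (*-congˡ (r≈ i))) ⟩
          b i * (π ^ e * b j′) - b j′ * (π ^ e * b i)
            ≈⟨ solve 3 (λ x y z → x :* (y :* z) :- z :* (y :* x) := x :- x) ≈-refl (b i) (π ^ e) (b j′) ⟩
          b i - b i
            ≈⟨ -‿inverseʳ (b i) ⟩
          0# ∎
          where
          open SetoidReasoning setoid
          j′ = Fin.punchIn i j

  kernel : ∀ {m} (rows : List (Fin m → Poly)) → length rows < m →
           ∃ λ (c : Fin m → Poly) → (∃ λ j → Unit (c j)) ×
           All (λ r → sum (λ j → r j * c j) ≈ 0#) rows
  kernel rows = kernel′ (length rows) rows refl

-- Divided differences

count : ℕ → List ℕ → ℕ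
count t []       = 0
count t (u ∷ us) with t ℕ.≟ u
... | yes _ = suc (count t us)
... | no _  = count t us

count-≤-∷ : ∀ t u us → count t us ≤ count t (u ∷ us)
count-≤-∷ t u us with t ℕ.≟ u
... | yes _ = ℕ.n≤1+n _
... | no _  = ℕ.≤-refl

count-≡-∷ : ∀ t us → count t (t ∷ us) ≡ suc (count t us)
count-≡-∷ t us with t ℕ.≟ t
... | yes _ = refl
... | no ¬e = contradiction refl ¬e

count-≢-∷ : ∀ {t u} us → t ≢ u → count t (u ∷ us) ≡ count t us
count-≢-∷ {t} {u} us t≢u with t ℕ.≟ u
... | yes e = contradiction e t≢u
... | no _  = refl

module DividedDifferences {p : ℕ} (pp : Prime p) (k : ℕ) where

  open Cyclotomic pp k

  -- Saturated: closed under division by nonzerodivisors.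
  data Span (G : (ℕ → Poly) → Set) : (ℕ → Poly) → Set where
    gen   : ∀ {ψ} → G ψ → Span G ψ
    add   : ∀ {ψ φ} → Span G ψ → Span G φ → Span G (λ s → ψ s + φ s)
    scale : ∀ c {ψ} → Span G ψ → Span G (λ s → c * ψ s)
    sat   : ∀ {c ψ} → NonZeroDivisor c → Span G (λ s → c * ψ s) → Span G ψ
    resp  : ∀ {ψ φ} → (∀ s → ψ s ≈ φ s) → Span G ψ → Span G φ

  span-mono : ∀ {G H} → (∀ {ψ} → G ψ → Span H ψ) → ∀ {ψ} → Span G ψ → Span H ψ
  span-mono f (gen g)     = f g
  span-mono f (add x y)   = add (span-mono f x) (span-mono f y)
  span-mono f (scale c x) = scale c (span-mono f x)
  span-mono f (sat n x)   = sat n (span-mono f x)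
  span-mono f (resp e x)  = resp e (span-mono f x)

  -- The right inverse, vanishing at 0, of the operator shift - z.
  T : Poly → (ℕ → Poly) → ℕ → Poly
  T z ψ zero    = 0#
  T z ψ (suc s) = z * T z ψ s + ψ s

  T-+ : ∀ z ψ φ s → T z (λ t → ψ t + φ t) s ≈ T z ψ s + T z φ s
  T-+ z ψ φ zero    = ≈-sym (+-identityˡ 0#)
  T-+ z ψ φ (suc s) = ≈-trans (+-congʳ (*-congˡ (T-+ z ψ φ s)))
    (solve 5 (λ z a b c d → z :* (a :+ b) :+ (c :+ d) := (z :* a :+ c) :+ (z :* b :+ d)) ≈-refl
      z (T z ψ s) (T z φ s) (ψ s) (φ s))

  T-* : ∀ z c ψ s → T z (λ t → c * ψ t) s ≈ c * T z ψ s
  T-* z c ψ zero    = ≈-sym (zeroʳ c)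
  T-* z c ψ (suc s) = ≈-trans (+-congʳ (*-congˡ (T-* z c ψ s)))
    (solve 4 (λ z c a b → z :* (c :* a) :+ c :* b := c :* (z :* a :+ b)) ≈-refl z c (T z ψ s) (ψ s))

  T-cong : ∀ z {ψ φ} → (∀ s → ψ s ≈ φ s) → ∀ s → T z ψ s ≈ T z φ s
  T-cong z h zero    = ≈-refl
  T-cong z h (suc s) = +-cong (*-congˡ (T-cong z h s)) (h s)

  T-span : ∀ {G H} z → (∀ {ψ} → G ψ → Span H (T z ψ)) → ∀ {ψ} → Span G ψ → Span H (T z ψ)
  T-span z f (gen g)     = f g
  T-span z f (add {ψ} {φ} x y)   = resp (λ s → ≈-sym (T-+ z ψ φ s)) (add (T-span z f x) (T-span z f y))
  T-span z f (scale c {ψ} x) = resp (λ s → ≈-sym (T-* z c ψ s)) (scale c (T-span z f x))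
  T-span z f (sat {c} {ψ} n x) = sat n (resp (T-* z c ψ) (T-span z f x))
  T-span z f (resp e x)  = resp (T-cong z e) (T-span z f x)

  -- The solutions `s^β ζ^(ts)` of a linear recurrence with the multiple root `ζᵗ`, written in the
  -- binomial basis, which is the one that `T` respects integrally.
  expPoly : ℕ → ℕ → ℕ → Poly
  expPoly t β s = (s C β) · x^ t ^ s

  private
    pascal : ∀ t β s → expPoly t (suc β) (suc s) ≈ x^ t * (expPoly t (suc β) s + expPoly t β s)
    pascal t β s = begin
      (suc s C suc β) · (z * w)   ≡⟨ cong (_· (z * w)) (trans (sym (nCk+nC[k+1]≡[n+1]C[k+1] s β)) (ℕ.+-comm (s C β) _)) ⟩
      ((s C suc β) ℕ.+ (s C β)) · (z * w)  ≈⟨ ×-homo-+ (z * w) (s C suc β) (s C β) ⟩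
      (s C suc β) · (z * w) + (s C β) · (z * w) ≈⟨ +-cong (·-out (s C suc β)) (·-out (s C β)) ⟩
      z * ((s C suc β) · w) + z * ((s C β) · w) ≈⟨ distribˡ z _ _ ⟨
      z * ((s C suc β) · w + (s C β) · w) ∎
      where
      open SetoidReasoning setoid
      z = x^ t
      w = x^ t ^ s
      ·-out : ∀ n → n · (z * w) ≈ z * (n · w)
      ·-out n = ≈-trans (×-congʳ n (*-comm z w)) (≈-trans (≈-sym (×-assoc-* n w z)) (*-comm (n · w) z))

    T-same : ∀ t β s → x^ t * T (x^ t) (expPoly t β) s ≈ expPoly t (suc β) s
    T-same t β zero    = zeroʳ (x^ t)
    T-same t β (suc s) = ≈-trans (*-congˡ (+-congʳ (T-same t β s))) (≈-sym (pascal t β s))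

    -- A geometric sum. Its denominator `ζᵗ - ζᵘ` is a multiple of `π`, which is why the span has to
    -- be saturated.
    T-other₀ : ∀ t u s → (x^ t - x^ u) * T (x^ u) (expPoly t 0) s ≈ expPoly t 0 s - expPoly u 0 s
    T-other₀ t u zero    = ≈-trans (zeroʳ _) (≈-sym (-‿inverseʳ _))
    T-other₀ t u (suc s) = begin
      (z - w) * (w * A + a)
        ≈⟨ solve 4 (λ z w A a → (z :- w) :* (w :* A :+ a) := w :* ((z :- w) :* A) :+ (z :- w) :* a) ≈-refl z w A a ⟩
      w * ((z - w) * A) + (z - w) * a
        ≈⟨ +-congʳ (*-congˡ (T-other₀ t u s)) ⟩
      w * (a - b) + (z - w) * a
        ≈⟨ solve 4 (λ z w a b → w :* (a :- b) :+ (z :- w) :* a := z :* a :- w :* b) ≈-refl z w a b ⟩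
      z * a - w * b
        ≈⟨ +-cong (head t) (-‿cong (head u)) ⟩
      expPoly t 0 (suc s) - expPoly u 0 (suc s) ∎
      where
      open SetoidReasoning setoid
      z = x^ t
      w = x^ u
      A = T w (expPoly t 0) s
      a = expPoly t 0 s
      b = expPoly u 0 s
      head : ∀ v → x^ v * expPoly v 0 s ≈ expPoly v 0 (suc s)
      head v = solve 3 (λ x y z → x :* (y :+ z) := x :* y :+ x :* z) ≈-refl (x^ v) (x^ v ^ s) 0#
        ⟨≈⟩ +-congˡ (zeroʳ (x^ v))
        where
        infixr 1 _⟨≈⟩_
        _⟨≈⟩_ : ∀ {a b c} → a ≈ b → b ≈ c → a ≈ c
        _⟨≈⟩_ = ≈-trans

    -- Both sides vanish at 0 and satisfy the same first-order recurrence in `s`, by `pascal`. It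
    -- lowers `β`, so induction ends at `T-other₀`.
    T-other : ∀ t u β s → (x^ t - x^ u) * T (x^ u) (expPoly t (suc β)) s
                        ≈ expPoly t (suc β) s - x^ t * T (x^ u) (expPoly t β) s
    T-other t u β zero    = ≈-trans (zeroʳ _) (≈-sym (≈-trans (+-congˡ (-‿cong (zeroʳ (x^ t)))) (-‿inverseʳ 0#)))
    T-other t u β (suc s) = begin
      (z - w) * (w * A + a)
        ≈⟨ solve 4 (λ z w A a → (z :- w) :* (w :* A :+ a) := w :* ((z :- w) :* A) :+ (z :- w) :* a) ≈-refl z w A a ⟩
      w * ((z - w) * A) + (z - w) * a
        ≈⟨ +-congʳ (*-congˡ (T-other t u β s)) ⟩
      w * (a - z * B) + (z - w) * a
        ≈⟨ solve 5 (λ z w a b B → w :* (a :- z :* B) :+ (z :- w) :* a := z :* (a :+ b) :- z :* (w :* B :+ b)) ≈-refl z w a b B ⟩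
      z * (a + b) - z * (w * B + b)
        ≈⟨ +-congʳ (pascal t β s) ⟨
      expPoly t (suc β) (suc s) - z * (w * B + b) ∎
      where
      open SetoidReasoning setoid
      z = x^ t
      w = x^ u
      A = T w (expPoly t (suc β)) s
      B = T w (expPoly t β) s
      a = expPoly t (suc β) s
      b = expPoly t β s

  Exponential : (ℕ → ℕ) → (ℕ → Poly) → Set
  Exponential μ ψ = ∃₂ λ t β → t < q × β < μ t × ψ ≡ expPoly t β

  private
    span-minus : ∀ {G ψ φ} → Span G ψ → Span G φ → Span G (λ s → ψ s - φ s)
    span-minus {φ = φ} x y = add x (resp (λ s → lem (φ s)) (scale (- 1#) y))
      where
      lem : ∀ a → - 1# * a ≈ - a
      lem a = ≈-trans (solve 2 (λ o a → :- o :* a := :- (o :* a)) ≈-refl 1# a) (-‿cong (*-identityˡ a))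

    T-exponential : ∀ {μ μ′ u} → u < q → (∀ t → μ t ≤ μ′ t) → μ u < μ′ u →
                    ∀ {ψ} → Exponential μ ψ → Span (Exponential μ′) (T (x^ u) ψ)
    T-exponential {μ} {μ′} {u} u<q μ≤ μu< (t , β , t<q , β< , refl) with t ℕ.≟ u
    ... | yes refl = sat (x^-nonZeroDivisor t) (resp (λ s → ≈-sym (T-same t β s))
                       (gen (t , suc β , t<q , ℕ.≤-<-trans β< μu< , refl)))
    ... | no t≢u = other β β<
      where
      nzd = x^-x^-nonZeroDivisor t u t<q u<q t≢u
      exponential : ∀ β → β < μ t → Span (Exponential μ′) (expPoly t β)
      exponential β β< = gen (t , β , t<q , ℕ.≤-trans β< (μ≤ t) , refl)
      other : ∀ β → β < μ t → Span (Exponential μ′) (T (x^ u) (expPoly t β))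
      other zero    β< = sat nzd (resp (λ s → ≈-sym (T-other₀ t u s)) (span-minus (exponential 0 β<)
        (gen (u , 0 , u<q , ℕ.≤-<-trans z≤n μu< , refl))))
      other (suc β) β< = sat nzd (resp (λ s → ≈-sym (T-other t u β s)) (span-minus (exponential (suc β) β<)
        (scale (x^ t) (other β (ℕ.<-trans (ℕ.n<1+n β) β<)))))

    -- The divided difference of X^s at the nodes ζᵘ, as a function of s.
    dividedDifference : ∀ u us → All (_< q) (u ∷ us) →
      ∃ λ ψ → Span (Exponential λ t → count t (u ∷ us)) ψ × ∀ s → ρ (ψ s) ≡ + (s C length us)
    dividedDifference u [] (u<q ∷ []) = expPoly u 0 , gen (u , 0 , u<q , ℕ.≤-reflexive (sym (count-≡-∷ u [])) , refl) , value
      where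
      value : ∀ s → ρ (1 · x^ u ^ s) ≡ 1ℤ
      value s = trans (ρ-+ (x^ u ^ s) 0#) (trans (cong₂ ℤ._+_ (trans (ρ-^ (x^ u) s)
        (trans (cong (ℤ._^ s) (ρ-term 1ℤ u)) (ℤ.^-zeroˡ s))) ρ-0) (ℤ.+-identityʳ 1ℤ))
    dividedDifference u (v ∷ us) (u<q ∷ us<q) =
      let (ψ , ψ∈ , ρψ) = dividedDifference v us us<q in
      T (x^ u) ψ , T-span (x^ u) (T-exponential u<q (λ t → count-≤-∷ t u (v ∷ us)) (ℕ.≤-reflexive (sym (count-≡-∷ u (v ∷ us))))) ψ∈ , value ψ ρψ
      where
      -- Under `ρ` every node becomes 1, and the recursion defining `T` turns into Pascal's rule.
      value : ∀ ψ → (∀ s → ρ (ψ s) ≡ + (s C length us)) → ∀ s → ρ (T (x^ u) ψ s) ≡ + (s C suc (length us))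
      value ψ h zero    = ρ-0
      value ψ h (suc s) = begin
        ρ (x^ u * T (x^ u) ψ s + ψ s)
          ≡⟨ ρ-+ (x^ u * T (x^ u) ψ s) (ψ s) ⟩
        ρ (x^ u * T (x^ u) ψ s) ℤ.+ ρ (ψ s)
          ≡⟨ cong₂ ℤ._+_ (trans (ρ-* (x^ u) (T (x^ u) ψ s)) (cong₂ ℤ._*_ (ρ-term 1ℤ u) (value ψ h s))) (h s) ⟩
        1ℤ ℤ.* + (s C suc (length us)) ℤ.+ + (s C length us)
          ≡⟨ cong (ℤ._+ + (s C length us)) (ℤ.*-identityˡ (+ (s C suc (length us)))) ⟩
        + (s C suc (length us)) ℤ.+ + (s C length us)
          ≡⟨ cong +_ (trans (ℕ.+-comm (s C suc (length us)) _) (nCk+nC[k+1]≡[n+1]C[k+1] s (length us))) ⟩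
        + (suc s C suc (length us)) ∎
        where open ≡-Reasoning

    count-++ : ∀ t us vs → count t (us ++ vs) ≡ count t us ℕ.+ count t vs
    count-++ t []       vs = refl
    count-++ t (u ∷ us) vs with t ℕ.≟ u
    ... | yes _ = cong suc (count-++ t us vs)
    ... | no _  = count-++ t us vs

    count-take : ∀ t i us → count t (List.take i us) ≤ count t us
    count-take t zero    us       = z≤n
    count-take t (suc i) []       = z≤n
    count-take t (suc i) (u ∷ us) with t ℕ.≟ u
    ... | yes _ = s≤s (count-take t i us)
    ... | no _  = count-take t i us

    count-replicate : ∀ t n → count t (List.replicate n t) ≤ n
    count-replicate t zero    = z≤n
    count-replicate t (suc n) =
      subst (_≤ suc n) (sym (count-≡-∷ t (List.replicate n t))) (s≤s (count-replicate t n))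

    count-replicate-≢ : ∀ t u n → t ≢ u → count t (List.replicate n u) ≡ 0
    count-replicate-≢ t u zero    _   = refl
    count-replicate-≢ t u (suc n) t≢u =
      trans (count-≢-∷ (List.replicate n u) t≢u) (count-replicate-≢ t u n t≢u)

    repeat : ℕ → List ℕ → List ℕ
    repeat n = List.concatMap (List.replicate n)

    length-repeat : ∀ n ts → length (repeat n ts) ≡ length ts ℕ.* n
    length-repeat n []       = refl
    length-repeat n (t ∷ ts) = trans (List.length-++ (List.replicate n t))
      (cong₂ ℕ._+_ (List.length-replicate n) (length-repeat n ts))

    count-repeat-∉ : ∀ n t ts → t ∉ ts → count t (repeat n ts) ≡ 0
    count-repeat-∉ n t []       _   = refl
    count-repeat-∉ n t (u ∷ ts) t∉ = trans (count-++ t (List.replicate n u) (repeat n ts))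
      (cong₂ ℕ._+_ (count-replicate-≢ t u n (t∉ ∘ here)) (count-repeat-∉ n t ts (t∉ ∘ there)))

    count-repeat : ∀ n t ts → Unique ts → 0 < count t (repeat n ts) →
                   t ∈ ts × count t (repeat n ts) ≤ n
    count-repeat n t (u ∷ ts) (u∉ ∷ uniq) pos with t ℕ.≟ u
    ... | yes refl = here refl , subst (_≤ n) (sym (trans (count-++ t (List.replicate n t) (repeat n ts))
            (trans (cong (_ ℕ.+_) (count-repeat-∉ n t ts λ t∈ → All.lookup u∉ t∈ refl)) (ℕ.+-identityʳ _))))
            (count-replicate t n)
    ... | no t≢u = let (t∈ , ≤n) = count-repeat n t ts uniq (subst (0 <_) eq pos) in
                   there t∈ , subst (_≤ n) (sym eq) ≤n
      where
      eq : count t (repeat n (u ∷ ts)) ≡ count t (repeat n ts)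
      eq = trans (count-++ t (List.replicate n u) (repeat n ts))
             (cong (ℕ._+ _) (count-replicate-≢ t u n t≢u))

  Node : List ℕ → ℕ → (ℕ → Poly) → Set
  Node ts n ψ = ∃₂ λ t β → t ∈ ts × β < n × ψ ≡ expPoly t β

  -- Every node may be repeated `n` times, so `e + 1` nodes are available; the divided difference at
  -- these reduces to the binomial coefficient of index `e`.
  binomial-span : ∀ ts n → Unique ts → All (_< q) ts → ∀ e → e < length ts ℕ.* n →
    ∃ λ ψ → Span (Node ts n) ψ × ∀ s → ρ (ψ s) ≡ + (s C e)
  binomial-span ts n uniq ts<q e e< = go (List.take (suc e) (repeat n ts)) refl
    where
    len : length (List.take (suc e) (repeat n ts)) ≡ suc e
    len = trans (List.length-take (suc e) (repeat n ts))
      (ℕ.m≤n⇒m⊓n≡m (subst (suc e ≤_) (sym (length-repeat n ts)) e<))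
    repeat<q : All (_< q) (repeat n ts)
    repeat<q = All.concat⁺ (All.map⁺ (All.map (All.replicate⁺ n) ts<q))
    go : ∀ us → List.take (suc e) (repeat n ts) ≡ us →
         ∃ λ ψ → Span (Node ts n) ψ × ∀ s → ρ (ψ s) ≡ + (s C e)
    go [] eq = contradiction (trans (sym len) (cong length eq)) λ ()
    go (u ∷ us) eq =
      let (ψ , ψ∈ , ρψ) = dividedDifference u us (subst (All (_< q)) eq (All.take⁺ (suc e) repeat<q)) in
      ψ , span-mono node ψ∈ , λ s → trans (ρψ s) (cong (λ l → + (s C l))
            (ℕ.suc-injective (trans (sym (cong length eq)) len)))
      where
      node : ∀ {ψ} → Exponential (λ t → count t (u ∷ us)) ψ → Span (Node ts n) ψ
      node (t , β , _ , β< , ψ≡) =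
        let c≤ = subst (λ l → count t l ≤ count t (repeat n ts)) eq (count-take t (suc e) (repeat n ts))
            (t∈ , ≤n) = count-repeat n t ts uniq (ℕ.≤-<-trans z≤n (ℕ.≤-trans β< c≤))
        in gen (t , β , t∈ , ℕ.≤-trans β< (ℕ.≤-trans c≤ ≤n) , ψ≡)

-- Orders of vanishing at 1 modulo p

module Valuation {p : ℕ} (pp : Prime p) where

  private
    instance
      p≢0 : NonZero p
      p≢0 = prime⇒nonZero pp

  primePart : ∀ D → ∃₂ λ v d → suc D ≡ p ℕ.^ v ℕ.* d × ¬ p ∣ d
  primePart = <-rec _ step
    where
    step : ∀ D → (∀ {E} → E < D → ∃₂ λ v d → suc E ≡ p ℕ.^ v ℕ.* d × ¬ p ∣ d) →
           ∃₂ λ v d → suc D ≡ p ℕ.^ v ℕ.* d × ¬ p ∣ d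
    step D rec with p ℕ.∣? suc D
    ... | no p∤   = 0 , suc D , sym (ℕ.*-identityˡ (suc D)) , p∤
    ... | yes (divides zero ())
    ... | yes (divides (suc E) eq) =
      let (v , d , eq′ , p∤d) = rec {E} (ℕ.≤-pred (subst (suc E <_) (sym eq)
            (subst (_< suc E ℕ.* p) (ℕ.*-identityʳ (suc E))
              (ℕ.*-monoʳ-< (suc E) (ℕ.nonTrivial⇒n>1 p {{prime⇒nonTrivial pp}})))))
      in suc v , d , trans eq (trans (ℕ.*-comm (suc E) p) (trans (cong (p ℕ.*_) eq′) (sym (ℕ.*-assoc p (p ℕ.^ v) d)))) , p∤d

  ppart : ℕ → ℕ
  ppart D = p ℕ.^ proj₁ (primePart D)

  -- The order of vanishing at 1 modulo `p` of the product of `xᵗ - 1` over `1 ≤ t ≤ i`: for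
  -- `t = pᵛ d` the factor is congruent to the `pᵛ`-th power of `xᵈ - 1`.
  weight : ℕ → ℕ
  weight zero    = 0
  weight (suc i) = ppart i ℕ.+ weight i

  private
    -- All powers `pᵗ` with `t < K` dividing `D + 1` are added up, instead of keeping the largest
    -- only: summed over `D`, the total then splits by `t`.
    bound : ℕ → ℕ → ℕ
    bound zero    D = 0
    bound (suc t) D = (if does (p ℕ.^ t ℕ.∣? suc D) then p ℕ.^ t else 0) ℕ.+ bound t D

    ∣⇒≤bound : ∀ K t D → t < K → p ℕ.^ t ∣ suc D → p ℕ.^ t ≤ bound K D
    ∣⇒≤bound (suc K) t D t<1+K h with ℕ.m<1+n⇒m<n∨m≡n t<1+K
    ... | inj₁ t<K  = ℕ.≤-trans (∣⇒≤bound K t D t<K h) (ℕ.m≤n+m _ _)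
    ... | inj₂ refl with p ℕ.^ t ℕ.∣? suc D
    ...   | yes _ = ℕ.m≤m+n _ _
    ...   | no ¬h = contradiction h ¬h

    sumBound : ℕ → ℕ → ℕ
    sumBound K zero    = 0
    sumBound K (suc i) = bound K i ℕ.+ sumBound K i

    multiples : ℕ → ℕ → ℕ
    multiples P zero    = 0
    multiples P (suc i) = (if does (P ℕ.∣? suc i) then P else 0) ℕ.+ multiples P i

    -- P ⌊i / P⌋
    multiples≤ : ∀ P i → multiples P i ≤ i × P ∣ multiples P i
    multiples≤ P zero = z≤n , P ℕ.∣0
    multiples≤ P (suc i) with multiples≤ P i | P ℕ.∣? suc i
    ... | ≤i , P∣ | no _  = ℕ.≤-trans ≤i (ℕ.n≤1+n i) , P∣
    ... | ≤i , P∣ | yes (divides e eq) =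
        ℕ.≤-trans (next (ℕ._∣_.quotient P∣) (ℕ._∣_.equality P∣)) ℕ.≤-refl , ℕ.∣m∣n⇒∣m+n ℕ.∣-refl P∣
      where
      next : ∀ m → multiples P i ≡ m ℕ.* P → P ℕ.+ multiples P i ≤ suc i
      next m m≡ = subst₂ (λ a b → P ℕ.+ a ≤ b) (sym m≡) (sym eq)
        (ℕ.*-monoˡ-≤ P (ℕ.*-cancelʳ-< P m e (subst₂ _<_ m≡ eq (s≤s ≤i))))

    sumBound≤ : ∀ K i → sumBound K i ≤ K ℕ.* i
    sumBound≤ zero i = ℕ.≤-reflexive (go i)
      where
      go : ∀ i → sumBound 0 i ≡ 0
      go zero    = refl
      go (suc i) = go i
    sumBound≤ (suc K) i = subst (_≤ i ℕ.+ K ℕ.* i) (sym (split i))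
      (ℕ.+-mono-≤ (proj₁ (multiples≤ (p ℕ.^ K) i)) (sumBound≤ K i))
      where
      split : ∀ i → sumBound (suc K) i ≡ multiples (p ℕ.^ K) i ℕ.+ sumBound K i
      split zero    = refl
      split (suc i) = trans (cong (bound (suc K) i ℕ.+_) (split i))
        (lem (if does (p ℕ.^ K ℕ.∣? suc i) then p ℕ.^ K else 0) (bound K i) (multiples (p ℕ.^ K) i) (sumBound K i))
        where
        lem : ∀ a b c d → a ℕ.+ b ℕ.+ (c ℕ.+ d) ≡ a ℕ.+ c ℕ.+ (b ℕ.+ d)
        lem = ℕSolver.solve-∀

  -- Each of the `K` powers `P = pᵗ` contributes `P ⌊i / P⌋`, at most `i`. The hypothesis ensures
  -- that no higher power of `p` occurs among the numbers up to `i`.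
  weight≤ : ∀ K i → i < p ℕ.^ K → weight i ≤ K ℕ.* i
  weight≤ K i i<p^K = ℕ.≤-trans (go i i<p^K) (sumBound≤ K i)
    where
    go : ∀ i → i < p ℕ.^ K → weight i ≤ sumBound K i
    go zero    _ = z≤n
    go (suc i) h = ℕ.+-mono-≤ (∣⇒≤bound K v i (ℕ.≰⇒> λ K≤v →
        ℕ.<⇒≱ (ℕ.≤-<-trans (ℕ.∣⇒≤ p^v∣) h) (ℕ.^-monoʳ-≤ p K≤v)) p^v∣) (go i (ℕ.<-trans (ℕ.n<1+n i) h))
      where
      v = proj₁ (primePart i)
      p^v∣ : p ℕ.^ v ∣ suc i
      p^v∣ = divides (proj₁ (proj₂ (primePart i)))
        (trans (proj₁ (proj₂ (proj₂ (primePart i)))) (ℕ.*-comm (p ℕ.^ v) _))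

-- Only the zero polynomial annihilates all of these, so their shift ring is ℤ[x] itself. Since
-- `x - 1` lowers the index by one, `act f (binomialSequence e) 0` is the coefficient of `(x - 1)ᵉ`
-- in `f`.
binomialSequence : ℕ → ℕ → ℤ
binomialSequence e s = + (s C e)

module LeadingTerm {p : ℕ} (pp : Prime p) where

  open ShiftRingProperties binomialSequence
  open CharP shiftRing pp using (_≡ₚ_; ≡ₚ-*; ≡ₚ-^; ≡ₚ-trans; ≡ₚ-reflexive; frobenius-^)
  open Valuation pp public
  open SetoidReasoning setoid

  private
    act-π : ∀ φ s → act π φ s ≡ φ (suc s) ℤ.- φ s
    act-π φ s = trans (act-add (x^ 1) (- 1#) φ s) (cong₂ ℤ._+_ (act-x^ 1 φ s)
      (trans (act-neg 1# φ s) (cong ℤ.-_ (act-x^ 0 φ s))))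

    act-π-suc : ∀ e s → act π (binomialSequence (suc e)) s ≡ binomialSequence e s
    act-π-suc e s = trans (act-π _ s) (trans
      (cong (λ b → + b ℤ.- + (s C suc e)) (sym (nCk+nC[k+1]≡[n+1]C[k+1] s e)))
      (lem (+ (s C e)) (+ (s C suc e))))
      where
      lem : ∀ a b → (a ℤ.+ b) ℤ.- b ≡ a
      lem = ℤSolver.solve-∀

    act-π-zero : ∀ s → act π (binomialSequence 0) s ≡ 0ℤ
    act-π-zero s = trans (act-π _ s) (ℤ.+-inverseʳ 1ℤ)

    act-π^-low : ∀ w f e s → e < w → act (π ^ w * f) (binomialSequence e) s ≡ 0ℤ
    act-π^-low (suc w) f e s e<w = trans (at (*-assoc π (π ^ w) f) e s)
      (trans (act-mul π (π ^ w * f) (binomialSequence e) s)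
      (trans (act-comm π (π ^ w * f) (binomialSequence e) s) (go e e<w)))
      where
      go : ∀ e → e < suc w → act (π ^ w * f) (act π (binomialSequence e)) s ≡ 0ℤ
      go zero    _ = trans (act-cong (π ^ w * f) act-π-zero s) (act-0 (π ^ w * f) s)
      go (suc e) h = trans (act-cong (π ^ w * f) (act-π-suc e) s) (act-π^-low w f e s (ℕ.≤-pred h))

    act-π^-eq : ∀ w f s → act (π ^ w * f) (binomialSequence w) s ≡ act f (binomialSequence 0) s
    act-π^-eq zero    f s = at (*-identityˡ f) 0 s
    act-π^-eq (suc w) f s = trans (at (*-assoc π (π ^ w) f) (suc w) s)
      (trans (act-mul π (π ^ w * f) _ s)
      (trans (act-comm π (π ^ w * f) _ s)
      (trans (act-cong (π ^ w * f) (act-π-suc w) s) (act-π^-eq w f s))))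

  -- Modulo `p`, `f` vanishes at 1 to order at least `w` and `l` is its coefficient there; the order
  -- is exactly `w` when `p` does not divide `l`.
  record Lead (w : ℕ) (l : ℤ) (f : Poly) : Set where
    constructor lead
    field
      rest  : Poly
      equal : f ≡ₚ π ^ w * (const l + π * rest)

  private
    act-≡ₚ : ∀ {f g} → f ≡ₚ g → ∀ e s →
             + p ∣ᶻ act f (binomialSequence e) s ℤ.- act g (binomialSequence e) s
    act-≡ₚ {f} {g} (z , h) e s = ℤ∣.divides (act z (binomialSequence e) s) (trans
      (sym (trans (act-add f (- g) _ s) (cong (λ a → act f (binomialSequence e) s ℤ.+ a) (act-neg g _ s))))
      (trans (at h e s) (trans (act-· p z _ s) (ℤ.*-comm (+ p) _))))

  lead-low : ∀ {w l f} → Lead w l f → ∀ e → e < w → + p ∣ᶻ act f (binomialSequence e) 0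
  lead-low {w} {l} {f} (lead g h) e e<w = subst (+ p ∣ᶻ_)
    (trans (cong (λ z → act f (binomialSequence e) 0 ℤ.- z) (act-π^-low w _ e 0 e<w)) (ℤ.+-identityʳ _))
    (act-≡ₚ h e 0)

  lead-at : ∀ {w l f} → Lead w l f → + p ∣ᶻ act f (binomialSequence w) 0 ℤ.- l
  lead-at {w} {l} {f} (lead g h) = subst (λ z → + p ∣ᶻ act f (binomialSequence w) 0 ℤ.- z)
    value (act-≡ₚ h w 0)
    where
    value : act (π ^ w * (const l + π * g)) (binomialSequence w) 0 ≡ l
    value = trans (act-π^-eq w _ 0) (trans (act-add (const l) (π * g) _ 0) (trans
      (cong₂ ℤ._+_ (trans (act-const l _ 0) (ℤ.*-identityʳ l))
        (trans (act-mul π g _ 0) (trans (act-comm π g _ 0)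
        (trans (act-cong g act-π-zero 0) (act-0 g 0))))) (ℤ.+-identityʳ l)))

  lead-resp : ∀ {w l f g} → f ≈ g → Lead w l f → Lead w l g
  lead-resp f≈g (lead r h) = lead r (≡ₚ-trans (≡ₚ-reflexive (≈-sym f≈g)) h)

  lead-* : ∀ {w l f w′ l′ f′} → Lead w l f → Lead w′ l′ f′ → Lead (w ℕ.+ w′) (l ℤ.* l′) (f * f′)
  lead-* {w} {l} {f} {w′} {l′} {f′} (lead r h) (lead r′ h′) =
    lead (const l * r′ + r * (const l′ + π * r′)) (≡ₚ-trans (≡ₚ-* h h′) (≡ₚ-reflexive (begin
      π ^ w * (const l + π * r) * (π ^ w′ * (const l′ + π * r′))
        ≈⟨ solve 7 (λ a b l l′ π r r′ → a :* (l :+ π :* r) :* (b :* (l′ :+ π :* r′))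
             := a :* b :* (l :* l′ :+ π :* (l :* r′ :+ r :* (l′ :+ π :* r′)))) ≈-refl
             (π ^ w) (π ^ w′) (const l) (const l′) π r r′ ⟩
      π ^ w * π ^ w′ * (const l * const l′ + π * (const l * r′ + r * (const l′ + π * r′)))
        ≈⟨ *-cong (≈-sym (^-homo-* π w w′)) (+-congʳ (≈-sym (const-* l l′))) ⟩
      π ^ (w ℕ.+ w′) * (const (l ℤ.* l′) + π * (const l * r′ + r * (const l′ + π * r′))) ∎)))

  lead-1 : Lead 0 1ℤ 1#
  lead-1 = lead 0# (≡ₚ-reflexive (begin
    1#                      ≈⟨ +-identityʳ 1# ⟨
    1# + 0#                 ≈⟨ +-congˡ (zeroʳ π) ⟨
    1# + π * 0#             ≈⟨ *-identityˡ _ ⟨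
    1# * (1# + π * 0#)      ∎))

  lead-x^ : ∀ e → Lead 0 1ℤ (x^ e)
  lead-x^ e = lead (proj₁ (x^≈1+π e)) (≡ₚ-reflexive (≈-trans (proj₂ (x^≈1+π e)) (≈-sym (*-identityˡ _))))

  lead-π : Lead 1 1ℤ π
  lead-π = lead 0# (≡ₚ-reflexive (begin
    π                            ≈⟨ *-identityʳ π ⟨
    π * 1#                       ≈⟨ *-cong (≈-sym (*-identityʳ π)) (≈-sym (≈-trans (+-congˡ (zeroʳ π)) (+-identityʳ 1#))) ⟩
    π * 1# * (1# + π * 0#)       ∎))

  private
    [1+y]^d : ∀ y d → ∃ λ g → (1# + y) ^ d ≈ 1# + y * (const (+ d) + y * g)
    [1+y]^d y zero = 0# , (begin
      1#                               ≈⟨ +-identityʳ 1# ⟨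
      1# + 0#                          ≈⟨ +-congˡ (≈-trans (*-congˡ (+-cong const-0 (zeroʳ y))) (≈-trans (*-congˡ (+-identityʳ 0#)) (zeroʳ y))) ⟨
      1# + y * (const 0ℤ + y * 0#)     ∎)
    [1+y]^d y (suc d) = const (+ d) + g + y * g , (begin
      (1# + y) * (1# + y) ^ d
        ≈⟨ *-congˡ h ⟩
      (1# + y) * (1# + y * (const (+ d) + y * g))
        ≈⟨ solve 4 (λ o y c g → (o :+ y) :* (o :+ y :* (c :+ y :* g))
             := o :* o :+ (y :* o :+ o :* (y :* c) :+ (o :* (y :* (y :* g)) :+ y :* (y :* (c :+ y :* g))))) ≈-refl 1# y (const (+ d)) g ⟩
      1# * 1# + (y * 1# + 1# * (y * const (+ d)) + (1# * (y * (y * g)) + y * (y * (const (+ d) + y * g))))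
        ≈⟨ +-cong (*-identityʳ 1#) (+-cong (+-congˡ (*-identityˡ _)) (+-congʳ (*-identityˡ _))) ⟩
      1# + (y * 1# + y * const (+ d) + (y * (y * g) + y * (y * (const (+ d) + y * g))))
        ≈⟨ solve 4 (λ o y c g → o :+ (y :* o :+ y :* c :+ (y :* (y :* g) :+ y :* (y :* (c :+ y :* g))))
             := o :+ y :* ((o :+ c) :+ y :* (c :+ g :+ y :* g))) ≈-refl 1# y (const (+ d)) g ⟩
      1# + y * (1# + const (+ d) + y * (const (+ d) + g + y * g))
        ≈⟨ +-congˡ (*-congˡ (+-congʳ (≈-sym (const-+ 1ℤ (+ d))))) ⟩
      1# + y * (const (+ suc d) + y * (const (+ d) + g + y * g)) ∎)
      where
      g = proj₁ ([1+y]^d y d)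
      h = proj₂ ([1+y]^d y d)

  -- Write `D + 1 = P d` with `P` the `p`-part. Frobenius gives `x^P ≡ 1 + π^P`, whose `d`-th power
  -- is `1 + d π^P` up to multiples of `π^(2P)`.
  lead-x^-1 : ∀ D → ∃ λ l → Lead (ppart D) l (x^ (suc D) - 1#) × ¬ + p ∣ᶻ l
  lead-x^-1 D = + d , lead r equal , λ h → p∤d (ℤ∣.∣⇒∣ᵤ h)
    where
    v = proj₁ (primePart D)
    d = proj₁ (proj₂ (primePart D))
    D≡ = proj₁ (proj₂ (proj₂ (primePart D)))
    p∤d = proj₂ (proj₂ (proj₂ (primePart D)))
    P = p ℕ.^ v
    g = proj₁ ([1+y]^d (π ^ P) d)
    r = π ^ ℕ.pred P * g
    π^P : π ^ P ≈ π * π ^ ℕ.pred P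
    π^P = reflexive (cong (π ^_) (sym (ℕ.suc-pred P {{ℕ.m^n≢0 p v {{prime⇒nonZero pp}}}})))
    x^P≡ : x^ P ≡ₚ 1# + π ^ P
    x^P≡ = ≡ₚ-trans (≡ₚ-reflexive (begin
      x^ P            ≡⟨ cong x^ (sym (ℕ.*-identityˡ P)) ⟩
      x^ (1 ℕ.* P)    ≈⟨ x^-pow 1 P ⟨
      x^ 1 ^ P        ≈⟨ ^-congˡ P 1+π≈x ⟨
      (1# + π) ^ P    ∎)) (frobenius-^ v π)
    x^D≡ : x^ (suc D) ≡ₚ 1# + π ^ P * (const (+ d) + π ^ P * g)
    x^D≡ = ≡ₚ-trans (≡ₚ-reflexive (≈-trans (reflexive (cong x^ D≡)) (≈-sym (x^-pow P d))))
      (≡ₚ-trans (≡ₚ-^ x^P≡ d) (≡ₚ-reflexive (proj₂ ([1+y]^d (π ^ P) d))))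
    equal : x^ (suc D) - 1# ≡ₚ π ^ P * (const (+ d) + π * r)
    equal = proj₁ x^D≡ , ≈-trans (begin
      (x^ (suc D) - 1#) - π ^ P * (const (+ d) + π * (π ^ ℕ.pred P * g))
        ≈⟨ +-congˡ (-‿cong (*-congˡ (+-congˡ (≈-trans (≈-sym (*-assoc π (π ^ ℕ.pred P) g)) (*-congʳ (≈-sym π^P)))))) ⟩
      (x^ (suc D) - 1#) - π ^ P * (const (+ d) + π ^ P * g)
        ≈⟨ solve 3 (λ x o a → (x :- o) :- a := x :- (o :+ a)) ≈-refl (x^ (suc D)) 1# (π ^ P * (const (+ d) + π ^ P * g)) ⟩
      x^ (suc D) - (1# + π ^ P * (const (+ d) + π ^ P * g)) ∎) (proj₂ x^D≡)

  lead-difference : ∀ c D → ∃ λ l → Lead (ppart D) l (x^ (c ℕ.+ suc D) - x^ c) × ¬ + p ∣ᶻ l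
  lead-difference c D = 1ℤ ℤ.* l , lead-resp eq (lead-* (lead-x^ c) L) , subst (λ z → ¬ + p ∣ᶻ z) (sym (ℤ.*-identityˡ l)) p∤l
    where
    l = proj₁ (lead-x^-1 D)
    L = proj₁ (proj₂ (lead-x^-1 D))
    p∤l = proj₂ (proj₂ (lead-x^-1 D))
    eq : x^ c * (x^ (suc D) - 1#) ≈ x^ (c ℕ.+ suc D) - x^ c
    eq = begin
      x^ c * (x^ (suc D) - 1#)         ≈⟨ solve 3 (λ a b o → a :* (b :- o) := a :* b :- a :* o) ≈-refl (x^ c) (x^ (suc D)) 1# ⟩
      x^ c * x^ (suc D) - x^ c * 1#    ≈⟨ +-cong (≈-sym (x^-homo c (suc D))) (-‿cong (*-identityʳ (x^ c))) ⟩
      x^ (c ℕ.+ suc D) - x^ c          ∎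

-- Exponent vectors

dot : ∀ {n} → Vec ℕ n → Vec ℕ n → ℕ
dot []       []       = 0
dot (u ∷ us) (i ∷ is) = u ℕ.* i ℕ.+ dot us is

addV : ∀ {n} → Vec ℕ n → Vec ℕ n → Vec ℕ n
addV = Vec.zipWith ℕ._+_

single : ∀ {n} → Fin n → ℕ → Vec ℕ n
single zero    c = c ∷ Vec.replicate _ 0
single (suc l) c = 0 ∷ single l c

dot-0 : ∀ {n} (u : Vec ℕ n) → dot u (Vec.replicate n 0) ≡ 0
dot-0 []       = refl
dot-0 (u ∷ us) = cong₂ ℕ._+_ (ℕ.*-zeroʳ u) (dot-0 us)

dot-single : ∀ {n} (u : Vec ℕ n) l c → dot u (single l c) ≡ Vec.lookup u l ℕ.* c
dot-single (u ∷ us) zero    c = trans (cong (u ℕ.* c ℕ.+_) (dot-0 us)) (ℕ.+-identityʳ _)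
dot-single (u ∷ us) (suc l) c = trans (cong (ℕ._+ dot us (single l c)) (ℕ.*-zeroʳ u)) (dot-single us l c)

dot-addV : ∀ {n} (u i j : Vec ℕ n) → dot u (addV i j) ≡ dot u i ℕ.+ dot u j
dot-addV []       []       []       = refl
dot-addV (u ∷ us) (i ∷ is) (j ∷ js) = trans (cong (u ℕ.* (i ℕ.+ j) ℕ.+_) (dot-addV us is js))
  (lem u i j (dot us is) (dot us js))
  where
  lem : ∀ u i j a b → u ℕ.* (i ℕ.+ j) ℕ.+ (a ℕ.+ b) ≡ u ℕ.* i ℕ.+ a ℕ.+ (u ℕ.* j ℕ.+ b)
  lem = ℕSolver.solve-∀

linePoint : ∀ {n} → Vec ℕ n → ℕ → Vec ℕ n → Vec ℕ n
linePoint a t u = Vec.zipWith (λ a u → a ℕ.+ t ℕ.* u) a u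

dot-linePoint : ∀ {n} (a : Vec ℕ n) t u i → dot (linePoint a t u) i ≡ dot a i ℕ.+ t ℕ.* dot u i
dot-linePoint []       t []       []       = sym (ℕ.*-zeroʳ t)
dot-linePoint (a ∷ as) t (u ∷ us) (i ∷ is) = trans
  (cong ((a ℕ.+ t ℕ.* u) ℕ.* i ℕ.+_) (dot-linePoint as t us is)) (lem a t u i (dot as is) (dot us is))
  where
  lem : ∀ a t u i x y → (a ℕ.+ t ℕ.* u) ℕ.* i ℕ.+ (x ℕ.+ t ℕ.* y) ≡ a ℕ.* i ℕ.+ x ℕ.+ t ℕ.* (u ℕ.* i ℕ.+ y)
  lem = ℕSolver.solve-∀

monomial : ∀ {n} → Vec ℕ n → Vec ℕ n → ℕ
monomial []       []       = 1
monomial (i ∷ is) (α ∷ αs) = i ℕ.^ α ℕ.* monomial is αs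

increment : ∀ {n} → Fin n → Vec ℕ n → Vec ℕ n
increment l α = Vec.updateAt α l suc

monomial-increment : ∀ {n} (i α : Vec ℕ n) l →
  monomial i (increment l α) ≡ Vec.lookup i l ℕ.* monomial i α
monomial-increment (i ∷ is) (α ∷ αs) zero    = ℕ.*-assoc i (i ℕ.^ α) (monomial is αs)
monomial-increment (i ∷ is) (α ∷ αs) (suc l) = trans
  (cong (i ℕ.^ α ℕ.*_) (monomial-increment is αs l))
  (lem (i ℕ.^ α) (Vec.lookup is l) (monomial is αs))
  where
  lem : ∀ a b c → a ℕ.* (b ℕ.* c) ≡ b ℕ.* (a ℕ.* c)
  lem = ℕSolver.solve-∀

sum-increment : ∀ {n} l (α : Vec ℕ n) → Vec.sum (increment l α) ≡ suc (Vec.sum α)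
sum-increment zero    (α ∷ αs) = refl
sum-increment (suc l) (α ∷ αs) = trans (cong (α ℕ.+_) (sum-increment l αs)) (ℕ.+-suc α _)

-- The vectors with coordinate sum less than D.
simplex : ∀ n → ℕ → List (Vec ℕ n)
simplex n       zero    = []
simplex zero    (suc D) = [] ∷ []
simplex (suc n) (suc D) = List.map (0 ∷_) (simplex n (suc D)) ++ List.map (increment zero) (simplex (suc n) D)

∈-simplex : ∀ {n} D (α : Vec ℕ n) → Vec.sum α < D → α ∈ simplex n D
∈-simplex (suc D) []           h = here refl
∈-simplex (suc D) (zero ∷ αs)  h = ∈.∈-++⁺ˡ (∈.∈-map⁺ (0 ∷_) (∈-simplex (suc D) αs h))
∈-simplex (suc D) (suc α ∷ αs) h = ∈.∈-++⁺ʳ (List.map (0 ∷_) (simplex _ (suc D)))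
  (∈.∈-map⁺ (increment zero) (∈-simplex D (α ∷ αs) (ℕ.≤-pred h)))

argmin : ∀ {m} {U : Fin m → Set} → (∀ j → Dec (U j)) → (f : Fin m → ℕ) → ∃ U →
         ∃ λ j → U j × ∀ i → U i → f j ≤ f i
argmin {m} {U} U? f (j , u) = go (f j) j u ℕ.≤-refl
  where
  go : ∀ fuel j → U j → f j ≤ fuel → ∃ λ j → U j × ∀ i → U i → f j ≤ f i
  go fuel j u ≤fuel with any? (λ i → U? i ×-dec (f i ℕ.<? f j))
  ... | no ¬smaller = j , u , λ i uᵢ → ℕ.≮⇒≥ λ lt → ¬smaller (i , uᵢ , lt)
  go zero    j u ≤fuel | yes (i , _ , lt) = contradiction (ℕ.≤-trans lt ≤fuel) λ ()
  go (suc n) j u ≤fuel | yes (i , uᵢ , lt) = go n i uᵢ (ℕ.≤-pred (ℕ.≤-trans lt ≤fuel))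

≤∧sum≥⇒≡ : ∀ {n} (u v : Vec ℕ n) → (∀ l → Vec.lookup u l ≤ Vec.lookup v l) → Vec.sum v ≤ Vec.sum u → u ≡ v
≤∧sum≥⇒≡ [] [] _ _ = refl
≤∧sum≥⇒≡ (u ∷ us) (v ∷ vs) le sum≥ = cong₂ _∷_ u≡v (≤∧sum≥⇒≡ us vs (le ∘ suc)
    (ℕ.+-cancelˡ-≤ u _ _ (subst (λ z → z ℕ.+ Vec.sum vs ≤ u ℕ.+ Vec.sum us) (sym u≡v) sum≥)))
  where
  sum≤ : ∀ {n} (u v : Vec ℕ n) → (∀ l → Vec.lookup u l ≤ Vec.lookup v l) → Vec.sum u ≤ Vec.sum v
  sum≤ []       []       _ = z≤n
  sum≤ (u ∷ us) (v ∷ vs) h = ℕ.+-mono-≤ (h zero) (sum≤ us vs (h ∘ suc))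
  u≡v : u ≡ v
  u≡v = ℕ.≤-antisym (le zero) (ℕ.+-cancelʳ-≤ (Vec.sum us) _ _
    (ℕ.≤-trans (ℕ.+-monoʳ-≤ v (sum≤ us vs (le ∘ suc))) sum≥))

-- The factor ((l , c) , (l′ , c′)) stands for the polynomial y_l^c - y_l′^c′.
Factor : ℕ → Set
Factor n = (Fin n × ℕ) × (Fin n × ℕ)

-- ∏_{d<m} (y_l - y₀^(j-1-d))
column : ∀ {n} → Fin (suc n) → ℕ → ℕ → List (Factor (suc n))
column l j zero    = []
column l j (suc m) = ((l , 1) , (zero , j ℕ.∸ suc m)) ∷ column l j m

columns : ∀ {n m} → (Fin m → Fin (suc n)) → Vec ℕ m → List (Factor (suc n))
columns f []       = []
columns f (j ∷ js) = column (f zero) j j ++ columns (f ∘ suc) js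

-- (y₀ - 1)^j₀ times the Newton basis polynomials with nodes 1, y₀, y₀², …
-- in the other variables.
newton : ∀ {n} → Vec ℕ (suc n) → List (Factor (suc n))
newton (j₀ ∷ j) = List.replicate j₀ ((zero , 1) , (zero , 0)) ++ columns suc j

-- Newton polynomials along lines

module NewtonOrder {p : ℕ} (pp : Prime p) where

  open ShiftRingProperties binomialSequence
  open LeadingTerm pp public
  open SetoidReasoning setoid

  -- The order of `newton (j₀ ∷ j)` along the direction `(1, j)`. The head `j₀` raises this order
  -- without changing the direction.
  level : ∀ {n} → Vec ℕ (suc n) → ℕ
  level (j₀ ∷ j) = j₀ ℕ.+ Vec.sum (Vec.map weight j)

  -- The univariate polynomial obtained from y_l = x^(u_l).
  specialise : ∀ {n} → Vec ℕ n → List (Factor n) → Poly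
  specialise u []                               = 1#
  specialise u (((l , c) , (l′ , c′)) ∷ fs) =
    (x^ (Vec.lookup u l ℕ.* c) - x^ (Vec.lookup u l′ ℕ.* c′)) * specialise u fs

  specialise-++ : ∀ {n} (u : Vec ℕ n) fs gs → specialise u (fs ++ gs) ≈ specialise u fs * specialise u gs
  specialise-++ u []       gs = ≈-sym (*-identityˡ _)
  specialise-++ u (((l , c) , (l′ , c′)) ∷ fs) gs =
    ≈-trans (*-congˡ (specialise-++ u fs gs)) (≈-sym (*-assoc _ (specialise u fs) _))

  private
    UnitLead : ℕ → Poly → Set
    UnitLead w f = ∃ λ l → Lead w l f × ¬ + p ∣ᶻ l

    p∤1 : ¬ + p ∣ᶻ 1ℤ
    p∤1 h = contradiction (ℕ.∣⇒≤ (ℤ∣.∣⇒∣ᵤ h)) (ℕ.<⇒≱ (ℕ.nonTrivial⇒n>1 p {{prime⇒nonTrivial pp}}))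

    unitLead-* : ∀ {w f w′ f′} → UnitLead w f → UnitLead w′ f′ → UnitLead (w ℕ.+ w′) (f * f′)
    unitLead-* (l , L , p∤l) (l′ , L′ , p∤l′) = l ℤ.* l′ , lead-* L L′ , λ h → case (euclidᶻ pp l l′ h)
      where
      case : + p ∣ᶻ l ⊎ + p ∣ᶻ l′ → ⊥
      case (inj₁ h) = p∤l h
      case (inj₂ h) = p∤l′ h

    unitLead-resp : ∀ {w f g} → f ≈ g → UnitLead w f → UnitLead w g
    unitLead-resp f≈g (l , L , u) = l , lead-resp f≈g L , u

    -- With `j` the exponent of `y_l`, the factor `y_l - y₀^(j-1-d)` becomes
    -- `x^(j-1-d) (x^(d+1) - 1)`, whose order is the `p`-part of `d + 1`.
    unitLead-column : ∀ {n} (u : Vec ℕ (suc n)) → Vec.lookup u zero ≡ 1 → ∀ l m → m ≤ Vec.lookup u l →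
      UnitLead (weight m) (specialise u (column l (Vec.lookup u l) m))
    unitLead-column u u₀ l zero    _   = 1ℤ , lead-1 , p∤1
    unitLead-column u u₀ l (suc m) m<j = unitLead-* (unitLead-resp eq (lead-difference c m))
      (unitLead-column u u₀ l m (ℕ.<⇒≤ m<j))
      where
      j = Vec.lookup u l
      c = j ℕ.∸ suc m
      eq : x^ (c ℕ.+ suc m) - x^ c ≈ x^ (j ℕ.* 1) - x^ (Vec.lookup u zero ℕ.* c)
      eq = reflexive (cong₂ (λ a b → x^ a - x^ b)
        (trans (ℕ.m∸n+n≡m m<j) (sym (ℕ.*-identityʳ j)))
        (trans (sym (ℕ.*-identityˡ c)) (cong (ℕ._* c) (sym u₀))))

    unitLead-columns : ∀ {n m} (u : Vec ℕ (suc n)) → Vec.lookup u zero ≡ 1 →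
      (f : Fin m → Fin (suc n)) (js : Vec ℕ m) → (∀ l → Vec.lookup u (f l) ≡ Vec.lookup js l) →
      UnitLead (Vec.sum (Vec.map weight js)) (specialise u (columns f js))
    unitLead-columns u u₀ f []       _ = 1ℤ , lead-1 , p∤1
    unitLead-columns u u₀ f (j ∷ js) h = unitLead-resp
      (≈-sym (specialise-++ u (column (f zero) j j) (columns (f ∘ suc) js)))
      (unitLead-* (subst (λ i → UnitLead (weight i) (specialise u (column (f zero) i i))) (h zero)
                    (unitLead-column u u₀ (f zero) (Vec.lookup u (f zero)) ℕ.≤-refl))
                  (unitLead-columns u u₀ (f ∘ suc) js (h ∘ suc)))

  newton-lead : ∀ {n} j₀ (j : Vec ℕ n) →
    ∃ λ l → Lead (level (j₀ ∷ j)) l (specialise (1 ∷ j) (newton (j₀ ∷ j))) × ¬ + p ∣ᶻ l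
  newton-lead j₀ j = unitLead-resp (≈-sym (specialise-++ (1 ∷ j) (List.replicate j₀ _) (columns suc j)))
    (unitLead-* (powers j₀) (unitLead-columns (1 ∷ j) refl suc j λ _ → refl))
    where
    powers : ∀ m → UnitLead m (specialise (1 ∷ j) (List.replicate m ((zero , 1) , (zero , 0))))
    powers zero    = 1ℤ , lead-1 , p∤1
    powers (suc m) = unitLead-* (1ℤ , lead-π , p∤1) (powers m)

  private
    -- An exponent of `y_l` below `j` is one of the nodes, so one factor is zero. The bound
    -- `j ∸ m ≤ Vec.lookup u l` says that this factor is among the `m` that remain.
    column-zero : ∀ {n} (u : Vec ℕ (suc n)) → Vec.lookup u zero ≡ 1 → ∀ l j m → m ≤ j →
      j ℕ.∸ m ≤ Vec.lookup u l → Vec.lookup u l < j → specialise u (column l j m) ≈ 0#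
    column-zero u u₀ l j zero    _   j≤u u<j = contradiction j≤u (ℕ.<⇒≱ u<j)
    column-zero u u₀ l j (suc m) m<j le  u<j with Vec.lookup u l ℕ.≟ j ℕ.∸ suc m
    ... | yes u≡ = ≈-trans (*-congʳ (≈-trans (+-congʳ (reflexive (cong x^ eq))) (-‿inverseʳ _))) (zeroˡ _)
      where
      eq : Vec.lookup u l ℕ.* 1 ≡ Vec.lookup u zero ℕ.* (j ℕ.∸ suc m)
      eq = trans (ℕ.*-identityʳ _) (trans u≡ (trans (sym (ℕ.*-identityˡ _)) (cong (ℕ._* (j ℕ.∸ suc m)) (sym u₀))))
    ... | no u≢ = ≈-trans (*-congˡ (column-zero u u₀ l j m (ℕ.<⇒≤ m<j)
          (subst (_≤ Vec.lookup u l) (ℕ.suc-pred (j ℕ.∸ m) {{ℕ.>-nonZero (ℕ.m<n⇒0<n∸m m<j)}})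
            (ℕ.≤∧≢⇒< (subst (_≤ Vec.lookup u l) pred≡ le) λ e → u≢ (trans (sym e) (sym pred≡)))) u<j)) (zeroʳ _)
      where
      pred≡ : j ℕ.∸ suc m ≡ ℕ.pred (j ℕ.∸ m)
      pred≡ = sym (ℕ.pred[m∸n]≡m∸[1+n] j m)

    columns-zero : ∀ {n m} (u : Vec ℕ (suc n)) → Vec.lookup u zero ≡ 1 →
      (f : Fin m → Fin (suc n)) (js : Vec ℕ m) → ∀ l → Vec.lookup u (f l) < Vec.lookup js l →
      specialise u (columns f js) ≈ 0#
    columns-zero u u₀ f (j ∷ js) zero    lt = ≈-trans (specialise-++ u (column (f zero) j j) _)
      (≈-trans (*-congʳ (column-zero u u₀ (f zero) j j ℕ.≤-refl
        (subst (_≤ Vec.lookup u (f zero)) (sym (ℕ.n∸n≡0 j)) z≤n) lt)) (zeroˡ _))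
    columns-zero u u₀ f (j ∷ js) (suc l) lt = ≈-trans (specialise-++ u (column (f zero) j j) _)
      (≈-trans (*-congˡ (columns-zero u u₀ (f ∘ suc) js l lt)) (zeroʳ _))

  newton-zero : ∀ {n} (u j : Vec ℕ n) i₀ l → Vec.lookup u l < Vec.lookup j l →
    specialise (1 ∷ u) (newton (i₀ ∷ j)) ≈ 0#
  newton-zero u j i₀ l lt = ≈-trans (specialise-++ (1 ∷ u) (List.replicate i₀ _) (columns suc j))
    (≈-trans (*-congˡ (columns-zero (1 ∷ u) refl suc j l lt)) (zeroʳ _))

length-cartesianProductWith : ∀ {A B C : Set} (f : A → B → C) xs ys →
  length (List.cartesianProductWith f xs ys) ≡ length xs ℕ.* length ys
length-cartesianProductWith f []       ys = refl
length-cartesianProductWith f (x ∷ xs) ys = trans (List.length-++ (List.map (f x) ys))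
  (cong₂ ℕ._+_ (List.length-map (f x) ys) (length-cartesianProductWith f xs ys))

-- Independence of the Newton functionals

module Independence {p : ℕ} (pp : Prime p) (k : ℕ) where

  open Cyclotomic pp k
  open DividedDifferences pp k
  open Elimination pp k
  open NewtonOrder pp using (level; specialise; newton-lead; newton-zero; lead-at; lead-low)
  open SemiringSum semiring using (sum; sum-remove; sum-cong-≋; ∑-distrib-+; *-distribˡ-sum)
  private
    module B = ShiftRingProperties binomialSequence
    instance
      p≢0 : NonZero p
      p≢0 = prime⇒nonZero pp
      q≢0 : NonZero q
      q≢0 = ℕ.m^n≢0 p (suc k)

  infix 4 _≡q_
  _≡q_ : ∀ {n} → Vec ℕ n → Vec ℕ n → Set
  _≡q_ = Pointwise λ a b → a % q ≡ b % q

  private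
    x^-% : ∀ a → x^ a ≈ x^ (a % q)
    x^-% a = ≈-trans (reflexive (cong x^ (ℕ.m≡m%n+[m/n]*n a q))) (x^-mod (a % q) (a / q))

    x^-dot-cong : ∀ {n} {y z : Vec ℕ n} → y ≡q z → ∀ i → x^ (dot y i) ≈ x^ (dot z i)
    x^-dot-cong []                     []       = ≈-refl
    x^-dot-cong {y = y ∷ ys} {z ∷ zs} (e ∷ es) (i ∷ is) = begin
      x^ (y ℕ.* i ℕ.+ dot ys is)   ≈⟨ x^-homo (y ℕ.* i) _ ⟩
      x^ (y ℕ.* i) * x^ (dot ys is) ≈⟨ *-cong (x^-pow y i) (≈-sym (x^-dot-cong es is)) ⟨
      x^ y ^ i * x^ (dot zs is)    ≈⟨ *-congʳ (^-congˡ i x^y≈x^z) ⟩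
      x^ z ^ i * x^ (dot zs is)    ≈⟨ *-congʳ (x^-pow z i) ⟩
      x^ (z ℕ.* i) * x^ (dot zs is) ≈⟨ x^-homo (z ℕ.* i) _ ⟨
      x^ (z ℕ.* i ℕ.+ dot zs is)   ∎
      where
      open SetoidReasoning setoid
      x^y≈x^z : x^ y ≈ x^ z
      x^y≈x^z = ≈-trans (x^-% y) (≈-trans (reflexive (cong x^ e)) (≈-sym (x^-% z)))

    ·-torsionFree : ∀ n f → suc n · f ≈ 0# → f ≈ 0#
    ·-torsionFree n f h = mk≈ λ _ s → trans (zero-value s) (sym (act-zero (κ tt) s))
      where
      zero-value : ∀ s → act f (κ tt) s ≡ 0ℤ
      zero-value s with ℤ.i*j≡0⇒i≡0∨j≡0 (+ suc n)
        (trans (sym (act-· (suc n) f (κ tt) s)) (trans (at h tt s) (act-zero (κ tt) s)))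
      ... | inj₂ e = e

    sum-0 : ∀ {m} (t : Fin m → Poly) → (∀ j → t j ≈ 0#) → sum t ≈ 0#
    sum-0 {zero}  t h = ≈-refl
    sum-0 {suc m} t h = ≈-trans (+-cong (h zero) (sum-0 (t ∘ suc) (h ∘ suc))) (+-identityʳ 0#)

    p∣ρ-sum : ∀ {m} (t : Fin m → Poly) → (∀ j → + p ∣ᶻ ρ (t j)) → + p ∣ᶻ ρ (sum t)
    p∣ρ-sum {zero}  t h = subst (+ p ∣ᶻ_) (sym ρ-0) (ℤ∣.divides 0ℤ refl)
    p∣ρ-sum {suc m} t h = subst (+ p ∣ᶻ_) (sym (ρ-+ (t zero) _))
      (ℤ∣.∣m∣n⇒∣m+n (h zero) (p∣ρ-sum (t ∘ suc) (h ∘ suc)))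

  -- Applying the functional i ↦ Ψ i to a product of factors times y^i.
  expand : ∀ {n} → List (Factor n) → (Vec ℕ n → Poly) → Vec ℕ n → Poly
  expand []                             Ψ i = Ψ i
  expand (((l , c) , (l′ , c′)) ∷ fs) Ψ i =
    expand fs Ψ (addV (single l c) i) - expand fs Ψ (addV (single l′ c′) i)

  private
    expand-cong : ∀ {n} (fs : List (Factor n)) {Ψ Θ} → (∀ i → Ψ i ≈ Θ i) → ∀ i → expand fs Ψ i ≈ expand fs Θ i
    expand-cong []       h i = h i
    expand-cong (_ ∷ fs) h i = +-cong (expand-cong fs h _) (-‿cong (expand-cong fs h _))

    expand-+ : ∀ {n} (fs : List (Factor n)) Ψ Θ i →
      expand fs (λ i → Ψ i + Θ i) i ≈ expand fs Ψ i + expand fs Θ i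
    expand-+ []       Ψ Θ i = ≈-refl
    expand-+ (((l , c) , (l′ , c′)) ∷ fs) Ψ Θ i = ≈-trans
      (+-cong (expand-+ fs Ψ Θ _) (-‿cong (expand-+ fs Ψ Θ _)))
      (solve 4 (λ a b c d → (a :+ b) :- (c :+ d) := (a :- c) :+ (b :- d)) ≈-refl
        (expand fs Ψ (addV (single l c) i)) (expand fs Θ (addV (single l c) i))
        (expand fs Ψ (addV (single l′ c′) i)) (expand fs Θ (addV (single l′ c′) i)))

    expand-* : ∀ {n} (fs : List (Factor n)) a Ψ i → expand fs (λ i → a * Ψ i) i ≈ a * expand fs Ψ i
    expand-* []       a Ψ i = ≈-refl
    expand-* (((l , c) , (l′ , c′)) ∷ fs) a Ψ i = ≈-trans
      (+-cong (expand-* fs a Ψ _) (-‿cong (expand-* fs a Ψ _)))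
      (solve 3 (λ a x y → a :* x :- a :* y := a :* (x :- y)) ≈-refl
        a (expand fs Ψ (addV (single l c) i)) (expand fs Ψ (addV (single l′ c′) i)))

    -- A functional that under `ρ` depends on `⟨u,i⟩` alone only sees the substitution
    -- `y_l = x^(u_l)`: multiplying by `y_l^c` moves `⟨u,i⟩` by `u_l c`.
    ρ-expand : ∀ {n} (u : Vec ℕ n) (fs : List (Factor n)) Ψ φ → (∀ i → ρ (Ψ i) ≡ φ (dot u i)) →
      ∀ i → ρ (expand fs Ψ i) ≡ act (specialise u fs) φ (dot u i)
    ρ-expand u [] Ψ φ h i = trans (h i) (sym (act-x^ 0 φ (dot u i)))
    ρ-expand u (((l , c) , (l′ , c′)) ∷ fs) Ψ φ h i = begin
      ρ (E (addV (single l c) i) - E (addV (single l′ c′) i))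
        ≡⟨ trans (ρ-+ _ _) (cong (λ z → ρ (E (addV (single l c) i)) ℤ.+ z) (ρ-neg _)) ⟩
      ρ (E (addV (single l c) i)) ℤ.- ρ (E (addV (single l′ c′) i))
        ≡⟨ cong₂ ℤ._-_ (shifted l c) (shifted l′ c′) ⟩
      act f φ (Vec.lookup u l ℕ.* c ℕ.+ s) ℤ.- act f φ (Vec.lookup u l′ ℕ.* c′ ℕ.+ s)
        ≡⟨ sym (cong₂ ℤ._+_ (act-x^ (Vec.lookup u l ℕ.* c) (act f φ) s)
             (trans (act-neg (x^ (Vec.lookup u l′ ℕ.* c′)) (act f φ) s)
               (cong ℤ.-_ (act-x^ (Vec.lookup u l′ ℕ.* c′) (act f φ) s)))) ⟩
      act (x^ (Vec.lookup u l ℕ.* c)) (act f φ) s ℤ.+ act (negPoly (x^ (Vec.lookup u l′ ℕ.* c′))) (act f φ) s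
        ≡⟨ sym (act-add (x^ (Vec.lookup u l ℕ.* c)) _ (act f φ) s) ⟩
      act (addPoly (x^ (Vec.lookup u l ℕ.* c)) (negPoly (x^ (Vec.lookup u l′ ℕ.* c′)))) (act f φ) s
        ≡⟨ sym (act-mul _ f φ s) ⟩
      act (specialise u (((l , c) , (l′ , c′)) ∷ fs)) φ s ∎
      where
      open ≡-Reasoning
      E = expand fs Ψ
      f = specialise u fs
      s = dot u i
      shifted : ∀ l c → ρ (E (addV (single l c) i)) ≡ act f φ (Vec.lookup u l ℕ.* c ℕ.+ s)
      shifted l c = trans (ρ-expand u fs Ψ φ h (addV (single l c) i))
        (cong (act f φ) (trans (dot-addV u (single l c) i) (cong (ℕ._+ s) (dot-single u l c))))

  -- Only the tail of `j` fixes the direction; indices with equal tails ask for the same direction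
  -- but for different numbers of points.
  record Hits {n} (T : List (Vec ℕ (suc n))) (j : Vec ℕ (suc n)) : Set where
    field
      base    : Vec ℕ (suc n)
      times   : List ℕ
      unique  : Unique times
      times<q : All (_< q) times
      onLine  : ∀ {t} → t ∈ times → ∃ λ y → y ∈ T × y ≡q linePoint base t (1 ∷ Vec.tail j)
      enough  : level j < length times ℕ.* suc n

  private
    module Contradiction {n} (T : List (Vec ℕ (suc n))) {m} (A : Fin m → Vec ℕ (suc n))
      (A-injective : ∀ i j → A i ≡ A j → i ≡ j) (hits : ∀ i → Hits T (A i))
      (few : length T ℕ.* length (simplex (suc n) (suc n)) < m) where

      point : Vec ℕ (suc n) → (Vec ℕ (suc n) → ℕ) → Vec ℕ (suc n) → Poly
      point y f i = f i · x^ (dot y i)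

      -- One linear condition for each point of `T` and each monomial of degree at most `n`; by
      -- `few` there are more unknown coefficients than conditions.
      rows : List (Fin m → Poly)
      rows = List.cartesianProductWith (λ y α j → expand (newton (A j)) (point y λ i → monomial i α) (Vec.replicate _ 0))
        T (simplex (suc n) (suc n))

      K = kernel rows (subst (_< m) (sym (length-cartesianProductWith _ T _)) few)

      c : Fin m → Poly
      c = proj₁ K

      Λ : (Vec ℕ (suc n) → Poly) → Poly
      Λ Ψ = sum λ j → expand (newton (A j)) Ψ (Vec.replicate _ 0) * c j

      Λ-cong : ∀ {Ψ Θ} → (∀ i → Ψ i ≈ Θ i) → Λ Ψ ≈ Λ Θ
      Λ-cong h = sum-cong-≋ λ j → *-congʳ (expand-cong (newton (A j)) h _)

      Λ-+ : ∀ Ψ Θ → Λ (λ i → Ψ i + Θ i) ≈ Λ Ψ + Λ Θ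
      Λ-+ Ψ Θ = ≈-trans
        (sum-cong-≋ λ j → ≈-trans (*-congʳ (expand-+ (newton (A j)) Ψ Θ _)) (distribʳ (c j) _ _))
        (∑-distrib-+ (λ j → expand (newton (A j)) Ψ (Vec.replicate _ 0) * c j) _)

      Λ-* : ∀ a Ψ → Λ (λ i → a * Ψ i) ≈ a * Λ Ψ
      Λ-* a Ψ = ≈-trans
        (sum-cong-≋ λ j → ≈-trans (*-congʳ (expand-* (newton (A j)) a Ψ _)) (*-assoc a _ (c j)))
        (≈-sym (*-distribˡ-sum a (λ j → expand (newton (A j)) Ψ (Vec.replicate _ 0) * c j)))

      Killed : (Vec ℕ (suc n) → Poly) → Set
      Killed Ψ = Λ Ψ ≈ 0#

      killed-+ : ∀ {Ψ Θ} → Killed Ψ → Killed Θ → Killed (λ i → Ψ i + Θ i)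
      killed-+ h h′ = ≈-trans (Λ-+ _ _) (≈-trans (+-cong h h′) (+-identityʳ 0#))

      killed-* : ∀ a {Ψ} → Killed Ψ → Killed (λ i → a * Ψ i)
      killed-* a h = ≈-trans (Λ-* a _) (≈-trans (*-congˡ h) (zeroʳ a))

      killed-resp : ∀ Ψ Θ → (∀ i → Ψ i ≈ Θ i) → Killed Θ → Killed Ψ
      killed-resp Ψ Θ h k = ≈-trans (Λ-cong {Ψ} {Θ} h) k

      killed-0 : Killed (λ _ → 0#)
      killed-0 = ≈-trans (Λ-cong λ i → ≈-sym (zeroˡ 0#)) (≈-trans (Λ-* 0# (λ _ → 0#)) (zeroˡ _))

      killed-· : ∀ a {Ψ} → Killed Ψ → Killed (λ i → a · Ψ i)
      killed-· zero    h = killed-0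
      killed-· (suc a) h = killed-+ h (killed-· a h)

      killed-monomial : ∀ {y α} → y ∈ T → Vec.sum α < suc n → Killed (point y λ i → monomial i α)
      killed-monomial {y} {α} y∈ α< = All.lookup (proj₂ (proj₂ K))
        (∈.∈-cartesianProductWith⁺ (λ y α j → expand (newton (A j)) (point y λ i → monomial i α) (Vec.replicate _ 0))
          y∈ (∈-simplex (suc n) α α<))

      killed-dot : ∀ {n₀} (us : Vec ℕ n₀) (vs : Vec ℕ (suc n) → Vec ℕ n₀) (G : Vec ℕ (suc n) → Poly) →
        (∀ l → Killed (λ i → Vec.lookup (vs i) l · G i)) → Killed (λ i → dot us (vs i) · G i)
      killed-dot [] vs G h = killed-resp (λ i → dot [] (vs i) · G i) _ (λ i → dot[] (vs i) (G i)) killed-0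
        where
        dot[] : ∀ (v : Vec ℕ 0) g → dot [] v · g ≈ 0#
        dot[] [] g = ≈-refl
      killed-dot (u ∷ us) vs G h = killed-resp (λ i → dot (u ∷ us) (vs i) · G i)
        (λ i → u · Vec.lookup (vs i) zero · G i + dot us (Vec.tail (vs i)) · G i)
        (λ i → ≈-trans (split (vs i) (G i)) (+-congʳ (reflexive (cong (λ a → u · a · G i) (head≡ (vs i))))))
        (killed-+ {λ i → u · Vec.lookup (vs i) zero · G i} (killed-· u (h zero))
          (killed-dot us (Vec.tail ∘ vs) G λ l → killed-resp (λ i → Vec.lookup (Vec.tail (vs i)) l · G i)
            (λ i → Vec.lookup (vs i) (suc l) · G i)
            (λ i → reflexive (cong (_· G i) (tail≡ (vs i) l))) (h (suc l))))
        where
        split : ∀ v g → dot (u ∷ us) v · g ≈ u · Vec.head v · g + dot us (Vec.tail v) · g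
        split (v ∷ vs) g = ≈-trans (×-homo-+ g (u ℕ.* v) (dot us vs))
          (+-congʳ (≈-sym (×-assocˡ g u v)))
        head≡ : ∀ {n} (v : Vec ℕ (suc n)) → Vec.head v ≡ Vec.lookup v zero
        head≡ (v ∷ vs) = refl
        tail≡ : ∀ {n} (v : Vec ℕ (suc n)) l → Vec.lookup (Vec.tail v) l ≡ Vec.lookup v (suc l)
        tail≡ (v ∷ vs) l = refl

      -- (β+1) C(s,β+1) = s C(s,β) - β C(s,β), and multiplication by
      -- s = ⟨u,i⟩ raises the degree of a monomial by one.
      killed-binomial : ∀ u {y} → y ∈ T → ∀ β α → β ℕ.+ Vec.sum α < suc n →
        Killed (point y λ i → (dot u i C β) ℕ.* monomial i α)
      killed-binomial u {y} y∈ zero α α< = ≈-trans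
        (Λ-cong λ i → reflexive (cong (_· x^ (dot y i)) (ℕ.*-identityˡ (monomial i α))))
        (killed-monomial y∈ α<)
      killed-binomial u {y} y∈ (suc β) α α< = ·-torsionFree β _ (≈-trans (≈-sym (Λ-· (suc β) _)) (begin
        Λ (λ i → suc β · F (suc β) i)
          ≈⟨ ≈-trans (≈-sym (+-identityʳ _)) (+-congˡ (≈-sym (killed-· β (killed-binomial u y∈ β α (ℕ.<-trans (ℕ.n<1+n _) α<))))) ⟩
        Λ (λ i → suc β · F (suc β) i) + Λ (λ i → β · F β i)
          ≈⟨ Λ-+ _ _ ⟨
        Λ (λ i → suc β · F (suc β) i + β · F β i)
          ≈⟨ Λ-cong (λ i → identity (dot u i) (monomial i α) (x^ (dot y i))) ⟩
        Λ (λ i → dot u i · F β i)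
          ≈⟨ killed-dot u id (F β) (λ l → killed-resp (λ i → Vec.lookup i l · F β i) _ (λ i → raise i l)
               (killed-binomial u y∈ β (increment l α) (subst (λ d → β ℕ.+ d < suc n) (sym (sum-increment l α))
                 (subst (_< suc n) (sym (ℕ.+-suc β (Vec.sum α))) α<)))) ⟩
        0# ∎))
        where
        open SetoidReasoning setoid
        F : ℕ → Vec ℕ (suc n) → Poly
        F β = point y λ i → (dot u i C β) ℕ.* monomial i α
        Λ-· : ∀ a Ψ → Λ (λ i → a · Ψ i) ≈ a · Λ Ψ
        Λ-· zero    Ψ = killed-0
        Λ-· (suc a) Ψ = ≈-trans (Λ-+ Ψ _) (+-congˡ (Λ-· a Ψ))
        absorb : ∀ s β → suc β ℕ.* (s C suc β) ℕ.+ β ℕ.* (s C β) ≡ s ℕ.* (s C β)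
        absorb zero    zero    = refl
        absorb zero    (suc β) = cong₂ ℕ._+_ (ℕ.*-zeroʳ (suc (suc β))) (ℕ.*-zeroʳ (suc β))
        absorb (suc s) zero    = trans (ℕ.+-identityʳ _) (C-absorb s zero)
        absorb (suc s) (suc β) = trans (cong₂ ℕ._+_ (C-absorb s (suc β)) (C-absorb s β))
          (trans (sym (ℕ.*-distribˡ-+ (suc s) (s C suc β) (s C β)))
            (cong (suc s ℕ.*_) (trans (ℕ.+-comm (s C suc β) _) (nCk+nC[k+1]≡[n+1]C[k+1] s β))))
        identity : ∀ s a w → suc β · ((s C suc β) ℕ.* a) · w + β · ((s C β) ℕ.* a) · w ≈ s · ((s C β) ℕ.* a) · w
        identity s a w = ≈-trans (+-cong (×-assocˡ w (suc β) ((s C suc β) ℕ.* a)) (×-assocˡ w β ((s C β) ℕ.* a)))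
          (≈-trans (≈-sym (×-homo-+ w (suc β ℕ.* ((s C suc β) ℕ.* a)) (β ℕ.* ((s C β) ℕ.* a))))
          (≈-trans (reflexive (cong (_· w) (trans (lem (suc β) (s C suc β) β (s C β) a)
             (trans (cong (ℕ._* a) (absorb s β)) (ℕ.*-assoc s (s C β) a)))))
            (≈-sym (×-assocˡ w s ((s C β) ℕ.* a)))))
          where
          lem : ∀ b x c y a → b ℕ.* (x ℕ.* a) ℕ.+ c ℕ.* (y ℕ.* a) ≡ (b ℕ.* x ℕ.+ c ℕ.* y) ℕ.* a
          lem = ℕSolver.solve-∀
        raise : ∀ i l → Vec.lookup i l · F β i ≈ point y (λ i → (dot u i C β) ℕ.* monomial i (increment l α)) i
        raise i l = ≈-trans (×-assocˡ (x^ (dot y i)) (Vec.lookup i l) ((dot u i C β) ℕ.* monomial i α)) (reflexive (cong (_· x^ (dot y i))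
          (trans (lem (Vec.lookup i l) (dot u i C β) (monomial i α)) (cong ((dot u i C β) ℕ.*_) (sym (monomial-increment i α l))))))
          where
          lem : ∀ a b c → a ℕ.* (b ℕ.* c) ≡ b ℕ.* (a ℕ.* c)
          lem = ℕSolver.solve-∀

      -- The points on the line supply the exponentials at `times` with `β ≤ n`. `binomial-span`
      -- puts into their saturated span a function reducing to the binomial coefficient of index
      -- `level (A j)`; the factor from `base` reduces to 1.
      killed-line : ∀ j → ∃ λ ψ → Killed (λ i → x^ (dot (Hits.base (hits j)) i) * ψ (dot (1 ∷ Vec.tail (A j)) i))
        × ∀ s → ρ (ψ s) ≡ + (s C level (A j))
      killed-line j = proj₁ span , along (proj₁ (proj₂ span)) , proj₂ (proj₂ span)
        where
        open Hits (hits j)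
        u = 1 ∷ Vec.tail (A j)
        span = binomial-span times (suc n) unique times<q (level (A j)) enough
        along : ∀ {ψ} → Span (Node times (suc n)) ψ → Killed (λ i → x^ (dot base i) * ψ (dot u i))
        along (gen (t , β , t∈ , β< , refl)) = let (y , y∈ , y≡) = onLine t∈ in
          killed-resp (λ i → x^ (dot base i) * expPoly t β (dot u i)) _ (node y≡) (killed-binomial u y∈ β (Vec.replicate _ 0)
            (subst (_< suc n) (sym (trans (cong (β ℕ.+_) (sum-replicate-0 (suc n))) (ℕ.+-identityʳ β))) β<))
          where
          sum-replicate-0 : ∀ m → Vec.sum (Vec.replicate m 0) ≡ 0
          sum-replicate-0 zero    = refl
          sum-replicate-0 (suc m) = sum-replicate-0 m
          monomial-0 : ∀ {m} (i : Vec ℕ m) → monomial i (Vec.replicate _ 0) ≡ 1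
          monomial-0 []       = refl
          monomial-0 (i ∷ is) = trans (ℕ.*-identityˡ _) (monomial-0 is)
          node : ∀ {y} → y ≡q linePoint base t u → ∀ i → x^ (dot base i) * expPoly t β (dot u i)
               ≈ point y (λ i → (dot u i C β) ℕ.* monomial i (Vec.replicate _ 0)) i
          node {y} y≡ i = begin
            x^ (dot base i) * (b · x^ t ^ dot u i)   ≈⟨ ×-comm-* b (x^ (dot base i)) _ ⟩
            b · (x^ (dot base i) * x^ t ^ dot u i)   ≈⟨ ×-congʳ b (*-congˡ (x^-pow t (dot u i))) ⟩
            b · (x^ (dot base i) * x^ (t ℕ.* dot u i)) ≈⟨ ×-congʳ b (x^-homo (dot base i) _) ⟨
            b · x^ (dot base i ℕ.+ t ℕ.* dot u i)    ≡⟨ cong (λ e → b · x^ e) (sym (dot-linePoint base t u i)) ⟩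
            b · x^ (dot (linePoint base t u) i)      ≈⟨ ×-congʳ b (x^-dot-cong y≡ i) ⟨
            b · x^ (dot y i)                         ≡⟨ cong (_· x^ (dot y i)) (sym (trans (cong (b ℕ.*_) (monomial-0 i)) (ℕ.*-identityʳ b))) ⟩
            (b ℕ.* monomial i (Vec.replicate _ 0)) · x^ (dot y i) ∎
            where
            open SetoidReasoning setoid
            b = dot u i C β
        along (add x y)     = ≈-trans (Λ-cong λ i → distribˡ (x^ (dot base i)) _ _) (killed-+ (along x) (along y))
        along (scale a {ψ} x)   = ≈-trans (Λ-cong λ i → swap (x^ (dot base i)) a (ψ (dot u i))) (killed-* a (along x))
          where
          swap : ∀ x a y → x * (a * y) ≈ a * (x * y)
          swap = solve 3 (λ x a y → x :* (a :* y) := a :* (x :* y)) ≈-refl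
        -- `Λ` commutes with the scalar `a`, so `a` times the value of `Λ` is zero and `a` can be
        -- cancelled.
        along (sat {a} {ψ} nzd x) = nzd _ (≈-trans (≈-sym (Λ-* a _))
          (≈-trans (Λ-cong λ i → swap (x^ (dot base i)) a (ψ (dot u i))) (along x)))
          where
          swap : ∀ x a y → a * (x * y) ≈ x * (a * y)
          swap = solve 3 (λ x a y → a :* (x :* y) := x :* (a :* y)) ≈-refl
        along (resp h x)    = ≈-trans (Λ-cong λ i → *-congˡ (≈-sym (h (dot u i)))) (along x)

      unit? : ∀ j → Dec (Unit (c j))
      unit? j = ¬? (+ p ∣ᶻ? ρ (c j))

      size : Fin m → ℕ
      size j = Vec.sum (Vec.tail (A j))

      -- The leading index: among those with a coefficient prime to `π`, the least tail sum, and
      -- among these the least head. The test function is built from its line.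
      minimal = argmin unit? size (proj₁ (proj₂ K))

      Minimal : Fin m → Set
      Minimal j = Unit (c j) × size j ≡ size (proj₁ minimal)

      extremal = argmin {U = Minimal} (λ j → unit? j ×-dec (size j ℕ.≟ size (proj₁ minimal)))
        (Vec.head ∘ A) (proj₁ minimal , proj₁ (proj₂ minimal) , refl)

      ⋆ : Fin m
      ⋆ = proj₁ extremal

      e : ℕ
      e = level (A ⋆)

      u′ : Vec ℕ n
      u′ = Vec.tail (A ⋆)

      line = killed-line ⋆
      Ψ : Vec ℕ (suc n) → Poly
      Ψ i = x^ (dot (Hits.base (hits ⋆)) i) * proj₁ line (dot (1 ∷ u′) i)

      summand : Fin m → Poly
      summand j = expand (newton (A j)) Ψ (Vec.replicate _ 0) * c j

      coefficient : ∀ j → ρ (expand (newton (A j)) Ψ (Vec.replicate _ 0))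
                        ≡ act (specialise (1 ∷ u′) (newton (A j))) (binomialSequence e) 0
      coefficient j = trans (ρ-expand (1 ∷ u′) (newton (A j)) Ψ (binomialSequence e) value (Vec.replicate _ 0))
        (cong (act (specialise (1 ∷ u′) (newton (A j))) (binomialSequence e)) (dot-0 (1 ∷ u′)))
        where
        value : ∀ i → ρ (Ψ i) ≡ binomialSequence e (dot (1 ∷ u′) i)
        value i = trans (ρ-* (x^ _) _) (trans (cong₂ ℤ._*_ (ρ-term 1ℤ _) (proj₂ (proj₂ line) (dot (1 ∷ u′) i)))
          (ℤ.*-identityˡ _))

      head∷tail : ∀ {n} (v : Vec ℕ (suc n)) → v ≡ Vec.head v ∷ Vec.tail v
      head∷tail (_ ∷ _) = refl

      -- If the tail of `A j` exceeds `u′` somewhere, its operator vanishes along the line.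
      -- Otherwise minimality of the sum forces equal tails; the head is then larger, and the level
      -- of `A j` lies above `e`.
      others : ∀ j → j ≢ ⋆ → Unit (c j) →
               + p ∣ᶻ act (specialise (1 ∷ u′) (newton (A j))) (binomialSequence e) 0
      others j j≢⋆ uⱼ = cases (any? λ l → Vec.lookup u′ l ℕ.<? Vec.lookup (Vec.tail (A j)) l)
        where
        cases : Dec (∃ λ l → Vec.lookup u′ l < Vec.lookup (Vec.tail (A j)) l) →
                + p ∣ᶻ act (specialise (1 ∷ u′) (newton (A j))) (binomialSequence e) 0
        cases (yes (l , lt)) = subst (λ v → + p ∣ᶻ act (specialise (1 ∷ u′) (newton v)) (binomialSequence e) 0)
          (sym (head∷tail (A j))) (subst (+ p ∣ᶻ_) (sym (trans (at-zero) (act-zero (binomialSequence e) 0)))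
            (ℤ∣.divides 0ℤ refl))
          where
          at-zero = B.at (newton-zero u′ (Vec.tail (A j)) (Vec.head (A j)) l lt) e 0
        cases (no ¬lt) = lead-low (subst (λ v → Lead (level v) (proj₁ (newton-lead (Vec.head (A j)) u′)) (specialise (1 ∷ u′) (newton v))) (sym A≡)
            (proj₁ (proj₂ (newton-lead (Vec.head (A j)) u′)))) e e<
          where
          open NewtonOrder pp using (Lead)
          tail≡ : Vec.tail (A j) ≡ u′
          tail≡ = ≤∧sum≥⇒≡ _ _ (λ l → ℕ.≮⇒≥ λ lt → ¬lt (l , lt))
            (subst (_≤ size j) (sym (proj₂ (proj₁ (proj₂ extremal)))) (proj₂ (proj₂ minimal) j uⱼ))
          A≡ : A j ≡ Vec.head (A j) ∷ u′
          A≡ = trans (head∷tail (A j)) (cong (Vec.head (A j) ∷_) tail≡)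
          head≤ : Vec.head (A ⋆) ≤ Vec.head (A j)
          head≤ = proj₂ (proj₂ extremal) j (uⱼ , trans (cong Vec.sum tail≡) (proj₂ (proj₁ (proj₂ extremal))))
          head≢ : Vec.head (A ⋆) ≢ Vec.head (A j)
          head≢ h = j≢⋆ (A-injective j ⋆ (trans A≡ (trans (cong (_∷ u′) (sym h)) (sym (head∷tail (A ⋆))))))
          e< : e < level (A j)
          e< = subst₂ _<_ (cong level (sym (head∷tail (A ⋆)))) (cong level (sym A≡))
            (ℕ.+-monoˡ-< (Vec.sum (Vec.map (NewtonOrder.weight pp) u′)) (ℕ.≤∧≢⇒< head≤ head≢))

      p∣summand : ∀ j → j ≢ ⋆ → + p ∣ᶻ ρ (summand j)
      p∣summand j j≢⋆ = subst (+ p ∣ᶻ_) (sym (ρ-* _ (c j))) (cases (+ p ∣ᶻ? ρ (c j)))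
        where
        cases : Dec (+ p ∣ᶻ ρ (c j)) →
                + p ∣ᶻ ρ (expand (newton (A j)) Ψ (Vec.replicate _ 0)) ℤ.* ρ (c j)
        cases (yes h) = ℤ∣.∣n⇒∣m*n (ρ (expand (newton (A j)) Ψ (Vec.replicate _ 0))) h
        cases (no ¬h) = ℤ∣.∣m⇒∣m*n (ρ (c j)) (subst (+ p ∣ᶻ_) (sym (coefficient j)) (others j j≢⋆ ¬h))

      p∤⋆ : ¬ + p ∣ᶻ ρ (expand (newton (A ⋆)) Ψ (Vec.replicate _ 0))
      p∤⋆ h = proj₂ (proj₂ L) (subst (+ p ∣ᶻ_) (lem value (proj₁ L)) (ℤ∣.∣m∣n⇒∣m-n (subst (+ p ∣ᶻ_) (coefficient ⋆) h)
        (subst (λ v → + p ∣ᶻ act (specialise (1 ∷ u′) (newton v)) (binomialSequence (level v)) 0 ℤ.- proj₁ L)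
          (sym (head∷tail (A ⋆))) (lead-at (proj₁ (proj₂ L))))))
        where
        L = newton-lead (Vec.head (A ⋆)) u′
        value = act (specialise (1 ∷ u′) (newton (A ⋆))) (binomialSequence e) 0
        lem : ∀ a b → a ℤ.- (a ℤ.- b) ≡ b
        lem = ℤSolver.solve-∀

      p∣total : + p ∣ᶻ ρ (sum summand)
      p∣total = subst (+ p ∣ᶻ_) (trans (cong (λ z → ρ (sum summand) ℤ.- z) ρ-0) (ℤ.+-identityʳ _))
        (ρ-cong (proj₁ (proj₂ line)))

      -- The sum is zero in ℤ[ζ], so its `ρ` is divisible by `p`, as is that of every term but the
      -- one at `⋆`. There both the operator, of exact order `e`, and the coefficient are prime to
      -- `p`.
      absurd : ⊥
      absurd = conclude m refl
        where
        conclude : ∀ m′ → m ≡ m′ → ⊥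
        conclude zero    refl = case ⋆
          where
          case : Fin 0 → ⊥
          case ()
        conclude (suc m′) refl = case (euclidᶻ pp _ (ρ (c ⋆)) (subst (+ p ∣ᶻ_) (ρ-* _ (c ⋆)) p∣⋆))
          where
          rest = Vector.removeAt summand ⋆
          p∣rest : + p ∣ᶻ ρ (sum rest)
          p∣rest = p∣ρ-sum rest λ j → p∣summand (Fin.punchIn ⋆ j) (Fin.punchInᵢ≢i ⋆ j)
          p∣split : + p ∣ᶻ ρ (summand ⋆ + sum rest)
          p∣split = subst (+ p ∣ᶻ_) (lem (ρ (sum summand)) _)
            (ℤ∣.∣m∣n⇒∣m-n p∣total (ρ-cong (sum-remove {i = ⋆} summand)))
            where
            lem : ∀ a b → a ℤ.- (a ℤ.- b) ≡ b
            lem = ℤSolver.solve-∀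
          p∣⋆ : + p ∣ᶻ ρ (summand ⋆)
          p∣⋆ = ℤ∣.∣m+n∣n⇒∣m {+ p} {ρ (summand ⋆)} (subst (+ p ∣ᶻ_) (ρ-+ (summand ⋆) (sum rest)) p∣split) p∣rest
          case : + p ∣ᶻ ρ (expand (newton (A ⋆)) Ψ (Vec.replicate _ 0)) ⊎ + p ∣ᶻ ρ (c ⋆) → ⊥
          case (inj₁ h) = p∤⋆ h
          case (inj₂ h) = proj₁ (proj₁ (proj₂ extremal)) h

  independence : ∀ {n} (T : List (Vec ℕ (suc n))) {m} (A : Fin m → Vec ℕ (suc n)) →
    (∀ i j → A i ≡ A j → i ≡ j) → (∀ i → Hits T (A i)) →
    m ≤ length T ℕ.* length (simplex (suc n) (suc n))
  independence T A inj hits = ℕ.≮⇒≥ λ few → Contradiction.absurd T A inj hits few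

-- Sums over lists and counting

open import Data.Nat.Base using (_+_; _*_; _^_; _∸_; _!)

[a*b]^n≡a^n*b^n : ∀ n a b → (a * b) ^ n ≡ a ^ n * b ^ n
[a*b]^n≡a^n*b^n zero    a b = refl
[a*b]^n≡a^n*b^n (suc n) a b = trans (cong (λ z → a * b * z) ([a*b]^n≡a^n*b^n n a b)) (lem a b (a ^ n) (b ^ n))
  where
  lem : ∀ a b c d → a * b * (c * d) ≡ a * c * (b * d)
  lem = ℕSolver.solve-∀

∑ : ∀ {A : Set} → List A → (A → ℕ) → ℕ
∑ []       f = 0
∑ (x ∷ xs) f = f x + ∑ xs f

module _ {A : Set} where

  ∑-cong : ∀ (xs : List A) {f g} → (∀ {x} → x ∈ xs → f x ≡ g x) → ∑ xs f ≡ ∑ xs g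
  ∑-cong []       h = refl
  ∑-cong (x ∷ xs) h = cong₂ _+_ (h (here refl)) (∑-cong xs (h ∘ there))

  ∑-mono : ∀ (xs : List A) {f g} → (∀ {x} → x ∈ xs → f x ≤ g x) → ∑ xs f ≤ ∑ xs g
  ∑-mono []       h = z≤n
  ∑-mono (x ∷ xs) h = ℕ.+-mono-≤ (h (here refl)) (∑-mono xs (h ∘ there))

  ∑-+ : ∀ (xs : List A) f g → ∑ xs (λ x → f x + g x) ≡ ∑ xs f + ∑ xs g
  ∑-+ []       f g = refl
  ∑-+ (x ∷ xs) f g = trans (cong (λ z → f x + g x + z) (∑-+ xs f g)) (lem (f x) (g x) (∑ xs f) (∑ xs g))
    where
    lem : ∀ a b c d → a + b + (c + d) ≡ a + c + (b + d)
    lem = ℕSolver.solve-∀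

  ∑-* : ∀ c (xs : List A) f → c * ∑ xs f ≡ ∑ xs (λ x → c * f x)
  ∑-* c []       f = ℕ.*-zeroʳ c
  ∑-* c (x ∷ xs) f = trans (ℕ.*-distribˡ-+ c (f x) (∑ xs f)) (cong (λ z → c * f x + z) (∑-* c xs f))

  ∑-const : ∀ (xs : List A) c → ∑ xs (λ _ → c) ≡ length xs * c
  ∑-const []       c = refl
  ∑-const (x ∷ xs) c = cong (λ z → c + z) (∑-const xs c)

  ∑-++ : ∀ (xs ys : List A) f → ∑ (xs ++ ys) f ≡ ∑ xs f + ∑ ys f
  ∑-++ []       ys f = refl
  ∑-++ (x ∷ xs) ys f = trans (cong (λ z → f x + z) (∑-++ xs ys f)) (sym (ℕ.+-assoc (f x) (∑ xs f) (∑ ys f)))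

module _ {A : Set} where

  ∑-map : ∀ {B : Set} (g : B → A) xs (f : A → ℕ) → ∑ (List.map g xs) f ≡ ∑ xs (f ∘ g)
  ∑-map g []       f = refl
  ∑-map g (x ∷ xs) f = cong (λ z → f (g x) + z) (∑-map g xs f)

  ∑-swap : ∀ {B : Set} (xs : List A) (ys : List B) (f : A → B → ℕ) →
           ∑ xs (λ x → ∑ ys (f x)) ≡ ∑ ys (λ y → ∑ xs (λ x → f x y))
  ∑-swap []       ys f = sym (trans (∑-const ys 0) (ℕ.*-zeroʳ (length ys)))
  ∑-swap (x ∷ xs) ys f = trans (cong (λ z → ∑ ys (f x) + z) (∑-swap xs ys f))
    (sym (∑-+ ys (f x) (λ y → ∑ xs (λ x → f x y))))

∑-cartesianProduct : ∀ {A B : Set} (xs : List A) (ys : List B) (f : A × B → ℕ) →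
  ∑ (List.cartesianProduct xs ys) f ≡ ∑ xs (λ x → ∑ ys (λ y → f (x , y)))
∑-cartesianProduct []       ys f = refl
∑-cartesianProduct (x ∷ xs) ys f = trans (∑-++ (List.map (x ,_) ys) _ f)
  (cong₂ _+_ (∑-map (x ,_) ys f) (∑-cartesianProduct xs ys f))

[_]? : ∀ {P : Set} → Dec P → ℕ
[ d ]? = if does d then 1 else 0

[]?-yes : ∀ {P : Set} (d : Dec P) → P → [ d ]? ≡ 1
[]?-yes (yes _) _ = refl
[]?-yes (no ¬p) p = contradiction p ¬p

[]?-no : ∀ {P : Set} (d : Dec P) → ¬ P → [ d ]? ≡ 0
[]?-no (yes p) ¬p = contradiction p ¬p
[]?-no (no _)  _  = refl

[]?-cong : ∀ {P Q : Set} (d : Dec P) (d′ : Dec Q) → (P → Q) → (Q → P) → [ d ]? ≡ [ d′ ]?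
[]?-cong (yes p) d′ f g = sym ([]?-yes d′ (f p))
[]?-cong (no ¬p) d′ f g = sym ([]?-no d′ (¬p ∘ g))

[]?-mono : ∀ {P Q : Set} (d : Dec P) (d′ : Dec Q) → (P → Q) → [ d ]? ≤ [ d′ ]?
[]?-mono (yes p) d′ f = ℕ.≤-reflexive (sym ([]?-yes d′ (f p)))
[]?-mono (no ¬p) d′ f = z≤n

module _ {A : Set} {P : A → Set} (P? : ∀ x → Dec (P x)) where

  length-filter : ∀ xs → length (List.filter P? xs) ≡ ∑ xs (λ x → [ P? x ]?)
  length-filter []       = refl
  length-filter (x ∷ xs) with does (P? x)
  ... | true  = cong suc (length-filter xs)
  ... | false = length-filter xs

  ∑-filter : ∀ xs f → ∑ (List.filter P? xs) f ≡ ∑ xs (λ x → [ P? x ]? * f x)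
  ∑-filter []       f = refl
  ∑-filter (x ∷ xs) f with does (P? x)
  ... | true  = cong₂ _+_ (sym (ℕ.+-identityʳ (f x))) (∑-filter xs f)
  ... | false = ∑-filter xs f

∑-subset : ∀ {A : Set} {xs ys : List A} {f : A → ℕ} → Unique xs → (∀ {x} → x ∈ xs → x ∈ ys) → ∑ xs f ≤ ∑ ys f
∑-subset [] _ = z≤n
∑-subset {A} {x ∷ xs} {f = f} (x∉ ∷ uniq) sub with ∈.∈-∃++ (sub (here refl))
... | ys , zs , refl = begin
  f x + ∑ xs f              ≤⟨ ℕ.+-monoʳ-≤ (f x) (∑-subset uniq remove) ⟩
  f x + ∑ (ys ++ zs) f      ≡⟨ cong (λ z → f x + z) (∑-++ ys zs f) ⟩
  f x + (∑ ys f + ∑ zs f)   ≡⟨ lem (f x) (∑ ys f) (∑ zs f) ⟩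
  ∑ ys f + (f x + ∑ zs f)   ≡⟨ ∑-++ ys (x ∷ zs) f ⟨
  ∑ (ys ++ x ∷ zs) f        ∎
  where
  open ℕ.≤-Reasoning
  lem : ∀ a b c → a + (b + c) ≡ b + (a + c)
  lem = ℕSolver.solve-∀
  remove : ∀ {y} → y ∈ xs → y ∈ ys ++ zs
  remove {y} y∈ with ∈.∈-++⁻ ys (sub (there y∈))
  ... | inj₁ h           = ∈.∈-++⁺ˡ h
  ... | inj₂ (here refl) = contradiction refl (All.lookup x∉ y∈)
  ... | inj₂ (there h)   = ∈.∈-++⁺ʳ ys h

unique-length-≤ : ∀ {A : Set} {xs ys : List A} → Unique xs → (∀ {x} → x ∈ xs → x ∈ ys) → length xs ≤ length ys
unique-length-≤ {xs = xs} {ys} uniq sub = subst₂ _≤_ (ones xs) (ones ys) (∑-subset {f = λ _ → 1} uniq sub)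
  where
  ones : ∀ {A : Set} (xs : List A) → ∑ xs (λ _ → 1) ≡ length xs
  ones xs = trans (∑-const xs 1) (ℕ.*-identityʳ (length xs))

module _ {A : Set} (_≟_ : DecidableEquality A) where

  ∑-≟ : ∀ {xs} → Unique xs → ∀ {x} → x ∈ xs → ∑ xs (λ y → [ x ≟ y ]?) ≡ 1
  ∑-≟ {z ∷ xs} (z∉ ∷ uniq) {x} (here refl) = cong₂ _+_ ([]?-yes (x ≟ x) refl)
    (trans (∑-cong xs λ {y} y∈ → []?-no (x ≟ y) (All.lookup z∉ y∈)) (trans (∑-const xs 0) (ℕ.*-zeroʳ (length xs))))
  ∑-≟ {z ∷ xs} (z∉ ∷ uniq) {x} (there x∈) = cong₂ _+_ ([]?-no (x ≟ z) λ x≡z → All.lookup z∉ x∈ (sym x≡z))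
    (∑-≟ uniq x∈)

  module _ {B : Set} (f : B → A) where

    fibre : A → List B → List B
    fibre y = List.filter λ x → f x ≟ y

    ∑-fibres : ∀ {ys} → Unique ys → ∀ xs → (∀ {x} → x ∈ xs → f x ∈ ys) →
               ∑ ys (λ y → length (fibre y xs)) ≡ length xs
    ∑-fibres {ys} uniq xs f∈ = begin
      ∑ ys (λ y → length (fibre y xs))        ≡⟨ ∑-cong ys (λ {y} _ → length-filter (λ x → f x ≟ y) xs) ⟩
      ∑ ys (λ y → ∑ xs (λ x → [ f x ≟ y ]?))  ≡⟨ ∑-swap ys xs (λ y x → [ f x ≟ y ]?) ⟩
      ∑ xs (λ x → ∑ ys (λ y → [ f x ≟ y ]?))  ≡⟨ ∑-cong xs (λ x∈ → ∑-≟ uniq (f∈ x∈)) ⟩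
      ∑ xs (λ _ → 1)                          ≡⟨ trans (∑-const xs 1) (ℕ.*-identityʳ _) ⟩
      length xs                               ∎
      where open ≡-Reasoning

-- The simplex

simplex-sum : ∀ n D {α} → α ∈ simplex n D → Vec.sum α < D
simplex-sum zero    (suc D) (here refl) = s≤s z≤n
simplex-sum (suc n) (suc D) α∈ with ∈.∈-++⁻ (List.map (0 ∷_) (simplex n (suc D))) α∈
... | inj₁ h with ∈.∈-map⁻ (0 ∷_) h
...   | α , α∈ , refl = simplex-sum n (suc D) α∈
simplex-sum (suc n) (suc D) α∈ | inj₂ h with ∈.∈-map⁻ (increment zero) h
...   | (a ∷ α) , α∈ , refl = s≤s (simplex-sum (suc n) D α∈)

simplex-unique : ∀ n D → Unique (simplex n D)
simplex-unique n       zero    = AllPairs.[]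
simplex-unique zero    (suc D) = [] ∷ []
simplex-unique (suc n) (suc D) = Unique.++⁺
  (Unique.map⁺ (λ { refl → refl }) (simplex-unique n (suc D)))
  (Unique.map⁺ injective (simplex-unique (suc n) D))
  λ (h , h′) → disjoint (∈.∈-map⁻ (0 ∷_) h) (∈.∈-map⁻ (increment zero) h′)
  where
  injective : ∀ {α β : Vec ℕ (suc n)} → increment zero α ≡ increment zero β → α ≡ β
  injective {_ ∷ _} {_ ∷ _} refl = refl
  disjoint : ∀ {v} → (∃ λ α → α ∈ simplex n (suc D) × v ≡ 0 ∷ α) →
             ¬ (∃ λ β → β ∈ simplex (suc n) D × v ≡ increment zero β)
  disjoint (α , _ , refl) ((b ∷ β) , _ , ())

card : ℕ → ℕ → ℕ
card n D = length (simplex n D)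

rising : ℕ → ℕ → ℕ
rising D zero    = 1
rising D (suc n) = rising D n * (D + n)

rising-suc : ∀ D n → rising D (suc n) ≡ D * rising (suc D) n
rising-suc D zero    = trans (ℕ.+-identityʳ (D + 0)) (trans (ℕ.+-identityʳ D) (sym (ℕ.*-identityʳ D)))
rising-suc D (suc n) = trans (cong₂ _*_ (rising-suc D n) (ℕ.+-suc D n)) (ℕ.*-assoc D (rising (suc D) n) (suc (D + n)))

-- The count is the binomial coefficient `(D + n) C (suc n)`, here with its denominator cleared. The
-- two halves of the recursion for `simplex` give its Pascal rule.
card-rising : ∀ n D → suc n ! * card (suc n) D ≡ rising D (suc n)
card-rising n zero = trans (ℕ.*-zeroʳ (suc n !)) (sym (rising-suc 0 n))
card-rising n (suc D) = begin
  suc n ! * card (suc n) (suc D)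
    ≡⟨ cong (λ z → suc n ! * z) (trans (List.length-++ (List.map (0 ∷_) (simplex n (suc D))))
         (cong₂ _+_ (List.length-map (0 ∷_) (simplex n (suc D))) (List.length-map (increment zero) (simplex (suc n) D)))) ⟩
  suc n ! * (card n (suc D) + card (suc n) D)
    ≡⟨ lem (suc n) (n !) (card n (suc D)) (card (suc n) D) ⟩
  suc n * (n ! * card n (suc D)) + suc n ! * card (suc n) D
    ≡⟨ cong₂ (λ a b → suc n * a + b) (previous n) (trans (card-rising n D) (rising-suc D n)) ⟩
  suc n * rising (suc D) n + D * rising (suc D) n
    ≡⟨ lem′ n D (rising (suc D) n) ⟩
  rising (suc D) n * (suc D + n) ∎
  where
  open ≡-Reasoning
  previous : ∀ n → n ! * card n (suc D) ≡ rising (suc D) n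
  previous zero    = refl
  previous (suc n) = card-rising n (suc D)
  lem : ∀ a b c d → a * b * (c + d) ≡ a * (b * c) + a * b * d
  lem = ℕSolver.solve-∀
  lem′ : ∀ n D r → suc n * r + D * r ≡ r * (suc D + n)
  lem′ = ℕSolver.solve-∀

-- Each factor of the quotient of rising factorials satisfies
-- (D + i) / (n + i) ≥ D / (2 n).
card-≥ : ∀ n D → D ^ suc n * card (suc n) (suc n) ≤ (2 * suc n) ^ suc n * card (suc n) D
card-≥ n′ D = ℕ.*-cancelˡ-≤ (n !) {{ℕ.>-nonZero (ℕ.1≤n! n)}} (begin
  n ! * (D ^ n * card n n)        ≡⟨ lem (n !) (D ^ n) (card n n) ⟩
  D ^ n * (n ! * card n n)        ≡⟨ cong (λ z → D ^ n * z) (card-rising n′ n) ⟩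
  D ^ n * rising n n               ≤⟨ go n ℕ.≤-refl ⟩
  (2 * n) ^ n * rising D n         ≡⟨ cong (λ z → (2 * n) ^ n * z) (sym (card-rising n′ D)) ⟩
  (2 * n) ^ n * (n ! * card n D)  ≡⟨ lem (n !) ((2 * n) ^ n) (card n D) ⟨
  n ! * ((2 * n) ^ n * card n D)  ∎)
  where
  open ℕ.≤-Reasoning
  n = suc n′
  lem : ∀ a b c → a * (b * c) ≡ b * (a * c)
  lem = ℕSolver.solve-∀
  go : ∀ m → m ≤ n → D ^ m * rising n m ≤ (2 * n) ^ m * rising D m
  go zero    _   = ℕ.≤-refl
  go (suc m) m<n = begin
    D * D ^ m * (rising n m * (n + m))             ≡⟨ lem₁ D (D ^ m) (rising n m) (n + m) ⟩
    (D ^ m * rising n m) * (D * (n + m))           ≤⟨ ℕ.*-mono-≤ (go m (ℕ.<⇒≤ m<n)) factor ⟩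
    (2 * n) ^ m * rising D m * (2 * n * (D + m))   ≡⟨ lem₂ ((2 * n) ^ m) (rising D m) (2 * n) (D + m) ⟩
    2 * n * (2 * n) ^ m * (rising D m * (D + m))   ∎
    where
    lem₁ : ∀ a b c d → a * b * (c * d) ≡ (b * c) * (a * d)
    lem₁ = ℕSolver.solve-∀
    lem₂ : ∀ a b c d → a * b * (c * d) ≡ c * a * (b * d)
    lem₂ = ℕSolver.solve-∀
    factor : D * (n + m) ≤ 2 * n * (D + m)
    factor = begin
      D * (n + m)              ≤⟨ ℕ.*-monoʳ-≤ D (ℕ.+-monoʳ-≤ n (ℕ.<⇒≤ m<n)) ⟩
      D * (n + n)              ≤⟨ ℕ.m≤m+n (D * (n + n)) (2 * n * m) ⟩
      D * (n + n) + 2 * n * m  ≡⟨ lem₃ D n m ⟩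
      2 * n * (D + m)          ∎
      where
      lem₃ : ∀ D n m → D * (n + n) + 2 * n * m ≡ 2 * n * (D + m)
      lem₃ = ℕSolver.solve-∀

-- Kakeya systems and their products

record System : Set₁ where
  field
    Pt     : Set
    _≟_    : DecidableEquality Pt
    dirs   : List Pt
    -- Incident a u x : the point x lies on the line through a in direction u.
    Incident : Pt → Pt → Pt → Set

module _ (Y : System) where

  open System Y

  -- Some points of `S` on a line, not necessarily all: fibres and layers of a line over a product
  -- are again of this kind.
  record Collinear (S : List Pt) (u : Pt) (xs : List Pt) : Set where
    constructor collinear
    field
      unique : Unique xs
      inside : ∀ {x} → x ∈ xs → x ∈ S
      base   : Pt
      incident : ∀ {x} → x ∈ xs → Incident base u x

  -- The lower bound den Σᵤ |L_u ∩ S|ⁿ ≤ num |S| |directions|: a Kakeya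
  -- estimate whose richness may depend on the direction, which is what
  -- makes it stable under products.
  Estimate : ℕ → ℕ → ℕ → Set
  Estimate n num den = ∀ S (xs : Pt → List Pt) → (∀ {u} → u ∈ dirs → Collinear S u (xs u)) →
    den * ∑ dirs (λ u → length (xs u) ^ n) ≤ num * (length S * length dirs)

  -- Some a satisfies a · #{y : M y ≥ a} ≥ (d / h) Σ M.
  Pigeonhole : ℕ → ℕ → ℕ → Set
  Pigeonhole q h d = ∀ (ys : List Pt) (M : Pt → ℕ) → Unique ys → (∀ {y} → y ∈ ys → M y ≤ q) →
    ∃ λ a → a ≤ q × ∑ ys M * d ≤ a * ∑ ys (λ y → [ a ℕ.≤? M y ]?) * h

product : System → System → System
product X Y = record
  { Pt = X.Pt × Y.Pt
  ; _≟_ = λ (x , y) (x′ , y′) → map′ (λ (e , e′) → cong₂ _,_ e e′) (λ e → cong proj₁ e , cong proj₂ e)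
            ((x X.≟ x′) ×-dec (y Y.≟ y′))
  ; dirs = List.cartesianProduct X.dirs Y.dirs
  ; Incident = λ (a , b) (u , v) (x , y) → X.Incident a u x × Y.Incident b v y
  }
  where
  module X = System X
  module Y = System Y

point-system : System
point-system = record
  { Pt = ⊤ ; _≟_ = λ _ _ → yes refl ; dirs = tt ∷ [] ; Incident = λ _ _ _ → ⊤ }

-- The combinatorial input on the prime power side: directions are
-- covered uniformly by affine charts, in each of which the Newton
-- functionals are independent.
record Charted (X : System) (n q K : ℕ) : Set₁ where
  open System X
  field
    line-size   : ∀ {S u xs} → Collinear X S u xs → length xs ≤ q
    Chart       : Set
    charts      : List Chart
    charts≢[]   : 0 < length charts
    dir         : Chart → Vec ℕ n → Pt
    dir∈        : ∀ {γ} → γ ∈ charts → ∀ v → dir γ v ∈ dirs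
    uniform     : ∀ v (f : Pt → ℕ) →
      length dirs * ∑ charts (λ γ → f (dir γ v)) ≡ length charts * ∑ dirs f
    level       : Vec ℕ (suc n) → ℕ
    K≥1         : 1 ≤ K
    level≤      : ∀ j → Vec.sum j < suc n * q → level j ≤ K * Vec.sum j
    independent : ∀ {γ} → γ ∈ charts → ∀ (T : List Pt) (A : List (Vec ℕ (suc n))) → Unique A →
      (∀ {j} → j ∈ A → ∃ λ xs → Collinear X T (dir γ (Vec.tail j)) xs × level j < length xs * suc n) →
      length A ≤ length T * card (suc n) (suc n)

-- The estimate for a product

module Product {X Y : System} {n q K : ℕ} (charted : Charted X n q K)
  {h d : ℕ} (pigeonhole : Pigeonhole Y q h d)
  {num den : ℕ} (estimate : Estimate Y (suc n) num den) where

  private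
    module X = System X
    module Y = System Y
    open Charted charted
    N : ℕ
    N = suc n

    c : ℕ
    c = card N N

    slice : List (X.Pt × Y.Pt) → Y.Pt → List X.Pt
    slice xs y = List.map proj₁ (fibre Y._≟_ proj₂ y xs)

    length-slice : ∀ xs y → length (slice xs y) ≡ length (fibre Y._≟_ proj₂ y xs)
    length-slice xs y = List.length-map proj₁ (fibre Y._≟_ proj₂ y xs)

    ∈-slice⁺ : ∀ {xs x y} → (x , y) ∈ xs → x ∈ slice xs y
    ∈-slice⁺ {xs} {x} {y} h = ∈.∈-map⁺ proj₁ (∈.∈-filter⁺ (λ z → proj₂ z Y.≟ y) h refl)

    ∈-slice⁻ : ∀ {xs x y} → x ∈ slice xs y → (x , y) ∈ xs
    ∈-slice⁻ {xs} {x} {y} h with ∈.∈-map⁻ proj₁ h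
    ... | (x , y′) , h′ , refl with ∈.∈-filter⁻ (λ z → proj₂ z Y.≟ y) {xs = xs} h′
    ...   | h″ , refl = h″

    slice-unique : ∀ {xs} y → Unique xs → Unique (slice xs y)
    slice-unique {xs} y uniq = go (fibre Y._≟_ proj₂ y xs) (Unique.filter⁺ (λ z → proj₂ z Y.≟ y) uniq)
      (λ z∈ → proj₂ (∈.∈-filter⁻ (λ z → proj₂ z Y.≟ y) {xs = xs} z∈))
      where
      go : ∀ zs → Unique zs → (∀ {z} → z ∈ zs → proj₂ z ≡ y) → Unique (List.map proj₁ zs)
      go []       _          _ = AllPairs.[]
      go (z ∷ zs) (z∉ ∷ uniq) e = All.tabulate fresh AllPairs.∷ go zs uniq (e ∘ there)
        where
        fresh : ∀ {x} → x ∈ List.map proj₁ zs → proj₁ z ≢ x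
        fresh x∈ with ∈.∈-map⁻ proj₁ x∈
        ... | z′ , z′∈ , refl = λ e₁ → All.lookup z∉ z′∈ (cong₂ _,_ e₁ (trans (e (here refl)) (sym (e (there z′∈)))))

    values : List (X.Pt × Y.Pt) → List Y.Pt
    values xs = List.deduplicate Y._≟_ (List.map proj₂ xs)

    values-unique : ∀ xs → Unique (values xs)
    values-unique xs = UniqueDec.deduplicate-! Y._≟_ (List.map proj₂ xs)

    ∈-values⁺ : ∀ {xs z} → z ∈ xs → proj₂ z ∈ values xs
    ∈-values⁺ h = ∈.∈-deduplicate⁺ Y._≟_ (∈.∈-map⁺ proj₂ h)

    ∈-values⁻ : ∀ {xs y} → y ∈ values xs → ∃ λ x → (x , y) ∈ xs
    ∈-values⁻ {xs} h with ∈.∈-map⁻ proj₂ (∈.∈-deduplicate⁻ Y._≟_ (List.map proj₂ xs) h)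
    ... | (x , y) , h′ , refl = x , h′

    ∑-slices : ∀ xs → ∑ (values xs) (λ y → length (slice xs y)) ≡ length xs
    ∑-slices xs = trans (∑-cong (values xs) λ {y} _ → length-slice xs y)
      (∑-fibres Y._≟_ proj₂ (values-unique xs) xs ∈-values⁺)

    -- The points of `Y` over which the line is long enough for the hypothesis of `independent`, for
    -- an index of level `L`.
    rich : List (X.Pt × Y.Pt) → ℕ → List Y.Pt
    rich xs L = List.filter (λ y → L ℕ.<? length (slice xs y) * N) (values xs)

    -- Large enough to contain the indices needed for any `a ≤ q`, and within the range of `level≤`.
    J : List (Vec ℕ N)
    J = simplex N (N * q)

    -- `N a / K` rounded up: a coordinate sum below it forces a level below `N a`.
    ceiling : ℕ → ℕ
    ceiling a = (N * a + (K ∸ 1)) / K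
      where instance _ = ℕ.>-nonZero K≥1

    N*a≤ceiling : ∀ a → N * a ≤ ceiling a * K
    N*a≤ceiling a = ℕ.+-cancelʳ-≤ (K ∸ 1) (N * a) (ceiling a * K) (begin
      m                     ≡⟨ ℕ.m≡m%n+[m/n]*n m K ⟩
      m % K + m / K * K     ≤⟨ ℕ.+-monoˡ-≤ (m / K * K) (ℕ.∸-monoˡ-≤ 1 (ℕ.m%n<n m K)) ⟩
      K ∸ 1 + m / K * K     ≡⟨ ℕ.+-comm (K ∸ 1) (m / K * K) ⟩
      m / K * K + (K ∸ 1)   ∎)
      where
      open ℕ.≤-Reasoning
      instance _ = ℕ.>-nonZero K≥1
      m = N * a + (K ∸ 1)

    <ceiling : ∀ a {s} → s < ceiling a → K * s < N * a
    <ceiling a {s} s< = ℕ.+-cancelʳ-< (K ∸ 1) (K * s) (N * a) (begin-strict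
      K * s + (K ∸ 1)     <⟨ ℕ.+-monoʳ-< (K * s) (ℕ.≤-reflexive (ℕ.suc-pred K)) ⟩
      K * s + K           ≡⟨ trans (ℕ.+-comm (K * s) K) (trans (sym (ℕ.*-suc K s)) (ℕ.*-comm K (suc s))) ⟩
      suc s * K           ≤⟨ ℕ.*-monoˡ-≤ K s< ⟩
      m / K * K           ≤⟨ ℕ.m/n*n≤m m K ⟩
      N * a + (K ∸ 1)     ∎)
      where
      open ℕ.≤-Reasoning
      instance _ = ℕ.>-nonZero K≥1
      m = N * a + (K ∸ 1)

    low-level : ∀ {a} → a ≤ q → ∀ {j} → j ∈ simplex N (ceiling a) → j ∈ J × level j < N * a
    low-level {a} a≤q {j} j∈ = ∈-simplex (N * q) j sum<Nq , ℕ.≤-<-trans (level≤ j sum<Nq) K*sum<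
      where
      instance _ = ℕ.>-nonZero K≥1
      K*sum< = <ceiling a (simplex-sum N (ceiling a) j∈)
      sum<Nq = ℕ.≤-<-trans (ℕ.m≤n*m (Vec.sum j) K) (ℕ.<-≤-trans K*sum< (ℕ.*-monoʳ-≤ N a≤q))

    -- A lower bound for the number of indices served by a fibre of `a` points. The `N` in `N a / K`
    -- cancels the one in `card-≥`, leaving `2 K`.
    card-ceiling : ∀ a → a ^ N * c ≤ (2 * K) ^ N * card N (ceiling a)
    card-ceiling a = ℕ.*-cancelˡ-≤ (N ^ N) {{ℕ.m^n≢0 N N}} (begin
      N ^ N * (a ^ N * c)                        ≡⟨ sym (ℕ.*-assoc (N ^ N) (a ^ N) c) ⟩
      N ^ N * a ^ N * c                          ≡⟨ cong (_* c) (sym ([a*b]^n≡a^n*b^n N N a)) ⟩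
      (N * a) ^ N * c                            ≤⟨ ℕ.*-monoˡ-≤ c (ℕ.^-monoˡ-≤ N (N*a≤ceiling a)) ⟩
      (ceiling a * K) ^ N * c                    ≡⟨ cong (_* c) ([a*b]^n≡a^n*b^n N (ceiling a) K) ⟩
      ceiling a ^ N * K ^ N * c                  ≡⟨ lem₁ (ceiling a ^ N) (K ^ N) c ⟩
      K ^ N * (ceiling a ^ N * c)                ≤⟨ ℕ.*-monoʳ-≤ (K ^ N) (card-≥ n (ceiling a)) ⟩
      K ^ N * ((2 * N) ^ N * D)                  ≡⟨ cong (λ z → K ^ N * (z * D)) ([a*b]^n≡a^n*b^n N 2 N) ⟩
      K ^ N * (2 ^ N * N ^ N * D)                ≡⟨ lem₂ (K ^ N) (2 ^ N) (N ^ N) D ⟩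
      N ^ N * (2 ^ N * K ^ N * D)                ≡⟨ cong (λ z → N ^ N * (z * D)) (sym ([a*b]^n≡a^n*b^n N 2 K)) ⟩
      N ^ N * ((2 * K) ^ N * D)                  ∎)
      where
      open ℕ.≤-Reasoning
      D = card N (ceiling a)
      lem₁ : ∀ a b c → a * b * c ≡ b * (a * c)
      lem₁ = ℕSolver.solve-∀
      lem₂ : ∀ a b c d → a * (b * c * d) ≡ c * (b * a * d)
      lem₂ = ℕSolver.solve-∀

    -- The layers {M ≥ a} of the multiplicity M of a line over Y.
    layer-estimate : ∀ xs → (∀ y → length (slice xs y) ≤ q) →
      c * (length xs * d) ^ N ≤ (2 * K * h) ^ N * ∑ J (λ j → length (rich xs (level j)) ^ N)
    layer-estimate xs M≤q = begin
      c * (length xs * d) ^ N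
        ≡⟨ cong (λ z → c * (z * d) ^ N) (sym (∑-slices xs)) ⟩
      c * (∑ ys M * d) ^ N
        ≤⟨ ℕ.*-monoʳ-≤ c (ℕ.^-monoˡ-≤ N large) ⟩
      c * (a * ν * h) ^ N
        ≡⟨ cong (λ z → c * z) (trans ([a*b]^n≡a^n*b^n N (a * ν) h) (cong (_* h ^ N) ([a*b]^n≡a^n*b^n N a ν))) ⟩
      c * (a ^ N * ν ^ N * h ^ N)
        ≡⟨ lem₁ c (a ^ N) (ν ^ N) (h ^ N) ⟩
      a ^ N * c * (ν ^ N * h ^ N)
        ≤⟨ ℕ.*-monoˡ-≤ (ν ^ N * h ^ N) (card-ceiling a) ⟩
      (2 * K) ^ N * card N (ceiling a) * (ν ^ N * h ^ N)
        ≡⟨ lem₂ ((2 * K) ^ N) (card N (ceiling a)) (ν ^ N) (h ^ N) ⟩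
      (2 * K) ^ N * h ^ N * (card N (ceiling a) * ν ^ N)
        ≡⟨ cong₂ _*_ (sym ([a*b]^n≡a^n*b^n N (2 * K) h)) (sym (∑-const (simplex N (ceiling a)) (ν ^ N))) ⟩
      (2 * K * h) ^ N * ∑ (simplex N (ceiling a)) (λ _ → ν ^ N)
        ≤⟨ ℕ.*-monoʳ-≤ ((2 * K * h) ^ N) (∑-mono (simplex N (ceiling a)) λ j∈ →
             ℕ.^-monoˡ-≤ N (ν≤rich (proj₂ (low-level a≤q j∈)))) ⟩
      (2 * K * h) ^ N * ∑ (simplex N (ceiling a)) (λ j → length (rich xs (level j)) ^ N)
        ≤⟨ ℕ.*-monoʳ-≤ ((2 * K * h) ^ N) (∑-subset (simplex-unique N (ceiling a)) (proj₁ ∘ low-level a≤q)) ⟩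
      (2 * K * h) ^ N * ∑ J (λ j → length (rich xs (level j)) ^ N) ∎
      where
      open ℕ.≤-Reasoning
      ys = values xs
      M : Y.Pt → ℕ
      M y = length (slice xs y)
      P = pigeonhole ys M (values-unique xs) λ {y} _ → M≤q y
      a = proj₁ P
      a≤q = proj₁ (proj₂ P)
      ν = ∑ ys (λ y → [ a ℕ.≤? M y ]?)
      large = proj₂ (proj₂ P)
      ν≤rich : ∀ {L} → L < N * a → ν ≤ length (rich xs L)
      ν≤rich {L} L< = begin
        ν
          ≤⟨ ∑-mono ys (λ {y} _ → indicator y) ⟩
        ∑ ys (λ y → [ L ℕ.<? M y * N ]?)
          ≡⟨ length-filter (λ y → L ℕ.<? M y * N) ys ⟨
        length (rich xs L) ∎
        where
        indicator : ∀ y → [ a ℕ.≤? M y ]? ≤ [ L ℕ.<? M y * N ]?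
        indicator y = []?-mono (a ℕ.≤? M y) (L ℕ.<? M y * N) λ a≤ →
          ℕ.<-≤-trans L< (subst (N * a ≤_) (ℕ.*-comm N (M y)) (ℕ.*-monoʳ-≤ N a≤))
      lem₁ : ∀ a b c d → a * (b * c * d) ≡ b * a * (c * d)
      lem₁ = ℕSolver.solve-∀
      lem₂ : ∀ a b c d → a * b * (c * d) ≡ a * d * (b * c)
      lem₂ = ℕSolver.solve-∀

  module _ (S : List (X.Pt × Y.Pt)) (xs : X.Pt × Y.Pt → List (X.Pt × Y.Pt))
    (xs-collinear : ∀ {u} → u ∈ List.cartesianProduct X.dirs Y.dirs → Collinear (product X Y) S u (xs u)) where

    private
      slice-collinear : ∀ {w u} → w ∈ X.dirs → u ∈ Y.dirs → ∀ y → Collinear X (slice S y) w (slice (xs (w , u)) y)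
      slice-collinear w∈ u∈ y = collinear (slice-unique y unique) (∈-slice⁺ ∘ inside ∘ ∈-slice⁻)
        (proj₁ base) (proj₁ ∘ incident ∘ ∈-slice⁻)
        where open Collinear (xs-collinear (∈.∈-cartesianProduct⁺ w∈ u∈))

      F : Vec ℕ N → Y.Pt → X.Pt → ℕ
      F j u w = length (rich (xs (w , u)) (level j)) ^ N

      -- The points of Y over which the functional (γ , j) is available.
      active : Chart → Vec ℕ N → List Y.Pt
      active γ j = List.deduplicate Y._≟_
        (List.concatMap (λ u → rich (xs (dir γ (Vec.tail j) , u)) (level j)) Y.dirs)

      active⁺ : ∀ {γ j u y} → u ∈ Y.dirs → y ∈ rich (xs (dir γ (Vec.tail j) , u)) (level j) → y ∈ active γ j
      active⁺ {γ} {j} u∈ y∈ = ∈.∈-deduplicate⁺ Y._≟_ (∈.∈-concatMap⁺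
        (λ u → rich (xs (dir γ (Vec.tail j) , u)) (level j)) (Any.map (λ { refl → y∈ }) u∈))

      active⁻ : ∀ {γ j y} → y ∈ active γ j → ∃ λ u → u ∈ Y.dirs × y ∈ rich (xs (dir γ (Vec.tail j) , u)) (level j)
      active⁻ {γ} {j} y∈ = find (∈.∈-concatMap⁻ (λ u → rich (xs (dir γ (Vec.tail j) , u)) (level j))
        (∈.∈-deduplicate⁻ Y._≟_ _ y∈))

      rich⁻ : ∀ {xs L y} → y ∈ rich xs L → y ∈ values xs × L < length (slice xs y) * N
      rich⁻ {xs} {L} = ∈.∈-filter⁻ (λ y → L ℕ.<? length (slice xs y) * N) {xs = values xs}

      ∈?active : ∀ γ j y → Dec (y ∈ active γ j)
      ∈?active γ j y = Any.any? (y Y.≟_) (active γ j)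

      active-⊆ : ∀ {γ} → γ ∈ charts → ∀ {j y} → y ∈ active γ j → y ∈ values S
      active-⊆ γ∈ {j} y∈ =
        let (u , u∈ , y∈) = active⁻ y∈
            (x , x∈) = ∈-values⁻ (proj₁ (rich⁻ y∈))
        in ∈-values⁺ (Collinear.inside (xs-collinear (∈.∈-cartesianProduct⁺ (dir∈ γ∈ (Vec.tail j)) u∈)) x∈)

      -- Counted over each `y` separately: the indices active over `y` have rich lines in the slice
      -- of `S` over `y`, so `independent` bounds their number.
      chart-bound : ∀ {γ} → γ ∈ charts → ∑ J (λ j → length (active γ j)) ≤ length S * c
      chart-bound {γ} γ∈ = begin
        ∑ J (λ j → length (active γ j))
          ≤⟨ ∑-mono J (λ {j} _ → length-active j) ⟩
        ∑ J (λ j → ∑ Ys (λ y → [ ∈?active γ j y ]?))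
          ≡⟨ ∑-swap J Ys (λ j y → [ ∈?active γ j y ]?) ⟩
        ∑ Ys (λ y → ∑ J (λ j → [ ∈?active γ j y ]?))
          ≤⟨ ∑-mono Ys (λ {y} _ → fibre-bound y) ⟩
        ∑ Ys (λ y → length (slice S y) * c)
          ≡⟨ ∑-cong Ys (λ {y} _ → ℕ.*-comm (length (slice S y)) c) ⟩
        ∑ Ys (λ y → c * length (slice S y))
          ≡⟨ ∑-* c Ys (λ y → length (slice S y)) ⟨
        c * ∑ Ys (λ y → length (slice S y))
          ≡⟨ trans (cong (λ z → c * z) (∑-slices S)) (ℕ.*-comm c (length S)) ⟩
        length S * c ∎
        where
        open ℕ.≤-Reasoning
        Ys = values S
        length-active : ∀ j → length (active γ j) ≤ ∑ Ys (λ y → [ ∈?active γ j y ]?)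
        length-active j = subst (length (active γ j) ≤_) (length-filter (∈?active γ j) Ys)
          (unique-length-≤ (UniqueDec.deduplicate-! Y._≟_ _)
            λ y∈ → ∈.∈-filter⁺ (∈?active γ j) (active-⊆ γ∈ y∈) y∈)
        fibre-bound : ∀ y → ∑ J (λ j → [ ∈?active γ j y ]?) ≤ length (slice S y) * c
        fibre-bound y = subst (_≤ length (slice S y) * c) (length-filter (λ j → ∈?active γ j y) J)
          (independent γ∈ (slice S y) (List.filter (λ j → ∈?active γ j y) J)
            (Unique.filter⁺ (λ j → ∈?active γ j y) (simplex-unique N (N * q)))
            λ {j} j∈ → let (u , u∈ , y∈) = active⁻ (proj₂ (∈.∈-filter⁻ (λ j → ∈?active γ j y) {xs = J} j∈)) in
              slice (xs (dir γ (Vec.tail j) , u)) y , slice-collinear (dir∈ γ∈ (Vec.tail j)) u∈ y , proj₂ (rich⁻ {xs (dir γ (Vec.tail j) , u)} y∈))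

      -- In a chart the index fixes the direction in `X`; what varies is the direction in `Y`, and
      -- the estimate on `Y` applies to the set of active points.
      fibre-estimate : ∀ {γ} → γ ∈ charts → ∀ j →
        den * ∑ Y.dirs (λ u → F j u (dir γ (Vec.tail j))) ≤ num * (length (active γ j) * length Y.dirs)
      fibre-estimate {γ} γ∈ j = estimate (active γ j) (λ u → rich (xs (dir γ (Vec.tail j) , u)) (level j)) good
        where
        good : ∀ {u} → u ∈ Y.dirs → Collinear Y (active γ j) u (rich (xs (dir γ (Vec.tail j) , u)) (level j))
        good {u} u∈ = collinear
          (Unique.filter⁺ (λ y → level j ℕ.<? length (slice (xs (dir γ (Vec.tail j) , u)) y) * N)
            (values-unique (xs (dir γ (Vec.tail j) , u)))) (active⁺ {γ} {j} u∈) (proj₂ base)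
          λ y∈ → proj₂ (incident (proj₂ (∈-values⁻ (proj₁ (rich⁻ {xs (dir γ (Vec.tail j) , u)} y∈)))))
          where open Collinear (xs-collinear (∈.∈-cartesianProduct⁺ (dir∈ γ∈ (Vec.tail j)) u∈))

      total : ℕ
      total = ∑ X.dirs λ w → ∑ Y.dirs λ u → ∑ J λ j → F j u w

      -- For each `j` separately, the sum over all directions of `X` becomes an average over charts
      -- of the one direction that `j` prescribes.
      charted-total : length charts * total ≡ length X.dirs * ∑ charts (λ γ → ∑ J λ j → ∑ Y.dirs λ u → F j u (dir γ (Vec.tail j)))
      charted-total = begin
        length charts * total
          ≡⟨ cong (λ z → length charts * z) (trans (∑-swap X.dirs Y.dirs (λ w u → ∑ J λ j → F j u w))
               (∑-cong Y.dirs λ {u} _ → ∑-swap X.dirs J (λ w j → F j u w))) ⟩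
        length charts * ∑ Y.dirs (λ u → ∑ J λ j → ∑ X.dirs (F j u))
          ≡⟨ trans (∑-* (length charts) Y.dirs _) (∑-cong Y.dirs λ {u} _ → ∑-* (length charts) J _) ⟩
        ∑ Y.dirs (λ u → ∑ J λ j → length charts * ∑ X.dirs (F j u))
          ≡⟨ ∑-cong Y.dirs (λ {u} _ → ∑-cong J λ {j} _ → sym (uniform (Vec.tail j) (F j u))) ⟩
        ∑ Y.dirs (λ u → ∑ J λ j → length X.dirs * ∑ charts (λ γ → F j u (dir γ (Vec.tail j))))
          ≡⟨ sym (trans (∑-* (length X.dirs) Y.dirs _) (∑-cong Y.dirs λ {u} _ → ∑-* (length X.dirs) J _)) ⟩
        length X.dirs * ∑ Y.dirs (λ u → ∑ J λ j → ∑ charts (λ γ → F j u (dir γ (Vec.tail j))))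
          ≡⟨ cong (λ z → length X.dirs * z) (trans (∑-cong Y.dirs λ {u} _ → ∑-swap J charts (λ j γ → F j u (dir γ (Vec.tail j))))
               (trans (∑-swap Y.dirs charts (λ u γ → ∑ J λ j → F j u (dir γ (Vec.tail j))))
                 (∑-cong charts λ {γ} _ → ∑-swap Y.dirs J (λ u j → F j u (dir γ (Vec.tail j)))))) ⟩
        length X.dirs * ∑ charts (λ γ → ∑ J λ j → ∑ Y.dirs λ u → F j u (dir γ (Vec.tail j))) ∎
        where open ≡-Reasoning

      den*total≤ : den * total ≤ num * (length S * c * (length X.dirs * length Y.dirs))
      den*total≤ = ℕ.*-cancelˡ-≤ (length charts) {{ℕ.>-nonZero charts≢[]}} (begin
        length charts * (den * total)
          ≡⟨ lem₁ (length charts) den total ⟩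
        den * (length charts * total)
          ≡⟨ cong (λ z → den * z) charted-total ⟩
        den * (length X.dirs * ∑ charts G)
          ≡⟨ lem₁ den (length X.dirs) _ ⟩
        length X.dirs * (den * ∑ charts G)
          ≡⟨ cong (λ z → length X.dirs * z) (trans (∑-* den charts G) (∑-cong charts λ _ → ∑-* den J _)) ⟩
        length X.dirs * ∑ charts (λ γ → ∑ J λ j → den * ∑ Y.dirs λ u → F j u (dir γ (Vec.tail j)))
          ≤⟨ ℕ.*-monoʳ-≤ (length X.dirs) (∑-mono charts λ γ∈ → ∑-mono J λ {j} _ → fibre-estimate γ∈ j) ⟩
        length X.dirs * ∑ charts (λ γ → ∑ J λ j → num * (length (active γ j) * length Y.dirs))
          ≡⟨ cong (λ z → length X.dirs * z) (∑-cong charts λ {γ} _ → trans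
               (∑-cong J λ {j} _ → lem₂ num (length (active γ j)) (length Y.dirs))
               (sym (∑-* (num * length Y.dirs) J (λ j → length (active γ j))))) ⟩
        length X.dirs * ∑ charts (λ γ → num * length Y.dirs * ∑ J λ j → length (active γ j))
          ≤⟨ ℕ.*-monoʳ-≤ (length X.dirs) (∑-mono charts λ γ∈ → ℕ.*-monoʳ-≤ (num * length Y.dirs) (chart-bound γ∈)) ⟩
        length X.dirs * ∑ charts (λ _ → num * length Y.dirs * (length S * c))
          ≡⟨ cong (λ z → length X.dirs * z) (∑-const charts _) ⟩
        length X.dirs * (length charts * (num * length Y.dirs * (length S * c)))
          ≡⟨ lem₃ (length X.dirs) (length charts) num (length Y.dirs) (length S * c) ⟩
        length charts * (num * (length S * c * (length X.dirs * length Y.dirs))) ∎)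
        where
        open ℕ.≤-Reasoning
        G = λ γ → ∑ J λ j → ∑ Y.dirs λ u → F j u (dir γ (Vec.tail j))
        lem₁ : ∀ a b c → a * (b * c) ≡ b * (a * c)
        lem₁ = ℕSolver.solve-∀
        lem₂ : ∀ a b c → a * (b * c) ≡ a * c * b
        lem₂ = ℕSolver.solve-∀
        lem₃ : ∀ a b c d e → a * (b * (c * d * e)) ≡ b * (c * (e * (a * d)))
        lem₃ = ℕSolver.solve-∀

    -- `layer-estimate` bounds each line by its layers and `den*total≤` bounds all layers together.
    -- Both carry the factor `c`, which cancels.
    product-bound : den * d ^ N * ∑ (List.cartesianProduct X.dirs Y.dirs) (λ u → length (xs u) ^ N)
                  ≤ num * (2 * K * h) ^ N * (length S * length (List.cartesianProduct X.dirs Y.dirs))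
    product-bound = ℕ.*-cancelˡ-≤ c {{ℕ.>-nonZero c>0}} (begin
      c * (den * d ^ N * ∑ dirs′ (λ u → length (xs u) ^ N))
        ≡⟨ trans (lem₁ c den (d ^ N) _) (cong (λ z → den * z) (trans (∑-* (c * d ^ N) dirs′ _)
             (∑-cartesianProduct X.dirs Y.dirs _))) ⟩
      den * ∑ X.dirs (λ w → ∑ Y.dirs λ u → c * d ^ N * length (xs (w , u)) ^ N)
        ≤⟨ ℕ.*-monoʳ-≤ den (∑-mono X.dirs λ w∈ → ∑-mono Y.dirs λ u∈ → line-estimate w∈ u∈) ⟩
      den * ∑ X.dirs (λ w → ∑ Y.dirs λ u → (2 * K * h) ^ N * ∑ J (λ j → F j u w))
        ≡⟨ cong (λ z → den * z) (sym (trans (∑-* ((2 * K * h) ^ N) X.dirs _) (∑-cong X.dirs λ _ → ∑-* ((2 * K * h) ^ N) Y.dirs _))) ⟩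
      den * ((2 * K * h) ^ N * total)
        ≡⟨ lem₂ den ((2 * K * h) ^ N) total ⟩
      (2 * K * h) ^ N * (den * total)
        ≤⟨ ℕ.*-monoʳ-≤ ((2 * K * h) ^ N) den*total≤ ⟩
      (2 * K * h) ^ N * (num * (length S * c * (length X.dirs * length Y.dirs)))
        ≡⟨ lem₃ ((2 * K * h) ^ N) num (length S) c (length X.dirs * length Y.dirs) ⟩
      c * (num * (2 * K * h) ^ N * (length S * (length X.dirs * length Y.dirs)))
        ≡⟨ cong (λ l → c * (num * (2 * K * h) ^ N * (length S * l))) (sym (length-cartesianProductWith _,_ X.dirs Y.dirs)) ⟩
      c * (num * (2 * K * h) ^ N * (length S * length dirs′)) ∎)
      where
      open ℕ.≤-Reasoning
      dirs′ = List.cartesianProduct X.dirs Y.dirs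
      c>0 : 0 < c
      c>0 = ∈.∈-length (∈-simplex N (Vec.replicate N 0) (subst (_< N) (sym (sum-0 N)) (s≤s z≤n)))
        where
        sum-0 : ∀ m → Vec.sum (Vec.replicate m 0) ≡ 0
        sum-0 zero    = refl
        sum-0 (suc m) = sum-0 m
      line-estimate : ∀ {w u} → w ∈ X.dirs → u ∈ Y.dirs →
        c * d ^ N * length (xs (w , u)) ^ N ≤ (2 * K * h) ^ N * ∑ J (λ j → F j u w)
      line-estimate {w} {u} w∈ u∈ = subst (_≤ (2 * K * h) ^ N * ∑ J (λ j → F j u w))
        (trans (cong (λ z → c * z) ([a*b]^n≡a^n*b^n N (length (xs (w , u))) d)) (lem c (length (xs (w , u)) ^ N) (d ^ N)))
        (layer-estimate (xs (w , u)) λ y → line-size (slice-collinear w∈ u∈ y))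
        where
        lem : ∀ a b c → a * (b * c) ≡ a * c * b
        lem = ℕSolver.solve-∀
      lem₁ : ∀ a b c d → a * (b * c * d) ≡ b * (a * c * d)
      lem₁ = ℕSolver.solve-∀
      lem₂ : ∀ a b c → a * (b * c) ≡ b * (a * c)
      lem₂ = ℕSolver.solve-∀
      lem₃ : ∀ a b c d e → a * (b * (c * d * e)) ≡ d * (b * a * (c * e))
      lem₃ = ℕSolver.solve-∀

  product-estimate : Estimate (product X Y) (suc n) (num * (2 * K * h) ^ suc n) (den * d ^ suc n)
  product-estimate = product-bound

-- Arithmetic modulo q

module Mod (q : ℕ) .{{_ : NonZero q}} where

  infix 4 _≡ₘ_
  record _≡ₘ_ (a b : ℕ) : Set where
    constructor mk≡
    field remainder : a % q ≡ b % q
  open _≡ₘ_ public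

  ≡ₘ-refl : ∀ {a} → a ≡ₘ a
  ≡ₘ-refl = mk≡ refl

  ≡ₘ-reflexive : ∀ {a b} → a ≡ b → a ≡ₘ b
  ≡ₘ-reflexive refl = mk≡ refl

  ≡ₘ-sym : ∀ {a b} → a ≡ₘ b → b ≡ₘ a
  ≡ₘ-sym (mk≡ h) = mk≡ (sym h)

  ≡ₘ-trans : ∀ {a b c} → a ≡ₘ b → b ≡ₘ c → a ≡ₘ c
  ≡ₘ-trans (mk≡ h) (mk≡ h′) = mk≡ (trans h h′)

  modSetoid : Setoid _ _
  modSetoid = record
    { Carrier = ℕ ; _≈_ = _≡ₘ_
    ; isEquivalence = record { refl = ≡ₘ-refl ; sym = ≡ₘ-sym ; trans = ≡ₘ-trans } }

  +-congₘ : ∀ {a a′ b b′} → a ≡ₘ a′ → b ≡ₘ b′ → a + b ≡ₘ a′ + b′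
  +-congₘ {a} {a′} {b} {b′} (mk≡ h) (mk≡ h′) = mk≡ (trans (ℕ.%-distribˡ-+ a b q)
    (trans (cong₂ (λ x y → (x + y) % q) h h′) (sym (ℕ.%-distribˡ-+ a′ b′ q))))

  *-congₘ : ∀ {a a′ b b′} → a ≡ₘ a′ → b ≡ₘ b′ → a * b ≡ₘ a′ * b′
  *-congₘ {a} {a′} {b} {b′} (mk≡ h) (mk≡ h′) = mk≡ (trans (ℕ.%-distribˡ-* a b q)
    (trans (cong₂ (λ x y → (x * y) % q) h h′) (sym (ℕ.%-distribˡ-* a′ b′ q))))

  +q*≡ₘ : ∀ a b → a + q * b ≡ₘ a
  +q*≡ₘ a b = mk≡ (trans (cong (λ z → (a + z) % q) (ℕ.*-comm q b)) (ℕ.[m+kn]%n≡m%n a b q))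

  -- q - 1 represents -1.
  minusOne : ℕ
  minusOne = ℕ.pred q

  a+b-b≡ₘa : ∀ a b → a + (b + minusOne * b) ≡ₘ a
  a+b-b≡ₘa a b = ≡ₘ-trans (≡ₘ-reflexive (cong (λ z → a + z * b) (ℕ.suc-pred q))) (+q*≡ₘ a b)

  +-cancelₘ : ∀ {a b} c → a + c ≡ₘ b + c → a ≡ₘ b
  +-cancelₘ {a} {b} c h = ≡ₘ-trans (≡ₘ-sym (a+b-b≡ₘa a c)) (≡ₘ-trans
    (≡ₘ-reflexive (sym (ℕ.+-assoc a c _))) (≡ₘ-trans (+-congₘ h (≡ₘ-refl {minusOne * c}))
    (≡ₘ-trans (≡ₘ-reflexive (ℕ.+-assoc b c _)) (a+b-b≡ₘa b c))))

  toℕ-mod : ∀ a → toℕ (a mod q) ≡ₘ a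
  toℕ-mod a = mk≡ (trans (cong (_% q) (Fin.toℕ-fromℕ< (ℕ.m%n<n a q))) (ℕ.m%n%n≡m%n a q))

  Fin-≡ₘ : ∀ {i j : Fin q} → toℕ i ≡ₘ toℕ j → i ≡ j
  Fin-≡ₘ {i} {j} (mk≡ h) = Fin.toℕ-injective (trans (sym (ℕ.m<n⇒m%n≡m (Fin.toℕ<n i)))
    (trans h (ℕ.m<n⇒m%n≡m (Fin.toℕ<n j))))

  mod-cong : ∀ {a b} → a ≡ₘ b → a mod q ≡ b mod q
  mod-cong {a} {b} h = Fin-≡ₘ (≡ₘ-trans (toℕ-mod a) (≡ₘ-trans h (≡ₘ-sym (toℕ-mod b))))

  mod-toℕ : ∀ (i : Fin q) → toℕ i mod q ≡ i
  mod-toℕ i = Fin-≡ₘ (toℕ-mod (toℕ i))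

  _≟ₘ_ : ∀ a b → Dec (a ≡ₘ b)
  a ≟ₘ b = map′ mk≡ remainder (a % q ℕ.≟ b % q)

  ∣-≡ₘ : ∀ {p a b} → p ∣ q → a ≡ₘ b → p ∣ a → p ∣ b
  ∣-≡ₘ {p} {a} {b} p∣q (mk≡ h) p∣a = subst (p ∣_) (sym (ℕ.m≡m%n+[m/n]*n b q))
    (ℕ.∣m∣n⇒∣m+n (subst (p ∣_) h p∣a%q) (ℕ.∣n⇒∣m*n (b / q) p∣q))
    where
    p∣a%q : p ∣ a % q
    p∣a%q = ℕ.∣m+n∣m⇒∣n (subst (p ∣_) (trans (ℕ.m≡m%n+[m/n]*n a q) (ℕ.+-comm (a % q) _)) p∣a) (ℕ.∣n⇒∣m*n (a / q) p∣q)

  inverse : ∀ a → Coprime a q → ∃ λ b → a * b ≡ₘ 1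
  inverse a cop with Coprime.coprime-Bézout cop
  ... | Bézout.+- x y eq = x , ≡ₘ-trans (≡ₘ-reflexive (trans (ℕ.*-comm a x) (trans (sym eq)
      (cong (λ z → 1 + z) (ℕ.*-comm y q))))) (+q*≡ₘ 1 y)
  ... | Bézout.-+ x y eq = minusOne * x , +-cancelₘ (a * x) (≡ₘ-trans
      (≡ₘ-reflexive (trans (lem a x minusOne) (cong (_* (a * x)) (ℕ.suc-pred q))))
      (≡ₘ-trans (+q*≡ₘ 0 (a * x)) (≡ₘ-sym (≡ₘ-trans
        (≡ₘ-reflexive (trans (cong (λ z → 1 + z) (ℕ.*-comm a x)) (trans eq (ℕ.*-comm y q)))) (+q*≡ₘ 0 y)))))
    where
    lem : ∀ a x m → a * (m * x) + a * x ≡ suc m * (a * x)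
    lem = ℕSolver.solve-∀

-- Vectors over ℤ/qℤ

allVec : ∀ {A : Set} → List A → ∀ n → List (Vec A n)
allVec xs zero    = [] ∷ []
allVec xs (suc n) = List.cartesianProductWith _∷_ xs (allVec xs n)

∈-allVec : ∀ {A : Set} {xs : List A} → (∀ x → x ∈ xs) → ∀ {n} (v : Vec A n) → v ∈ allVec xs n
∈-allVec all []      = here refl
∈-allVec all (x ∷ v) = ∈.∈-cartesianProductWith⁺ _∷_ (all x) (∈-allVec all v)

allVec-unique : ∀ {A : Set} {xs : List A} → Unique xs → ∀ n → Unique (allVec xs n)
allVec-unique uniq zero    = [] ∷ []
allVec-unique uniq (suc n) = Unique.cartesianProductWith⁺ _∷_ (λ { refl → refl , refl }) uniq (allVec-unique uniq n)

length-allVec : ∀ {A : Set} (xs : List A) n → length (allVec xs n) ≡ length xs ^ n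
length-allVec xs zero    = refl
length-allVec xs (suc n) = trans (length-cartesianProductWith _∷_ xs (allVec xs n))
  (cong (λ z → length xs * z) (length-allVec xs n))

∑-allVec : ∀ {A : Set} (xs : List A) n (f : Vec A (suc n) → ℕ) →
  ∑ (allVec xs (suc n)) f ≡ ∑ xs (λ x → ∑ (allVec xs n) (λ v → f (x ∷ v)))
∑-allVec xs n f = go xs
  where
  go : ∀ ys → ∑ (List.cartesianProductWith _∷_ ys (allVec xs n)) f ≡ ∑ ys (λ x → ∑ (allVec xs n) (λ v → f (x ∷ v)))
  go []       = refl
  go (y ∷ ys) = trans (∑-++ (List.map (y ∷_) (allVec xs n)) _ f) (cong₂ _+_ (∑-map (y ∷_) (allVec xs n) f) (go ys))

∑-bijection : ∀ {A : Set} {xs : List A} → Unique xs → (∀ x → x ∈ xs) → (σ τ : A → A) →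
  (∀ x → σ (τ x) ≡ x) → (∀ x → τ (σ x) ≡ x) → ∀ f → ∑ xs (f ∘ σ) ≡ ∑ xs f
∑-bijection {xs = xs} uniq all σ τ στ τσ f = trans (sym (∑-map σ xs f)) (ℕ.≤-antisym
  (∑-subset (Unique.map⁺ (λ {x} {y} e → trans (sym (τσ x)) (trans (cong τ e) (τσ y))) uniq) (λ {x} _ → all x))
  (∑-subset uniq (λ {x} _ → subst (_∈ List.map σ xs) (στ x) (∈.∈-map⁺ σ (all (τ x))))))

dot-insertAt : ∀ {n} (u : Vec ℕ (suc n)) v l x →
  dot u (Vec.insertAt v l x) ≡ Vec.lookup u l * x + dot (Vec.removeAt u l) v
dot-insertAt (u ∷ us)     v       zero    x = refl
dot-insertAt (u ∷ u′ ∷ us) (v ∷ vs) (suc l) x = trans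
  (cong (λ z → u * v + z) (dot-insertAt (u′ ∷ us) vs l x))
  (lem (u * v) (Vec.lookup (u′ ∷ us) l * x) (dot (Vec.removeAt (u′ ∷ us) l) vs))
  where
  lem : ∀ a b c → a + (b + c) ≡ b + (a + c)
  lem = ℕSolver.solve-∀

-- Charts of projective space over ℤ/pᵏ⁺¹ℤ

dot-comm : ∀ {n} (u v : Vec ℕ n) → dot u v ≡ dot v u
dot-comm []       []       = refl
dot-comm (u ∷ us) (v ∷ vs) = cong₂ _+_ (ℕ.*-comm u v) (dot-comm us vs)

∣-dot : ∀ {n p} (u v : Vec ℕ n) → (∀ i → p ∣ Vec.lookup u i) → p ∣ dot u v
∣-dot []       []       _ = _ ℕ.∣0
∣-dot (u ∷ us) (v ∷ vs) h = ℕ.∣m∣n⇒∣m+n (ℕ.∣m⇒∣m*n v (h zero)) (∣-dot us vs (h ∘ suc))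

removeAt-pointwise : ∀ {R : ℕ → ℕ → Set} {n} {u v : Vec ℕ (suc n)} i →
  Pointwise R u v → Pointwise R (Vec.removeAt u i) (Vec.removeAt v i)
removeAt-pointwise zero    (_ ∷ rs)           = rs
removeAt-pointwise (suc i) (r ∷ rs@(_ ∷ _)) = r ∷ removeAt-pointwise i rs

removeAt-zipWith : ∀ (f : ℕ → ℕ → ℕ) {n} (u v : Vec ℕ (suc n)) i →
  Vec.removeAt (Vec.zipWith f u v) i ≡ Vec.zipWith f (Vec.removeAt u i) (Vec.removeAt v i)
removeAt-zipWith f (_ ∷ _)         (_ ∷ _)         zero    = refl
removeAt-zipWith f (u ∷ us@(_ ∷ _)) (v ∷ vs@(_ ∷ _)) (suc i) = cong (f u v ∷_) (removeAt-zipWith f us vs i)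

coprime-^ : ∀ {p} → Prime p → ∀ {a} → ¬ p ∣ a → ∀ k → Coprime a (p ^ k)
coprime-^ pp {a} p∤a zero    (_ , d∣1) = ℕ.∣1⇒≡1 d∣1
coprime-^ {p} pp {a} p∤a (suc k) {d} (d∣a , d∣) = coprime-^ pp p∤a k (d∣a ,
  Coprime.coprime-divisor {d} {p} (prime∤⇒coprime pp d λ p∣d → p∤a (ℕ.∣-trans p∣d d∣a)) d∣)

module PrimePower {p : ℕ} (pp : Prime p) (k : ℕ) where

  private
    instance
      p≢0 : NonZero p
      p≢0 = prime⇒nonZero pp

  q : ℕ
  q = p ^ suc k

  instance
    q≢0 : NonZero q
    q≢0 = ℕ.m^n≢0 p (suc k)

  open Mod q public

  private
    p>1 : 1 < p
    p>1 = ℕ.nonTrivial⇒n>1 p {{prime⇒nonTrivial pp}}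

    p∣q : p ∣ q
    p∣q = ℕ.m∣m*n (p ^ k)

  p∤1 : ∀ {a} → a ≡ₘ 1 → ¬ p ∣ a
  p∤1 a≡1 p∣a = ℕ.>⇒∤ p>1 (∣-≡ₘ p∣q a≡1 p∣a)

  ι : ∀ {m} → Vec (Fin q) m → Vec ℕ m
  ι = Vec.map toℕ

  HasUnit : ∀ {m} → Vec (Fin q) m → Set
  HasUnit = VecAny.Any (λ c → ¬ p ∣ toℕ c)

  hasUnit? : ∀ {m} (w : Vec (Fin q) m) → Dec (HasUnit w)
  hasUnit? = VecAny.any? λ c → ¬? (p ℕ.∣? toℕ c)

  inverse-unit : ∀ {a} → ¬ p ∣ a → ∃ λ b → a * b ≡ₘ 1
  inverse-unit p∤a = inverse _ (coprime-^ pp p∤a (suc k))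

  vectors : ∀ m → List (Vec (Fin q) m)
  vectors = allVec (List.allFin q)

  ∈-vectors : ∀ {m} (v : Vec (Fin q) m) → v ∈ vectors m
  ∈-vectors = ∈-allVec ∈.∈-allFin

  vectors-unique : ∀ m → Unique (vectors m)
  vectors-unique = allVec-unique (Unique.allFin⁺ q)

  length-vectors : ∀ m → length (vectors m) ≡ q ^ m
  length-vectors m = trans (length-allVec (List.allFin q) m) (cong (_^ m) (List.length-tabulate {n = q} id))

  private
    open SetoidReasoning modSetoid

    one-solution : ∀ {w : Fin q} → ¬ p ∣ toℕ w → ∀ s c →
      ∑ (List.allFin q) (λ u → [ (toℕ u * toℕ w + s) ≟ₘ c ]?) ≡ 1
    one-solution {w} p∤w s c = trans
      (∑-cong (List.allFin q) λ {u} _ → []?-cong ((toℕ u * toℕ w + s) ≟ₘ c) (x₀ Fin.≟ u) (λ h → Fin-≡ₘ (unique u h)) solves)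
      (∑-≟ Fin._≟_ (Unique.allFin⁺ q) (∈.∈-allFin x₀))
      where
      b = proj₁ (inverse-unit p∤w)
      wb≡1 = proj₂ (inverse-unit p∤w)
      x₀ : Fin q
      x₀ = (b * (c + minusOne * s)) mod q
      unique : ∀ u → toℕ u * toℕ w + s ≡ₘ c → toℕ x₀ ≡ₘ toℕ u
      unique u h = begin
        toℕ x₀                                    ≈⟨ toℕ-mod _ ⟩
        b * (c + minusOne * s)                    ≈⟨ *-congₘ (≡ₘ-refl {b}) (+-congₘ (≡ₘ-sym h) (≡ₘ-refl {minusOne * s})) ⟩
        b * (toℕ u * toℕ w + s + minusOne * s)    ≡⟨ cong (λ z → b * z) (ℕ.+-assoc (toℕ u * toℕ w) s _) ⟩
        b * (toℕ u * toℕ w + (s + minusOne * s))  ≈⟨ *-congₘ (≡ₘ-refl {b}) (a+b-b≡ₘa (toℕ u * toℕ w) s) ⟩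
        b * (toℕ u * toℕ w)                       ≡⟨ lem b (toℕ u) (toℕ w) ⟩
        toℕ u * (toℕ w * b)                       ≈⟨ *-congₘ (≡ₘ-refl {toℕ u}) wb≡1 ⟩
        toℕ u * 1                                 ≡⟨ ℕ.*-identityʳ _ ⟩
        toℕ u                                     ∎
        where
        lem : ∀ a b c → a * (b * c) ≡ b * (c * a)
        lem = ℕSolver.solve-∀
      solves : ∀ {u} → x₀ ≡ u → toℕ u * toℕ w + s ≡ₘ c
      solves refl = begin
        toℕ x₀ * toℕ w + s                        ≈⟨ +-congₘ (*-congₘ (toℕ-mod _) (≡ₘ-refl {toℕ w})) (≡ₘ-refl {s}) ⟩
        b * (c + minusOne * s) * toℕ w + s        ≡⟨ lem b (c + minusOne * s) (toℕ w) s ⟩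
        toℕ w * b * (c + minusOne * s) + s        ≈⟨ +-congₘ (*-congₘ wb≡1 (≡ₘ-refl {c + minusOne * s})) (≡ₘ-refl {s}) ⟩
        1 * (c + minusOne * s) + s                ≡⟨ lem′ c minusOne s ⟩
        c + (s + minusOne * s)                    ≈⟨ a+b-b≡ₘa c s ⟩
        c                                         ∎
        where
        lem : ∀ a b c d → a * b * c + d ≡ c * a * b + d
        lem = ℕSolver.solve-∀
        lem′ : ∀ c m s → 1 * (c + m * s) + s ≡ c + (s + m * s)
        lem′ = ℕSolver.solve-∀

  -- The coordinate of `u` facing a unit coordinate of `w` is determined by the others, which are
  -- free.
  solutions : ∀ {m} {w : Vec (Fin q) (suc m)} → HasUnit w → ∀ s c →
    ∑ (vectors (suc m)) (λ u → [ (dot (ι u) (ι w) + s) ≟ₘ c ]?) ≡ q ^ m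
  solutions {m} {w ∷ ws} (VecAny.here p∤w) s c = P.begin
    ∑ (vectors (suc m)) (λ u → [ (dot (ι u) (ι (w ∷ ws)) + s) ≟ₘ c ]?)
      P.≡⟨ ∑-allVec (List.allFin q) m _ ⟩
    ∑ (List.allFin q) (λ u → ∑ (vectors m) (λ us → [ (toℕ u * toℕ w + dot (ι us) (ι ws) + s) ≟ₘ c ]?))
      P.≡⟨ ∑-swap (List.allFin q) (vectors m) (λ u us → [ (toℕ u * toℕ w + dot (ι us) (ι ws) + s) ≟ₘ c ]?) ⟩
    ∑ (vectors m) (λ us → ∑ (List.allFin q) (λ u → [ (toℕ u * toℕ w + dot (ι us) (ι ws) + s) ≟ₘ c ]?))
      P.≡⟨ ∑-cong (vectors m) (λ {us} _ → trans
             (∑-cong (List.allFin q) λ {u} _ → cong (λ z → [ z ≟ₘ c ]?) (ℕ.+-assoc (toℕ u * toℕ w) (dot (ι us) (ι ws)) s))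
             (one-solution p∤w (dot (ι us) (ι ws) + s) c)) ⟩
    ∑ (vectors m) (λ _ → 1)
      P.≡⟨ trans (∑-const (vectors m) 1) (trans (ℕ.*-identityʳ _) (length-vectors m)) ⟩
    q ^ m P.∎
    where module P = ≡-Reasoning
  solutions {suc m} {w ∷ ws} (VecAny.there h) s c = P.begin
    ∑ (vectors (suc (suc m))) (λ u → [ (dot (ι u) (ι (w ∷ ws)) + s) ≟ₘ c ]?)
      P.≡⟨ ∑-allVec (List.allFin q) (suc m) _ ⟩
    ∑ (List.allFin q) (λ u → ∑ (vectors (suc m)) (λ us → [ (toℕ u * toℕ w + dot (ι us) (ι ws) + s) ≟ₘ c ]?))
      P.≡⟨ ∑-cong (List.allFin q) (λ {u} _ → trans
             (∑-cong (vectors (suc m)) λ {us} _ → cong (λ z → [ z ≟ₘ c ]?) (lem (toℕ u * toℕ w) (dot (ι us) (ι ws)) s))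
             (solutions h (toℕ u * toℕ w + s) c)) ⟩
    ∑ (List.allFin q) (λ _ → q ^ m)
      P.≡⟨ trans (∑-const (List.allFin q) (q ^ m)) (cong (_* q ^ m) (List.length-tabulate {n = q} id)) ⟩
    q ^ suc m P.∎
    where
    module P = ≡-Reasoning
    lem : ∀ a b c → a + b + c ≡ b + (a + c)
    lem = ℕSolver.solve-∀

  infix 4 _≋_
  _≋_ : ∀ {m} → Vec ℕ m → Vec ℕ m → Set
  _≋_ = Pointwise _≡ₘ_

  dot-congₘ : ∀ {m} (u : Vec ℕ m) {v w} → v ≋ w → dot u v ≡ₘ dot u w
  dot-congₘ []       []       = ≡ₘ-refl
  dot-congₘ (u ∷ us) (h ∷ hs) = +-congₘ (*-congₘ (≡ₘ-refl {u}) h) (dot-congₘ us hs)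

  shift : ∀ {m} → Vec (Fin q) m → Vec ℕ m → Vec (Fin q) m
  shift = Vec.zipWith λ w b → (toℕ w + b) mod q

  ι-shift : ∀ {m} (w : Vec (Fin q) m) b → ι (shift w b) ≋ addV (ι w) b
  ι-shift []       []       = []
  ι-shift (w ∷ ws) (b ∷ bs) = toℕ-mod (toℕ w + b) ∷ ι-shift ws bs

  shift-inverse : ∀ {m} (b c : Vec ℕ m) → (∀ a → ∀ i → a + Vec.lookup b i + Vec.lookup c i ≡ₘ a) →
    ∀ w → shift (shift w b) c ≡ w
  shift-inverse []       []       h []       = refl
  shift-inverse (b ∷ bs) (c ∷ cs) h (w ∷ ws) = cong₂ _∷_
    (trans (mod-cong (≡ₘ-trans (+-congₘ (toℕ-mod (toℕ w + b)) (≡ₘ-refl {c})) (h (toℕ w) zero))) (mod-toℕ w))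
    (shift-inverse bs cs (λ a i → h a (suc i)) ws)

  ∑-shift : ∀ {m} (b : Vec ℕ m) (f : Vec (Fin q) m → ℕ) → ∑ (vectors m) (λ w → f (shift w b)) ≡ ∑ (vectors m) f
  ∑-shift {m} b = ∑-bijection (vectors-unique m) ∈-vectors (λ w → shift w b) (λ w → shift w c)
    (shift-inverse c b λ a i → ≡ₘ-trans (≡ₘ-reflexive (lem a (Vec.lookup c i) (Vec.lookup b i))) (cancel a i))
    (shift-inverse b c λ a i → ≡ₘ-trans (≡ₘ-reflexive (ℕ.+-assoc a _ _)) (cancel a i))
    where
    c : Vec ℕ m
    c = Vec.map (minusOne *_) b
    cancel : ∀ a i → a + (Vec.lookup b i + Vec.lookup c i) ≡ₘ a
    cancel a i = ≡ₘ-trans (≡ₘ-reflexive (cong (λ z → a + (Vec.lookup b i + z)) (Vec.lookup-map i (minusOne *_) b)))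
      (a+b-b≡ₘa a (Vec.lookup b i))
    lem : ∀ a x y → a + x + y ≡ a + (y + x)
    lem = ℕSolver.solve-∀

  module Charts (n : ℕ) where

    N : ℕ
    N = suc n

    V : Set
    V = Vec (Fin q) N

    system : System
    system = record
      { Pt = V ; _≟_ = Vec.≡-dec Fin._≟_
      ; dirs = List.filter hasUnit? (vectors N)
      ; Incident = OnLine }

    open System system using (dirs)

    infix 7 _∙_
    _∙_ : V → V → ℕ
    l ∙ w = dot (ι l) (ι w)

    -- A linear form `l` and an origin `w` of the affine hyperplane `l = 1`; `charts` keeps the
    -- pairs for which `w` lies on it. The directions seen are `w` plus the kernel of `l`.
    Chart : Set
    Chart = V × V

    normalised? : (γ : Chart) → Dec (proj₁ γ ∙ proj₂ γ ≡ₘ 1)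
    normalised? (l , w) = (l ∙ w) ≟ₘ 1

    charts : List Chart
    charts = List.filter normalised? (List.cartesianProduct (vectors N) (vectors N))

    Pivot : V → Set
    Pivot l = ∃ λ i → ¬ p ∣ toℕ (Vec.lookup l i)

    pivot? : ∀ l → Dec (Pivot l)
    pivot? l = any? λ i → ¬? (p ℕ.∣? toℕ (Vec.lookup l i))

    -- The vector orthogonal to l with coordinates v outside the pivot.
    offset : ∀ l → Dec (Pivot l) → Vec ℕ n → Vec ℕ N
    offset l (yes (i , p∤)) v =
      Vec.insertAt v i (proj₁ (inverse-unit p∤) * (minusOne * dot (Vec.removeAt (ι l) i) v))
    offset l (no _) v = Vec.replicate N 0

    offset-orthogonal : ∀ l (d : Dec (Pivot l)) v → dot (ι l) (offset l d v) ≡ₘ 0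
    offset-orthogonal l (no _) v = ≡ₘ-reflexive (dot-0 (ι l))
    offset-orthogonal l (yes (i , p∤)) v = begin
      dot (ι l) (Vec.insertAt v i (b * (minusOne * r)))
        ≡⟨ dot-insertAt (ι l) v i _ ⟩
      Vec.lookup (ι l) i * (b * (minusOne * r)) + r
        ≡⟨ cong (λ z → z * (b * (minusOne * r)) + r) (Vec.lookup-map i toℕ l) ⟩
      toℕ (Vec.lookup l i) * (b * (minusOne * r)) + r
        ≡⟨ cong (_+ r) (sym (ℕ.*-assoc (toℕ (Vec.lookup l i)) b _)) ⟩
      toℕ (Vec.lookup l i) * b * (minusOne * r) + r
        ≈⟨ +-congₘ (*-congₘ (proj₂ (inverse-unit p∤)) (≡ₘ-refl {minusOne * r})) (≡ₘ-refl {r}) ⟩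
      1 * (minusOne * r) + r
        ≡⟨ lem (minusOne * r) r ⟩
      0 + (r + minusOne * r)
        ≈⟨ a+b-b≡ₘa 0 r ⟩
      0 ∎
      where
      b = proj₁ (inverse-unit p∤)
      r = dot (Vec.removeAt (ι l) i) v
      lem : ∀ a r → 1 * a + r ≡ 0 + (r + a)
      lem = ℕSolver.solve-∀

    dir : Chart → Vec ℕ n → V
    dir (l , w) v = shift w (offset l (pivot? l) v)

    ∙-shift : ∀ l w v → dot (ι l) (ι (shift w (offset l (pivot? l) v))) ≡ₘ l ∙ w
    ∙-shift l w v = begin
      dot (ι l) (ι (shift w b))          ≈⟨ dot-congₘ (ι l) (ι-shift w b) ⟩
      dot (ι l) (addV (ι w) b)           ≡⟨ dot-addV (ι l) (ι w) b ⟩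
      l ∙ w + dot (ι l) b                ≈⟨ +-congₘ (≡ₘ-refl {l ∙ w}) (offset-orthogonal l (pivot? l) v) ⟩
      l ∙ w + 0                          ≡⟨ ℕ.+-identityʳ _ ⟩
      l ∙ w                              ∎
      where b = offset l (pivot? l) v

    normalised⇒hasUnit : ∀ l w → l ∙ w ≡ₘ 1 → HasUnit w
    normalised⇒hasUnit l w h with hasUnit? w
    ... | yes u = u
    ... | no ¬u = contradiction (subst (p ∣_) (dot-comm (ι w) (ι l)) (∣-dot (ι w) (ι l) (all w ¬u))) (p∤1 h)
      where
      all : ∀ {m} (w : Vec (Fin q) m) → ¬ HasUnit w → ∀ i → p ∣ Vec.lookup (ι w) i
      all (w ∷ ws) ¬u zero    = decidable-stable (p ℕ.∣? toℕ w) (¬u ∘ VecAny.here)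
      all (w ∷ ws) ¬u (suc i) = all ws (¬u ∘ VecAny.there) i

    ∈charts⇒normalised : ∀ {γ} → γ ∈ charts → proj₁ γ ∙ proj₂ γ ≡ₘ 1
    ∈charts⇒normalised γ∈ = proj₂ (∈.∈-filter⁻ normalised? {xs = List.cartesianProduct (vectors N) (vectors N)} γ∈)

    dir-normalised : ∀ {γ} → γ ∈ charts → ∀ v → proj₁ γ ∙ dir γ v ≡ₘ 1
    dir-normalised {l , w} γ∈ v = ≡ₘ-trans (∙-shift l w v) (∈charts⇒normalised γ∈)

    dir∈ : ∀ {γ} → γ ∈ charts → ∀ v → dir γ v ∈ dirs
    dir∈ {γ} γ∈ v = ∈.∈-filter⁺ hasUnit? (∈-vectors _) (normalised⇒hasUnit (proj₁ γ) _ (dir-normalised γ∈ v))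

    -- For fixed `l` and `v`, passing from `w` to the direction is a translation along the kernel of
    -- `l`. Each vector with a unit coordinate is normalised by exactly `q ^ n` forms.
    ∑-charts : ∀ v (f : V → ℕ) → ∑ charts (λ γ → f (dir γ v)) ≡ q ^ n * ∑ dirs f
    ∑-charts v f = P.begin
      ∑ charts (λ γ → f (dir γ v))
        P.≡⟨ trans (∑-filter normalised? (List.cartesianProduct (vectors N) (vectors N)) (λ γ → f (dir γ v))) (∑-cartesianProduct (vectors N) (vectors N) _) ⟩
      ∑ (vectors N) (λ l → ∑ (vectors N) λ w → [ (l ∙ w) ≟ₘ 1 ]? * f (dir (l , w) v))
        P.≡⟨ ∑-cong (vectors N) (λ {l} _ → trans
               (∑-cong (vectors N) λ {w} _ → cong (_* f (dir (l , w) v)) ([]?-cong ((l ∙ w) ≟ₘ 1) ((l ∙ dir (l , w) v) ≟ₘ 1)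
                 (≡ₘ-trans (∙-shift l w v)) (≡ₘ-trans (≡ₘ-sym (∙-shift l w v)))))
               (∑-shift (offset l (pivot? l) v) (λ w → [ (l ∙ w) ≟ₘ 1 ]? * f w))) ⟩
      ∑ (vectors N) (λ l → ∑ (vectors N) λ w → [ (l ∙ w) ≟ₘ 1 ]? * f w)
        P.≡⟨ ∑-swap (vectors N) (vectors N) (λ l w → [ (l ∙ w) ≟ₘ 1 ]? * f w) ⟩
      ∑ (vectors N) (λ w → ∑ (vectors N) λ l → [ (l ∙ w) ≟ₘ 1 ]? * f w)
        P.≡⟨ ∑-cong (vectors N) (λ {w} _ → trans
               (∑-cong (vectors N) λ {l} _ → ℕ.*-comm [ (l ∙ w) ≟ₘ 1 ]? (f w))
               (trans (sym (∑-* (f w) (vectors N) λ l → [ (l ∙ w) ≟ₘ 1 ]?))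
                 (trans (cong (λ z → f w * z) (number w)) (lem (f w) (q ^ n) [ hasUnit? w ]?)))) ⟩
      ∑ (vectors N) (λ w → q ^ n * ([ hasUnit? w ]? * f w))
        P.≡⟨ sym (∑-* (q ^ n) (vectors N) _) ⟩
      q ^ n * ∑ (vectors N) (λ w → [ hasUnit? w ]? * f w)
        P.≡⟨ cong (λ z → q ^ n * z) (sym (∑-filter hasUnit? (vectors N) f)) ⟩
      q ^ n * ∑ dirs f P.∎
      where
      module P = ≡-Reasoning
      lem : ∀ a b c → a * (b * c) ≡ b * (c * a)
      lem = ℕSolver.solve-∀
      number : ∀ w → ∑ (vectors N) (λ l → [ (l ∙ w) ≟ₘ 1 ]?) ≡ q ^ n * [ hasUnit? w ]?
      number w = cases (hasUnit? w)
        where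
        cases : (d : Dec (HasUnit w)) → ∑ (vectors N) (λ l → [ (l ∙ w) ≟ₘ 1 ]?) ≡ q ^ n * [ d ]?
        cases (yes u) = trans
          (∑-cong (vectors N) λ {l} _ → cong (λ z → [ z ≟ₘ 1 ]?) (sym (ℕ.+-identityʳ (l ∙ w))))
          (trans (solutions u 0 1) (sym (ℕ.*-identityʳ (q ^ n))))
        cases (no ¬u) = trans
          (∑-cong (vectors N) λ {l} _ → []?-no ((l ∙ w) ≟ₘ 1) (¬u ∘ normalised⇒hasUnit l w))
          (trans (∑-const (vectors N) 0) (trans (ℕ.*-zeroʳ (length (vectors N))) (sym (ℕ.*-zeroʳ (q ^ n)))))

    length-charts : length charts ≡ q ^ n * length dirs
    length-charts = trans (sym (trans (∑-const charts 1) (ℕ.*-identityʳ _)))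
      (trans (∑-charts (Vec.replicate n 0) (λ _ → 1)) (cong (λ z → q ^ n * z) (trans (∑-const dirs 1) (ℕ.*-identityʳ _))))

    uniform : ∀ v (f : V → ℕ) → length dirs * ∑ charts (λ γ → f (dir γ v)) ≡ length charts * ∑ dirs f
    uniform v f = trans (cong (λ z → length dirs * z) (∑-charts v f))
      (trans (lem (length dirs) (q ^ n) (∑ dirs f)) (cong (_* ∑ dirs f) (sym length-charts)))
      where
      lem : ∀ a b c → a * (b * c) ≡ b * a * c
      lem = ℕSolver.solve-∀

    dirs≢[] : 0 < length dirs
    dirs≢[] = ∈.∈-length (∈.∈-filter⁺ hasUnit? (∈-vectors (Vec.replicate N (1 mod q)))
      (VecAny.here (p∤1 (toℕ-mod 1))))

    residual : ∀ {m} → ℕ → Vec ℕ m → Vec ℕ m → Vec ℕ m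
    residual D = Vec.zipWith λ x w → x + minusOne * (w * D)

    -- Affine coordinates in which the chart is {1} × ℤⁿ.
    coordinates : ∀ (γ : Chart) → Dec (Pivot (proj₁ γ)) → V → Vec ℕ N
    coordinates (l , w) (yes (i , _)) x = l ∙ x ∷ residual (l ∙ x) (Vec.removeAt (ι x) i) (Vec.removeAt (ι w) i)
    coordinates _       (no _)        x = Vec.replicate N 0

    ι-line : ∀ {m} (a u : Vec (Fin q) m) t → ι (a ⊕ t • u) ≋ linePoint (ι a) (toℕ t) (ι u)
    ι-line []       []       t = []
    ι-line (a ∷ as) (u ∷ us) t = ≡ₘ-trans (toℕ-mod _) (+-congₘ (≡ₘ-refl {toℕ a}) (toℕ-mod (toℕ t * toℕ u)))
      ∷ ι-line as us t

    -- Along the line `l` grows by `t`. Subtracting `l ∙ x` times `w` leaves `t` times the offset,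
    -- whose coordinates away from the pivot are `v`.
    coordinates-line : ∀ {γ} → γ ∈ charts → ∀ v a t → let g = coordinates γ (pivot? (proj₁ γ)) in
      g (a ⊕ t • dir γ v) ≋ linePoint (g a) (toℕ t) (1 ∷ v)
    coordinates-line {l , w} γ∈ v a t = cases (pivot? l) (dir-normalised γ∈ v)
      where
      cases : (d : Dec (Pivot l)) → l ∙ shift w (offset l d v) ≡ₘ 1 →
        coordinates (l , w) d (a ⊕ t • shift w (offset l d v)) ≋ linePoint (coordinates (l , w) d a) (toℕ t) (1 ∷ v)
      cases (no ¬pivot) _ = contradiction
        (∣-dot (ι l) (ι w) λ i → subst (p ∣_) (sym (Vec.lookup-map i toℕ l))
          (decidable-stable (p ℕ.∣? toℕ (Vec.lookup l i)) λ p∤ → ¬pivot (i , p∤)))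
        (p∤1 (∈charts⇒normalised γ∈))
      cases (yes (i , p∤)) lu≡1 = lx≡ ∷ residual-line
          (subst (Vec.removeAt (ι x) i ≋_) (removeAt-zipWith _ (ι a) (ι u) i) (removeAt-pointwise i (ι-line a u t)))
          (subst (Vec.removeAt (ι u) i ≋_) (trans (removeAt-zipWith _+_ (ι w) b i)
            (cong (addV (Vec.removeAt (ι w) i)) (Vec.removeAt-insertAt v i _))) (removeAt-pointwise i (ι-shift w b)))
        where
        b = offset l (yes (i , p∤)) v
        u = shift w b
        x = a ⊕ t • u
        τ = toℕ t
        lx≡ : l ∙ x ≡ₘ l ∙ a + τ * 1
        lx≡ = begin
          l ∙ x                                  ≈⟨ dot-congₘ (ι l) (ι-line a u t) ⟩
          dot (ι l) (linePoint (ι a) τ (ι u))    ≡⟨ dot-comm (ι l) _ ⟩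
          dot (linePoint (ι a) τ (ι u)) (ι l)    ≡⟨ dot-linePoint (ι a) τ (ι u) (ι l) ⟩
          dot (ι a) (ι l) + τ * dot (ι u) (ι l)  ≡⟨ cong₂ (λ y z → y + τ * z) (dot-comm (ι a) (ι l)) (dot-comm (ι u) (ι l)) ⟩
          l ∙ a + τ * (l ∙ u)                    ≈⟨ +-congₘ (≡ₘ-refl {l ∙ a}) (*-congₘ (≡ₘ-refl {τ}) lu≡1) ⟩
          l ∙ a + τ * 1                          ∎
        residual-line : ∀ {m} {X A U W V : Vec ℕ m} → X ≋ linePoint A τ U → U ≋ addV W V →
          residual (l ∙ x) X W ≋ linePoint (residual (l ∙ a) A W) τ V
        residual-line {X = []} {[]} {[]} {[]} {[]} [] [] = []
        residual-line {X = x₁ ∷ X} {a₁ ∷ A} {u₁ ∷ U} {w₁ ∷ W} {v₁ ∷ V} (hx ∷ hX) (hu ∷ hU) = (begin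
          x₁ + minusOne * (w₁ * (l ∙ x))
            ≈⟨ +-congₘ (≡ₘ-trans hx (+-congₘ (≡ₘ-refl {a₁}) (*-congₘ (≡ₘ-refl {τ}) hu)))
                 (*-congₘ (≡ₘ-refl {minusOne}) (*-congₘ (≡ₘ-refl {w₁}) lx≡)) ⟩
          a₁ + τ * (w₁ + v₁) + minusOne * (w₁ * (l ∙ a + τ * 1))
            ≡⟨ lem a₁ τ w₁ v₁ minusOne (l ∙ a) ⟩
          a₁ + minusOne * (w₁ * (l ∙ a)) + τ * v₁ + (τ * w₁ + minusOne * (τ * w₁))
            ≈⟨ a+b-b≡ₘa _ (τ * w₁) ⟩
          a₁ + minusOne * (w₁ * (l ∙ a)) + τ * v₁ ∎) ∷ residual-line hX hU
          where
          lem : ∀ a t w v m d → a + t * (w + v) + m * (w * (d + t * 1)) ≡ a + m * (w * d) + t * v + (t * w + m * (t * w))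
          lem = ℕSolver.solve-∀

    open Independence pp k using (Hits; independence)
    open NewtonOrder pp using (level)

    independent : ∀ {γ} → γ ∈ charts → ∀ (T : List V) (A : List (Vec ℕ N)) → Unique A →
      (∀ {j} → j ∈ A → ∃ λ xs → Collinear system T (dir γ (Vec.tail j)) xs × level j < length xs * N) →
      length A ≤ length T * card N N
    independent {γ} γ∈ T A uniq h = subst (λ z → length A ≤ z * card N N) (List.length-map g T)
      (independence (List.map g T) (List.lookup A) (lookup-injective uniq) λ i → hits (∈.∈-lookup {xs = A} i))
      where
      g : V → Vec ℕ N
      g = coordinates γ (pivot? (proj₁ γ))
      lookup-injective : ∀ {A : List (Vec ℕ N)} → Unique A → ∀ i j → List.lookup A i ≡ List.lookup A j → i ≡ j
      lookup-injective (_ ∷ _)     zero    zero    _ = refl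
      lookup-injective (x∉ ∷ _)    zero    (suc j) e = contradiction e (All.lookup x∉ (∈.∈-lookup j))
      lookup-injective (x∉ ∷ _)    (suc i) zero    e = contradiction (sym e) (All.lookup x∉ (∈.∈-lookup i))
      lookup-injective (_ ∷ uniq)  (suc i) (suc j) e = cong suc (lookup-injective uniq i j e)
      hits : ∀ {j} → j ∈ A → Hits (List.map g T) j
      hits {j} j∈ = record
        { base    = g base
        ; times   = List.map toℕ times
        ; unique  = Unique.map⁺ Fin.toℕ-injective (Unique.filter⁺ onXs? (Unique.allFin⁺ q))
        ; times<q = All.map⁺ (All.tabulate λ {t} _ → Fin.toℕ<n t)
        ; onLine  = λ t∈ → line-hit (∈.∈-map⁻ toℕ t∈)
        ; enough  = ℕ.<-≤-trans (proj₂ (proj₂ (h j∈))) (ℕ.*-monoˡ-≤ N (subst (length xs ≤_) (sym (List.length-map toℕ times))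
            (subst (length xs ≤_) (List.length-map point times) (unique-length-≤ unique hit))))
        }
        where
        xs = proj₁ (h j∈)
        u = dir γ (Vec.tail j)
        open Collinear (proj₁ (proj₂ (h j∈)))
        point : Fin q → V
        point t = base ⊕ t • u
        onXs? : ∀ t → Dec (point t ∈ xs)
        onXs? t = Any.any? (Vec.≡-dec Fin._≟_ (point t)) xs
        -- Counting parameters rather than points: every point of `xs` comes from one of these, so
        -- they are at least as many.
        times = List.filter onXs? (List.allFin q)
        hit : ∀ {x} → x ∈ xs → x ∈ List.map point times
        hit x∈ with incident x∈
        ... | t , refl = ∈.∈-map⁺ point (∈.∈-filter⁺ onXs? (∈.∈-allFin t) x∈)
        line-hit : ∀ {t} → (∃ λ t′ → t′ ∈ times × t ≡ toℕ t′) →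
          ∃ λ y → y ∈ List.map g T × Pointwise (λ a b → a % q ≡ b % q) y (linePoint (g base) t (1 ∷ Vec.tail j))
        line-hit (t′ , t′∈ , refl) = g (point t′)
          , ∈.∈-map⁺ g (inside (proj₂ (∈.∈-filter⁻ onXs? {xs = List.allFin q} t′∈)))
          , Pointwise.map remainder (coordinates-line γ∈ (Vec.tail j) base t′)

    line-size : ∀ {S u xs} → Collinear system S u xs → length xs ≤ q
    line-size {S} {u} {xs} col = subst (length xs ≤_)
      (trans (List.length-map point (List.allFin q)) (List.length-tabulate {n = q} id))
      (unique-length-≤ unique λ x∈ → on (incident x∈))
      where
      open Collinear col
      point : Fin q → V
      point t = base ⊕ t • u
      on : ∀ {x} → OnLine base u x → x ∈ List.map point (List.allFin q)
      on (t , refl) = ∈.∈-map⁺ point (∈.∈-allFin t)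

    -- Chosen so that `N * q ≤ p ^ K`: all coordinates of an index with sum below `N * q` are then
    -- in the range of `weight≤`.
    K : ℕ
    K = suc k + ⌈log p ⌉ N

    level≤ : ∀ (j : Vec ℕ N) → Vec.sum j < N * q → level j ≤ K * Vec.sum j
    level≤ (j₀ ∷ j) sum< = subst (level (j₀ ∷ j) ≤_) (sym (ℕ.*-distribˡ-+ K j₀ (Vec.sum j)))
      (ℕ.+-mono-≤ (ℕ.m≤m+n j₀ _) (weights j (ℕ.<-≤-trans (ℕ.≤-<-trans (ℕ.m≤n+m _ j₀) sum<) Nq≤)))
      where
      open Valuation pp using (weight; weight≤)
      Nq≤ : N * q ≤ p ^ K
      Nq≤ = subst (N * q ≤_) (trans (ℕ.*-comm (p ^ ⌈log p ⌉ N) q) (sym (ℕ.^-distribˡ-+-* p (suc k) (⌈log p ⌉ N))))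
        (ℕ.*-monoˡ-≤ q (proj₁ (⌈log⌉-least p N p>1)))
      weights : ∀ {m} (j : Vec ℕ m) → Vec.sum j < p ^ K → Vec.sum (Vec.map weight j) ≤ K * Vec.sum j
      weights []       _  = z≤n
      weights (j ∷ js) j< = subst (weight j + Vec.sum (Vec.map weight js) ≤_) (sym (ℕ.*-distribˡ-+ K j (Vec.sum js)))
        (ℕ.+-mono-≤ (weight≤ K j (ℕ.≤-<-trans (ℕ.m≤m+n j _) j<)) (weights js (ℕ.≤-<-trans (ℕ.m≤n+m _ j) j<)))

    charted : Charted system n q K
    charted = record
      { line-size   = line-size
      ; Chart       = Chart
      ; charts      = charts
      ; charts≢[]   = subst (0 <_) (sym length-charts) (ℕ.*-mono-≤ (ℕ.m^n>0 q n) dirs≢[])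
      ; dir         = dir
      ; dir∈        = dir∈
      ; uniform     = uniform
      ; level       = level
      ; K≥1         = s≤s z≤n
      ; level≤      = level≤
      ; independent = independent
      }

-- Products over all primes

-- n ! (1 + 1/2 + … + 1/n)
harmonicNumerator : ℕ → ℕ
harmonicNumerator zero    = 0
harmonicNumerator (suc n) = harmonicNumerator n * suc n + n !

private
  argmax : (f : ℕ → ℕ) → ∀ q → ∃ λ a → a ≤ q × ∀ b → b ≤ q → f b ≤ f a
  argmax f zero = 0 , z≤n , λ { zero z≤n → ℕ.≤-refl }
  argmax f (suc q) =
    let (a , a≤q , max) = argmax f q in cases a a≤q max (ℕ.≤-total (f (suc q)) (f a))
    where
    cases : ∀ a → a ≤ q → (∀ b → b ≤ q → f b ≤ f a) → f (suc q) ≤ f a ⊎ f a ≤ f (suc q) →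
            ∃ λ a → a ≤ suc q × ∀ b → b ≤ suc q → f b ≤ f a
    cases a a≤q max (inj₁ h) = a , ℕ.m≤n⇒m≤1+n a≤q , λ b b≤ → case (ℕ.m≤n⇒m<n∨m≡n b≤)
      where
      case : ∀ {b} → b < suc q ⊎ b ≡ suc q → f b ≤ f a
      case (inj₁ b<)  = max _ (ℕ.≤-pred b<)
      case (inj₂ refl) = h
    cases a a≤q max (inj₂ h) = suc q , ℕ.≤-refl , λ b b≤ → case (ℕ.m≤n⇒m<n∨m≡n b≤)
      where
      case : ∀ {b} → b < suc q ⊎ b ≡ suc q → f b ≤ f (suc q)
      case (inj₁ b<)  = ℕ.≤-trans (max _ (ℕ.≤-pred b<)) h
      case (inj₂ refl) = ℕ.≤-refl

-- The sum of `M` is the sum of `ν b` over `1 ≤ b ≤ q`. With `a` maximising `a * ν a`, each `ν b` is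
-- at most `a * ν a` divided by `b`.
harmonic-pigeonhole : ∀ Y q → Pigeonhole Y q (harmonicNumerator q) (q !)
harmonic-pigeonhole Y q ys M _ M≤q = a , a≤q , (begin
  ∑ ys M * q !              ≡⟨ cong (_* q !) (∑-cong ys λ y∈ → sym (ℕ.m≤n⇒m⊓n≡m (M≤q y∈))) ⟩
  layers q * q !            ≤⟨ go q ℕ.≤-refl ⟩
  a * ν a * harmonicNumerator q ∎)
  where
  open ℕ.≤-Reasoning
  ν : ℕ → ℕ
  ν a = ∑ ys (λ y → [ a ℕ.≤? M y ]?)
  best = argmax (λ a → a * ν a) q
  a = proj₁ best
  a≤q = proj₁ (proj₂ best)
  layers : ℕ → ℕ
  layers b = ∑ ys (λ y → M y ℕ.⊓ b)
  ⊓-suc : ∀ m b → m ℕ.⊓ suc b ≡ m ℕ.⊓ b + [ suc b ℕ.≤? m ]?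
  ⊓-suc m b with ℕ.≤-total m b
  ... | inj₁ m≤b = trans (ℕ.m≤n⇒m⊓n≡m (ℕ.m≤n⇒m≤1+n m≤b)) (sym (trans
    (cong₂ _+_ (ℕ.m≤n⇒m⊓n≡m m≤b) ([]?-no (suc b ℕ.≤? m) (ℕ.≤⇒≯ m≤b))) (ℕ.+-identityʳ m)))
  ... | inj₂ b≤m with ℕ.m≤n⇒m<n∨m≡n b≤m
  ...   | inj₁ b<m  = trans (ℕ.m≥n⇒m⊓n≡n b<m) (sym (trans
    (cong₂ _+_ (ℕ.m≥n⇒m⊓n≡n b≤m) ([]?-yes (suc b ℕ.≤? m) b<m)) (ℕ.+-comm b 1)))
  ...   | inj₂ refl = trans (ℕ.m≤n⇒m⊓n≡m (ℕ.n≤1+n b)) (sym (trans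
    (cong₂ _+_ (ℕ.⊓-idem b) ([]?-no (suc b ℕ.≤? b) (ℕ.<-irrefl refl))) (ℕ.+-identityʳ b)))
  layers-suc : ∀ b → layers (suc b) ≡ layers b + ν (suc b)
  layers-suc b = trans (∑-cong ys λ {y} _ → ⊓-suc (M y) b) (∑-+ ys (λ y → M y ℕ.⊓ b) _)
  go : ∀ b → b ≤ q → layers b * b ! ≤ a * ν a * harmonicNumerator b
  go zero    _   = ℕ.≤-reflexive (trans (ℕ.*-identityʳ (layers 0)) (trans
    (trans (∑-cong ys λ {y} _ → ℕ.⊓-zeroʳ (M y)) (trans (∑-const ys 0) (ℕ.*-zeroʳ (length ys)))) (sym (ℕ.*-zeroʳ (a * ν a)))))
  go (suc b) b<q = begin
    layers (suc b) * (suc b * b !)               ≡⟨ cong (_* (suc b * b !)) (layers-suc b) ⟩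
    (layers b + ν (suc b)) * (suc b * b !)       ≡⟨ lem (layers b) (ν (suc b)) (suc b) (b !) ⟩
    suc b * (layers b * b !) + suc b * ν (suc b) * b !
      ≤⟨ ℕ.+-mono-≤ (ℕ.*-monoʳ-≤ (suc b) (go b (ℕ.<⇒≤ b<q)))
                     (ℕ.*-monoˡ-≤ (b !) (proj₂ (proj₂ best) (suc b) b<q)) ⟩
    suc b * (a * ν a * harmonicNumerator b) + a * ν a * b !
      ≡⟨ lem′ (suc b) (a * ν a) (harmonicNumerator b) (b !) ⟩
    a * ν a * harmonicNumerator (suc b) ∎
    where
    lem : ∀ l v b f → (l + v) * (b * f) ≡ b * (l * f) + b * v * f
    lem = ℕSolver.solve-∀
    lem′ : ∀ b m h f → b * (m * h) + m * f ≡ m * (h * b + f)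
    lem′ = ℕSolver.solve-∀

-- Over a single point the multiplicity itself is the best `a` and nothing is lost; this spares one
-- prime its harmonic factor.
point-pigeonhole : ∀ q → Pigeonhole point-system q 1 1
point-pigeonhole q []            M _            _   = 0 , z≤n , z≤n
point-pigeonhole q (y ∷ [])      M _            M≤q = M y , M≤q (here refl) , ℕ.≤-reflexive (trans
  (cong (_* 1) (trans (ℕ.+-identityʳ (M y)) (sym (ℕ.*-identityʳ (M y)))))
  (cong (λ z → M y * z * 1) (sym (trans (ℕ.+-identityʳ _) ([]?-yes (M y ℕ.≤? M y) ℕ.≤-refl)))))
point-pigeonhole q (_ ∷ _ ∷ _)   M ((y≢ ∷ _) ∷ _) _ = contradiction refl y≢

point-estimate : ∀ n → Estimate point-system (suc n) 1 1
point-estimate n S xs h = cases (xs tt) (h (here refl))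
  where
  cases : ∀ l → Collinear point-system S tt l → 1 * (length l ^ suc n + 0) ≤ 1 * (length S * 1)
  cases []          _ = z≤n
  cases (_ ∷ [])    c = subst₂ _≤_ (sym (trans (ℕ.+-identityʳ _) (trans (ℕ.+-identityʳ _) (ℕ.^-zeroˡ (suc n)))))
    (sym (trans (ℕ.+-identityʳ _) (ℕ.*-identityʳ (length S)))) (∈.∈-length (Collinear.inside c (here refl)))
  cases (_ ∷ _ ∷ _) c with Collinear.unique c
  ... | (y≢ ∷ _) ∷ _ = contradiction refl y≢

module PrimeProduct (n : ℕ) where

  N : ℕ
  N = suc n

  total-system : ∀ {r} (p : Fin r → ℕ) → (∀ i → Prime (p i)) → (Fin r → ℕ) → System
  total-system {zero}  p pp k = point-system
  total-system {suc r} p pp k = product (PrimePower.Charts.system (pp zero) (k zero) n)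
    (total-system (p ∘ suc) (pp ∘ suc) (k ∘ suc))

  scale : ∀ {r} → (Fin r → ℕ) → (Fin r → ℕ) → Fin r → ℕ
  scale p k i = 2 * (suc (k i) + ⌈log p i ⌉ N)

  prod : ∀ {r} → (Fin r → ℕ) → ℕ
  prod = Vector.foldr _*_ 1

  modulus : ∀ {r} → (Fin r → ℕ) → (Fin r → ℕ) → Fin r → ℕ
  modulus p k i = p i ^ suc (k i)

  -- The last prime contributes no harmonic factor.
  numerator denominator′ : ∀ {r} (p k : Fin (suc r) → ℕ) → ℕ
  numerator    p k = prod (scale p k) * prod (λ j → harmonicNumerator (modulus p k (Fin.inject₁ j)))
  denominator′ p k = prod (λ j → modulus p k (Fin.inject₁ j) !)

  -- Each prime is placed over the product of the later ones and pays the harmonic number of its own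
  -- prime power, the maximal size of a fibre; the last prime lies over a point.
  total-estimate : ∀ {r} (p : Fin (suc r) → ℕ) (pp : ∀ i → Prime (p i)) (k : Fin (suc r) → ℕ) →
    Estimate (total-system p pp k) N (numerator p k ^ N) (denominator′ p k ^ N)
  total-estimate {zero} p pp k = subst₂ (Estimate (total-system p pp k) N) num≡ den≡
    (Product.product-estimate (PrimePower.Charts.charted (pp zero) (k zero) n)
      {h = 1} {d = 1} (point-pigeonhole (modulus p k zero)) {num = 1} {den = 1} (point-estimate n))
    where
    num≡ : 1 * (scale p k zero * 1) ^ N ≡ numerator p k ^ N
    num≡ = trans (ℕ.*-identityˡ _) (cong (_^ N) (sym (ℕ.*-identityʳ (scale p k zero * 1))))
    den≡ : 1 * 1 ^ N ≡ 1 ^ N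
    den≡ = ℕ.*-identityˡ _
  total-estimate {suc r} p pp k = subst₂ (Estimate (total-system p pp k) N) num≡ den≡
    (Product.product-estimate (PrimePower.Charts.charted (pp zero) (k zero) n)
      {h = h} {d = q₀ !} (harmonic-pigeonhole (total-system (p ∘ suc) (pp ∘ suc) (k ∘ suc)) q₀)
      {num = numerator (p ∘ suc) (k ∘ suc) ^ N} {den = denominator′ (p ∘ suc) (k ∘ suc) ^ N}
      (total-estimate (p ∘ suc) (pp ∘ suc) (k ∘ suc)))
    where
    q₀ = modulus p k zero
    h = harmonicNumerator q₀
    s = scale p k zero
    num≡ : numerator (p ∘ suc) (k ∘ suc) ^ N * (s * h) ^ N ≡ numerator p k ^ N
    num≡ = trans (sym ([a*b]^n≡a^n*b^n N (numerator (p ∘ suc) (k ∘ suc)) (s * h)))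
      (cong (_^ N) (lem (prod (scale (p ∘ suc) (k ∘ suc))) _ s h))
      where
      lem : ∀ a b s h → a * b * (s * h) ≡ s * a * (h * b)
      lem = ℕSolver.solve-∀
    den≡ : denominator′ (p ∘ suc) (k ∘ suc) ^ N * (q₀ !) ^ N ≡ denominator′ p k ^ N
    den≡ = trans (sym ([a*b]^n≡a^n*b^n N (denominator′ (p ∘ suc) (k ∘ suc)) (q₀ !)))
      (cong (_^ N) (ℕ.*-comm (denominator′ (p ∘ suc) (k ∘ suc)) (q₀ !)))

-- The Chinese remainder theorem

-- Divisibility of the distance is the form in which congruences for several moduli are combined
-- below.
≡ₘ⇒∣ : ∀ {m} .{{_ : NonZero m}} {a b} → Mod._≡ₘ_ m a b → m ∣ ℕ.∣ a - b ∣
≡ₘ⇒∣ {m} {a} {b} h = divides ℕ.∣ a / m - b / m ∣ (begin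
  ℕ.∣ a - b ∣                                     ≡⟨ cong₂ ℕ.∣_-_∣ (ℕ.m≡m%n+[m/n]*n a m) (ℕ.m≡m%n+[m/n]*n b m) ⟩
  ℕ.∣ a % m + a / m * m - b % m + b / m * m ∣     ≡⟨ cong (λ z → ℕ.∣ a % m + a / m * m - z + b / m * m ∣) (sym (Mod.remainder h)) ⟩
  ℕ.∣ a % m + a / m * m - a % m + b / m * m ∣     ≡⟨ ℕ.∣m+n-m+o∣≡∣n-o∣ (a % m) (a / m * m) (b / m * m) ⟩
  ℕ.∣ a / m * m - b / m * m ∣                     ≡⟨ ℕ.*-distribʳ-∣-∣ m (a / m) (b / m) ⟨
  ℕ.∣ a / m - b / m ∣ * m                         ∎)
  where open ≡-Reasoning

∣⇒≡ₘ : ∀ {m} .{{_ : NonZero m}} {a b} → m ∣ ℕ.∣ a - b ∣ → Mod._≡ₘ_ m a b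
∣⇒≡ₘ {m} {a} {b} h with ℕ.≤-total a b
... | inj₁ a≤b = Mod.≡ₘ-sym m (ordered a≤b (subst (m ∣_) (ℕ.m≤n⇒∣m-n∣≡n∸m a≤b) h))
  where
  ordered : ∀ {a b} → a ≤ b → m ∣ b ∸ a → Mod._≡ₘ_ m b a
  ordered {a} {b} a≤b (divides c eq) = Mod.≡ₘ-trans m
    (Mod.≡ₘ-reflexive m (trans (sym (ℕ.m+[n∸m]≡n a≤b)) (cong (λ z → a + z) (trans eq (ℕ.*-comm c m))))) (Mod.+q*≡ₘ m a c)
... | inj₂ b≤a = ordered b≤a (subst (m ∣_) (ℕ.m≤n⇒∣n-m∣≡n∸m b≤a) h)
  where
  ordered : ∀ {a b} → a ≤ b → m ∣ b ∸ a → Mod._≡ₘ_ m b a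
  ordered {a} {b} a≤b (divides c eq) = Mod.≡ₘ-trans m
    (Mod.≡ₘ-reflexive m (trans (sym (ℕ.m+[n∸m]≡n a≤b)) (cong (λ z → a + z) (trans eq (ℕ.*-comm c m))))) (Mod.+q*≡ₘ m a c)

coprime-* : ∀ {a b m} → Coprime a b → a ∣ m → b ∣ m → a * b ∣ m
coprime-* {a} {b} cop (divides c refl) b∣ with Coprime.coprime-divisor {b} {a} (Coprime.sym cop) (subst (b ∣_) (ℕ.*-comm c a) b∣)
... | divides d refl = divides d (lem d b a)
  where
  lem : ∀ d b a → d * b * a ≡ d * (a * b)
  lem = ℕSolver.solve-∀

chineseRemainder : ∀ {a b} .{{_ : NonZero a}} .{{_ : NonZero b}} → Coprime a b → ∀ x y →
  ∃ λ z → Mod._≡ₘ_ a z x × Mod._≡ₘ_ b z y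
chineseRemainder {a} {b} cop x y = b * b′ * x + a * a′ * y
  , A.≡ₘ-trans (A.≡ₘ-trans (A.≡ₘ-reflexive (cong (λ z → b * b′ * x + z) (ℕ.*-assoc a a′ y))) (A.+q*≡ₘ (b * b′ * x) (a′ * y)))
      (A.≡ₘ-trans (A.*-congₘ (proj₂ (A.inverse b (Coprime.sym cop))) (A.≡ₘ-refl {x})) (A.≡ₘ-reflexive (ℕ.*-identityˡ x)))
  , B.≡ₘ-trans (B.≡ₘ-trans (B.≡ₘ-reflexive (trans (ℕ.+-comm (b * b′ * x) _) (cong (λ z → a * a′ * y + z) (ℕ.*-assoc b b′ x))))
        (B.+q*≡ₘ (a * a′ * y) (b′ * x)))
      (B.≡ₘ-trans (B.*-congₘ (proj₂ (B.inverse a cop)) (B.≡ₘ-refl {y})) (B.≡ₘ-reflexive (ℕ.*-identityˡ y)))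
  where
  module A = Mod a
  module B = Mod b
  b′ = proj₁ (A.inverse b (Coprime.sym cop))
  a′ = proj₁ (B.inverse a cop)

lookup-ext : ∀ {A : Set} {m} {u v : Vec A m} → (∀ l → Vec.lookup u l ≡ Vec.lookup v l) → u ≡ v
lookup-ext {u = []}    {[]}    h = refl
lookup-ext {u = _ ∷ _} {_ ∷ _} h = cong₂ _∷_ (h zero) (lookup-ext (h ∘ suc))

module Residues (n : ℕ) where

  open PrimeProduct n public

  Decreasing : ∀ {r} → (Fin r → ℕ) → Set
  Decreasing p = ∀ {i j} → i Fin.< j → p j < p i

  ∣-prod : ∀ {r} (f : Fin r → ℕ) i → f i ∣ prod f
  ∣-prod f zero    = ℕ.m∣m*n _
  ∣-prod f (suc i) = ℕ.∣n⇒∣m*n (f zero) (∣-prod (f ∘ suc) i)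

  coprime-prod : ∀ {r a} (f : Fin r → ℕ) → (∀ i → Coprime a (f i)) → Coprime a (prod f)
  coprime-prod {zero}  f h (_ , d∣1) = ℕ.∣1⇒≡1 d∣1
  coprime-prod {suc r} {a} f h {d} (d∣a , d∣) = coprime-prod (f ∘ suc) (h ∘ suc)
    (d∣a , Coprime.coprime-divisor {d} {f zero} (λ (e∣d , e∣f) → h zero (ℕ.∣-trans e∣d d∣a , e∣f)) d∣)

  module _ {r} {p : Fin (suc r) → ℕ} (pp : ∀ i → Prime (p i)) (dec : Decreasing p) (k : Fin (suc r) → ℕ) where

    coprime-head : Coprime (modulus p k zero) (prod (modulus (p ∘ suc) (k ∘ suc)))
    coprime-head = coprime-prod (modulus (p ∘ suc) (k ∘ suc)) λ i → coprime-^ (pp (suc i)) (∤ i) (suc (k (suc i)))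
      where
      ∣^⇒∣ : ∀ {p a} → Prime p → ∀ k → p ∣ a ^ k → p ∣ a
      ∣^⇒∣ pp zero    h = contradiction (ℕ.∣⇒≤ h) (ℕ.<⇒≱ (ℕ.nonTrivial⇒n>1 _ {{prime⇒nonTrivial pp}}))
      ∣^⇒∣ {a = a} pp (suc k) h with euclidsLemma a (a ^ k) pp h
      ... | inj₁ h = h
      ... | inj₂ h = ∣^⇒∣ pp k h
      ∤ : ∀ i → ¬ p (suc i) ∣ modulus p k zero
      ∤ i h with prime⇒irreducible (pp zero) (∣^⇒∣ (pp (suc i)) (suc (k zero)) h)
      ... | inj₁ e = contradiction e (ℕ.>⇒≢ (ℕ.nonTrivial⇒n>1 _ {{prime⇒nonTrivial (pp (suc i))}}))
      ... | inj₂ e = contradiction e (ℕ.<⇒≢ (dec {zero} {suc i} (s≤s z≤n)))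

  ∣-all⇒prod∣ : ∀ {r} {p : Fin r → ℕ} → (∀ i → Prime (p i)) → Decreasing p → (k : Fin r → ℕ) → ∀ {m} →
    (∀ i → modulus p k i ∣ m) → prod (modulus p k) ∣ m
  ∣-all⇒prod∣ {zero}  pp dec k h = ℕ.1∣ _
  ∣-all⇒prod∣ {suc r} pp dec k h = coprime-* (coprime-head pp dec k) (h zero)
    (∣-all⇒prod∣ (pp ∘ suc) (λ lt → dec (s≤s lt)) (k ∘ suc) (h ∘ suc))

  prod≢0 : ∀ {r} {p : Fin r → ℕ} → (∀ i → Prime (p i)) → (k : Fin r → ℕ) → NonZero (prod (modulus p k))
  prod≢0 {zero}  pp k = _
  prod≢0 {suc r} pp k = ℕ.m*n≢0 _ _ {{PrimePower.q≢0 (pp zero) (k zero)}} {{prod≢0 (pp ∘ suc) (k ∘ suc)}}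

  residues : ∀ {r} {p : Fin r → ℕ} (pp : ∀ i → Prime (p i)) (k : Fin r → ℕ) → Vec ℕ N → System.Pt (total-system p pp k)
  residues {zero}      pp k v = tt
  residues {suc r} {p} pp k v =
    Vec.map (λ a → (a mod modulus p k zero) {{PrimePower.q≢0 (pp zero) (k zero)}}) v , residues (pp ∘ suc) (k ∘ suc) v

  residues-injective : ∀ {r} {p : Fin r → ℕ} (pp : ∀ i → Prime (p i)) (k : Fin r → ℕ) {v w} →
    residues pp k v ≡ residues pp k w → ∀ i l → modulus p k i ∣ ℕ.∣ Vec.lookup v l - Vec.lookup w l ∣
  residues-injective pp k {v} {w} e (suc i) l = residues-injective (pp ∘ suc) (k ∘ suc) (cong proj₂ e) i l
  residues-injective pp k {v} {w} e zero    l = ≡ₘ⇒∣ (M.≡ₘ-trans (M.≡ₘ-sym (M.toℕ-mod _)) (M.≡ₘ-trans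
    (M.≡ₘ-reflexive (cong toℕ (trans (sym (Vec.lookup-map l _ v)) (trans (cong (λ u → Vec.lookup u l) (cong proj₁ e)) (Vec.lookup-map l _ w)))))
    (M.toℕ-mod _)))
    where module M = PrimePower (pp zero) (k zero)

  residues-cong : ∀ {r} {p : Fin r → ℕ} (pp : ∀ i → Prime (p i)) (k : Fin r → ℕ) {v w} →
    (∀ i l → modulus p k i ∣ ℕ.∣ Vec.lookup v l - Vec.lookup w l ∣) → residues pp k v ≡ residues pp k w
  residues-cong {zero}  pp k h = refl
  residues-cong {suc r} pp k {v} {w} h = cong₂ _,_
    (lookup-ext λ l → trans (Vec.lookup-map l _ v) (trans (M.mod-cong (∣⇒≡ₘ (h zero l))) (sym (Vec.lookup-map l _ w))))
    (residues-cong (pp ∘ suc) (k ∘ suc) (h ∘ suc))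
    where module M = PrimePower (pp zero) (k zero)

  residues-dirs : ∀ {r} {p : Fin r → ℕ} (pp : ∀ i → Prime (p i)) (k : Fin r → ℕ) v →
    (∀ i → ∃ λ l → ¬ p i ∣ Vec.lookup v l) → residues pp k v ∈ System.dirs (total-system p pp k)
  residues-dirs {zero}      pp k v h = here refl
  residues-dirs {suc r} {p} pp k v h = ∈.∈-cartesianProduct⁺
    (∈.∈-filter⁺ M.hasUnit? (M.∈-vectors _) (unit v (proj₁ (h zero)) (proj₂ (h zero))))
    (residues-dirs (pp ∘ suc) (k ∘ suc) v (h ∘ suc))
    where
    module M = PrimePower (pp zero) (k zero)
    unit : ∀ {m} (v : Vec ℕ m) l → ¬ p zero ∣ Vec.lookup v l → M.HasUnit (Vec.map (λ a → a mod M.q) v)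
    unit (a ∷ _) zero    h = VecAny.here λ d → h (M.∣-≡ₘ (ℕ.m∣m*n _) (M.toℕ-mod a) d)
    unit (_ ∷ v) (suc l) h = VecAny.there (unit v l h)

  residues-incident : ∀ {r} {p : Fin r → ℕ} (pp : ∀ i → Prime (p i)) (k : Fin r → ℕ) {a u x} t →
    (∀ i l → modulus p k i ∣ ℕ.∣ Vec.lookup x l - Vec.lookup a l + t * Vec.lookup u l ∣) →
    System.Incident (total-system p pp k) (residues pp k a) (residues pp k u) (residues pp k x)
  residues-incident {zero}      pp k t h = tt
  residues-incident {suc r} {p} pp k {a} {u} {x} t h =
    (t mod M.q , line a u x (h zero)) , residues-incident (pp ∘ suc) (k ∘ suc) t (h ∘ suc)
    where
    module M = PrimePower (pp zero) (k zero)
    line : ∀ {m} (a u x : Vec ℕ m) → (∀ l → M.q ∣ ℕ.∣ Vec.lookup x l - Vec.lookup a l + t * Vec.lookup u l ∣) →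
      Vec.map (λ a → a mod M.q) x ≡ Vec.map (λ a → a mod M.q) a ⊕ (t mod M.q) • Vec.map (λ a → a mod M.q) u
    line []       []       []       h = refl
    line (a ∷ as) (u ∷ us) (x ∷ xs) h = cong₂ _∷_ (M.Fin-≡ₘ (M.≡ₘ-trans (M.toℕ-mod x) (M.≡ₘ-trans (∣⇒≡ₘ (h zero))
      (M.≡ₘ-trans (M.+-congₘ (M.≡ₘ-sym (M.toℕ-mod a)) (M.≡ₘ-trans (M.*-congₘ (M.≡ₘ-sym (M.toℕ-mod t)) (M.≡ₘ-sym (M.toℕ-mod u)))
        (M.≡ₘ-sym (M.toℕ-mod _)))) (M.≡ₘ-sym (M.toℕ-mod _)))))) (line as us xs (h ∘ suc))

  -- Coordinatewise Chinese remaindering, one prime at a time. The coordinate prime to `p i` may sit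
  -- at a different place for each `i`.
  lift : ∀ {r} {p : Fin r → ℕ} (pp : ∀ i → Prime (p i)) → Decreasing p → (k : Fin r → ℕ) → ∀ {u} →
    u ∈ System.dirs (total-system p pp k) → ∃ λ v → residues pp k v ≡ u × ∀ i → ∃ λ l → ¬ p i ∣ Vec.lookup v l
  lift {zero} pp dec k {tt} _ = Vec.replicate N 0 , refl , λ ()
  lift {suc r} {p} pp dec k {u , u′} u∈ = z , cong₂ _,_ head≡ tail≡ , units
    where
    module M = PrimePower (pp zero) (k zero)
    Q′ = prod (modulus (p ∘ suc) (k ∘ suc))
    instance Q′≢0 = prod≢0 (pp ∘ suc) (k ∘ suc)
    module M′ = Mod Q′
    u∈′ = ∈.∈-cartesianProduct⁻ (System.dirs (M.Charts.system n)) (System.dirs (total-system (p ∘ suc) (pp ∘ suc) (k ∘ suc))) u∈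
    IH = lift (pp ∘ suc) (λ lt → dec (s≤s lt)) (k ∘ suc) (proj₂ u∈′)
    v′ = proj₁ IH
    combine : ∀ x y → ∃ λ z → Mod._≡ₘ_ M.q z x × Mod._≡ₘ_ Q′ z y
    combine = chineseRemainder (coprime-head pp dec k)
    z : Vec ℕ N
    z = Vec.zipWith (λ x y → proj₁ (combine x y)) (M.ι u) v′
    z≡ : ∀ l → Vec.lookup z l ≡ proj₁ (combine (Vec.lookup (M.ι u) l) (Vec.lookup v′ l))
    z≡ l = Vec.lookup-zipWith _ l (M.ι u) v′
    z≡u : ∀ l → Vec.lookup z l M.≡ₘ toℕ (Vec.lookup u l)
    z≡u l = M.≡ₘ-trans (M.≡ₘ-reflexive (z≡ l)) (M.≡ₘ-trans (proj₁ (proj₂ (combine _ _))) (M.≡ₘ-reflexive (Vec.lookup-map l toℕ u)))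
    z≡v′ : ∀ l → Vec.lookup z l M′.≡ₘ Vec.lookup v′ l
    z≡v′ l = M′.≡ₘ-trans (M′.≡ₘ-reflexive (z≡ l)) (proj₂ (proj₂ (combine _ _)))
    head≡ : Vec.map (λ a → a mod M.q) z ≡ u
    head≡ = lookup-ext λ l → trans (Vec.lookup-map l _ z) (M.Fin-≡ₘ (M.≡ₘ-trans (M.toℕ-mod _) (z≡u l)))
    tail∣ : ∀ i l → modulus (p ∘ suc) (k ∘ suc) i ∣ ℕ.∣ Vec.lookup z l - Vec.lookup v′ l ∣
    tail∣ i l = ℕ.∣-trans (∣-prod (modulus (p ∘ suc) (k ∘ suc)) i) (≡ₘ⇒∣ (z≡v′ l))
    tail≡ : residues (pp ∘ suc) (k ∘ suc) z ≡ u′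
    tail≡ = trans (residues-cong (pp ∘ suc) (k ∘ suc) tail∣) (proj₁ (proj₂ IH))
    hasUnit⁻ : ∀ {m} {w : Vec (Fin M.q) m} → M.HasUnit w → ∃ λ l → ¬ p zero ∣ toℕ (Vec.lookup w l)
    hasUnit⁻ (VecAny.here h)  = zero , h
    hasUnit⁻ (VecAny.there h) = suc (proj₁ (hasUnit⁻ h)) , proj₂ (hasUnit⁻ h)
    units : ∀ i → ∃ λ l → ¬ p i ∣ Vec.lookup z l
    units zero = let (l , h) = hasUnit⁻ (proj₂ (∈.∈-filter⁻ M.hasUnit? {xs = M.vectors N} (proj₁ u∈′))) in
      l , λ d → h (M.∣-≡ₘ (ℕ.m∣m*n _) (z≡u l) d)
    units (suc i) = let (l , h) = proj₂ (proj₂ IH) i in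
      l , λ d → h (M′.∣-≡ₘ (ℕ.∣-trans (ℕ.m∣m*n _) (∣-prod (modulus (p ∘ suc) (k ∘ suc)) i)) (z≡v′ l) d)

  dirs-unique : ∀ {r} (p : Fin r → ℕ) (pp : ∀ i → Prime (p i)) (k : Fin r → ℕ) → Unique (System.dirs (total-system p pp k))
  dirs-unique {zero}  p pp k = [] ∷ []
  dirs-unique {suc r} p pp k = Unique.cartesianProduct⁺ (Unique.filter⁺ M.hasUnit? (M.vectors-unique N))
    (dirs-unique (p ∘ suc) (pp ∘ suc) (k ∘ suc))
    where module M = PrimePower (pp zero) (k zero)

-- Transfer to (ℤ/Nℤ)ⁿ

unit⇒∤ : ∀ {p M} .{{_ : NonZero M}} → Prime p → p ∣ M → (c : ℤ/ M) → IsUnit c → ¬ p ∣ toℕ c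
unit⇒∤ {p} {M} pp p∣M c (b , cb≡1) p∣c = ℕ.>⇒∤ (ℕ.nonTrivial⇒n>1 p {{prime⇒nonTrivial pp}})
  (M.∣-≡ₘ p∣M (M.≡ₘ-trans (M.≡ₘ-sym (M.toℕ-mod _)) (M.≡ₘ-trans (M.≡ₘ-reflexive (cong toℕ cb≡1)) (M.toℕ-mod 1)))
    (ℕ.∣m⇒∣m*n (toℕ b) p∣c))
  where module M = Mod M

unique-map-on : ∀ {A B : Set} (f : A → B) {xs} → (∀ {x y} → x ∈ xs → y ∈ xs → f x ≡ f y → x ≡ y) →
  Unique xs → Unique (List.map f xs)
unique-map-on f inj []           = AllPairs.[]
unique-map-on f inj (x∉ ∷ uniq) = All.map⁺ (All.tabulate λ y∈ e → All.lookup x∉ y∈ (inj (here refl) (there y∈) e))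
  AllPairs.∷ unique-map-on f (λ x∈ y∈ → inj (there x∈) (there y∈)) uniq

module Scalars {N : ℕ} .{{_ : NonZero N}} where

  open Mod N

  toℕ-*ₘ : ∀ (a b : ℤ/ N) → toℕ (a *ₘ b) ≡ₘ toℕ a * toℕ b
  toℕ-*ₘ a b = toℕ-mod _

  *ₘ-assoc : ∀ (a b c : ℤ/ N) → (a *ₘ b) *ₘ c ≡ a *ₘ (b *ₘ c)
  *ₘ-assoc a b c = Fin-≡ₘ (≡ₘ-trans (toℕ-*ₘ (a *ₘ b) c) (≡ₘ-trans (*-congₘ (toℕ-*ₘ a b) (≡ₘ-refl {toℕ c}))
    (≡ₘ-trans (≡ₘ-reflexive (ℕ.*-assoc (toℕ a) (toℕ b) (toℕ c))) (≡ₘ-sym (≡ₘ-trans (toℕ-*ₘ a (b *ₘ c))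
      (*-congₘ (≡ₘ-refl {toℕ a}) (toℕ-*ₘ b c)))))))

  *ₘ-comm : ∀ (a b : ℤ/ N) → a *ₘ b ≡ b *ₘ a
  *ₘ-comm a b = cong (_mod N) (ℕ.*-comm (toℕ a) (toℕ b))

  *ₘ-identityˡ : ∀ (a : ℤ/ N) → (1 mod N) *ₘ a ≡ a
  *ₘ-identityˡ a = Fin-≡ₘ (≡ₘ-trans (toℕ-*ₘ (1 mod N) a) (≡ₘ-trans (*-congₘ (toℕ-mod 1) (≡ₘ-refl {toℕ a}))
    (≡ₘ-reflexive (ℕ.*-identityˡ (toℕ a)))))

  •-assoc : ∀ {m} a b (u : Vec (ℤ/ N) m) → (a *ₘ b) • u ≡ a • (b • u)
  •-assoc a b []       = refl
  •-assoc a b (u ∷ us) = cong₂ _∷_ (*ₘ-assoc a b u) (•-assoc a b us)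

  •-identity : ∀ {m} (u : Vec (ℤ/ N) m) → (1 mod N) • u ≡ u
  •-identity []       = refl
  •-identity (u ∷ us) = cong₂ _∷_ (*ₘ-identityˡ u) (•-identity us)

  unit-inverse : ∀ (c : ℤ/ N) ((b , _) : IsUnit c) → IsUnit b
  unit-inverse c (b , e) = c , trans (*ₘ-comm b c) e

  •-cancel : ∀ {m} (c : ℤ/ N) ((b , _) : IsUnit c) (u : Vec (ℤ/ N) m) → b • (c • u) ≡ u
  •-cancel c (b , e) u = trans (sym (•-assoc b c u)) (trans (cong (_• u) (trans (*ₘ-comm b c) e)) (•-identity u))

  isUnit-1 : IsUnit (1 mod N)
  isUnit-1 = 1 mod N , *ₘ-identityˡ (1 mod N)

  isUnit-* : ∀ (a b : ℤ/ N) → IsUnit a → IsUnit b → IsUnit (a *ₘ b)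
  isUnit-* a b (a′ , e) (b′ , e′) = a′ *ₘ b′ , (begin
    (a *ₘ b) *ₘ (a′ *ₘ b′)   ≡⟨ *ₘ-assoc a b (a′ *ₘ b′) ⟩
    a *ₘ (b *ₘ (a′ *ₘ b′))   ≡⟨ cong (a *ₘ_) (trans (sym (*ₘ-assoc b a′ b′)) (trans (cong (_*ₘ b′) (*ₘ-comm b a′)) (*ₘ-assoc a′ b b′))) ⟩
    a *ₘ (a′ *ₘ (b *ₘ b′))   ≡⟨ cong (λ z → a *ₘ (a′ *ₘ z)) e′ ⟩
    a *ₘ (a′ *ₘ (1 mod N))   ≡⟨ cong (a *ₘ_) (trans (*ₘ-comm a′ _) (*ₘ-identityˡ a′)) ⟩
    a *ₘ a′                  ≡⟨ e ⟩
    1 mod N                  ∎)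
    where open ≡-Reasoning

  isUnit? : ∀ (c : ℤ/ N) → Dec (IsUnit c)
  isUnit? c = any? λ b → (c *ₘ b) Fin.≟ (1 mod N)

  units : List (ℤ/ N)
  units = List.filter isUnit? (List.allFin N)

  lookup-• : ∀ {m} c (u : Vec (ℤ/ N) m) l → Vec.lookup (Vec.map toℕ (c • u)) l ≡ₘ toℕ c * toℕ (Vec.lookup u l)
  lookup-• c u l = ≡ₘ-trans (≡ₘ-reflexive (trans (Vec.lookup-map l toℕ (c • u)) (cong toℕ (Vec.lookup-map l (c *ₘ_) u))))
    (toℕ-*ₘ c (Vec.lookup u l))

  onLine-scale : ∀ {m} (c : ℤ/ N) → IsUnit c → ∀ {a u x : Vec (ℤ/ N) m} → OnLine a u x → OnLine a (c • u) x
  onLine-scale c (b , e) {a} {u} (t , refl) = t *ₘ b , cong (a ⊕_)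
    (sym (trans (•-assoc t b (c • u)) (cong (t •_) (•-cancel c (b , e) u))))

module Transfer {r N n : ℕ} .{{N≢0 : NonZero N}} (F : PrimeFactorisation (suc r) N) (P : ProjectiveSpace F (suc n)) where

  open PrimeFactorisation F
  open ProjectiveSpace P
  open Scalars {N}
  open Residues n hiding (N)

  -- The prime power systems use the modulus `p ^ suc k`, so exponents are lowered by one here.
  k : Fin (suc r) → ℕ
  k i = ℕ.pred (exponent i)

  suc-k : ∀ i → suc (k i) ≡ exponent i
  suc-k i = ℕ.suc-pred (exponent i) {{ℕ.>-nonZero (exponent≥1 i)}}

  modulus≡ : ∀ i → modulus prime k i ≡ primePower i
  modulus≡ i = cong (prime i ^_) (suc-k i)

  N≡prod : N ≡ prod (modulus prime k)
  N≡prod = trans factors (sym (prod-cong modulus≡))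
    where
    prod-cong : ∀ {r} {f g : Fin r → ℕ} → (∀ i → f i ≡ g i) → prod f ≡ prod g
    prod-cong {zero}  h = refl
    prod-cong {suc r} h = cong₂ _*_ (h zero) (prod-cong (h ∘ suc))

  private
    module M = Mod N
    V = Vec (ℤ/ N) (suc n)
    Y = total-system prime isPrime k
    module Y = System Y

    modulus∣N : ∀ i → modulus prime k i ∣ N
    modulus∣N i = subst (modulus prime k i ∣_) (sym N≡prod) (∣-prod (modulus prime k) i)

    prime∣N : ∀ i → prime i ∣ N
    prime∣N i = ℕ.∣-trans (ℕ.m∣m*n _) (modulus∣N i)

    ≡-from-moduli : ∀ {a b : ℤ/ N} → (∀ i → modulus prime k i ∣ ℕ.∣ toℕ a - toℕ b ∣) → a ≡ b
    ≡-from-moduli {a} {b} h = M.Fin-≡ₘ (∣⇒≡ₘ (subst (_∣ ℕ.∣ toℕ a - toℕ b ∣) (sym N≡prod)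
      (∣-all⇒prod∣ isPrime decreasing k h)))

    τ : V → Y.Pt
    τ v = residues isPrime k (Vec.map toℕ v)

    τ-injective : ∀ {v w} → τ v ≡ τ w → v ≡ w
    τ-injective {v} {w} e = lookup-ext λ l → ≡-from-moduli λ i →
      subst₂ (λ a b → modulus prime k i ∣ ℕ.∣ a - b ∣) (Vec.lookup-map l toℕ v) (Vec.lookup-map l toℕ w)
        (residues-injective isPrime k e i l)

    UnitCoordinates : V → Set
    UnitCoordinates v = ∀ i → ∃ λ l → ¬ prime i ∣ toℕ (Vec.lookup v l)

    unitCoordinates⁺ : ∀ {v} → HasUnitCoordinates F v → UnitCoordinates v
    unitCoordinates⁺ {v} h i = go v (h i)
      where
      instance _ = primePower≢0 i
      p∣ : prime i ∣ primePower i
      p∣ = subst (prime i ∣_) (modulus≡ i) (ℕ.m∣m*n _)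
      go : ∀ {m} (v : Vec (ℤ/ N) m) → VecAny.Any (IsUnit ∘ reduce (primePower i)) v → ∃ λ l → ¬ prime i ∣ toℕ (Vec.lookup v l)
      go (a ∷ v) (VecAny.here u)  = zero , λ d → unit⇒∤ (isPrime i) p∣ (reduce (primePower i) a) u
        (Mod.∣-≡ₘ (primePower i) p∣ (Mod.≡ₘ-sym (primePower i) (Mod.toℕ-mod (primePower i) (toℕ a))) d)
      go (a ∷ v) (VecAny.there h) = suc (proj₁ (go v h)) , proj₂ (go v h)

    unitCoordinates⁻ : ∀ {v} → UnitCoordinates v → HasUnitCoordinates F v
    unitCoordinates⁻ {v} h i = go v (proj₁ (h i)) (proj₂ (h i))
      where
      instance _ = primePower≢0 i
      module Mᵢ = Mod (primePower i)
      go : ∀ {m} (v : Vec (ℤ/ N) m) l → ¬ prime i ∣ toℕ (Vec.lookup v l) → VecAny.Any (IsUnit ∘ reduce (primePower i)) v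
      go (a ∷ v) (suc l) p∤ = VecAny.there (go v l p∤)
      go (a ∷ v) zero    p∤ = VecAny.here (b mod primePower i , Mᵢ.mod-cong
          (Mᵢ.≡ₘ-trans (Mᵢ.*-congₘ (Mᵢ.toℕ-mod (toℕ a)) (Mᵢ.toℕ-mod b)) (proj₂ inv)))
        where
        inv = Mᵢ.inverse (toℕ a) (coprime-^ (isPrime i) p∤ (exponent i))
        b = proj₁ inv

    •-unitCoordinates : ∀ c v → IsUnit c → UnitCoordinates v → ∀ i → ∃ λ l → ¬ prime i ∣ Vec.lookup (Vec.map toℕ (c • v)) l
    •-unitCoordinates c v u h i = let (l , p∤) = h i in l , λ d →
      case (euclidsLemma (toℕ c) (toℕ (Vec.lookup v l)) (isPrime i) (M.∣-≡ₘ (prime∣N i) (lookup-• c v l) d)) p∤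
      where
      case : ∀ {a} → prime i ∣ toℕ c ⊎ prime i ∣ a → ¬ ¬ prime i ∣ a
      case (inj₁ d) _  = unit⇒∤ (isPrime i) (prime∣N i) c u d
      case (inj₂ d) p∤ = p∤ d

    -- For every prime some coordinate of `v` is prime to it and can be cancelled modulo the prime
    -- power. Hence each projective class contributes exactly as many vectors as there are units.
    •-free : ∀ {c c′ v} → UnitCoordinates v → c • v ≡ c′ • v → c ≡ c′
    •-free {c} {c′} {v} h e = ≡-from-moduli λ i → let (l , p∤) = h i in cancel i l p∤
      where
      cancel : ∀ i l → ¬ prime i ∣ toℕ (Vec.lookup v l) → modulus prime k i ∣ ℕ.∣ toℕ c - toℕ c′ ∣
      cancel i l p∤ = Coprime.coprime-divisor (Coprime.sym (coprime-^ (isPrime i) p∤ (suc (k i))))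
        (subst (modulus prime k i ∣_) (trans (cong₂ ℕ.∣_-_∣ (ℕ.*-comm (toℕ c) x) (ℕ.*-comm (toℕ c′) x))
          (sym (ℕ.*-distribˡ-∣-∣ x (toℕ c) (toℕ c′))))
          (ℕ.∣-trans (modulus∣N i) (≡ₘ⇒∣ (M.≡ₘ-trans (M.≡ₘ-sym (lookup-• c v l))
            (M.≡ₘ-trans (M.≡ₘ-reflexive (cong (λ w → Vec.lookup (Vec.map toℕ w) l) e)) (lookup-• c′ v l))))))
        where x = toℕ (Vec.lookup v l)

    -- The estimate runs over vectors rather than projective classes, so `D` is replaced by its
    -- orbit under the units, taken to residues.
    scaled : List V → List Y.Pt
    scaled D = List.map (λ (c , d) → τ (c • d)) (List.cartesianProduct units D)

    ∈-units : ∀ c → IsUnit c → c ∈ units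
    ∈-units c u = ∈.∈-filter⁺ isUnit? (∈.∈-allFin _) u

    units-∈ : ∀ {c} → c ∈ units → IsUnit c
    units-∈ c∈ = proj₂ (∈.∈-filter⁻ isUnit? {xs = List.allFin N} c∈)

    length-scaled : ∀ D → length (scaled D) ≡ length units * length D
    length-scaled D = trans (List.length-map _ (List.cartesianProduct units D)) (length-cartesianProductWith _,_ units D)

    -- A direction of the product lifts to a vector with unit coordinates, whose class has a
    -- representative in `points`; the unit relating the two is inverted.
    dirs≤ : length Y.dirs ≤ length units * length points
    dirs≤ = subst (length Y.dirs ≤_) (length-scaled points)
      (unique-length-≤ (dirs-unique prime isPrime k) λ u∈ → covered (lift isPrime decreasing k u∈))
      where
      covered : ∀ {u} → (∃ λ v → residues isPrime k v ≡ u × ∀ i → ∃ λ l → ¬ prime i ∣ Vec.lookup v l) → u ∈ scaled points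
      covered {u} (v , v≡u , units-v) = subst (_∈ scaled points) τ≡ (∈.∈-map⁺ (λ (c , d) → τ (c • d)) {x = proj₁ isU , d}
          (∈.∈-cartesianProduct⁺ (∈-units (proj₁ isU) (unit-inverse c isU)) d∈))
        where
        w : V
        w = Vec.map (_mod N) v
        w≡ : ∀ l → Vec.lookup (Vec.map toℕ w) l M.≡ₘ Vec.lookup v l
        w≡ l = M.≡ₘ-trans (M.≡ₘ-reflexive (trans (Vec.lookup-map l toℕ w) (cong toℕ (Vec.lookup-map l (_mod N) v)))) (M.toℕ-mod _)
        w-units : UnitCoordinates w
        w-units i = let (l , p∤) = units-v i in l , λ d → p∤ (M.∣-≡ₘ (prime∣N i)
          (w≡ l) (subst (prime i ∣_) (sym (Vec.lookup-map l toℕ w)) d))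
        rep = find (exhaustive w (unitCoordinates⁻ w-units))
        d = proj₁ rep
        d∈ = proj₁ (proj₂ rep)
        c = proj₁ (proj₂ (proj₂ rep))
        isU = proj₁ (proj₂ (proj₂ (proj₂ rep)))
        d≡ = proj₂ (proj₂ (proj₂ (proj₂ rep)))
        τ≡ : τ (proj₁ isU • d) ≡ u
        τ≡ = trans (cong τ (trans (cong (proj₁ isU •_) d≡) (•-cancel c isU w)))
          (trans (residues-cong isPrime k λ i l → ℕ.∣-trans (modulus∣N i) (≡ₘ⇒∣ (w≡ l))) v≡u)

  -- ∣D∣ / ∣ℙ∣ is also the proportion of the multiples of D by units among
  -- all directions.
  combinatorial-bound : ∀ S m D → D ⊆ points → All (HasRichLine {F = F} S m) D → Unique S →
    denominator′ prime k ^ suc n * (length D * m ^ suc n) ≤ numerator prime k ^ suc n * (length S * length points)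
  combinatorial-bound S m D D⊆ rich uniqS = ℕ.*-cancelˡ-≤ (length units) {{ℕ.>-nonZero (∈.∈-length (∈-units (1 mod N) isUnit-1))}} (begin
    length units * (den * (length D * m ^ suc n))
      ≡⟨ lem₁ (length units) den (length D) (m ^ suc n) ⟩
    den * (length units * length D * m ^ suc n)
      ≡⟨ cong (λ z → den * z) (trans (cong (_* m ^ suc n) (sym (length-scaled D))) (sym (∑-const (scaled D) (m ^ suc n)))) ⟩
    den * ∑ (scaled D) (λ _ → m ^ suc n)
      ≤⟨ ℕ.*-monoʳ-≤ den (∑-mono (scaled D) λ u∈ → ℕ.^-monoˡ-≤ (suc n) (lines-rich u∈)) ⟩
    den * ∑ (scaled D) (λ u → length (lines u) ^ suc n)
      ≤⟨ ℕ.*-monoʳ-≤ den (∑-subset scaled-unique scaled⊆dirs) ⟩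
    den * ∑ Y.dirs (λ u → length (lines u) ^ suc n)
      ≤⟨ total-estimate prime isPrime k (List.map τ S) lines lines-collinear ⟩
    num * (length (List.map τ S) * length Y.dirs)
      ≤⟨ ℕ.*-monoʳ-≤ num (ℕ.*-mono-≤ (ℕ.≤-reflexive (List.length-map τ S)) dirs≤) ⟩
    num * (length S * (length units * length points))
      ≡⟨ lem₂ num (length S) (length units) (length points) ⟩
    length units * (num * (length S * length points)) ∎)
    where
    open ℕ.≤-Reasoning
    den = denominator′ prime k ^ suc n
    num = numerator prime k ^ suc n
    lem₁ : ∀ a b c d → a * (b * (c * d)) ≡ b * (a * c * d)
    lem₁ = ℕSolver.solve-∀
    lem₂ : ∀ a b c d → a * (b * (c * d)) ≡ c * (a * (b * d))
    lem₂ = ℕSolver.solve-∀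
    D-∈ : ∀ {d} → d ∈ D → d ∈ points
    D-∈ = Sublist.lookup D⊆
    D-units : ∀ {d} → d ∈ D → UnitCoordinates d
    D-units d∈ = unitCoordinates⁺ (All.lookup sound (D-∈ d∈))
    proportional-injective : ∀ {d d′} → d ∈ points → d′ ∈ points → Proportional d d′ → d ≡ d′
    proportional-injective {d} {d′} d∈ d′∈ (c , u , refl) with ∈.∈-AllPairs₂ distinct d∈ d′∈
    ... | inj₁ e        = e
    ... | inj₂ (inj₁ h) = contradiction (c , u , refl) h
    ... | inj₂ (inj₂ h) = contradiction (proj₁ u , unit-inverse c u , sym (•-cancel c u d)) h
    D-unique : Unique D
    D-unique = sublist-unique D⊆ (AllPairs.map (λ h e → h (1 mod N , isUnit-1 , trans (sym e) (sym (•-identity _)))) distinct)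
      where
      sublist-unique : ∀ {xs ys : List V} → xs ⊆ ys → Unique ys → Unique xs
      sublist-unique Sublist.[]        _           = AllPairs.[]
      sublist-unique (_ Sublist.∷ʳ s)  (_ ∷ uniq)  = sublist-unique s uniq
      sublist-unique (refl Sublist.∷ s) (y∉ ∷ uniq) =
        All.tabulate (λ x∈ → All.lookup y∉ (Sublist.lookup s x∈)) AllPairs.∷ sublist-unique s uniq
    scaled-injective : ∀ {x y} → x ∈ List.cartesianProduct units D → y ∈ List.cartesianProduct units D →
      τ (proj₁ x • proj₂ x) ≡ τ (proj₁ y • proj₂ y) → x ≡ y
    scaled-injective {c , d} {c′ , d′} x∈ y∈ e = cong₂ _,_ c≡c′ d≡d′
      where
      x∈′ = ∈.∈-cartesianProduct⁻ units D x∈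
      y∈′ = ∈.∈-cartesianProduct⁻ units D y∈
      u = units-∈ (proj₁ x∈′)
      u′ = units-∈ (proj₁ y∈′)
      cd≡ : c • d ≡ c′ • d′
      cd≡ = τ-injective e
      d≡d′ : d ≡ d′
      d≡d′ = proportional-injective (D-∈ (proj₂ x∈′)) (D-∈ (proj₂ y∈′)) (proj₁ u′ *ₘ c , isUnit-* (proj₁ u′) c (unit-inverse c′ u′) u ,
        trans (sym (•-cancel c′ u′ d′)) (trans (cong (proj₁ u′ •_) (sym cd≡)) (sym (•-assoc (proj₁ u′) c d))))
      c≡c′ : c ≡ c′
      c≡c′ = •-free {v = d} (D-units (proj₂ x∈′)) (trans cd≡ (cong (c′ •_) (sym d≡d′)))
    scaled-unique : Unique (scaled D)
    scaled-unique = unique-map-on _ scaled-injective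
      (Unique.cartesianProduct⁺ (Unique.filter⁺ isUnit? (Unique.allFin⁺ N)) D-unique)
    scaled⊆dirs : ∀ {u} → u ∈ scaled D → u ∈ Y.dirs
    scaled⊆dirs u∈ with ∈.∈-map⁻ (λ (c , d) → τ (c • d)) u∈
    ... | (c , d) , cd∈ , refl = let (c∈ , d∈) = ∈.∈-cartesianProduct⁻ units D cd∈ in
      residues-dirs isPrime k _ (•-unitCoordinates c d (units-∈ c∈) (D-units d∈))
    richLine : ∀ {d} → d ∈ D → HasRichLine {F = F} S m d
    richLine = All.lookup rich
    Source : Y.Pt → Set
    Source u = ∃ λ d → d ∈ D × ∃ λ c → IsUnit c × u ≡ τ (c • d)
    source? : ∀ u → Dec (Any (λ x → u ≡ τ (proj₁ x • proj₂ x)) (List.cartesianProduct units D))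
    source? u = Any.any? (λ x → u Y.≟ τ (proj₁ x • proj₂ x)) _
    source : ∀ {u} → Any (λ x → u ≡ τ (proj₁ x • proj₂ x)) (List.cartesianProduct units D) → Source u
    source h = let ((c , d) , cd∈ , e) = find h
                   (c∈ , d∈) = ∈.∈-cartesianProduct⁻ units D cd∈ in d , d∈ , c , units-∈ c∈ , e
    linesAt : ∀ u → Dec (Any (λ x → u ≡ τ (proj₁ x • proj₂ x)) (List.cartesianProduct units D)) → List Y.Pt
    -- Directions outside the orbit of `D` get the empty list, which is collinear and contributes 0
    -- to the sum of powers.
    linesAt u (no _)  = []
    linesAt u (yes h) = let (d , d∈ , _) = source h in
      List.map τ (List.filter (onLine? (proj₁ (richLine d∈)) d) S)
    lines : Y.Pt → List Y.Pt
    lines u = linesAt u (source? u)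
    lines-rich : ∀ {u} → u ∈ scaled D → m ≤ length (lines u)
    lines-rich {u} u∈ = cases (source? u)
      where
      cases : ∀ d → m ≤ length (linesAt u d)
      cases (no ¬h) = let (x , x∈ , e) = ∈.∈-map⁻ (λ (c , d) → τ (c • d)) u∈ in
        contradiction (Any.map (λ { refl → e }) x∈) ¬h
      cases (yes h) = let (d , d∈ , _) = source h in
        subst (m ≤_) (sym (List.length-map τ (List.filter (onLine? (proj₁ (richLine d∈)) d) S))) (proj₂ (richLine d∈))
    lines-collinear : ∀ {u} → u ∈ Y.dirs → Collinear Y (List.map τ S) u (lines u)
    lines-collinear {u} _ = cases (source? u)
      where
      cases : ∀ d → Collinear Y (List.map τ S) u (linesAt u d)
      cases (no _)  = collinear AllPairs.[] (λ ()) (τ (Vec.replicate (suc n) (0 mod N))) λ ()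
      cases (yes h) = collinear
          (Unique.map⁺ τ-injective (Unique.filter⁺ (onLine? a d) uniqS))
          (λ x∈ → inside (∈.∈-map⁻ τ x∈))
          (τ a)
          (λ x∈ → on (∈.∈-map⁻ τ x∈))
        where
        src = source h
        d = proj₁ src
        d∈ = proj₁ (proj₂ src)
        c = proj₁ (proj₂ (proj₂ src))
        isU = proj₁ (proj₂ (proj₂ (proj₂ src)))
        u≡ = proj₂ (proj₂ (proj₂ (proj₂ src)))
        a = proj₁ (richLine d∈)
        L = List.filter (onLine? a d) S
        inside : ∀ {x} → (∃ λ y → y ∈ L × x ≡ τ y) → x ∈ List.map τ S
        inside (y , y∈ , refl) = ∈.∈-map⁺ τ (proj₁ (∈.∈-filter⁻ (onLine? a d) y∈))
        on : ∀ {x} → (∃ λ y → y ∈ L × x ≡ τ y) → Y.Incident (τ a) u x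
        on (y , y∈ , refl) = subst (λ u → Y.Incident (τ a) u (τ y)) (sym u≡)
          (incidence (onLine-scale c isU (proj₂ (∈.∈-filter⁻ (onLine? a d) {xs = S} y∈))))
          where
          incidence : OnLine a (c • d) y → Y.Incident (τ a) (τ (c • d)) (τ y)
          incidence (t , refl) = residues-incident isPrime k (toℕ t) λ i l → ℕ.∣-trans (modulus∣N i) (≡ₘ⇒∣ (pointwise l))
            where
            pointwise : ∀ l → Vec.lookup (Vec.map toℕ (a ⊕ t • (c • d))) l M.≡ₘ
              Vec.lookup (Vec.map toℕ a) l + toℕ t * Vec.lookup (Vec.map toℕ (c • d)) l
            pointwise l = M.≡ₘ-trans (M.≡ₘ-reflexive (trans (Vec.lookup-map l toℕ (a ⊕ t • (c • d)))
                (cong toℕ (Vec.lookup-zipWith _+ₘ_ l a (t • (c • d))))))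
              (M.≡ₘ-trans (M.toℕ-mod _) (M.+-congₘ (M.≡ₘ-reflexive (sym (Vec.lookup-map l toℕ a)))
                (M.≡ₘ-trans (M.≡ₘ-reflexive (cong toℕ (Vec.lookup-map l (t *ₘ_) (c • d))))
                  (M.≡ₘ-trans (toℕ-*ₘ t _) (M.*-congₘ (M.≡ₘ-refl {toℕ t}) (M.≡ₘ-reflexive (sym (Vec.lookup-map l toℕ (c • d)))))))))

  points≢[] : 0 < length points
  points≢[] = ∈.∈-length (proj₁ (proj₂ (find (exhaustive ones (unitCoordinates⁻ units-ones)))))
    where
    ones : V
    ones = Vec.replicate (suc n) (1 mod N)
    units-ones : UnitCoordinates ones
    units-ones i = zero , unit⇒∤ (isPrime i) (prime∣N i) (1 mod N) isUnit-1

-- Real estimates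

private
  ℚ-ring : AlmostCommutativeRing 0ℓ 0ℓ
  ℚ-ring = fromCommutativeRing ℚ.+-*-commutativeRing (λ q → dec⇒maybe (0ℚ ℚ.≟ q))

ιℚ : ℕ → ℚ
ιℚ n = + n ℚ./ 1

private
  toℚᵘ-ιℚ : ∀ n → ℚ.toℚᵘ (ιℚ n) ℚᵘ.≃ ℚᵘ.mkℚᵘ (+ n) 0
  toℚᵘ-ιℚ n = ℚ.toℚᵘ-fromℚᵘ (ℚᵘ.mkℚᵘ (+ n) 0)

ιℚ-+ : ∀ a b → ιℚ (a + b) ≡ ιℚ a ℚ.+ ιℚ b
ιℚ-+ a b = ℚ.toℚᵘ-injective (begin
  ℚ.toℚᵘ (ιℚ (a + b))                       ≈⟨ toℚᵘ-ιℚ (a + b) ⟩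
  ℚᵘ.mkℚᵘ (+ (a + b)) 0                     ≈⟨ ℚᵘ.*≡* (cong (ℤ._* 1ℤ) (cong₂ ℤ._+_ (sym (ℤ.*-identityʳ (+ a))) (sym (ℤ.*-identityʳ (+ b))))) ⟩
  ℚᵘ.mkℚᵘ (+ a) 0 ℚᵘ.+ ℚᵘ.mkℚᵘ (+ b) 0      ≈⟨ ℚᵘ.+-cong (ℚᵘ.≃-sym (toℚᵘ-ιℚ a)) (ℚᵘ.≃-sym (toℚᵘ-ιℚ b)) ⟩
  ℚ.toℚᵘ (ιℚ a) ℚᵘ.+ ℚ.toℚᵘ (ιℚ b)          ≈⟨ ℚ.toℚᵘ-homo-+ (ιℚ a) (ιℚ b) ⟨
  ℚ.toℚᵘ (ιℚ a ℚ.+ ιℚ b)                    ∎)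
  where open ℚᵘ.≃-Reasoning

ιℚ-* : ∀ a b → ιℚ (a * b) ≡ ιℚ a ℚ.* ιℚ b
ιℚ-* a b = ℚ.toℚᵘ-injective (begin
  ℚ.toℚᵘ (ιℚ (a * b))                       ≈⟨ toℚᵘ-ιℚ (a * b) ⟩
  ℚᵘ.mkℚᵘ (+ (a * b)) 0                     ≈⟨ ℚᵘ.*≡* (cong (ℤ._* 1ℤ) (ℤ.pos-* a b)) ⟩
  ℚᵘ.mkℚᵘ (+ a) 0 ℚᵘ.* ℚᵘ.mkℚᵘ (+ b) 0      ≈⟨ ℚᵘ.*-cong (ℚᵘ.≃-sym (toℚᵘ-ιℚ a)) (ℚᵘ.≃-sym (toℚᵘ-ιℚ b)) ⟩
  ℚ.toℚᵘ (ιℚ a) ℚᵘ.* ℚ.toℚᵘ (ιℚ b)          ≈⟨ ℚ.toℚᵘ-homo-* (ιℚ a) (ιℚ b) ⟨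
  ℚ.toℚᵘ (ιℚ a ℚ.* ιℚ b)                    ∎)
  where open ℚᵘ.≃-Reasoning

ιℚ-mono : ∀ {a b} → a ≤ b → ιℚ a ℚ.≤ ιℚ b
ιℚ-mono {a} {b} a≤b = ℚ.toℚᵘ-cancel-≤ (ℚᵘ.≤-respˡ-≃ (ℚᵘ.≃-sym (toℚᵘ-ιℚ a)) (ℚᵘ.≤-respʳ-≃ (ℚᵘ.≃-sym (toℚᵘ-ιℚ b))
  (ℚᵘ.*≤* (ℤ.*-monoʳ-≤-nonNeg 1ℤ (ℤ.+≤+ a≤b)))))

0≤ιℚ : ∀ n → 0ℚ ℚ.≤ ιℚ n
0≤ιℚ n = ιℚ-mono {0} {n} z≤n

0<ιℚ : ∀ {n} → 0 < n → 0ℚ ℚ.< ιℚ n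
0<ιℚ {n} 0<n = ℚ.<-≤-trans (ℚ.positive⁻¹ 1ℚ) (ιℚ-mono {1} {n} 0<n)

1/n*n≡1 : ∀ n .{{_ : NonZero n}} → (+ 1 ℚ./ n) ℚ.* ιℚ n ≡ 1ℚ
1/n*n≡1 n@(suc n′) = ℚ.toℚᵘ-injective (begin
  ℚ.toℚᵘ ((+ 1 ℚ./ n) ℚ.* ιℚ n)             ≈⟨ ℚ.toℚᵘ-homo-* (+ 1 ℚ./ n) (ιℚ n) ⟩
  ℚ.toℚᵘ (+ 1 ℚ./ n) ℚᵘ.* ℚ.toℚᵘ (ιℚ n)     ≈⟨ ℚᵘ.*-cong (ℚ.toℚᵘ-fromℚᵘ (ℚᵘ.mkℚᵘ (+ 1) n′)) (toℚᵘ-ιℚ n) ⟩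
  ℚᵘ.mkℚᵘ (+ 1) n′ ℚᵘ.* ℚᵘ.mkℚᵘ (+ n) 0     ≈⟨ ℚᵘ.*≡* (cong +_ (lem n′)) ⟩
  ℚᵘ.1ℚᵘ                                    ∎)
  where
  open ℚᵘ.≃-Reasoning
  lem : ∀ n → 1 * suc n * 1 ≡ 1 * (suc n * 1)
  lem = ℕSolver.solve-∀

*-mono-≤ℚ : ∀ {a b c d} → 0ℚ ℚ.≤ a → a ℚ.≤ b → 0ℚ ℚ.≤ c → c ℚ.≤ d → a ℚ.* c ℚ.≤ b ℚ.* d
*-mono-≤ℚ {a} {b} {c} {d} 0≤a a≤b 0≤c c≤d = ℚ.≤-trans
  (ℚ.*-monoʳ-≤-nonNeg c {{ℚ.nonNegative 0≤c}} a≤b)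
  (ℚ.*-monoˡ-≤-nonNeg b {{ℚ.nonNegative (ℚ.≤-trans 0≤a a≤b)}} c≤d)

*-nonNeg : ∀ {a b} → 0ℚ ℚ.≤ a → 0ℚ ℚ.≤ b → 0ℚ ℚ.≤ a ℚ.* b
*-nonNeg {a} {b} 0≤a 0≤b = subst (ℚ._≤ a ℚ.* b) (ℚ.*-zeroˡ b) (ℚ.*-monoʳ-≤-nonNeg b {{ℚ.nonNegative 0≤b}} 0≤a)

private
  cancelʳ : ∀ {a b} c → 0ℚ ℚ.< c → a ℚ.* c ℚ.≤ b ℚ.* c → a ℚ.≤ b
  cancelʳ c 0<c = ℚ.*-cancelʳ-≤-pos c {{ℚ.positive 0<c}}

-- Harmonic sums and logarithms

private
  1/suc : ℕ → ℚ
  1/suc a = + 1 ℚ./ suc a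

  harmonic-last : ∀ a l → harmonic a (suc l) ≡ harmonic a l ℚ.+ 1/suc (a + l)
  harmonic-last a zero    = trans (ℚ.+-comm (1/suc a) 0ℚ) (cong (λ z → 0ℚ ℚ.+ 1/suc z) (sym (ℕ.+-identityʳ a)))
  harmonic-last a (suc l) = trans (cong (λ z → 1/suc a ℚ.+ z) (harmonic-last (suc a) l))
    (trans (sym (ℚ.+-assoc (1/suc a) (harmonic (suc a) l) _)) (cong (λ z → harmonic a (suc l) ℚ.+ 1/suc z) (sym (ℕ.+-suc a l))))

  harmonic-++ : ∀ a l l′ → harmonic a (l + l′) ≡ harmonic a l ℚ.+ harmonic (a + l) l′
  harmonic-++ a zero    l′ = trans (sym (ℚ.+-identityˡ _)) (cong (λ z → 0ℚ ℚ.+ harmonic z l′) (sym (ℕ.+-identityʳ a)))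
  harmonic-++ a (suc l) l′ = trans (cong (λ z → 1/suc a ℚ.+ z) (harmonic-++ (suc a) l l′))
    (trans (sym (ℚ.+-assoc (1/suc a) (harmonic (suc a) l) _)) (cong (λ z → harmonic a (suc l) ℚ.+ harmonic z l′) (sym (ℕ.+-suc a l))))

  harmonic-lower : ∀ B a l → a + l ≤ B → ιℚ l ℚ.≤ ιℚ B ℚ.* harmonic a l
  harmonic-lower B a zero    _  = ℚ.≤-reflexive (sym (ℚ.*-zeroʳ (ιℚ B)))
  harmonic-lower B a (suc l) le = subst₂ ℚ._≤_ (sym (ιℚ-+ 1 l)) (sym (ℚ.*-distribˡ-+ (ιℚ B) (1/suc a) (harmonic (suc a) l)))
    (ℚ.+-mono-≤ (subst (ℚ._≤ ιℚ B ℚ.* 1/suc a) (trans (ℚ.*-comm (ιℚ (suc a)) (1/suc a)) (1/n*n≡1 (suc a)))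
        (ℚ.*-monoʳ-≤-nonNeg (1/suc a) {{ℚ.normalize-nonNeg 1 (suc a)}} (ιℚ-mono (ℕ.≤-trans (ℕ.m≤m+n (suc a) l) le′))))
      (harmonic-lower B (suc a) l le′))
    where
    le′ : suc a + l ≤ B
    le′ = subst (_≤ B) (ℕ.+-suc a l) le

  harmonic-block : ∀ K a → 1/suc a ℚ.≤ harmonic (a * suc K) (suc K)
  harmonic-block K a = cancelʳ (ιℚ (suc a * suc K)) (0<ιℚ {suc a * suc K} (s≤s z≤n)) (begin
    1/suc a ℚ.* ιℚ (suc a * suc K)           ≡⟨ cong (λ z → 1/suc a ℚ.* z) (ιℚ-* (suc a) (suc K)) ⟩
    1/suc a ℚ.* (ιℚ (suc a) ℚ.* ιℚ (suc K))  ≡⟨ sym (ℚ.*-assoc (1/suc a) _ _) ⟩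
    1/suc a ℚ.* ιℚ (suc a) ℚ.* ιℚ (suc K)    ≡⟨ cong (ℚ._* ιℚ (suc K)) (1/n*n≡1 (suc a)) ⟩
    1ℚ ℚ.* ιℚ (suc K)                        ≡⟨ ℚ.*-identityˡ _ ⟩
    ιℚ (suc K)                               ≤⟨ harmonic-lower (suc a * suc K) (a * suc K) (suc K) (ℕ.≤-reflexive (ℕ.+-comm (a * suc K) (suc K))) ⟩
    ιℚ (suc a * suc K) ℚ.* harmonic (a * suc K) (suc K) ≡⟨ ℚ.*-comm (ιℚ (suc a * suc K)) _ ⟩
    harmonic (a * suc K) (suc K) ℚ.* ιℚ (suc a * suc K) ∎)
    where open ℚ.≤-Reasoning

  harmonic-refine : ∀ K a l → harmonic a l ℚ.≤ harmonic (a * suc K) (l * suc K)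
  harmonic-refine K a zero    = ℚ.≤-refl
  harmonic-refine K a (suc l) = subst (harmonic a (suc l) ℚ.≤_) (sym (trans (harmonic-++ (a * suc K) (suc K) (l * suc K))
      (cong (λ z → harmonic (a * suc K) (suc K) ℚ.+ harmonic z (l * suc K)) (ℕ.+-comm (a * suc K) (suc K)))))
    (ℚ.+-mono-≤ (harmonic-block K a) (harmonic-refine K (suc a) l))

  harmonicNumerator≡ : ∀ n → ιℚ (harmonicNumerator n) ≡ ιℚ (n !) ℚ.* harmonic 0 n
  harmonicNumerator≡ zero    = refl
  harmonicNumerator≡ (suc n) = begin
    ιℚ (harmonicNumerator n * suc n + n !)
      ≡⟨ trans (ιℚ-+ (harmonicNumerator n * suc n) (n !)) (cong (ℚ._+ ιℚ (n !)) (ιℚ-* (harmonicNumerator n) (suc n))) ⟩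
    ιℚ (harmonicNumerator n) ℚ.* ιℚ (suc n) ℚ.+ ιℚ (n !)
      ≡⟨ cong₂ (λ a b → a ℚ.* ιℚ (suc n) ℚ.+ b) (harmonicNumerator≡ n)
           (sym (trans (cong (λ z → ιℚ (n !) ℚ.* z) (1/n*n≡1 (suc n))) (ℚ.*-identityʳ _))) ⟩
    ιℚ (n !) ℚ.* harmonic 0 n ℚ.* ιℚ (suc n) ℚ.+ ιℚ (n !) ℚ.* (1/suc n ℚ.* ιℚ (suc n))
      ≡⟨ lem (ιℚ (n !)) (harmonic 0 n) (ιℚ (suc n)) (1/suc n) ⟩
    ιℚ (suc n) ℚ.* ιℚ (n !) ℚ.* (harmonic 0 n ℚ.+ 1/suc n)
      ≡⟨ cong₂ ℚ._*_ (sym (ιℚ-* (suc n) (n !))) (sym (harmonic-last 0 n)) ⟩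
    ιℚ (suc n * n !) ℚ.* harmonic 0 (suc n) ∎
    where
    open ≡-Reasoning
    lem : ∀ f h s t → f ℚ.* h ℚ.* s ℚ.+ f ℚ.* (t ℚ.* s) ≡ s ℚ.* f ℚ.* (h ℚ.+ t)
    lem = RingSolver.solve-∀ ℚ-ring

  -- Right Riemann sums of the decreasing function `1/x` grow under refinement, and mesh 1 gives the
  -- harmonic number minus 1. So the bound holds for every approximation, not only in the limit.
  harmonic≤1+log : ∀ q i → harmonic 0 q ℚ.≤ 1ℚ ℚ.+ approx (log q) i
  harmonic≤1+log zero    i = ℚ.<⇒≤ (ℚ.positive⁻¹ 1ℚ)
  harmonic≤1+log (suc q) i = ℚ.+-monoʳ-≤ 1ℚ (subst (λ z → harmonic 1 q ℚ.≤ harmonic z (q * suc i)) (ℕ.*-identityˡ (suc i))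
    (harmonic-refine i 1 q))

-- H_q ≤ 1 + k log p for q = pᵏ.
harmonicNumerator≤ : ∀ p k q → 2 ≤ p → q ≤ p ^ k → ∀ δ → 0ℚ ℚ.< δ → ∃ λ M → ∀ i → M ≤ i →
  ιℚ (harmonicNumerator q) ℚ.≤ ιℚ (q !) ℚ.* (approx (fromℕ k *ᴿ log p +ᴿ fromℕ 1) i ℚ.+ δ)
harmonicNumerator≤ p k q 2≤p q≤ δ δ>0 =
  -- That `log q` is at most `k log p` up to `δ` comes from the characterisation of the ceiling,
  -- since `q ≤ p ^ k` makes `⌈log p ⌉ q` at most `k`.
  let (M , h) = proj₁ (⌈log⌉-ceiling p q k 2≤p) (proj₂ (⌈log⌉-least p q 2≤p) k q≤) δ δ>0 in
  M , λ i M≤i → begin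
    ιℚ (harmonicNumerator q)                      ≡⟨ harmonicNumerator≡ q ⟩
    ιℚ (q !) ℚ.* harmonic 0 q                    ≤⟨ ℚ.*-monoˡ-≤-nonNeg (ιℚ (q !)) {{ℚ.nonNegative (0≤ιℚ (q !))}} (H≤ i (h i M≤i)) ⟩
    ιℚ (q !) ℚ.* (x i ℚ.+ δ)                     ∎
  where
  open ℚ.≤-Reasoning
  x : ℕ → ℚ
  x i = approx (fromℕ k *ᴿ log p +ᴿ fromℕ 1) i
  H≤ : ∀ i → approx (log q) i ℚ.≤ approx (fromℕ k *ᴿ log p) i ℚ.+ δ → harmonic 0 q ℚ.≤ x i ℚ.+ δ
  H≤ i h = begin
    harmonic 0 q                                  ≤⟨ harmonic≤1+log q i ⟩
    1ℚ ℚ.+ approx (log q) i                       ≤⟨ ℚ.+-monoʳ-≤ 1ℚ h ⟩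
    1ℚ ℚ.+ (approx (fromℕ k *ᴿ log p) i ℚ.+ δ)    ≡⟨ lem (approx (fromℕ k *ᴿ log p) i) δ ⟩
    x i ℚ.+ δ                                     ∎
    where
    lem : ∀ a d → 1ℚ ℚ.+ (a ℚ.+ d) ≡ a ℚ.+ 1ℚ ℚ.+ d
    lem = RingSolver.solve-∀ ℚ-ring

-- Products of sequences in the unit interval

-- Estimates are made on approximating sequences, where equality of
-- reals, which involves Cauchy moduli, never has to be checked.
Seq : Set
Seq = ℕ → ℚ

infix 4 _≤ˢ_
_≤ˢ_ : Seq → Seq → Set
u ≤ˢ v = ∀ δ → 0ℚ ℚ.< δ → ∃ λ M → ∀ i → M ≤ i → u i ℚ.≤ v i ℚ.+ δ

infixl 7 _*ˢ_
_*ˢ_ : Seq → Seq → Seq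
(u *ˢ v) i = u i ℚ.* v i

∏ˢ : ∀ {r} → (Fin r → Seq) → Seq
∏ˢ {zero}  u = λ _ → 1ℚ
∏ˢ {suc r} u = u zero *ˢ ∏ˢ (u ∘ suc)

infixr 8 _^ˢ_
_^ˢ_ : Seq → ℕ → Seq
u ^ˢ zero  = λ _ → 1ℚ
u ^ˢ suc n = u *ˢ (u ^ˢ n)

approx-∏ : ∀ {r} (x : Fin r → ℝ) i → approx (∏ᴿ x) i ≡ ∏ˢ (approx ∘ x) i
approx-∏ {zero}  x i = refl
approx-∏ {suc r} x i = cong (λ z → approx (x zero) i ℚ.* z) (approx-∏ (x ∘ suc) i)

approx-^ : ∀ x n i → approx (x ^ᴿ n) i ≡ (approx x ^ˢ n) i
approx-^ x zero    i = refl
approx-^ x (suc n) i = cong (λ z → approx x i ℚ.* z) (approx-^ x n i)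

^ˢ-cong : ∀ {u v : Seq} i → u i ≡ v i → ∀ n → (u ^ˢ n) i ≡ (v ^ˢ n) i
^ˢ-cong i e zero    = refl
^ˢ-cong i e (suc n) = cong₂ ℚ._*_ e (^ˢ-cong i e n)

approx-[∏*∏]^ : ∀ {r s} (x : Fin r → ℝ) (y : Fin s → ℝ) n i →
  approx ((∏ᴿ x *ᴿ ∏ᴿ y) ^ᴿ n) i ≡ ((∏ˢ (approx ∘ x) *ˢ ∏ˢ (approx ∘ y)) ^ˢ n) i
approx-[∏*∏]^ x y n i = trans (approx-^ (∏ᴿ x *ᴿ ∏ᴿ y) n i)
  (^ˢ-cong {approx (∏ᴿ x *ᴿ ∏ᴿ y)} {∏ˢ (approx ∘ x) *ˢ ∏ˢ (approx ∘ y)} i (cong₂ ℚ._*_ (approx-∏ x i) (approx-∏ y i)) n)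

-- All factors of the constant lie in the unit interval, which makes errors add up instead of being
-- magnified in products.
record Unital (u : Seq) : Set where
  constructor unital
  field
    nonNegative : ∀ i → 0ℚ ℚ.≤ u i
    ≤1          : ∀ i → u i ℚ.≤ 1ℚ
open Unital

unital-1 : Unital (λ _ → 1ℚ)
unital-1 = unital (λ _ → ℚ.<⇒≤ (ℚ.positive⁻¹ 1ℚ)) λ _ → ℚ.≤-refl

unital-* : ∀ {u v} → Unital u → Unital v → Unital (u *ˢ v)
unital-* (unital 0≤u u≤1) (unital 0≤v v≤1) = unital (λ i → *-nonNeg (0≤u i) (0≤v i))
  λ i → *-mono-≤ℚ (0≤u i) (u≤1 i) (0≤v i) (v≤1 i)

unital-∏ : ∀ {r} {u : Fin r → Seq} → (∀ j → Unital (u j)) → Unital (∏ˢ u)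
unital-∏ {zero}  h = unital-1
unital-∏ {suc r} h = unital-* (h zero) (unital-∏ (h ∘ suc))

unital-^ : ∀ {u} → Unital u → ∀ n → Unital (u ^ˢ n)
unital-^ h zero    = unital-1
unital-^ h (suc n) = unital-* h (unital-^ h n)

≤ˢ-refl : ∀ u → u ≤ˢ u
≤ˢ-refl u δ δ>0 = 0 , λ i _ → subst (ℚ._≤ u i ℚ.+ δ) (ℚ.+-identityʳ _) (ℚ.+-monoʳ-≤ (u i) (ℚ.<⇒≤ δ>0))

private
  0<½*δ : ∀ {δ} → 0ℚ ℚ.< δ → 0ℚ ℚ.< ℚ.½ ℚ.* δ
  0<½*δ {δ} δ>0 = subst (ℚ._< ℚ.½ ℚ.* δ) (ℚ.*-zeroʳ ℚ.½) (ℚ.*-monoʳ-<-pos ℚ.½ δ>0)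

  halves : ∀ δ → ℚ.½ ℚ.* δ ℚ.+ ℚ.½ ℚ.* δ ≡ δ
  halves δ = trans (sym (ℚ.*-distribʳ-+ δ ℚ.½ ℚ.½)) (ℚ.*-identityˡ δ)

-- The chain `x y ≤ (x′ + η) y ≤ x′ y + η ≤ x′ y′ + 2 η` multiplies by `x′` and by `y`; these are
-- the two that have to be unital.
*ˢ-mono : ∀ {x x′ y y′} → Unital x′ → Unital y → x ≤ˢ x′ → y ≤ˢ y′ → x *ˢ y ≤ˢ x′ *ˢ y′
*ˢ-mono {x} {x′} {y} {y′} ux′ uy x≤ y≤ δ δ>0 =
  let (L , hx) = x≤ η η>0
      (M , hy) = y≤ η η>0
  in L ℕ.⊔ M , λ i h → step (x i) (x′ i) (y i) (y′ i)
       (nonNegative ux′ i) (≤1 ux′ i) (nonNegative uy i) (≤1 uy i)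
       (hx i (ℕ.m⊔n≤o⇒m≤o L M h)) (hy i (ℕ.m⊔n≤o⇒n≤o L M h))
  where
  open ℚ.≤-Reasoning
  η : ℚ
  η = ℚ.½ ℚ.* δ
  η>0 : 0ℚ ℚ.< η
  η>0 = 0<½*δ δ>0
  instance
    η≥0 : ℚ.NonNegative η
    η≥0 = ℚ.nonNegative (ℚ.<⇒≤ η>0)
  step : ∀ a a′ b b′ → 0ℚ ℚ.≤ a′ → a′ ℚ.≤ 1ℚ → 0ℚ ℚ.≤ b → b ℚ.≤ 1ℚ →
    a ℚ.≤ a′ ℚ.+ η → b ℚ.≤ b′ ℚ.+ η → a ℚ.* b ℚ.≤ a′ ℚ.* b′ ℚ.+ δ
  step a a′ b b′ 0≤a′ a′≤1 0≤b b≤1 ha hb = begin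
    a ℚ.* b                            ≤⟨ ℚ.*-monoʳ-≤-nonNeg b {{ℚ.nonNegative 0≤b}} ha ⟩
    (a′ ℚ.+ η) ℚ.* b                   ≡⟨ ℚ.*-distribʳ-+ b a′ η ⟩
    a′ ℚ.* b ℚ.+ η ℚ.* b               ≤⟨ ℚ.+-mono-≤ (ℚ.*-monoˡ-≤-nonNeg a′ {{ℚ.nonNegative 0≤a′}} hb) (ℚ.*-monoˡ-≤-nonNeg η b≤1) ⟩
    a′ ℚ.* (b′ ℚ.+ η) ℚ.+ η ℚ.* 1ℚ     ≡⟨ cong (ℚ._+ η ℚ.* 1ℚ) (ℚ.*-distribˡ-+ a′ b′ η) ⟩
    a′ ℚ.* b′ ℚ.+ a′ ℚ.* η ℚ.+ η ℚ.* 1ℚ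
      ≤⟨ ℚ.+-monoˡ-≤ (η ℚ.* 1ℚ) (ℚ.+-monoʳ-≤ (a′ ℚ.* b′) (ℚ.*-monoʳ-≤-nonNeg η a′≤1)) ⟩
    a′ ℚ.* b′ ℚ.+ 1ℚ ℚ.* η ℚ.+ η ℚ.* 1ℚ ≡⟨ lem (a′ ℚ.* b′) η ⟩
    a′ ℚ.* b′ ℚ.+ (η ℚ.+ η)            ≡⟨ cong (λ z → a′ ℚ.* b′ ℚ.+ z) (halves δ) ⟩
    a′ ℚ.* b′ ℚ.+ δ                    ∎
    where
    lem : ∀ a η → a ℚ.+ 1ℚ ℚ.* η ℚ.+ η ℚ.* 1ℚ ≡ a ℚ.+ (η ℚ.+ η)
    lem = RingSolver.solve-∀ ℚ-ring

∏ˢ-mono : ∀ {r} {x y : Fin r → Seq} → (∀ j → Unital (x j)) → (∀ j → Unital (y j)) → (∀ j → x j ≤ˢ y j) → ∏ˢ x ≤ˢ ∏ˢ y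
∏ˢ-mono {zero}          ux uy h = ≤ˢ-refl (λ _ → 1ℚ)
∏ˢ-mono {suc r} {x} {y} ux uy h = *ˢ-mono {x zero} {y zero} {∏ˢ (x ∘ suc)} {∏ˢ (y ∘ suc)} (uy zero) (unital-∏ (ux ∘ suc))
  (h zero) (∏ˢ-mono (ux ∘ suc) (uy ∘ suc) (h ∘ suc))

^ˢ-mono : ∀ {x y} → Unital x → Unital y → x ≤ˢ y → ∀ n → x ^ˢ n ≤ˢ y ^ˢ n
^ˢ-mono         ux uy h zero    = ≤ˢ-refl (λ _ → 1ℚ)
^ˢ-mono {x} {y} ux uy h (suc n) = *ˢ-mono {x} {y} {x ^ˢ n} {y ^ˢ n} uy (unital-^ ux n) h (^ˢ-mono ux uy h n)

fraction : (d h : ℕ) .{{_ : NonZero h}} → ℚ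
fraction d h = ιℚ d ℚ.* (+ 1 ℚ./ h)

-- Constantly the fraction `d / h`, stated without division so that products of sequences match the
-- natural numbers `denominator′` and `numerator`.
Represents : Seq → ℕ → ℕ → Set
Represents x d h = ∀ i → x i ℚ.* ιℚ h ≡ ιℚ d

fraction-represents : ∀ d h .{{_ : NonZero h}} → Represents (λ _ → fraction d h) d h
fraction-represents d h _ = trans (ℚ.*-assoc (ιℚ d) _ (ιℚ h)) (trans (cong (λ z → ιℚ d ℚ.* z) (1/n*n≡1 h)) (ℚ.*-identityʳ _))

represents-* : ∀ x y {d h d′ h′} → Represents x d h → Represents y d′ h′ → Represents (x *ˢ y) (d * d′) (h * h′)
represents-* x y {d} {h} {d′} {h′} rx ry i = begin
  a ℚ.* b ℚ.* ιℚ (h * h′)          ≡⟨ cong (λ z → a ℚ.* b ℚ.* z) (ιℚ-* h h′) ⟩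
  a ℚ.* b ℚ.* (ιℚ h ℚ.* ιℚ h′)     ≡⟨ lem a b (ιℚ h) (ιℚ h′) ⟩
  (a ℚ.* ιℚ h) ℚ.* (b ℚ.* ιℚ h′)   ≡⟨ cong₂ ℚ._*_ (rx i) (ry i) ⟩
  ιℚ d ℚ.* ιℚ d′                   ≡⟨ sym (ιℚ-* d d′) ⟩
  ιℚ (d * d′)                      ∎
  where
  open ≡-Reasoning
  a = x i
  b = y i
  lem : ∀ a b c d → a ℚ.* b ℚ.* (c ℚ.* d) ≡ a ℚ.* c ℚ.* (b ℚ.* d)
  lem = RingSolver.solve-∀ ℚ-ring

represents-∏ : ∀ {r} {x : Fin r → Seq} {d h : Fin r → ℕ} → (∀ j → Represents (x j) (d j) (h j)) →
  Represents (∏ˢ x) (Vector.foldr _*_ 1 d) (Vector.foldr _*_ 1 h)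
represents-∏ {zero}  _ = λ _ → refl
represents-∏ {suc r} {x} {d} {h} rx = represents-* (x zero) (∏ˢ (x ∘ suc)) {d zero} {h zero}
  {Vector.foldr _*_ 1 (d ∘ suc)} {Vector.foldr _*_ 1 (h ∘ suc)} (rx zero) (represents-∏ (rx ∘ suc))

represents-^ : ∀ x {d h} → Represents x d h → ∀ n → Represents (x ^ˢ n) (d ^ n) (h ^ n)
represents-^ x         rx zero    = λ _ → refl
represents-^ x {d} {h} rx (suc n) = represents-* x (x ^ˢ n) {d} {h} {d ^ n} {h ^ n} rx (represents-^ x rx n)

unital-represents : ∀ x {d h} → Represents x d h → 0 < h → d ≤ h → Unital x
unital-represents x {d} {h} rx 0<h d≤h = unital
  (λ i → cancelʳ (ιℚ h) (0<ιℚ 0<h) (subst₂ ℚ._≤_ (sym (ℚ.*-zeroˡ (ιℚ h))) (sym (rx i)) (0≤ιℚ d)))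
  (λ i → cancelʳ (ιℚ h) (0<ιℚ 0<h) (subst₂ ℚ._≤_ (sym (rx i)) (sym (ℚ.*-identityˡ (ιℚ h))) (ιℚ-mono d≤h)))

!≤harmonicNumerator : ∀ q → 0 < q → q ! ≤ harmonicNumerator q
!≤harmonicNumerator (suc zero)    _ = ℕ.≤-refl
!≤harmonicNumerator (suc (suc q)) _ = ℕ.≤-trans (subst (_≤ harmonicNumerator (suc q) * suc (suc q)) (ℕ.*-comm (suc q !) (suc (suc q)))
  (ℕ.*-monoˡ-≤ (suc (suc q)) (!≤harmonicNumerator (suc q) (s≤s z≤n)))) (ℕ.m≤m+n _ _)

module _ (p k : ℕ) where

  private
    x : ℝ
    x = fromℕ k *ᴿ log p +ᴿ fromℕ 1

    x≥1 : ∀ i → 1ℚ ℚ.≤ approx x i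
    x≥1 i = Positive.bound≤ (k·log+1-positive k p) i z≤n

    x>0 : ∀ i → 0ℚ ℚ.< approx x i
    x>0 i = ℚ.<-≤-trans (ℚ.positive⁻¹ 1ℚ) (x≥1 i)

  1/[k·log+1] : Seq
  1/[k·log+1] = approx (recip x (k·log+1-positive k p))

  private
    -- The lower bound in `k·log+1-positive` holds from index 0 on, so the reciprocal involves no
    -- shift of the index.
    inverse-x : ∀ i → 1/[k·log+1] i ℚ.* approx x i ≡ 1ℚ
    inverse-x i = ℚ.*-inverseˡ (approx x i) {{ℚ.>-nonZero (x>0 i)}}

  unital-1/[k·log+1] : Unital 1/[k·log+1]
  unital-1/[k·log+1] = unital
    (λ i → cancelʳ (approx x i) (x>0 i) (subst₂ ℚ._≤_ (sym (ℚ.*-zeroˡ (approx x i))) (sym (inverse-x i)) (ℚ.<⇒≤ (ℚ.positive⁻¹ 1ℚ))))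
    (λ i → cancelʳ (approx x i) (x>0 i) (subst₂ ℚ._≤_ (sym (inverse-x i)) (sym (ℚ.*-identityˡ (approx x i))) (x≥1 i)))

  -- Here `y` is the inverse of the harmonic number of `q`. The bound `harmonicNumerator≤` is
  -- multiplied by the reciprocal, which is at most 1 and so does not enlarge the error.
  1/[k·log+1]≤ : ∀ q → 2 ≤ p → 0 < q → q ≤ p ^ k → ∀ y → Represents y (q !) (harmonicNumerator q) → 1/[k·log+1] ≤ˢ y
  1/[k·log+1]≤ q 2≤p 0<q q≤ y ry δ δ>0 =
    let (M , h≤) = harmonicNumerator≤ p k q 2≤p q≤ δ δ>0 in
    M , λ i M≤i → cancelʳ (ιℚ h) (0<ιℚ 0<h) (bound (1/[k·log+1] i) (approx x i) (y i)
      (nonNegative unital-1/[k·log+1] i) (≤1 unital-1/[k·log+1] i) (inverse-x i) (ry i) (h≤ i M≤i))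
    where
    open ℚ.≤-Reasoning
    h d : ℕ
    h = harmonicNumerator q
    d = q !
    d≤h : d ≤ h
    d≤h = !≤harmonicNumerator q 0<q
    0<h : 0 < h
    0<h = ℕ.<-≤-trans (ℕ.1≤n! q) d≤h
    bound : ∀ a x y → 0ℚ ℚ.≤ a → a ℚ.≤ 1ℚ → a ℚ.* x ≡ 1ℚ → y ℚ.* ιℚ h ≡ ιℚ d →
      ιℚ h ℚ.≤ ιℚ d ℚ.* (x ℚ.+ δ) → a ℚ.* ιℚ h ℚ.≤ (y ℚ.+ δ) ℚ.* ιℚ h
    bound a x y 0≤a a≤1 ax≡1 yh≡d h≤ = begin
      a ℚ.* ιℚ h                            ≤⟨ ℚ.*-monoˡ-≤-nonNeg a {{ℚ.nonNegative 0≤a}} h≤ ⟩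
      a ℚ.* (ιℚ d ℚ.* (x ℚ.+ δ))            ≡⟨ lem a (ιℚ d) x δ ⟩
      (a ℚ.* x) ℚ.* ιℚ d ℚ.+ a ℚ.* (δ ℚ.* ιℚ d)
        ≤⟨ ℚ.+-mono-≤ (ℚ.≤-reflexive (trans (cong (ℚ._* ιℚ d) ax≡1) (trans (ℚ.*-identityˡ (ιℚ d)) (sym yh≡d))))
             (*-mono-≤ℚ 0≤a a≤1 (*-nonNeg 0≤δ (0≤ιℚ d)) (ℚ.*-monoˡ-≤-nonNeg δ {{ℚ.nonNegative 0≤δ}} (ιℚ-mono d≤h))) ⟩
      y ℚ.* ιℚ h ℚ.+ 1ℚ ℚ.* (δ ℚ.* ιℚ h)    ≡⟨ lem′ y (ιℚ h) δ ⟩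
      (y ℚ.+ δ) ℚ.* ιℚ h                    ∎
      where
      0≤δ = ℚ.<⇒≤ δ>0
      lem : ∀ a d x δ → a ℚ.* (d ℚ.* (x ℚ.+ δ)) ≡ a ℚ.* x ℚ.* d ℚ.+ a ℚ.* (δ ℚ.* d)
      lem = RingSolver.solve-∀ ℚ-ring
      lem′ : ∀ y h δ → y ℚ.* h ℚ.+ 1ℚ ℚ.* (δ ℚ.* h) ≡ (y ℚ.+ δ) ℚ.* h
      lem′ = RingSolver.solve-∀ ℚ-ring

bound-product : ∀ {u c v w : Seq} → Unital u → u ≤ˢ c → ∀ e → 0ℚ ℚ.≤ e → v ≤ˢ (λ _ → e) → ∀ m → 0ℚ ℚ.≤ m → (∀ i → w i ≡ m) →
  ∀ s → (∀ i → c i ℚ.* e ℚ.* m ℚ.≤ s) → u *ˢ v *ˢ w ≤ˢ (λ _ → s)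
bound-product {u} {c} {v} {w} uu u≤c e 0≤e v≤e m 0≤m w≡m s ≤s δ δ>0 =
  let (L₁ , h₁) = u≤c η η>0
      (L₂ , h₂) = v≤e η η>0
  in L₁ ℕ.⊔ L₂ , λ i L≤i → subst (λ z → u i ℚ.* v i ℚ.* z ℚ.≤ s ℚ.+ δ) (sym (w≡m i))
       (step (u i) (c i) (v i) (nonNegative uu i) (≤1 uu i)
         (h₁ i (ℕ.m⊔n≤o⇒m≤o L₁ L₂ L≤i)) (h₂ i (ℕ.m⊔n≤o⇒n≤o L₁ L₂ L≤i)) (≤s i))
  where
  open ℚ.≤-Reasoning
  -- Errors `η` in `c` and `e` change the product by at most `η (e + 1) m`; the added 1 makes `B`
  -- positive even for `m = 0`.
  B : ℚ
  B = (e ℚ.+ 1ℚ) ℚ.* m ℚ.+ 1ℚ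
  0≤[e+1]m : 0ℚ ℚ.≤ (e ℚ.+ 1ℚ) ℚ.* m
  0≤[e+1]m = *-nonNeg (ℚ.+-mono-≤ 0≤e (ℚ.<⇒≤ (ℚ.positive⁻¹ 1ℚ))) 0≤m
  B>0 : 0ℚ ℚ.< B
  B>0 = ℚ.+-mono-≤-< 0≤[e+1]m (ℚ.positive⁻¹ 1ℚ)
  η : ℚ
  η = (ℚ.1/ B) {{ℚ.>-nonZero B>0}} ℚ.* δ
  ηB≡δ : η ℚ.* B ≡ δ
  ηB≡δ = trans (lem ((ℚ.1/ B) {{ℚ.>-nonZero B>0}}) δ B) (trans (cong (ℚ._* δ) (ℚ.*-inverseˡ B {{ℚ.>-nonZero B>0}})) (ℚ.*-identityˡ δ))
    where
    lem : ∀ a d b → a ℚ.* d ℚ.* b ≡ a ℚ.* b ℚ.* d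
    lem = RingSolver.solve-∀ ℚ-ring
  η>0 : 0ℚ ℚ.< η
  η>0 = ℚ.*-cancelʳ-<-nonNeg B {{ℚ.nonNegative (ℚ.<⇒≤ B>0)}} (subst₂ ℚ._<_ (sym (ℚ.*-zeroˡ B)) (sym ηB≡δ) δ>0)
  step : ∀ a c x → 0ℚ ℚ.≤ a → a ℚ.≤ 1ℚ → a ℚ.≤ c ℚ.+ η → x ℚ.≤ e ℚ.+ η → c ℚ.* e ℚ.* m ℚ.≤ s → a ℚ.* x ℚ.* m ℚ.≤ s ℚ.+ δ
  step a c x 0≤a a≤1 a≤c x≤e c≤s = begin
    a ℚ.* x ℚ.* m
      ≤⟨ ℚ.*-monoʳ-≤-nonNeg m {{ℚ.nonNegative 0≤m}} (ℚ.*-monoˡ-≤-nonNeg a {{ℚ.nonNegative 0≤a}} x≤e) ⟩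
    a ℚ.* (e ℚ.+ η) ℚ.* m
      ≡⟨ cong (ℚ._* m) (ℚ.*-distribˡ-+ a e η) ⟩
    (a ℚ.* e ℚ.+ a ℚ.* η) ℚ.* m
      ≤⟨ ℚ.*-monoʳ-≤-nonNeg m {{ℚ.nonNegative 0≤m}} (ℚ.+-mono-≤ (ℚ.*-monoʳ-≤-nonNeg e {{ℚ.nonNegative 0≤e}} a≤c)
           (ℚ.*-monoʳ-≤-nonNeg η {{ℚ.nonNegative (ℚ.<⇒≤ η>0)}} a≤1)) ⟩
    ((c ℚ.+ η) ℚ.* e ℚ.+ 1ℚ ℚ.* η) ℚ.* m
      ≡⟨ lem c η e m ⟩
    c ℚ.* e ℚ.* m ℚ.+ η ℚ.* ((e ℚ.+ 1ℚ) ℚ.* m)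
      ≤⟨ ℚ.+-mono-≤ c≤s (ℚ.*-monoˡ-≤-nonNeg η {{ℚ.nonNegative (ℚ.<⇒≤ η>0)}}
           (subst (ℚ._≤ B) (ℚ.+-identityʳ _) (ℚ.+-monoʳ-≤ ((e ℚ.+ 1ℚ) ℚ.* m) (ℚ.<⇒≤ (ℚ.positive⁻¹ 1ℚ))))) ⟩
    s ℚ.+ η ℚ.* B
      ≡⟨ cong (λ z → s ℚ.+ z) ηB≡δ ⟩
    s ℚ.+ δ ∎
    where
    lem : ∀ c η e m → ((c ℚ.+ η) ℚ.* e ℚ.+ 1ℚ ℚ.* η) ℚ.* m ≡ c ℚ.* e ℚ.* m ℚ.+ η ℚ.* ((e ℚ.+ 1ℚ) ℚ.* m)
    lem = RingSolver.solve-∀ ℚ-ring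

divide-≤ᴿ : ∀ ε D P .{{_ : NonZero P}} → ε *ᴿ fromℕ P ≤ᴿ fromℕ D → approx ε ≤ˢ (λ _ → fraction D P)
divide-≤ᴿ ε D P@(suc _) h δ δ>0 = let (L , h≤) = h δ δ>0 in L , λ i L≤i → cancelʳ (ιℚ P) (0<ιℚ {P} (s≤s z≤n)) (begin
  approx ε i ℚ.* ιℚ P                ≤⟨ h≤ i L≤i ⟩
  ιℚ D ℚ.+ δ                         ≡⟨ cong₂ ℚ._+_ (sym (fraction-represents D P 0)) (sym (ℚ.*-identityʳ δ)) ⟩
  e ℚ.* ιℚ P ℚ.+ δ ℚ.* 1ℚ            ≤⟨ ℚ.+-monoʳ-≤ (e ℚ.* ιℚ P) (ℚ.*-monoˡ-≤-nonNeg δ {{ℚ.nonNegative (ℚ.<⇒≤ δ>0)}} (ιℚ-mono {1} {P} (s≤s z≤n))) ⟩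
  e ℚ.* ιℚ P ℚ.+ δ ℚ.* ιℚ P          ≡⟨ sym (ℚ.*-distribʳ-+ (ιℚ P) e δ) ⟩
  (e ℚ.+ δ) ℚ.* ιℚ P                 ∎)
  where
  open ℚ.≤-Reasoning
  e = fraction D P

approx-fromℕ-^ : ∀ m n i → approx (fromℕ m ^ᴿ n) i ≡ ιℚ (m ^ n)
approx-fromℕ-^ m zero    i = refl
approx-fromℕ-^ m (suc n) i = trans (cong (λ z → ιℚ m ℚ.* z) (approx-fromℕ-^ m n i)) (sym (ιℚ-* m (m ^ n)))

-- The constant and the final bound

module _ {r N : ℕ} (F : PrimeFactorisation (suc r) N) where

  open PrimeFactorisation F

  logFactor : Fin r → Seq
  logFactor j = 1/[k·log+1] (prime (Fin.inject₁ j)) (exponent (Fin.inject₁ j))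

  denominatorFactor : ℕ → Fin (suc r) → Seq
  denominatorFactor n i _ = (+ 1 ℚ./ denominator F n i) {{denominator≢0 F n i}}

  approx-kakeyaConstant : ∀ n i →
    approx (kakeyaConstant F n) i ≡ ((∏ˢ logFactor *ˢ ∏ˢ (denominatorFactor n)) ^ˢ n) i
  approx-kakeyaConstant n i = approx-[∏*∏]^ {r} {suc r}
    (λ j → recip (fromℕ (exponent (Fin.inject₁ j)) *ᴿ log (prime (Fin.inject₁ j)) +ᴿ fromℕ 1)
      (k·log+1-positive (exponent (Fin.inject₁ j)) (prime (Fin.inject₁ j))))
    (λ i → fromℚ ((+ 1 ℚ./ denominator F n i) {{denominator≢0 F n i}})) n i

corollary1p4 : (n r N : ℕ) .{{_ : NonZero N}} → 1 ≤ n →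
    (F : PrimeFactorisation (suc r) N) (P : ProjectiveSpace F n) →
    (m : ℕ) (ε : ℝ) → fromℕ 0 ≤ᴿ ε → ε ≤ᴿ fromℕ 1 →
    (S : List (Vec (ℤ/ N) n)) → Unique S → IsKakeya P m ε S →
    kakeyaConstant F n *ᴿ ε *ᴿ fromℕ m ^ᴿ n ≤ᴿ fromℕ (length S)
corollary1p4 (suc n′) r N _ F P m ε _ _ S uniq (D , D⊆ , rich , ε≤) δ δ>0 =
  let (M , h) = estimate δ δ>0 in
  M , λ i M≤i → subst (λ K → K ℚ.* approx ε i ℚ.* approx (fromℕ m ^ᴿ n) i ℚ.≤ ιℚ (length S) ℚ.+ δ)
    (sym (approx-kakeyaConstant F n i)) (h i M≤i)
  where
  n : ℕ
  n = suc n′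
  open PrimeFactorisation F
  open ProjectiveSpace P
  open Transfer F P
  open Residues n′ using (modulus; scale; prod; numerator; denominator′)
  instance
    points≢0 : NonZero (length points)
    points≢0 = ℕ.>-nonZero points≢[]

  q : Fin r → ℕ
  q j = modulus prime k (Fin.inject₁ j)
  q>0 : ∀ j → 0 < q j
  q>0 j = ℕ.>-nonZero⁻¹ (q j) {{PrimePower.q≢0 (isPrime (Fin.inject₁ j)) (k (Fin.inject₁ j))}}
  h : Fin r → ℕ
  h j = harmonicNumerator (q j)
  h>0 : ∀ j → 0 < h j
  h>0 j = ℕ.<-≤-trans (ℕ.1≤n! (q j)) (!≤harmonicNumerator (q j) (q>0 j))
  instance
    h≢0 : ∀ {j} → NonZero (h j)
    h≢0 {j} = ℕ.>-nonZero (h>0 j)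

  -- `a` is the factor with the logarithm and `a′` the inverse harmonic number that dominates it.
  -- After this replacement the constant is an exact fraction.
  a a′ : Fin r → Seq
  a = logFactor F
  a′ j _ = fraction (q j !) (h j)
  b : Fin (suc r) → Seq
  b = denominatorFactor F n
  A A′ B c : Seq
  A = ∏ˢ a
  A′ = ∏ˢ a′
  B = ∏ˢ b
  c = (A′ *ˢ B) ^ˢ n

  a′-represents : ∀ j → Represents (a′ j) (q j !) (h j)
  a′-represents j = fraction-represents (q j !) (h j)
  b-represents : ∀ i → Represents (b i) 1 (scale prime k i)
  b-represents i l = trans (cong (λ z → b i l ℚ.* ιℚ (2 * (z + ⌈log prime i ⌉ n))) (suc-k i))
    (1/n*n≡1 (denominator F n i) {{denominator≢0 F n i}})

  uA : ∀ j → Unital (a j)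
  uA j = unital-1/[k·log+1] (prime (Fin.inject₁ j)) (exponent (Fin.inject₁ j))
  uA′ : ∀ j → Unital (a′ j)
  uA′ j = unital-represents (a′ j) {q j !} {h j} (a′-represents j) (h>0 j) (!≤harmonicNumerator (q j) (q>0 j))
  uB : ∀ i → Unital (b i)
  uB i = unital-represents (b i) {1} {scale prime k i} (b-represents i) (s≤s z≤n) (s≤s z≤n)
  A≤A′ : ∀ j → a j ≤ˢ a′ j
  A≤A′ j = 1/[k·log+1]≤ (prime i) (exponent i) (q j)
    (ℕ.nonTrivial⇒n>1 (prime i) {{prime⇒nonTrivial (isPrime i)}}) (q>0 j) (ℕ.≤-reflexive (modulus≡ i)) (a′ j) (a′-represents j)
    where i = Fin.inject₁ j

  e : ℚ
  e = fraction (length D) (length points)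

  num den : ℕ
  num = numerator prime k
  den = denominator′ prime k

  c-represents : Represents c (den ^ n) (num ^ n)
  c-represents = subst₂ (λ d h → Represents c (d ^ n) (h ^ n))
    (trans (cong (λ z → den * z) (ones≡1 (suc r))) (ℕ.*-identityʳ den)) (ℕ.*-comm (prod h) (prod (scale prime k)))
    (represents-^ (A′ *ˢ B) {den * prod ones} {prod h * prod (scale prime k)}
      (represents-* A′ B {den} {prod h} {prod ones} {prod (scale prime k)}
        (represents-∏ {x = a′} {λ j → q j !} {h} a′-represents)
        (represents-∏ {x = b} {ones} {scale prime k} b-represents)) n)
    where
    ones : Fin (suc r) → ℕ
    ones _ = 1
    ones≡1 : ∀ r → prod {r} (λ _ → 1) ≡ 1
    ones≡1 zero    = refl
    ones≡1 (suc r) = trans (ℕ.+-identityʳ _) (ones≡1 r)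

  num>0 : 0 < num
  num>0 = ℕ.*-mono-≤ (prod>0 (scale prime k) λ _ → s≤s z≤n) (prod>0 h h>0)
    where
    prod>0 : ∀ {r} (f : Fin r → ℕ) → (∀ i → 0 < f i) → 0 < prod f
    prod>0 {zero}  f _ = s≤s z≤n
    prod>0 {suc r} f h = ℕ.*-mono-≤ (h zero) (prod>0 (f ∘ suc) (h ∘ suc))

  -- Multiplying by both denominators turns this into `combinatorial-bound`.
  final : ∀ i → c i ℚ.* e ℚ.* ιℚ (m ^ n) ℚ.≤ ιℚ (length S)
  final i = cancelʳ (ιℚ (num ^ n * length points))
    (0<ιℚ (ℕ.*-mono-≤ (ℕ.m^n>0 num {{ℕ.>-nonZero num>0}} n) points≢[])) (begin
      c i ℚ.* e ℚ.* ιℚ (m ^ n) ℚ.* ιℚ (num ^ n * length points)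
        ≡⟨ cong (λ z → c i ℚ.* e ℚ.* ιℚ (m ^ n) ℚ.* z) (ιℚ-* (num ^ n) (length points)) ⟩
      c i ℚ.* e ℚ.* ιℚ (m ^ n) ℚ.* (ιℚ (num ^ n) ℚ.* ιℚ (length points))
        ≡⟨ lem (c i) e (ιℚ (m ^ n)) (ιℚ (num ^ n)) (ιℚ (length points)) ⟩
      (c i ℚ.* ιℚ (num ^ n)) ℚ.* ((e ℚ.* ιℚ (length points)) ℚ.* ιℚ (m ^ n))
        ≡⟨ cong₂ (λ x y → x ℚ.* (y ℚ.* ιℚ (m ^ n))) (c-represents i) (fraction-represents (length D) (length points) i) ⟩
      ιℚ (den ^ n) ℚ.* (ιℚ (length D) ℚ.* ιℚ (m ^ n))
        ≡⟨ sym (trans (ιℚ-* (den ^ n) (length D * m ^ n)) (cong (λ z → ιℚ (den ^ n) ℚ.* z) (ιℚ-* (length D) (m ^ n)))) ⟩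
      ιℚ (den ^ n * (length D * m ^ n))
        ≤⟨ ιℚ-mono (combinatorial-bound S m D D⊆ rich uniq) ⟩
      ιℚ (num ^ n * (length S * length points))
        ≡⟨ cong ιℚ (lem′ (num ^ n) (length S) (length points)) ⟩
      ιℚ (length S * (num ^ n * length points))
        ≡⟨ ιℚ-* (length S) (num ^ n * length points) ⟩
      ιℚ (length S) ℚ.* ιℚ (num ^ n * length points) ∎)
    where
    open ℚ.≤-Reasoning
    lem : ∀ c e m u v → c ℚ.* e ℚ.* m ℚ.* (u ℚ.* v) ≡ c ℚ.* u ℚ.* (e ℚ.* v ℚ.* m)
    lem = RingSolver.solve-∀ ℚ-ring
    lem′ : ∀ a b c → a * (b * c) ≡ b * (a * c)
    lem′ = ℕSolver.solve-∀

  estimate : (A *ˢ B) ^ˢ n *ˢ approx ε *ˢ approx (fromℕ m ^ᴿ n) ≤ˢ (λ _ → ιℚ (length S))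
  estimate = bound-product {c = c} (unital-^ (unital-* (unital-∏ uA) (unital-∏ uB)) n)
    (^ˢ-mono (unital-* (unital-∏ uA) (unital-∏ uB)) (unital-* (unital-∏ uA′) (unital-∏ uB))
      (*ˢ-mono {A} {A′} {B} {B} (unital-∏ uA′) (unital-∏ uB) (∏ˢ-mono uA uA′ A≤A′) (≤ˢ-refl B)) n)
    e (*-nonNeg (0≤ιℚ (length D)) (ℚ.nonNegative⁻¹ (+ 1 ℚ./ length points) {{ℚ.normalize-nonNeg 1 (length points)}}))
    (divide-≤ᴿ ε (length D) (length points) ε≤)
    (ιℚ (m ^ n)) (0≤ιℚ (m ^ n)) (approx-fromℕ-^ m n)
    (ιℚ (length S)) final
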